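{- Let $p\le 11$ be a prime and let $k\in\{1,\dots,p-1\}\cup\{p+1\}$. Let $Z_k(q)=\sum_{n\ge -k}w_k(n)q^n$ be the unique weakly holomorphic modular function on $\mathrm{SL}_2(\mathbb{Z})$ satisfying $Z_k(q)=q^{ -k}\prod_{n\ge2}(1-q^n)^{ -1}+O(q)$. Then for every non-zero integer $n$, $$w_k(pn)\equiv 0\pmod{2^{11}}\ \text{if } p=2,\quad w_k(pn)\equiv0\pmod{3^5}\ \text{if } p=3,\quad w_k(pn)\equiv0\pmod{5^2}\ \text{if } p=5,\quad w_k(pn)\equiv 0\pmod p\ \text{if } p=7,11.$$
   Context: Here $q=e^{2\pi i\tau}$ with $\tau$ in the upper half-plane; a weakly holomorphic modular function on $\mathrm{SL}_2(\mathbb{Z})$ is one holomorphic on the upper half-plane whose poles (if any) are supported at the cusp $i\infty$. The coefficients $w_k(n)$ are integers (indeed $Z_k$ is a polynomial with integer coefficients in $j(\tau)$). -}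

module Defs where

open import Data.Nat as ℕ using (ℕ; zero; suc; _⊔_; _∸_; _≤_; _^_)
open import Data.Nat.Divisibility using (_∣?_)
open import Data.Integer as ℤ using (ℤ; +_; -[1+_])
open import Data.List using (List; []; _∷_)
open import Relation.Nullary.Decidable using (does)
open import Data.Bool using (if_then_else_)

Series : Set
Series = ℕ → ℤ

sumTo : (ℕ → ℤ) → ℕ → ℤ
sumTo f zero    = f zero
sumTo f (suc n) = sumTo f n ℤ.+ f (suc n)

conv : Series → Series → Series
conv f g n = sumTo (λ i → f i ℤ.* g (n ∸ i)) n

oneS : Series
oneS zero    = + 1
oneS (suc _) = + 0

-- geometric series 1/(1 - q^d) = Σ_{i, d ∣ i} q^i   (used for d ≥ 1)
geo : ℕ → Series
geo d i = if does (d ∣? i) then + 1 else + 0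

prodFrom : ℕ → ℕ → Series
prodFrom s zero    = oneS
prodFrom s (suc M) = conv (prodFrom s M) (geo (s ℕ.+ M))

-- ∏_{n≥s} (1 - q^n)^{-1}   (for s ≥ 1): coefficient N only involves factors n ≤ N
infProd : ℕ → Series
infProd s N = prodFrom s N N

powS : Series → ℕ → Series
powS f zero    = oneS
powS f (suc e) = conv f (powS f e)

σ3 : ℕ → ℕ
σ3 n = go n
  where
  go : ℕ → ℕ
  go zero    = 0
  go (suc d) = (if does (suc d ∣? n) then suc d ^ 3 else 0) ℕ.+ go d

E4 : Series
E4 zero    = + 1
E4 (suc n) = + (240 ℕ.* σ3 (suc n))

-- Laurent series with pole order at most `ord`: Σ_{m≥0} co m · q^(m - ord)
record Laurent : Set where
  constructor mkL
  field
    ord : ℕ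
    co  : Series
open Laurent public

coeff : Laurent → ℤ → ℤ
coeff f n with n ℤ.+ + ord f
... | + m      = co f m
... | -[1+ _ ] = + 0

shift : ℕ → Series → Series
shift zero    f m       = f m
shift (suc d) f zero    = + 0
shift (suc d) f (suc m) = shift d f m

addL : Laurent → Laurent → Laurent
addL f g = mkL o (λ m → shift (o ∸ ord f) (co f) m ℤ.+ shift (o ∸ ord g) (co g) m)
  where o = ord f ⊔ ord g

mulL : Laurent → Laurent → Laurent
mulL f g = mkL (ord f ℕ.+ ord g) (conv (co f) (co g))

constL : ℤ → Laurent
constL c = mkL 0 (λ { zero → c ; (suc _) → + 0 })

-- Klein's j-invariant: j = E4^3 / Δ = q^{-1} E4^3 ∏_{n≥1} (1 - q^n)^{-24}
jL : Laurent
jL = mkL 1 (conv (powS E4 3) (powS (infProd 1) 24))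

polyJ : List ℤ → Laurent
polyJ []       = constL (+ 0)
polyJ (c ∷ cs) = addL (constL c) (mulL jL (polyJ cs))

target : ℕ → Laurent
target k = mkL k (infProd 2)

-- Z is the weakly holomorphic modular function (polynomial in j) with
-- Z = q^{-k} ∏_{n≥2}(1-q^n)^{-1} + O(q): all coefficients of q^n, n ≤ 0, agree
IsZk : ℕ → Laurent → Set
IsZk k Z = ∀ (n : ℤ) → n ℤ.≤ + 0 → coeff Z n ≡ coeff (target k) n
  where open import Relation.Binary.PropositionalEquality using (_≡_)

modulus : ℕ → ℕ
modulus 2  = 2 ^ 11
modulus 3  = 3 ^ 5
modulus 5  = 5 ^ 2
modulus 7  = 7
modulus 11 = 11
modulus _  = 1

{-# OPTIONS --safe #-}
-- Z_k is an integral combination of 1, j, …, j^k, and if k = p + 1 the absence of a term in q in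
-- ∏_{n≥2} (1 - q^n)^{-1} forces j^p and j^{p+1} into the combination j^{p+1} - 744 (p+1) j^p. So it suffices
-- that the coefficients at multiples of p of this function and of j, …, j^{p-1} vanish modulo p^a,
-- apart from the constant ones.
--
-- The identity x/(1-x) · y/(1-y) = xy/(1-xy) · (1 + x/(1-x) + y/(1-y)), summed over x = q^a, y = q^b with weights
-- invariant under a dihedral group, yields without any modularity Ramanujan's differential equations for
-- E₂, E₄, E₆, the product E₄E₆ = E₁₀ and convolution identities with characters modulo 2 and 3. From these
-- one finds E₄, Δ and hence j:
--   modulo 7 and 11, the functions in question are constants plus derivatives θ(f);
--   modulo 25, they are constants plus θ(θ(f) + 240 Σσ₃(n)q^n · h), of which every coefficient at a
--   multiple of 5 is divisible by 25;
--   for p = 2, 3, E₄ and Δ are polynomials in two forms α, γ whose exponents are ≡ 0 and ≡ 1 modulo p, so the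
--   coefficients at multiples of p can be separated, and divisibility by 2^11 and 3^5 is read off.
module Submission where

open import Defs
open import Data.Nat as ℕ using (ℕ; zero; suc; _∸_; _≤_; _<_; z≤n; s≤s)
import Data.Nat.Properties as ℕP
import Data.Nat.Divisibility as ℕD
import Data.Nat.DivMod as ℕM
open import Data.Nat.Induction using (<-rec)
open import Data.Nat.Primality using (Prime)
open import Data.Integer as ℤ using (ℤ; +_; -[1+_])
import Data.Integer.Properties as ℤP
open import Data.Integer.Divisibility using (_∣_)
open import Data.Bool using (Bool; true; false; _∧_; if_then_else_)
open import Data.Fin using (Fin; zero; suc)
open import Data.List using (List; []; _∷_; length)
open import Data.Maybe as Maybe using (Maybe; just; nothing)
open import Data.Vec using (Vec; []; _∷_; lookup)
open import Data.Product using (_×_; _,_; proj₁; proj₂)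
open import Data.Sum using (_⊎_; inj₁; inj₂)
open import Data.Empty using (⊥-elim)
open import Relation.Nullary using (Dec; does; yes; no; ¬_)
open import Relation.Nullary.Decidable using (dec-true; dec-false)
open import Relation.Binary.PropositionalEquality as ≡ using (_≡_; _≢_)
open import Algebra.Bundles using (CommutativeRing)
open import Level using (0ℓ)

-- Formal series offer no finite-dimensional spaces of modular forms, so identities cannot be
-- checked on a few coefficients. What replaces this is θ = q d/dq: over ℤ a series fixed by θ is a
-- multiple of q, so a product formula for Δ follows once the logarithmic derivatives of its factors
-- add up to E₂. Identities with denominators are proved exactly, where integers cancel, and reduced
-- afterwards. Each case rests on a special feature. Modulo 7 and 11, E₆ ≡ 1 and E₄E₆ ≡ 1 leave a
-- single Eisenstein series, and one works with polynomials in t = j/(j - 1728). Modulo 25, E₄ - 1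
-- squares to 0. For 2 and 3, α and γ have level 4 and 9: for 2, α ± 8γ are the fourth powers of the
-- theta series with terms q^(n²) and (-1)^n q^(n²); for 3, α and 3γ are the cubic theta functions
-- a(q³) and c(q³) of the Borweins. The constants to be split off are forced: each is the constant
-- term of the function modulo p^a, because the other summand has coefficient 0 there at exponent 0.

-- Polynomial normal forms and linear combinations in commutative rings

Poly : ℕ → Set
Poly zero    = ℤ
Poly (suc n) = List (Poly n)

0ᴾ : ∀ n → Poly n
0ᴾ zero    = + 0
0ᴾ (suc n) = []

conᴾ : ∀ n → ℤ → Poly n
conᴾ zero    c = c
conᴾ (suc n) c = conᴾ n c ∷ []

varᴾ : ∀ {n} → Fin n → Poly n
varᴾ {suc n} zero    = 0ᴾ n ∷ conᴾ n (+ 1) ∷ []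
varᴾ {suc n} (suc i) = varᴾ i ∷ []

addᴾ : ∀ n → Poly n → Poly n → Poly n
addᴾ zero    a        b        = a ℤ.+ b
addᴾ (suc n) []       q        = q
addᴾ (suc n) (a ∷ p)  []       = a ∷ p
addᴾ (suc n) (a ∷ p)  (b ∷ q)  = addᴾ n a b ∷ addᴾ (suc n) p q

negᴾ : ∀ n → Poly n → Poly n
negᴾ zero    a       = ℤ.- a
negᴾ (suc n) []      = []
negᴾ (suc n) (a ∷ p) = negᴾ n a ∷ negᴾ (suc n) p

mulᴾ   : ∀ n → Poly n → Poly n → Poly n
scaleᴾ : ∀ n → Poly n → List (Poly n) → List (Poly n)

mulᴾ zero    a       b = a ℤ.* b
mulᴾ (suc n) []      q = []
mulᴾ (suc n) (a ∷ p) q = addᴾ (suc n) (scaleᴾ n a q) (0ᴾ n ∷ mulᴾ (suc n) p q)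

scaleᴾ n a []      = []
scaleᴾ n a (b ∷ q) = mulᴾ n a b ∷ scaleᴾ n a q

-- The clause for zero makes the test compute for a variable `m`, so that identities valid over
-- every modulus are still checked by `refl`.
isMultiple : ℕ → ℕ → Bool
isMultiple m zero    = true
isMultiple m (suc n) = does (m ℕD.∣? suc n)

isMultiple-ok : ∀ m n → isMultiple m n ≡ true → m ℕD.∣ n
isMultiple-ok m zero    _ = m ℕD.∣0
isMultiple-ok m (suc n) h with m ℕD.∣? suc n
... | yes d = d

isZero : ℕ → ∀ n → Poly n → Bool
isZero m zero    c       = isMultiple m ℤ.∣ c ∣
isZero m (suc n) []      = true
isZero m (suc n) (a ∷ p) = isZero m n a ∧ isZero m (suc n) p

infixl 6 _:+_ _:-_
infixl 7 _:*_
infixr 8 _:^_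
infixr 9 :-_

data Expr (n : ℕ) : Set where
  con       : ℤ → Expr n
  var       : Fin n → Expr n
  _:+_ _:*_ : Expr n → Expr n → Expr n
  :-_       : Expr n → Expr n
  _:^_      : Expr n → ℕ → Expr n

_:-_ : ∀ {n} → Expr n → Expr n → Expr n
a :- b = a :+ (:- b)

norm : ∀ {n} → Expr n → Poly n
norm {n} (con c)  = conᴾ n c
norm     (var i)  = varᴾ i
norm {n} (a :+ b) = addᴾ n (norm a) (norm b)
norm {n} (a :* b) = mulᴾ n (norm a) (norm b)
norm {n} (:- a)   = negᴾ n (norm a)
norm {n} (a :^ k) = pow k
  where
  pow : ℕ → Poly n
  pow zero    = conᴾ n (+ 1)
  pow (suc j) = mulᴾ n (norm a) (pow j)

power : {A : Set} → A → (A → A → A) → A → ℕ → A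
power ε _∙_ x zero    = ε
power ε _∙_ x (suc k) = x ∙ power ε _∙_ x k

-- A homomorphism from ℤ that kills the multiples of `m`: a polynomial identity then has to hold
-- only modulo `m` in its coefficients.
record Constants (R : CommutativeRing 0ℓ 0ℓ) (m : ℕ) : Set where
  open CommutativeRing R
  field
    ι     : ℤ → Carrier
    ι-+   : ∀ a b → ι (a ℤ.+ b) ≈ ι a + ι b
    ι-*   : ∀ a b → ι (a ℤ.* b) ≈ ι a * ι b
    ι-neg : ∀ a → ι (ℤ.- a) ≈ - ι a
    ι-1   : ι (+ 1) ≈ 1#
    ι-m   : ∀ a → m ℕD.∣ ℤ.∣ a ∣ → ι a ≈ 0#

module RingSolver (R : CommutativeRing 0ℓ 0ℓ) (m : ℕ) (constants : Constants R m) where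

  open CommutativeRing R
  open Constants constants
  open import Relation.Binary.Reasoning.Setoid setoid
  open import Algebra.Properties.Ring ring using (-‿distribˡ-*; -‿+-comm; -0#≈0#)

  infixr 8 _^_
  _^_ : Carrier → ℕ → Carrier
  x ^ k = power 1# _*_ x k

  ⟦_⟧ᴾ : ∀ {n} → Poly n → Vec Carrier n → Carrier
  ⟦_⟧ᴾ {zero}  c       ρ       = ι c
  ⟦_⟧ᴾ {suc n} []      ρ       = 0#
  ⟦_⟧ᴾ {suc n} (a ∷ p) (x ∷ ρ) = ⟦ a ⟧ᴾ ρ + x * ⟦_⟧ᴾ {suc n} p (x ∷ ρ)

  ⟦_⟧ : ∀ {n} → Expr n → Vec Carrier n → Carrier
  ⟦ con c ⟧  ρ = ι c
  ⟦ var i ⟧  ρ = lookup ρ i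
  ⟦ a :+ b ⟧ ρ = ⟦ a ⟧ ρ + ⟦ b ⟧ ρ
  ⟦ a :* b ⟧ ρ = ⟦ a ⟧ ρ * ⟦ b ⟧ ρ
  ⟦ :- a ⟧   ρ = - ⟦ a ⟧ ρ
  ⟦ a :^ k ⟧ ρ = ⟦ a ⟧ ρ ^ k

  private
    interchange : ∀ a b c d → (a + b) + (c + d) ≈ (a + c) + (b + d)
    interchange a b c d = begin
      (a + b) + (c + d)  ≈⟨ +-assoc a b _ ⟩
      a + (b + (c + d))  ≈⟨ +-congˡ (+-assoc b c d) ⟨
      a + (b + c + d)    ≈⟨ +-congˡ (+-congʳ (+-comm b c)) ⟩
      a + (c + b + d)    ≈⟨ +-congˡ (+-assoc c b d) ⟩
      a + (c + (b + d))  ≈⟨ +-assoc a c _ ⟨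
      (a + c) + (b + d)  ∎

    swap : ∀ a x p → a * (x * p) ≈ x * (a * p)
    swap a x p = trans (sym (*-assoc a x p)) (trans (*-congʳ (*-comm a x)) (*-assoc x a p))

  ι-0 : ι (+ 0) ≈ 0#
  ι-0 = ι-m (+ 0) (m ℕD.∣0)

  0ᴾ-ok : ∀ n (ρ : Vec Carrier n) → ⟦ 0ᴾ n ⟧ᴾ ρ ≈ 0#
  0ᴾ-ok zero    ρ = ι-0
  0ᴾ-ok (suc n) ρ = refl

  conᴾ-ok : ∀ n c (ρ : Vec Carrier n) → ⟦ conᴾ n c ⟧ᴾ ρ ≈ ι c
  conᴾ-ok zero    c ρ       = refl
  conᴾ-ok (suc n) c (x ∷ ρ) = trans (+-cong (conᴾ-ok n c ρ) (zeroʳ x)) (+-identityʳ _)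

  varᴾ-ok : ∀ {n} (i : Fin n) ρ → ⟦ varᴾ i ⟧ᴾ ρ ≈ lookup ρ i
  varᴾ-ok {suc n} zero (x ∷ ρ) = begin
    ⟦ 0ᴾ n ⟧ᴾ ρ + x * (⟦ conᴾ n (+ 1) ⟧ᴾ ρ + x * 0#)
      ≈⟨ +-cong (0ᴾ-ok n ρ) (*-congˡ (+-cong (trans (conᴾ-ok n (+ 1) ρ) ι-1) (zeroʳ x))) ⟩
    0# + x * (1# + 0#)  ≈⟨ +-identityˡ _ ⟩
    x * (1# + 0#)       ≈⟨ *-congˡ (+-identityʳ 1#) ⟩
    x * 1#              ≈⟨ *-identityʳ x ⟩
    x                   ∎
  varᴾ-ok {suc n} (suc i) (x ∷ ρ) = trans (+-cong (varᴾ-ok i ρ) (zeroʳ x)) (+-identityʳ _)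

  addᴾ-ok : ∀ n p q (ρ : Vec Carrier n) → ⟦ addᴾ n p q ⟧ᴾ ρ ≈ ⟦ p ⟧ᴾ ρ + ⟦ q ⟧ᴾ ρ
  addᴾ-ok zero    a b ρ = ι-+ a b
  addᴾ-ok (suc n) []      q       ρ = sym (+-identityˡ _)
  addᴾ-ok (suc n) (a ∷ p) []      ρ = sym (+-identityʳ _)
  addᴾ-ok (suc n) (a ∷ p) (b ∷ q) (x ∷ ρ) = begin
    ⟦ addᴾ n a b ⟧ᴾ ρ + x * ⟦_⟧ᴾ {suc n} (addᴾ (suc n) p q) (x ∷ ρ)
      ≈⟨ +-cong (addᴾ-ok n a b ρ) (trans (*-congˡ (addᴾ-ok (suc n) p q (x ∷ ρ))) (distribˡ x _ _)) ⟩
    (⟦ a ⟧ᴾ ρ + ⟦ b ⟧ᴾ ρ) + (x * ⟦_⟧ᴾ {suc n} p (x ∷ ρ) + x * ⟦_⟧ᴾ {suc n} q (x ∷ ρ))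
      ≈⟨ interchange _ _ _ _ ⟩
    (⟦ a ⟧ᴾ ρ + x * ⟦_⟧ᴾ {suc n} p (x ∷ ρ)) + (⟦ b ⟧ᴾ ρ + x * ⟦_⟧ᴾ {suc n} q (x ∷ ρ)) ∎

  negᴾ-ok : ∀ n p (ρ : Vec Carrier n) → ⟦ negᴾ n p ⟧ᴾ ρ ≈ - ⟦ p ⟧ᴾ ρ
  negᴾ-ok zero    a       ρ       = ι-neg a
  negᴾ-ok (suc n) []      ρ       = sym -0#≈0#
  negᴾ-ok (suc n) (a ∷ p) (x ∷ ρ) = begin
    ⟦ negᴾ n a ⟧ᴾ ρ + x * ⟦_⟧ᴾ {suc n} (negᴾ (suc n) p) (x ∷ ρ)
      ≈⟨ +-cong (negᴾ-ok n a ρ) (trans (*-congˡ (negᴾ-ok (suc n) p (x ∷ ρ)))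
           (trans (*-comm x _) (trans (sym (-‿distribˡ-* _ x)) (-‿cong (*-comm _ x))))) ⟩
    - ⟦ a ⟧ᴾ ρ + - (x * ⟦_⟧ᴾ {suc n} p (x ∷ ρ))
      ≈⟨ -‿+-comm _ _ ⟩
    - (⟦ a ⟧ᴾ ρ + x * ⟦_⟧ᴾ {suc n} p (x ∷ ρ)) ∎

  mulᴾ-ok   : ∀ n p q (ρ : Vec Carrier n) → ⟦ mulᴾ n p q ⟧ᴾ ρ ≈ ⟦ p ⟧ᴾ ρ * ⟦ q ⟧ᴾ ρ
  scaleᴾ-ok : ∀ n a q x (ρ : Vec Carrier n) →
              ⟦_⟧ᴾ {suc n} (scaleᴾ n a q) (x ∷ ρ) ≈ ⟦ a ⟧ᴾ ρ * ⟦_⟧ᴾ {suc n} q (x ∷ ρ)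

  mulᴾ-ok zero    a       b ρ       = ι-* a b
  mulᴾ-ok (suc n) []      q (x ∷ ρ) = sym (zeroˡ _)
  mulᴾ-ok (suc n) (a ∷ p) q (x ∷ ρ) = begin
    ⟦_⟧ᴾ {suc n} (mulᴾ (suc n) (a ∷ p) q) (x ∷ ρ)
      ≈⟨ addᴾ-ok (suc n) (scaleᴾ n a q) _ (x ∷ ρ) ⟩
    ⟦_⟧ᴾ {suc n} (scaleᴾ n a q) (x ∷ ρ) + (⟦ 0ᴾ n ⟧ᴾ ρ + x * ⟦_⟧ᴾ {suc n} (mulᴾ (suc n) p q) (x ∷ ρ))
      ≈⟨ +-cong (scaleᴾ-ok n a q x ρ) (trans (+-congʳ (0ᴾ-ok n ρ)) (+-identityˡ _)) ⟩
    ⟦ a ⟧ᴾ ρ * ⟦_⟧ᴾ {suc n} q (x ∷ ρ) + x * ⟦_⟧ᴾ {suc n} (mulᴾ (suc n) p q) (x ∷ ρ)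
      ≈⟨ +-congˡ (trans (*-congˡ (mulᴾ-ok (suc n) p q (x ∷ ρ))) (sym (*-assoc x _ _))) ⟩
    ⟦ a ⟧ᴾ ρ * ⟦_⟧ᴾ {suc n} q (x ∷ ρ) + x * ⟦_⟧ᴾ {suc n} p (x ∷ ρ) * ⟦_⟧ᴾ {suc n} q (x ∷ ρ)
      ≈⟨ distribʳ _ _ _ ⟨
    (⟦ a ⟧ᴾ ρ + x * ⟦_⟧ᴾ {suc n} p (x ∷ ρ)) * ⟦_⟧ᴾ {suc n} q (x ∷ ρ) ∎

  scaleᴾ-ok n a []      x ρ = sym (zeroʳ _)
  scaleᴾ-ok n a (b ∷ q) x ρ = begin
    ⟦ mulᴾ n a b ⟧ᴾ ρ + x * ⟦_⟧ᴾ {suc n} (scaleᴾ n a q) (x ∷ ρ)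
      ≈⟨ +-cong (mulᴾ-ok n a b ρ) (trans (*-congˡ (scaleᴾ-ok n a q x ρ)) (swap x _ _)) ⟩
    ⟦ a ⟧ᴾ ρ * ⟦ b ⟧ᴾ ρ + ⟦ a ⟧ᴾ ρ * (x * ⟦_⟧ᴾ {suc n} q (x ∷ ρ))
      ≈⟨ distribˡ _ _ _ ⟨
    ⟦ a ⟧ᴾ ρ * (⟦ b ⟧ᴾ ρ + x * ⟦_⟧ᴾ {suc n} q (x ∷ ρ)) ∎

  norm-ok : ∀ {n} (e : Expr n) ρ → ⟦ norm e ⟧ᴾ ρ ≈ ⟦ e ⟧ ρ
  norm-ok {n} (con c)  ρ = conᴾ-ok n c ρ
  norm-ok     (var i)  ρ = varᴾ-ok i ρ
  norm-ok {n} (a :+ b) ρ = trans (addᴾ-ok n _ _ ρ) (+-cong (norm-ok a ρ) (norm-ok b ρ))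
  norm-ok {n} (a :* b) ρ = trans (mulᴾ-ok n _ _ ρ) (*-cong (norm-ok a ρ) (norm-ok b ρ))
  norm-ok {n} (:- a)   ρ = trans (negᴾ-ok n _ ρ) (-‿cong (norm-ok a ρ))
  norm-ok {n} (a :^ zero)  ρ = trans (conᴾ-ok n (+ 1) ρ) ι-1
  norm-ok {n} (a :^ suc k) ρ = trans (mulᴾ-ok n _ _ ρ) (*-cong (norm-ok a ρ) (norm-ok (a :^ k) ρ))

  isZero-ok : ∀ n p (ρ : Vec Carrier n) → isZero m n p ≡ true → ⟦ p ⟧ᴾ ρ ≈ 0#
  isZero-ok zero c ρ h = ι-m c (isMultiple-ok m ℤ.∣ c ∣ h)
  isZero-ok (suc n) []      ρ       h = refl
  isZero-ok (suc n) (a ∷ p) (x ∷ ρ) h with isZero m n a in ha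
  ... | true = trans (+-cong (isZero-ok n a ρ ha) (trans (*-congˡ (isZero-ok (suc n) p (x ∷ ρ) h)) (zeroʳ x)))
                     (+-identityʳ 0#)

  x-y≈0⇒x≈y : ∀ {x y} → x - y ≈ 0# → x ≈ y
  x-y≈0⇒x≈y {x} {y} h = begin
    x              ≈⟨ +-identityʳ x ⟨
    x + 0#         ≈⟨ +-congˡ (-‿inverseˡ y) ⟨
    x + (- y + y)  ≈⟨ +-assoc x (- y) y ⟨
    x - y + y      ≈⟨ +-congʳ h ⟩
    0# + y         ≈⟨ +-identityˡ y ⟩
    y              ∎

  x≈y⇒x-y≈0 : ∀ {x y} → x ≈ y → x - y ≈ 0#
  x≈y⇒x-y≈0 {x} {y} h = trans (+-congʳ h) (-‿inverseʳ y)

  infix 3 _⊛_≐_by_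
  -- The cofactor is the multiplier that the hypothesis receives. Lists of facts are the
  -- certificates by which most identities below are proved.
  record Fact {n} (ρ : Vec Carrier n) : Set where
    constructor _⊛_≐_by_
    field
      cofactor lhs rhs : Expr n
      proof            : ⟦ lhs ⟧ ρ ≈ ⟦ rhs ⟧ ρ

  combination : ∀ {n} {ρ : Vec Carrier n} → List (Fact ρ) → Expr n
  combination []                      = con (+ 0)
  combination ((c ⊛ l ≐ r by _) ∷ hs) = c :* (l :- r) :+ combination hs

  combination≈0 : ∀ {n} {ρ : Vec Carrier n} (hs : List (Fact ρ)) → ⟦ combination hs ⟧ ρ ≈ 0#
  combination≈0 []                      = ι-0
  combination≈0 ((c ⊛ l ≐ r by p) ∷ hs) =
    trans (+-cong (trans (*-congˡ (x≈y⇒x-y≈0 p)) (zeroʳ _)) (combination≈0 hs)) (+-identityʳ 0#)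

  -- l ≈ r holds as soon as l - r equals Σ cofactor · (lhs - rhs) as a polynomial modulo m.
  linear-combination : ∀ {n} (ρ : Vec Carrier n) (l r : Expr n) (hs : List (Fact ρ)) →
    isZero m n (norm (l :- r :- combination hs)) ≡ true → ⟦ l ⟧ ρ ≈ ⟦ r ⟧ ρ
  linear-combination ρ l r hs h = x-y≈0⇒x≈y (begin
    ⟦ l :- r ⟧ ρ                                   ≈⟨ +-identityʳ _ ⟨
    ⟦ l :- r ⟧ ρ + 0#                              ≈⟨ +-congˡ -0#≈0# ⟨
    ⟦ l :- r ⟧ ρ + - 0#                            ≈⟨ +-congˡ (-‿cong (combination≈0 hs)) ⟨
    ⟦ l :- r :- combination hs ⟧ ρ                 ≈⟨ norm-ok (l :- r :- combination hs) ρ ⟨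
    ⟦ norm (l :- r :- combination hs) ⟧ᴾ ρ         ≈⟨ isZero-ok _ _ ρ h ⟩
    0#                                             ∎)

  identity : ∀ {n} (ρ : Vec Carrier n) (l r : Expr n) →
    isZero m n (norm (l :- r :- con (+ 0))) ≡ true → ⟦ l ⟧ ρ ≈ ⟦ r ⟧ ρ
  identity ρ l r h = linear-combination ρ l r [] h

v₀ : ∀ {n} → Expr (1 ℕ.+ n)
v₀ = var zero
v₁ : ∀ {n} → Expr (2 ℕ.+ n)
v₁ = var (suc zero)
v₂ : ∀ {n} → Expr (3 ℕ.+ n)
v₂ = var (suc (suc zero))
v₃ : ∀ {n} → Expr (4 ℕ.+ n)
v₃ = var (suc (suc (suc zero)))
v₄ : ∀ {n} → Expr (5 ℕ.+ n)
v₄ = var (suc (suc (suc (suc zero))))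
v₅ : ∀ {n} → Expr (6 ℕ.+ n)
v₅ = var (suc (suc (suc (suc (suc zero)))))
v₆ : ∀ {n} → Expr (7 ℕ.+ n)
v₆ = var (suc (suc (suc (suc (suc (suc zero))))))
v₇ : ∀ {n} → Expr (8 ℕ.+ n)
v₇ = var (suc (suc (suc (suc (suc (suc (suc zero)))))))
v₈ : ∀ {n} → Expr (9 ℕ.+ n)
v₈ = var (suc (suc (suc (suc (suc (suc (suc (suc zero))))))))
v₉ : ∀ {n} → Expr (10 ℕ.+ n)
v₉ = var (suc (suc (suc (suc (suc (suc (suc (suc (suc zero)))))))))
v₁₀ : ∀ {n} → Expr (11 ℕ.+ n)
v₁₀ = var (suc (suc (suc (suc (suc (suc (suc (suc (suc (suc zero))))))))))
v₁₁ : ∀ {n} → Expr (12 ℕ.+ n)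
v₁₁ = var (suc (suc (suc (suc (suc (suc (suc (suc (suc (suc (suc zero)))))))))))
v₁₂ : ∀ {n} → Expr (13 ℕ.+ n)
v₁₂ = var (suc (suc (suc (suc (suc (suc (suc (suc (suc (suc (suc (suc zero))))))))))))
v₁₃ : ∀ {n} → Expr (14 ℕ.+ n)
v₁₃ = var (suc (suc (suc (suc (suc (suc (suc (suc (suc (suc (suc (suc (suc zero)))))))))))))
v₁₄ : ∀ {n} → Expr (15 ℕ.+ n)
v₁₄ = var (suc (suc (suc (suc (suc (suc (suc (suc (suc (suc (suc (suc (suc (suc zero))))))))))))))
v₁₅ : ∀ {n} → Expr (16 ℕ.+ n)
v₁₅ = var (suc (suc (suc (suc (suc (suc (suc (suc (suc (suc (suc (suc (suc (suc (suc zero)))))))))))))))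
v₁₆ : ∀ {n} → Expr (17 ℕ.+ n)
v₁₆ = var (suc (suc (suc (suc (suc (suc (suc (suc (suc (suc (suc (suc (suc (suc (suc (suc zero))))))))))))))))
v₁₇ : ∀ {n} → Expr (18 ℕ.+ n)
v₁₇ = var (suc (suc (suc (suc (suc (suc (suc (suc (suc (suc (suc (suc (suc (suc (suc (suc (suc zero)))))))))))))))))
v₁₈ : ∀ {n} → Expr (19 ℕ.+ n)
v₁₈ = var (suc (suc (suc (suc (suc (suc (suc (suc (suc (suc (suc (suc (suc (suc (suc (suc (suc (suc zero))))))))))))))))))

infix 10 #_
#_ : ∀ {n} → ℕ → Expr n
# k = con (+ k)

integerConstants : Constants ℤP.+-*-commutativeRing 0
integerConstants = record
  { ι     = λ c → c
  ; ι-+   = λ _ _ → ≡.refl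
  ; ι-*   = λ _ _ → ≡.refl
  ; ι-neg = λ _ → ≡.refl
  ; ι-1   = ≡.refl
  ; ι-m   = λ a h → ℤP.∣i∣≡0⇒i≡0 (ℕD.0∣⇒≡0 h)
  }

private module Z = RingSolver ℤP.+-*-commutativeRing 0 integerConstants
open Z using () renaming (_^_ to _^ᶻ_)

open import Data.Integer using (_+_; _*_; -_; _-_)
open import Relation.Binary.PropositionalEquality using (refl; sym; trans; cong; cong₂; subst; module ≡-Reasoning)
open ≡-Reasoning

-- Finite sums, the ring of power series and congruences

sumTo-cong : ∀ {f g} n → (∀ i → i ≤ n → f i ≡ g i) → sumTo f n ≡ sumTo g n
sumTo-cong zero    h = h 0 z≤n
sumTo-cong (suc n) h =
  cong₂ _+_ (sumTo-cong n λ i i≤n → h i (ℕP.m≤n⇒m≤1+n i≤n)) (h (suc n) ℕP.≤-refl)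

sumTo-+ : ∀ f g n → sumTo (λ i → f i + g i) n ≡ sumTo f n + sumTo g n
sumTo-+ f g zero    = refl
sumTo-+ f g (suc n) rewrite sumTo-+ f g n =
  Z.identity (sumTo f n ∷ sumTo g n ∷ f (suc n) ∷ g (suc n) ∷ [])
      ((v₀ :+ v₁) :+ (v₂ :+ v₃)) ((v₀ :+ v₂) :+ (v₁ :+ v₃)) refl

sumTo-* : ∀ c f n → sumTo (λ i → c * f i) n ≡ c * sumTo f n
sumTo-* c f zero    = refl
sumTo-* c f (suc n) rewrite sumTo-* c f n = sym (ℤP.*-distribˡ-+ c (sumTo f n) (f (suc n)))

sumTo-suc : ∀ f n → sumTo f (suc n) ≡ f 0 + sumTo (λ i → f (suc i)) n
sumTo-suc f zero    = refl
sumTo-suc f (suc n) = begin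
  sumTo f (suc n) + f (suc (suc n))
    ≡⟨ cong (_+ f (suc (suc n))) (sumTo-suc f n) ⟩
  f 0 + sumTo (λ i → f (suc i)) n + f (suc (suc n))
    ≡⟨ ℤP.+-assoc (f 0) _ _ ⟩
  f 0 + sumTo (λ i → f (suc i)) (suc n) ∎

sumTo-zero : ∀ {f} n → (∀ i → i ≤ n → f i ≡ + 0) → sumTo f n ≡ + 0
sumTo-zero zero    h = h 0 z≤n
sumTo-zero (suc n) h
  rewrite sumTo-zero n (λ i i≤n → h i (ℕP.m≤n⇒m≤1+n i≤n)) | h (suc n) ℕP.≤-refl = refl

conv-congᵇ : ∀ {f f′ g g′} n → (∀ i → i ≤ n → f i ≡ f′ i) → (∀ i → i ≤ n → g i ≡ g′ i) →
             conv f g n ≡ conv f′ g′ n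
conv-congᵇ n hf hg = sumTo-cong n λ i i≤n → cong₂ _*_ (hf i i≤n) (hg (n ∸ i) (ℕP.m∸n≤m n i))

tail : Series → Series
tail f n = f (suc n)

infixl 6 _⊕_
_⊕_ : Series → Series → Series
(f ⊕ g) n = f n + g n

⊖_ : Series → Series
(⊖ f) n = - f n

constS : ℤ → Series
constS c zero    = c
constS c (suc _) = + 0

conv-suc : ∀ f g n → conv f g (suc n) ≡ f 0 * g (suc n) + conv (tail f) g n
conv-suc f g n = sumTo-suc (λ i → f i * g (suc n ∸ i)) n

conv-sucʳ : ∀ f g n → conv f g (suc n) ≡ conv f (tail g) n + f (suc n) * g 0
conv-sucʳ f g n = cong₂ _+_
  (sumTo-cong n λ i i≤n → cong (λ k → f i * g k) (ℕP.+-∸-assoc 1 i≤n))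
  (cong (λ k → f (suc n) * g k) (ℕP.n∸n≡0 n))

conv-comm : ∀ f g n → conv f g n ≡ conv g f n
conv-comm f g zero    = ℤP.*-comm (f 0) (g 0)
conv-comm f g (suc n) = begin
  conv f g (suc n)                     ≡⟨ conv-suc f g n ⟩
  f 0 * g (suc n) + conv (tail f) g n  ≡⟨ cong₂ _+_ (ℤP.*-comm (f 0) _) (conv-comm (tail f) g n) ⟩
  g (suc n) * f 0 + conv g (tail f) n  ≡⟨ ℤP.+-comm _ (conv g (tail f) n) ⟩
  conv g (tail f) n + g (suc n) * f 0  ≡⟨ conv-sucʳ g f n ⟨
  conv g f (suc n)                     ∎

conv-distribʳ : ∀ f g h n → conv (g ⊕ h) f n ≡ conv g f n + conv h f n
conv-distribʳ f g h n = trans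
  (sumTo-cong n λ i _ → ℤP.*-distribʳ-+ (f (n ∸ i)) (g i) (h i))
  (sumTo-+ _ _ n)

conv-scale : ∀ c f g n → conv (λ i → c * f i) g n ≡ c * conv f g n
conv-scale c f g n = trans (sumTo-cong n λ i _ → ℤP.*-assoc c (f i) _) (sumTo-* c _ n)

-- Induction on the exponent: `tail (conv f g)` is `f 0` times `tail g` plus `conv (tail f) g`, so
-- the claim for `tail f` suffices.
conv-assoc : ∀ f g h n → conv (conv f g) h n ≡ conv f (conv g h) n
conv-assoc f g h zero    = ℤP.*-assoc (f 0) (g 0) (h 0)
conv-assoc f g h (suc n) = begin
  conv (conv f g) h (suc n)
    ≡⟨ conv-suc (conv f g) h n ⟩
  f 0 * g 0 * h (suc n) + conv (tail (conv f g)) h n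
    ≡⟨ cong (λ x → f 0 * g 0 * h (suc n) + x) (trans
         (conv-congᵇ {g = h} n (λ i _ → conv-suc f g i) (λ _ _ → refl))
         (conv-distribʳ h (λ i → f 0 * g (suc i)) (conv (tail f) g) n)) ⟩
  f 0 * g 0 * h (suc n) + (conv (λ i → f 0 * tail g i) h n + conv (conv (tail f) g) h n)
    ≡⟨ cong₂ (λ x y → f 0 * g 0 * h (suc n) + (x + y))
         (conv-scale (f 0) (tail g) h n) (conv-assoc (tail f) g h n) ⟩
  f 0 * g 0 * h (suc n) + (f 0 * conv (tail g) h n + conv (tail f) (conv g h) n)
    ≡⟨ Z.identity (f 0 ∷ g 0 ∷ h (suc n) ∷ conv (tail g) h n ∷ conv (tail f) (conv g h) n ∷ [])
      (v₀ :* v₁ :* v₂ :+ (v₀ :* v₃ :+ v₄)) (v₀ :* (v₁ :* v₂ :+ v₃) :+ v₄) refl ⟩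
  f 0 * (g 0 * h (suc n) + conv (tail g) h n) + conv (tail f) (conv g h) n
    ≡⟨ cong (λ x → f 0 * x + conv (tail f) (conv g h) n) (conv-suc g h n) ⟨
  f 0 * conv g h (suc n) + conv (tail f) (conv g h) n
    ≡⟨ conv-suc f (conv g h) n ⟨
  conv f (conv g h) (suc n) ∎

conv-const : ∀ c f n → conv (constS c) f n ≡ c * f n
conv-const c f zero    = refl
conv-const c f (suc n) = begin
  conv (constS c) f (suc n)                      ≡⟨ conv-suc (constS c) f n ⟩
  c * f (suc n) + conv (λ _ → + 0) f n
    ≡⟨ cong (λ x → c * f (suc n) + x) (sumTo-zero n λ i _ → refl) ⟩
  c * f (suc n) + + 0                            ≡⟨ ℤP.+-identityʳ _ ⟩
  c * f (suc n) ∎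

oneS≡ : ∀ n → oneS n ≡ constS (+ 1) n
oneS≡ zero    = refl
oneS≡ (suc n) = refl

θ : Series → Series
θ f n = + n * f n

θ-conv : ∀ f g n → θ (conv f g) n ≡ conv (θ f) g n + conv f (θ g) n
θ-conv f g n = begin
  + n * conv f g n
    ≡⟨ sumTo-* (+ n) _ n ⟨
  sumTo (λ i → + n * (f i * g (n ∸ i))) n
    ≡⟨ sumTo-cong n (λ i i≤n → trans
         (cong (λ k → + k * (f i * g (n ∸ i))) (sym (ℕP.m+[n∸m]≡n i≤n)))
         (Z.identity (+ i ∷ + (n ∸ i) ∷ f i ∷ g (n ∸ i) ∷ [])
      ((v₀ :+ v₁) :* (v₂ :* v₃)) ((v₀ :* v₂) :* v₃ :+ v₂ :* (v₁ :* v₃)) refl)) ⟩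
  sumTo (λ i → θ f i * g (n ∸ i) + f i * θ g (n ∸ i)) n
    ≡⟨ sumTo-+ _ _ n ⟩
  conv (θ f) g n + conv f (θ g) n ∎

-- Congruence of series modulo m; for m = 0 this is pointwise equality.
module Congruence (m : ℕ) where

  infix 4 _≡ᶻ_ _≋_
  record _≡ᶻ_ (a b : ℤ) : Set where
    constructor mk
    field
      quot : ℤ
      eq   : a ≡ b + quot * + m

  refl′ : ∀ {a b} → a ≡ b → a ≡ᶻ b
  refl′ {a} refl = mk (+ 0) (sym (ℤP.+-identityʳ a))

  sym′ : ∀ {a b} → a ≡ᶻ b → b ≡ᶻ a
  sym′ {_} {b} (mk q refl) = mk (- q)
    (Z.identity (b ∷ q ∷ + m ∷ [])
      (v₀) ((v₀ :+ v₁ :* v₂) :+ (:- v₁) :* v₂) refl)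

  trans′ : ∀ {a b c} → a ≡ᶻ b → b ≡ᶻ c → a ≡ᶻ c
  trans′ {_} {_} {c} (mk q refl) (mk r refl) = mk (r + q)
    (Z.identity (c ∷ q ∷ r ∷ + m ∷ [])
      ((v₀ :+ v₂ :* v₃) :+ v₁ :* v₃) (v₀ :+ (v₂ :+ v₁) :* v₃) refl)

  +-cong′ : ∀ {a b c d} → a ≡ᶻ b → c ≡ᶻ d → a + c ≡ᶻ b + d
  +-cong′ {_} {b} {_} {d} (mk q refl) (mk r refl) = mk (q + r)
    (Z.identity (b ∷ d ∷ q ∷ r ∷ + m ∷ [])
      ((v₀ :+ v₂ :* v₄) :+ (v₁ :+ v₃ :* v₄)) (v₀ :+ v₁ :+ (v₂ :+ v₃) :* v₄) refl)

  *-cong′ : ∀ {a b c d} → a ≡ᶻ b → c ≡ᶻ d → a * c ≡ᶻ b * d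
  *-cong′ {_} {b} {_} {d} (mk q refl) (mk r refl) = mk (q * (d + r * + m) + b * r)
    (Z.identity (b ∷ d ∷ q ∷ r ∷ + m ∷ [])
      ((v₀ :+ v₂ :* v₄) :* (v₁ :+ v₃ :* v₄)) (v₀ :* v₁ :+ (v₂ :* (v₁ :+ v₃ :* v₄) :+ v₀ :* v₃) :* v₄) refl)

  neg-cong′ : ∀ {a b} → a ≡ᶻ b → - a ≡ᶻ - b
  neg-cong′ {_} {b} (mk q refl) = mk (- q)
    (Z.identity (b ∷ q ∷ + m ∷ [])
      (:- (v₀ :+ v₁ :* v₂)) (:- v₀ :+ (:- v₁) :* v₂) refl)

  sumTo-cong′ : ∀ {f g} n → (∀ i → i ≤ n → f i ≡ᶻ g i) → sumTo f n ≡ᶻ sumTo g n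
  sumTo-cong′ zero    h = h 0 z≤n
  sumTo-cong′ (suc n) h =
    +-cong′ (sumTo-cong′ n λ i i≤n → h i (ℕP.m≤n⇒m≤1+n i≤n)) (h (suc n) ℕP.≤-refl)

  -- A record rather than a function type, so that both series can be inferred from the type of a
  -- congruence.
  record _≋_ (f g : Series) : Set where
    constructor pointwise
    field at : ∀ n → f n ≡ᶻ g n
  open _≋_ public

  exact : ∀ {f g} → (∀ n → f n ≡ g n) → f ≋ g
  exact h = pointwise λ n → refl′ (h n)

  conv-cong : ∀ {f f′ g g′} → f ≋ f′ → g ≋ g′ → conv f g ≋ conv f′ g′
  conv-cong p q = pointwise λ n → sumTo-cong′ n λ i _ → *-cong′ (at p i) (at q (n ∸ i))

  θ-cong : ∀ {f g} → f ≋ g → θ f ≋ θ g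
  θ-cong p = pointwise λ n → *-cong′ (refl′ {+ n} refl) (at p n)

  seriesRing : CommutativeRing 0ℓ 0ℓ
  seriesRing = record
    { Carrier = Series
    ; _≈_ = _≋_
    ; _+_ = _⊕_
    ; _*_ = conv
    ; -_ = ⊖_
    ; 0# = constS (+ 0)
    ; 1# = constS (+ 1)
    ; isCommutativeRing = record
      { isRing = record
        { +-isAbelianGroup = record
          { isGroup = record
            { isMonoid = record
              { isSemigroup = record
                { isMagma = record
                  { isEquivalence = record
                    { refl  = exact λ _ → refl
                    ; sym   = λ p → pointwise λ n → sym′ (at p n)
                    ; trans = λ p q → pointwise λ n → trans′ (at p n) (at q n)
                    }
                  ; ∙-cong = λ p q → pointwise λ n → +-cong′ (at p n) (at q n)
                  }
                ; assoc = λ f g h → exact λ n → ℤP.+-assoc (f n) (g n) (h n)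
                }
              ; identity = (λ f → exact (λ n → trans (cong (_+ f n) (zero≡ n)) (ℤP.+-identityˡ (f n))))
                         , (λ f → exact (λ n → trans (cong (λ x → f n + x) (zero≡ n)) (ℤP.+-identityʳ (f n))))
              }
            ; inverse = (λ f → exact (λ n → trans (ℤP.+-inverseˡ (f n)) (sym (zero≡ n))))
                      , (λ f → exact (λ n → trans (ℤP.+-inverseʳ (f n)) (sym (zero≡ n))))
            ; ⁻¹-cong = λ p → pointwise λ n → neg-cong′ (at p n)
            }
          ; comm = λ f g → exact λ n → ℤP.+-comm (f n) (g n)
          }
        ; *-cong = conv-cong
        ; *-assoc = λ f g h → exact (conv-assoc f g h)
        ; *-identity = (λ f → exact (λ n → trans (conv-const (+ 1) f n) (ℤP.*-identityˡ (f n))))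
                     , (λ f → exact (λ n → trans (conv-comm f (constS (+ 1)) n)
                         (trans (conv-const (+ 1) f n) (ℤP.*-identityˡ (f n)))))
        ; distrib = (λ f g h → exact (λ n → trans (conv-comm f (g ⊕ h) n)
                       (trans (conv-distribʳ f g h n)
                         (cong₂ _+_ (conv-comm g f n) (conv-comm h f n)))))
                  , (λ f g h → exact (conv-distribʳ f g h))
        }
      ; *-comm = λ f g → exact (conv-comm f g)
      }
    }
    where
    zero≡ : ∀ n → constS (+ 0) n ≡ + 0
    zero≡ zero    = refl
    zero≡ (suc n) = refl

constS-zero : ∀ n → constS (+ 0) n ≡ + 0
constS-zero zero    = refl
constS-zero (suc n) = refl

constS-* : ∀ a b n → constS (a * b) n ≡ a * constS b n
constS-* a b zero    = refl
constS-* a b (suc n) = sym (ℤP.*-zeroʳ a)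

module SeriesMod (m : ℕ) where
  open Congruence m public

  ∣⇒≡ᶻ0 : ∀ a → m ℕD.∣ ℤ.∣ a ∣ → a ≡ᶻ + 0
  ∣⇒≡ᶻ0 (+ _)    (ℕD.divides q refl) = mk (+ q) (trans (ℤP.pos-* q m) (sym (ℤP.+-identityˡ _)))
  ∣⇒≡ᶻ0 -[1+ n ] (ℕD.divides q e)    = mk (- (+ q)) (begin
    - (+ suc n)       ≡⟨ cong (λ k → - (+ k)) e ⟩
    - (+ (q ℕ.* m))   ≡⟨ cong -_ (ℤP.pos-* q m) ⟩
    - (+ q * + m)     ≡⟨ ℤP.neg-distribˡ-* (+ q) (+ m) ⟩
    - (+ q) * + m     ≡⟨ ℤP.+-identityˡ _ ⟨
    + 0 + - (+ q) * + m ∎)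

  constS-multiple : ∀ a → m ℕD.∣ ℤ.∣ a ∣ → constS a ≋ constS (+ 0)
  constS-multiple a d = pointwise λ { zero → ∣⇒≡ᶻ0 a d ; (suc n) → refl′ refl }

  seriesConstants : Constants seriesRing m
  seriesConstants = record
    { ι     = constS
    ; ι-+   = λ a b → exact λ { zero → refl ; (suc n) → refl }
    ; ι-*   = λ a b → exact λ n → trans (constS-* a b n) (sym (conv-const a (constS b) n))
    ; ι-neg = λ a → exact λ { zero → refl ; (suc n) → refl }
    ; ι-1   = exact λ _ → refl
    ; ι-m   = constS-multiple
    }

  open RingSolver seriesRing m seriesConstants public

  open CommutativeRing seriesRing public
    using ()
    renaming (refl to ≋-refl; sym to ≋-sym; trans to ≋-trans; +-cong to ⊕-cong; -‿cong to ⊖-cong)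

  θ-⊕ : ∀ f g → θ (f ⊕ g) ≋ θ f ⊕ θ g
  θ-⊕ f g = exact λ n → ℤP.*-distribˡ-+ (+ n) (f n) (g n)

  θ-⊖ : ∀ f → θ (⊖ f) ≋ ⊖ (θ f)
  θ-⊖ f = exact λ n → sym (ℤP.neg-distribʳ-* (+ n) (f n))

  θ-* : ∀ f g → θ (conv f g) ≋ conv (θ f) g ⊕ conv f (θ g)
  θ-* f g = exact (θ-conv f g)

  θ-const : ∀ c → θ (constS c) ≋ constS (+ 0)
  θ-const c = exact λ { zero → refl ; (suc n) → ℤP.*-zeroʳ (+ suc n) }

  θ-scale : ∀ c f → θ (conv (constS c) f) ≋ conv (constS c) (θ f)
  θ-scale c f = exact λ n → trans (cong (λ x → + n * x) (conv-const c f n))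
    (trans (trans (sym (ℤP.*-assoc (+ n) c (f n)))
      (trans (cong (_* f n) (ℤP.*-comm (+ n) c)) (ℤP.*-assoc c (+ n) (f n))))
      (sym (conv-const c (θ f) n)))

-- Lambert series and Skoruppa's identity

module LambertSeries where
  open SeriesMod 0

  exact⁻¹ : ∀ {f g} → f ≋ g → ∀ n → f n ≡ g n
  exact⁻¹ {f} {g} p n with at p n
  ... | mk q e = trans e (trans (cong (λ x → g n + x) (ℤP.*-zeroʳ q)) (ℤP.+-identityʳ (g n)))

  -- The bridge from exact identities, where `·-cancel` is available, to congruences.
  mod : ∀ m {f g} → f ≋ g → Congruence._≋_ m f g
  mod m p = Congruence.exact m (exact⁻¹ p)

  mono : ℕ → Series
  mono d = shift d (constS (+ 1))

  shift-+ : ∀ a b f n → shift a (shift b f) n ≡ shift (a ℕ.+ b) f n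
  shift-+ zero    b f n       = refl
  shift-+ (suc a) b f zero    = refl
  shift-+ (suc a) b f (suc n) = shift-+ a b f n

  shift-cong : ∀ d {f g : Series} → (∀ n → f n ≡ g n) → ∀ n → shift d f n ≡ shift d g n
  shift-cong zero    h n       = h n
  shift-cong (suc d) h zero    = refl
  shift-cong (suc d) h (suc n) = shift-cong d h n

  shift-at : ∀ d f n → shift d f (d ℕ.+ n) ≡ f n
  shift-at zero    f n = refl
  shift-at (suc d) f n = shift-at d f n

  shift-< : ∀ d f {n} → n < d → shift d f n ≡ + 0
  shift-< (suc d) f {zero}  _         = refl
  shift-< (suc d) f {suc n} (s≤s n<d) = shift-< d f n<d

  conv-shift : ∀ d f g n → conv (shift d f) g n ≡ shift d (conv f g) n
  conv-shift zero    f g n       = refl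
  conv-shift (suc d) f g zero    = refl
  conv-shift (suc d) f g (suc n) = trans (conv-suc (shift (suc d) f) g n)
    (trans (ℤP.+-identityˡ _) (conv-shift d f g n))

  mono-conv : ∀ d f n → conv (mono d) f n ≡ shift d f n
  mono-conv d f n = trans (conv-shift d (constS (+ 1)) f n)
    (shift-cong d (λ k → trans (conv-const (+ 1) f k) (ℤP.*-identityˡ (f k))) n)

  mono-+ : ∀ a b → conv (mono a) (mono b) ≋ mono (a ℕ.+ b)
  mono-+ a b = exact λ n → trans (mono-conv a (mono b) n) (shift-+ a b _ n)

  θ-shift1 : ∀ d n → θ (mono d) n ≡ + d * mono d n
  θ-shift1 d n with ℕP.≤-total d n
  θ-shift1 d n | inj₁ d≤n with n ∸ d | ℕP.m+[n∸m]≡n d≤n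
  ... | zero  | refl = cong (λ k → + k * mono d (d ℕ.+ 0)) (ℕP.+-identityʳ d)
  ... | suc k | refl = trans (cong (λ x → + (d ℕ.+ suc k) * x) (shift-at d (constS (+ 1)) (suc k)))
    (trans (ℤP.*-zeroʳ (+ (d ℕ.+ suc k)))
    (sym (trans (cong (λ x → + d * x) (shift-at d (constS (+ 1)) (suc k))) (ℤP.*-zeroʳ (+ d)))))
  θ-shift1 d n | inj₂ n≤d with ℕP.m≤n⇒m<n∨m≡n n≤d
  ... | inj₂ refl = refl
  ... | inj₁ n<d = trans (cong (λ x → + n * x) (shift-< d (constS (+ 1)) n<d))
    (trans (ℤP.*-zeroʳ (+ n))
    (sym (trans (cong (λ x → + d * x) (shift-< d (constS (+ 1)) n<d)) (ℤP.*-zeroʳ (+ d)))))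

  θ-mono : ∀ d → θ (mono d) ≋ conv (constS (+ d)) (mono d)
  θ-mono d = exact λ n → trans (θ-shift1 d n) (sym (conv-const (+ d) (mono d) n))

  geo-yes : ∀ {d n} → d ℕD.∣ n → geo d n ≡ + 1
  geo-yes {d} {n} h rewrite dec-true (d ℕD.∣? n) h = refl

  geo-no : ∀ {d n} → ¬ (d ℕD.∣ n) → geo d n ≡ + 0
  geo-no {d} {n} h rewrite dec-false (d ℕD.∣? n) h = refl

  geo-periodic : ∀ d k → geo d (d ℕ.+ k) ≡ geo d k
  geo-periodic d k = go (d ℕD.∣? k)
    where
    go : Dec (d ℕD.∣ k) → geo d (d ℕ.+ k) ≡ geo d k
    go (yes h) = trans (geo-yes {d} (ℕD.∣m∣n⇒∣m+n ℕD.∣-refl h)) (sym (geo-yes {d} h))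
    go (no ¬h) = trans (geo-no {d} (λ h → ¬h (ℕD.∣m+n∣m⇒∣n h ℕD.∣-refl))) (sym (geo-no {d} ¬h))

  -- The equation x = 1 + q^d x for 1/(1 - q^d). The product and derivative formulas below are
  -- linear combinations of its instances.
  geo-rec : ∀ d → geo (suc d) ≋ constS (+ 1) ⊕ conv (mono (suc d)) (geo (suc d))
  geo-rec d = exact λ n → trans (go n (suc d ℕP.≤? n))
    (cong (λ x → constS (+ 1) n + x) (sym (mono-conv (suc d) (geo (suc d)) n)))
    where
    go : ∀ n → _ → geo (suc d) n ≡ constS (+ 1) n + shift (suc d) (geo (suc d)) n
    go n (yes d≤n) with n ∸ suc d | ℕP.m+[n∸m]≡n d≤n
    ... | k | refl rewrite shift-at d (geo (suc d)) k | ℤP.+-identityˡ (geo (suc d) k)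
      = geo-periodic (suc d) k
    go zero    (no _)  = geo-yes {suc d} (suc d ℕD.∣0)
    go (suc n) (no ¬h) rewrite shift-< d (geo (suc d)) {n} (ℕP.≤-pred (ℕP.≰⇒> ¬h)) =
      geo-no (λ h → ¬h (ℕD.∣⇒≤ h))

  -- ℓ d = q^d / (1 - q^d)
  ℓ : ℕ → Series
  ℓ d = geo d ⊕ ⊖ constS (+ 1)

  -- This is 1 - xy = (1 - x) + (1 - y) - (1 - x)(1 - y), divided by (1 - x)(1 - y)(1 - xy).
  geo-* : ∀ a b → conv (geo (suc a)) (geo (suc b)) ≋
    conv (geo (suc a ℕ.+ suc b)) (geo (suc a) ⊕ geo (suc b) ⊕ ⊖ constS (+ 1))
  geo-* a b = linear-combination
    (mono (suc a) ∷ mono (suc b) ∷ geo (suc a) ∷ geo (suc b) ∷ geo (suc a ℕ.+ suc b) ∷ [])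
    (v₂ :* v₃) (v₄ :* (v₂ :+ v₃ :- # 1))
    ( ((v₄ :* (v₃ :- # 1)) ⊛ v₂ ≐ (# 1 :+ v₀ :* v₂) by geo-rec a)
    ∷ ((v₄ :* v₀ :* v₂) ⊛ v₃ ≐ (# 1 :+ v₁ :* v₃) by geo-rec b)
    ∷ ((:- (v₂ :* v₃)) ⊛ v₄ ≐ (# 1 :+ v₀ :* v₁ :* v₄)
        by ≋-trans (geo-rec (a ℕ.+ suc b)) (⊕-cong (≋-refl {constS (+ 1)})
          (conv-cong (≋-sym (mono-+ (suc a) (suc b))) (≋-refl {geo (suc a ℕ.+ suc b)}))))
    ∷ []) refl

  ℓ-* : ∀ a b → conv (ℓ (suc a)) (ℓ (suc b)) ≋
    ℓ (suc a ℕ.+ suc b) ⊕ conv (ℓ (suc a ℕ.+ suc b)) (ℓ (suc a)) ⊕ conv (ℓ (suc a ℕ.+ suc b)) (ℓ (suc b))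
  ℓ-* a b = linear-combination (geo (suc a) ∷ geo (suc b) ∷ geo (suc a ℕ.+ suc b) ∷ [])
    (l₀ :* l₁) (l₂ :+ l₂ :* l₀ :+ l₂ :* l₁)
    ((# 1 ⊛ (v₀ :* v₁) ≐ (v₂ :* (v₀ :+ v₁ :- # 1)) by geo-* a b) ∷ []) refl
    where
    l₀ l₁ l₂ : Expr 3
    l₀ = v₀ :- # 1
    l₁ = v₁ :- # 1
    l₂ = v₂ :- # 1

  θ-geo : ∀ d → θ (geo (suc d)) ≋ conv (constS (+ suc d)) (conv (geo (suc d)) (ℓ (suc d)))
  θ-geo d = linear-combination
    (mono (suc d) ∷ geo (suc d) ∷ θ (geo (suc d)) ∷ constS (+ suc d) ∷ θ (mono (suc d)) ∷ [])
    v₂ (v₃ :* (v₁ :* (v₁ :- # 1)))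
    ( ((:- (v₃ :* v₁) :- v₂) ⊛ v₁ ≐ (# 1 :+ v₀ :* v₁) by geo-rec d)
    ∷ (v₁ ⊛ v₂ ≐ (v₄ :* v₁ :+ v₀ :* v₂) by
        ≋-trans (θ-cong (geo-rec d)) (≋-trans (θ-⊕ _ _)
          (≋-trans (⊕-cong (θ-const (+ 1)) (θ-* (mono (suc d)) (geo (suc d))))
            (identity (θ (mono (suc d)) ∷ geo (suc d) ∷ mono (suc d) ∷ θ (geo (suc d)) ∷ [])
              (# 0 :+ (v₀ :* v₁ :+ v₂ :* v₃)) (v₀ :* v₁ :+ v₂ :* v₃) refl))))
    ∷ ((v₁ :* v₁) ⊛ v₄ ≐ (v₃ :* v₀) by θ-mono (suc d))
    ∷ []) refl

  θ-ℓ : ∀ d → θ (ℓ (suc d)) ≋ conv (constS (+ suc d)) (conv (ℓ (suc d)) (ℓ (suc d)) ⊕ ℓ (suc d))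
  θ-ℓ d = ≋-trans (θ-⊕ (geo (suc d)) (⊖ constS (+ 1)))
    (≋-trans (⊕-cong (θ-geo d) (≋-trans (θ-⊖ (constS (+ 1))) (⊖-cong (θ-const (+ 1)))))
      (identity (constS (+ suc d) ∷ geo (suc d) ∷ [])
        (v₀ :* (v₁ :* (v₁ :- # 1)) :+ (:- # 0))
        (v₀ :* ((v₁ :- # 1) :* (v₁ :- # 1) :+ (v₁ :- # 1))) refl))

  ℓ-vanish : ∀ {a n} → n ≤ a → ℓ (suc a) n ≡ + 0
  ℓ-vanish {a} {zero}  _   = cong (λ x → x + -[1+ 0 ]) (geo-yes {suc a} (suc a ℕD.∣0))
  ℓ-vanish {a} {suc n} n<a = cong (λ x → x + + 0) (geo-no {suc a} (λ h → ℕP.<⇒≱ (s≤s n<a) (ℕD.∣⇒≤ h)))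

  -- The product starts at q^(a+b+2): the first factor kills the term if i ≤ a, the second one
  -- otherwise. This keeps the double sums finite.
  ℓℓ-vanish : ∀ {a b n} → n ≤ suc (a ℕ.+ b) → conv (ℓ (suc a)) (ℓ (suc b)) n ≡ + 0
  ℓℓ-vanish {a} {b} {n} h = sumTo-zero n λ i i≤n → lem i (ℕP.≤-total i a)
    where
    lem : ∀ i → _ → ℓ (suc a) i * ℓ (suc b) (n ∸ i) ≡ + 0
    lem i (inj₁ i≤a) rewrite ℓ-vanish i≤a = refl
    lem i (inj₂ a≤i) with ℕP.m≤n⇒m<n∨m≡n a≤i
    ... | inj₂ refl rewrite ℓ-vanish {a} ℕP.≤-refl = refl
    ... | inj₁ a<i = trans (cong (λ x → ℓ (suc a) i * x) (ℓ-vanish (ℕP.≤-trans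
            (ℕP.∸-mono h a<i) (ℕP.≤-reflexive (ℕP.m+n∸m≡n a b))))) (ℤP.*-zeroʳ (ℓ (suc a) i))

  Σ< : ℕ → (ℕ → ℤ) → ℤ
  Σ< zero    f = + 0
  Σ< (suc n) f = Σ< n f + f n

  Σ<-cong : ∀ {f g} n → (∀ i → i < n → f i ≡ g i) → Σ< n f ≡ Σ< n g
  Σ<-cong zero    h = refl
  Σ<-cong (suc n) h = cong₂ _+_ (Σ<-cong n λ i i<n → h i (ℕP.m<n⇒m<1+n i<n)) (h n ℕP.≤-refl)

  Σ<-+ : ∀ f g n → Σ< n (λ i → f i + g i) ≡ Σ< n f + Σ< n g
  Σ<-+ f g zero    = refl
  Σ<-+ f g (suc n) = trans (cong (_+ (f n + g n)) (Σ<-+ f g n))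
    (Z.identity (Σ< n f ∷ Σ< n g ∷ f n ∷ g n ∷ [])
      (v₀ :+ v₁ :+ (v₂ :+ v₃)) (v₀ :+ v₂ :+ (v₁ :+ v₃)) refl)

  Σ<-* : ∀ c f n → Σ< n (λ i → c * f i) ≡ c * Σ< n f
  Σ<-* c f zero    = sym (ℤP.*-zeroʳ c)
  Σ<-* c f (suc n) = trans (cong (_+ c * f n) (Σ<-* c f n)) (sym (ℤP.*-distribˡ-+ c (Σ< n f) (f n)))

  Σ<-zero : ∀ {f} n → (∀ i → i < n → f i ≡ + 0) → Σ< n f ≡ + 0
  Σ<-zero zero    h = refl
  Σ<-zero (suc n) h = cong₂ _+_ (Σ<-zero n λ i i<n → h i (ℕP.m<n⇒m<1+n i<n)) (h n ℕP.≤-refl)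

  Σ<-extend : ∀ {f} n k → (∀ i → n ≤ i → f i ≡ + 0) → Σ< (k ℕ.+ n) f ≡ Σ< n f
  Σ<-extend n zero    h = refl
  Σ<-extend n (suc k) h = trans (cong₂ _+_ (Σ<-extend n k h) (h (k ℕ.+ n) (ℕP.m≤n+m n k))) (ℤP.+-identityʳ _)

  Σ<-truncate : ∀ {f} {n N} → n ≤ N → (∀ i → n ≤ i → f i ≡ + 0) → Σ< N f ≡ Σ< n f
  Σ<-truncate {f} {n} {N} n≤N h =
    trans (cong (λ k → Σ< k f) (sym (ℕP.m∸n+n≡m n≤N))) (Σ<-extend n (N ∸ n) h)

  Σ<-suc : ∀ f n → Σ< (suc n) f ≡ f 0 + Σ< n (λ i → f (suc i))
  Σ<-suc f zero    = trans (ℤP.+-identityˡ (f 0)) (sym (ℤP.+-identityʳ (f 0)))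
  Σ<-suc f (suc n) = trans (cong (_+ f (suc n)) (Σ<-suc f n)) (ℤP.+-assoc (f 0) _ _)

  Σ<-reverse : ∀ f n → Σ< n (λ i → f (n ∸ suc i)) ≡ Σ< n f
  Σ<-reverse f zero    = refl
  Σ<-reverse f (suc n) = trans (Σ<-suc (λ i → f (n ∸ i)) n)
    (trans (cong (λ x → f n + x) (Σ<-reverse f n)) (ℤP.+-comm (f n) _))

  Σ<-swap : ∀ (F : ℕ → ℕ → ℤ) m n → Σ< m (λ i → Σ< n (F i)) ≡ Σ< n (λ j → Σ< m (λ i → F i j))
  Σ<-swap F zero    n = sym (Σ<-zero n λ _ _ → refl)
  Σ<-swap F (suc m) n = trans (cong (_+ Σ< n (F m)) (Σ<-swap F m n))
    (sym (Σ<-+ (λ j → Σ< m (λ i → F i j)) (F m) n))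

  -- Both sides reduce to the triangle i + j + 1 < N. The index c = i + j + 1 stands for the integer
  -- c + 1 = (i + 1) + (j + 1).
  Σ<-antidiagonal : ∀ (F : ℕ → ℕ → ℤ) N → (∀ i j → N ≤ suc (i ℕ.+ j) → F i j ≡ + 0) →
    Σ< N (λ i → Σ< N (F i)) ≡ Σ< N (λ c → Σ< c (λ i → F i (c ∸ suc i)))
  Σ<-antidiagonal F N vanish = trans
    (Σ<-cong N λ i i<N → Σ<-truncate (ℕP.m∸n≤m N (suc i)) λ j h → vanish i j (ℕP.≤-trans (ℕP.m≤n+m∸n N (suc i)) (ℕP.+-monoʳ-≤ (suc i) h)))
    (sym (triangle N))
    where
    triangle : ∀ N → Σ< N (λ c → Σ< c (λ i → F i (c ∸ suc i))) ≡ Σ< N (λ i → Σ< (N ∸ suc i) (F i))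
    triangle zero    = refl
    triangle (suc N) = begin
      Σ< N (λ c → Σ< c (λ i → F i (c ∸ suc i))) + Σ< N (λ i → F i (N ∸ suc i))
        ≡⟨ cong (_+ Σ< N (λ i → F i (N ∸ suc i))) (triangle N) ⟩
      Σ< N (λ i → Σ< (N ∸ suc i) (F i)) + Σ< N (λ i → F i (N ∸ suc i))
        ≡⟨ Σ<-+ _ _ N ⟨
      Σ< N (λ i → Σ< (suc (N ∸ suc i)) (F i))
        ≡⟨ Σ<-cong N (λ i i<N → cong (λ k → Σ< k (F i)) (sym (ℕP.+-∸-assoc 1 i<N))) ⟩
      Σ< N (λ i → Σ< (N ∸ i) (F i))
        ≡⟨ ℤP.+-identityʳ _ ⟨
      Σ< N (λ i → Σ< (N ∸ i) (F i)) + + 0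
        ≡⟨ cong (λ k → Σ< N (λ i → Σ< (N ∸ i) (F i)) + Σ< k (F N)) (sym (ℕP.n∸n≡0 N)) ⟩
      Σ< (suc N) (λ i → Σ< (N ∸ i) (F i)) ∎

  -- The square grows by gnomons: column c, row c and the corner.
  Σ<-square : ∀ (F : ℕ → ℕ → ℤ) N →
    Σ< N (λ i → Σ< N (F i)) ≡ Σ< N (λ c → Σ< c (λ i → F i c + F c i) + F c c)
  Σ<-square F zero    = refl
  Σ<-square F (suc N) = begin
    Σ< N (λ i → Σ< N (F i) + F i N) + (Σ< N (F N) + F N N)
      ≡⟨ cong (_+ (Σ< N (F N) + F N N)) (Σ<-+ (λ i → Σ< N (F i)) (λ i → F i N) N) ⟩
    Σ< N (λ i → Σ< N (F i)) + Σ< N (λ i → F i N) + (Σ< N (F N) + F N N)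
      ≡⟨ Z.identity (Σ< N (λ i → Σ< N (F i)) ∷ Σ< N (λ i → F i N) ∷ Σ< N (F N) ∷ F N N ∷ [])
           (v₀ :+ v₁ :+ (v₂ :+ v₃)) (v₀ :+ (v₁ :+ v₂ :+ v₃)) refl ⟩
    Σ< N (λ i → Σ< N (F i)) + (Σ< N (λ i → F i N) + Σ< N (F N) + F N N)
      ≡⟨ cong₂ (λ x y → x + (y + F N N)) (Σ<-square F N) (sym (Σ<-+ _ _ N)) ⟩
    Σ< (suc N) (λ c → Σ< c (λ i → F i c + F c i) + F c c) ∎

  -- Index i stands for the integer i + 1, so that lambert w = Σ_{a ≥ 1} w(a) q^a / (1 - q^a).
  lambert : (ℤ → ℤ) → Series
  lambert w n = Σ< n (λ i → w (+ suc i) * ℓ (suc i) n)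

  lambert-cong : ∀ u v → (∀ i → u (+ suc i) ≡ v (+ suc i)) → ∀ n → lambert u n ≡ lambert v n
  lambert-cong u v h n = Σ<-cong n λ i _ → cong (_* ℓ (suc i) n) (h i)

  lambert-+ : ∀ u v n → lambert (λ a → u a + v a) n ≡ lambert u n + lambert v n
  lambert-+ u v n = trans (Σ<-cong n λ i _ → ℤP.*-distribʳ-+ (ℓ (suc i) n) (u (+ suc i)) (v (+ suc i)))
    (Σ<-+ _ _ n)

  lambert-* : ∀ c u n → lambert (λ a → c * u a) n ≡ c * lambert u n
  lambert-* c u n = trans (Σ<-cong n λ i _ → ℤP.*-assoc c (u (+ suc i)) _) (Σ<-* c _ n)

  lambert₂ : (ℤ → ℤ → ℤ) → Series
  lambert₂ F n = Σ< n λ i → Σ< n λ j → F (+ suc i) (+ suc j) * conv (ℓ (suc i)) (ℓ (suc j)) n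

  lambert₂-cong : ∀ F G → (∀ i j → F (+ suc i) (+ suc j) ≡ G (+ suc i) (+ suc j)) →
                  ∀ n → lambert₂ F n ≡ lambert₂ G n
  lambert₂-cong F G h n = Σ<-cong n λ i _ → Σ<-cong n λ j _ → cong (_* conv (ℓ (suc i)) (ℓ (suc j)) n) (h i j)

  lambert₂-+ : ∀ F G n → lambert₂ (λ a b → F a b + G a b) n ≡ lambert₂ F n + lambert₂ G n
  lambert₂-+ F G n = trans
    (Σ<-cong n λ i _ → trans (Σ<-cong n λ j _ → ℤP.*-distribʳ-+ _ (F (+ suc i) (+ suc j)) _) (Σ<-+ _ _ n))
    (Σ<-+ _ _ n)

  lambert₂-* : ∀ c F n → lambert₂ (λ a b → c * F a b) n ≡ c * lambert₂ F n
  lambert₂-* c F n = trans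
    (Σ<-cong n λ i _ → trans (Σ<-cong n λ j _ → ℤP.*-assoc c (F (+ suc i) (+ suc j)) _) (Σ<-* c _ n))
    (Σ<-* c _ n)

  conv-Σ< : ∀ (u : ℕ → ℤ) (f : ℕ → Series) g N n →
    conv (λ k → Σ< N (λ i → u i * f i k)) g n ≡ Σ< N (λ i → u i * conv (f i) g n)
  conv-Σ< u f g zero    n = sumTo-zero n λ _ _ → refl
  conv-Σ< u f g (suc N) n = trans
    (conv-distribʳ g (λ k → Σ< N (λ i → u i * f i k)) (λ k → u N * f N k) n)
    (cong₂ _+_ (conv-Σ< u f g N n) (conv-scale (u N) (f N) g n))

  -- Since q^a/(1 - q^a) starts at q^a, all coefficients up to exponent n may be summed to the
  -- common bound n; then the product is bilinear.
  lambert-product : ∀ u v n → conv (lambert u) (lambert v) n ≡ lambert₂ (λ a b → u a * v b) n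
  lambert-product u v n = begin
    conv (lambert u) (lambert v) n
      ≡⟨ conv-congᵇ n (extend u) (extend v) ⟩
    conv (λ k → Σ< n (λ i → u (+ suc i) * ℓ (suc i) k)) V n
      ≡⟨ conv-Σ< (λ i → u (+ suc i)) (λ i → ℓ (suc i)) V n n ⟩
    Σ< n (λ i → u (+ suc i) * conv (ℓ (suc i)) V n)
      ≡⟨ Σ<-cong n (λ i _ → trans
           (cong (λ x → u (+ suc i) * x) (trans (conv-comm (ℓ (suc i)) V n)
             (conv-Σ< (λ j → v (+ suc j)) (λ j → ℓ (suc j)) (ℓ (suc i)) n n)))
           (trans (sym (Σ<-* (u (+ suc i)) _ n)) (Σ<-cong n λ j _ → trans
             (sym (ℤP.*-assoc (u (+ suc i)) (v (+ suc j)) _))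
             (cong (λ x → u (+ suc i) * v (+ suc j) * x) (conv-comm (ℓ (suc j)) (ℓ (suc i)) n))))) ⟩
    lambert₂ (λ a b → u a * v b) n ∎
    where
    V : Series
    V k = Σ< n (λ i → v (+ suc i) * ℓ (suc i) k)
    extend : ∀ w k → k ≤ n → lambert w k ≡ Σ< n (λ i → w (+ suc i) * ℓ (suc i) k)
    extend w k k≤n = sym (Σ<-truncate k≤n λ i k≤i →
      trans (cong (λ x → w (+ suc i) * x) (ℓ-vanish k≤i)) (ℤP.*-zeroʳ (w (+ suc i))))

  -- Σ_{a+b=c} G(a,b) for c = m + 1
  antidiagonalSum : (ℤ → ℤ → ℤ) → ℕ → ℤ
  antidiagonalSum G m = Σ< m λ i → G (+ suc i) (+ suc m - + suc i)

  lambertℕ : (ℕ → ℤ) → Series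
  lambertℕ w n = Σ< n (λ i → w i * ℓ (suc i) n)

  suc-split : ∀ {i m} → i < m → + suc m - + suc i ≡ + suc (m ∸ suc i)
  suc-split {i} {m} i<m = trans (cong (_- + suc i)
      (cong +_ (trans (cong suc (sym (ℕP.m+[n∸m]≡n i<m))) (sym (ℕP.+-suc (suc i) (m ∸ suc i))))))
    (Z.identity (+ suc i ∷ + suc (m ∸ suc i) ∷ []) (v₀ :+ v₁ :- v₀) v₁ refl)

  -- Skoruppa's identity. With x = q^a and y = q^b it comes from
  --   x/(1-x) · y/(1-y) = xy/(1-xy) · (1 + x/(1-x) + y/(1-y)),
  -- after which the pairs (a, a+b) are renamed; G is invariant under a dihedral group of order 12.
  module _ (G : ℤ → ℤ → ℤ)
           (G-sym : ∀ a b → G a b ≡ G b a)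
           (G-rot : ∀ a b → G a b ≡ G (a + b) (- b)) where

    private
      H : ℤ → ℤ → ℤ
      H a b = G a (b - a)

      H-sym : ∀ a b → H a b ≡ H b a
      H-sym a b = trans (G-rot a (b - a))
        (cong₂ G (Z.identity (a ∷ b ∷ []) (v₀ :+ (v₁ :- v₀)) v₁ refl)
                 (Z.identity (a ∷ b ∷ []) (:- (v₁ :- v₀)) (v₀ :- v₁) refl))

    skoruppa : ∀ N → lambert₂ G N ≡ lambert₂ (λ a b → G a (b - a)) N
      + lambertℕ (antidiagonalSum G) N - Σ< N (λ i → H (+ suc i) (+ suc i) * conv (ℓ (suc i)) (ℓ (suc i)) N)
    skoruppa N = begin
      lambert₂ G N
        ≡⟨ Σ<-antidiagonal (λ i j → g i j * w i j) N (λ i j h →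
             trans (cong (λ x → g i j * x) (ℓℓ-vanish {i} {j} h)) (ℤP.*-zeroʳ (g i j))) ⟩
      Σ< N (λ c → Σ< c (λ i → g i (c ∸ suc i) * w i (c ∸ suc i)))
        ≡⟨ Σ<-cong N (λ c _ → column c) ⟩
      Σ< N (λ c → antidiagonalSum G c * l c + Σ< c (λ i → h i c * w i c + h c i * w c i))
        ≡⟨ Σ<-+ _ _ N ⟩
      lambertℕ (antidiagonalSum G) N + Σ< N (λ c → Σ< c (λ i → h i c * w i c + h c i * w c i))
        -- The pairs below and above the diagonal lack only the diagonal to form the full square; it
        -- is added and subtracted.
        ≡⟨ Z.identity (lambertℕ (antidiagonalSum G) N ∷ Σ< N (λ c → Σ< c (λ i → h i c * w i c + h c i * w c i))
             ∷ Σ< N (λ c → h c c * w c c) ∷ [])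
             (v₀ :+ v₁) (v₁ :+ v₂ :+ v₀ :- v₂) refl ⟩
      Σ< N (λ c → Σ< c (λ i → h i c * w i c + h c i * w c i)) + Σ< N (λ c → h c c * w c c)
        + lambertℕ (antidiagonalSum G) N - Σ< N (λ c → h c c * w c c)
        ≡⟨ cong (λ x → x + lambertℕ (antidiagonalSum G) N - Σ< N (λ c → h c c * w c c))
             (trans (sym (Σ<-+ _ _ N)) (sym (Σ<-square (λ i j → h i j * w i j) N))) ⟩
      lambert₂ H N + lambertℕ (antidiagonalSum G) N - Σ< N (λ c → h c c * w c c) ∎
      where
      g h w : ℕ → ℕ → ℤ
      g i j = G (+ suc i) (+ suc j)
      h i j = H (+ suc i) (+ suc j)
      w i j = conv (ℓ (suc i)) (ℓ (suc j)) N
      l : ℕ → ℤ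
      l i = ℓ (suc i) N
      w-sum : ∀ c i → i < c → w i (c ∸ suc i) ≡ l c + w c i + w c (c ∸ suc i)
      w-sum c i i<c = trans (exact⁻¹ (ℓ-* i (c ∸ suc i)) N)
        (cong (λ k → ℓ k N + conv (ℓ k) (ℓ (suc i)) N + conv (ℓ k) (ℓ (suc (c ∸ suc i))) N)
          (trans (ℕP.+-suc (suc i) (c ∸ suc i)) (cong suc (ℕP.m+[n∸m]≡n i<c))))
      g≡h : ∀ c i → i < c → g i (c ∸ suc i) ≡ h i c
      g≡h c i i<c = cong (G (+ suc i)) (sym (suc-split i<c))
      reflect : ∀ c i → i < c → c ∸ suc (c ∸ suc i) ≡ i
      reflect c i i<c = trans (cong (c ∸_) (sym (ℕP.+-∸-assoc 1 i<c)))
        (ℕP.m∸[m∸n]≡n (ℕP.<⇒≤ i<c))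
      column : ∀ c → Σ< c (λ i → g i (c ∸ suc i) * w i (c ∸ suc i)) ≡
        antidiagonalSum G c * l c + Σ< c (λ i → h i c * w i c + h c i * w c i)
      column c = begin
        Σ< c (λ i → g i (c ∸ suc i) * w i (c ∸ suc i))
          ≡⟨ Σ<-cong c (λ i i<c → trans
               (cong₂ _*_ (g≡h c i i<c) (w-sum c i i<c))
               (Z.identity (h i c ∷ l c ∷ w c i ∷ w c (c ∸ suc i) ∷ [])
                 (v₀ :* (v₁ :+ v₂ :+ v₃)) (v₁ :* v₀ :+ v₀ :* v₂ :+ v₀ :* v₃) refl)) ⟩
        Σ< c (λ i → l c * h i c + h i c * w c i + h i c * w c (c ∸ suc i))
          ≡⟨ trans (Σ<-+ _ _ c) (cong₂ _+_ (trans (Σ<-+ _ _ c) (cong (_+ Σ< c (λ i → h i c * w c i)) (Σ<-* (l c) _ c))) refl) ⟩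
        l c * antidiagonalSum G c + Σ< c (λ i → h i c * w c i) + Σ< c (λ i → h i c * w c (c ∸ suc i))
          ≡⟨ cong₂ (λ x y → l c * antidiagonalSum G c + x + y)
               (Σ<-cong c λ i _ → cong (λ x → h i c * x) (conv-comm (ℓ (suc c)) (ℓ (suc i)) N))
               -- The symmetries of `G` turn the weight of ℓ_c ℓ_(c-a) into H(c, c - a); reversing
               -- the sum then gives H(c, a) ℓ_c ℓ_a.
               (trans (Σ<-cong c λ i i<c → cong (_* w c (c ∸ suc i)) (reflected i i<c))
                 (Σ<-reverse (λ i → h c i * w c i) c)) ⟩
        l c * antidiagonalSum G c + Σ< c (λ i → h i c * w i c) + Σ< c (λ i → h c i * w c i)
          ≡⟨ trans (ℤP.+-assoc (l c * antidiagonalSum G c) (Σ< c (λ i → h i c * w i c)) (Σ< c (λ i → h c i * w c i)))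
               (cong₂ _+_ (ℤP.*-comm (l c) (antidiagonalSum G c))
                 (sym (Σ<-+ (λ i → h i c * w i c) (λ i → h c i * w c i) c))) ⟩
        antidiagonalSum G c * l c + Σ< c (λ i → h i c * w i c + h c i * w c i) ∎
        where
        reflected : ∀ i → i < c → h i c ≡ h c (c ∸ suc i)
        reflected i i<c = begin
          h i c                              ≡⟨ g≡h c i i<c ⟨
          g i (c ∸ suc i)                    ≡⟨ G-sym _ _ ⟩
          g (c ∸ suc i) i                    ≡⟨ cong (g (c ∸ suc i)) (reflect c i i<c) ⟨
          g (c ∸ suc i) (c ∸ suc (c ∸ suc i)) ≡⟨ g≡h c (c ∸ suc i) (ℕP.∸-monoʳ-< {o = 0} (s≤s z≤n) i<c) ⟩
          h (c ∸ suc i) c                    ≡⟨ H-sym _ _ ⟩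
          h c (c ∸ suc i)                    ∎

  private
    variable
      f g : Series

  infixl 7 _·_
  _·_ : ℤ → Series → Series
  c · f = conv (constS c) f

  ·-at : ∀ c f n → (c · f) n ≡ c * f n
  ·-at = conv-const

  ·-cancel : ∀ c .{{_ : ℤ.NonZero c}} → c · f ≋ c · g → f ≋ g
  ·-cancel {f} {g} c h = exact λ n → ℤP.*-cancelˡ-≡ c (f n) (g n)
    (trans (sym (·-at c f n)) (trans (exact⁻¹ h n) (·-at c g n)))

  -- s r = Σ_n σ_r(n) q^n
  s : ℕ → Series
  s r = lambert (_^ᶻ r)

  Lin : Set
  Lin = List (ℤ × ℕ)

  lin : Lin → ℤ → ℤ
  lin []            a = + 0
  lin ((c , r) ∷ t) a = c * a ^ᶻ r + lin t a

  linˢ : Lin → Series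
  linˢ []            = constS (+ 0)
  linˢ ((c , r) ∷ t) = c · s r ⊕ linˢ t

  lin₂ : List (ℤ × ℕ × ℕ) → ℤ → ℤ → ℤ
  lin₂ []                 a b = + 0
  lin₂ ((c , i , j) ∷ t)  a b = c * (a ^ᶻ i * b ^ᶻ j) + lin₂ t a b

  linˢ₂ : List (ℤ × ℕ × ℕ) → Series
  linˢ₂ []                = constS (+ 0)
  linˢ₂ ((c , i , j) ∷ t) = c · conv (s i) (s j) ⊕ linˢ₂ t

  lambert-lin : ∀ t n → lambert (lin t) n ≡ linˢ t n
  lambert-lin []            n = trans (Σ<-zero n λ _ _ → refl) (sym (constS-zero n))
  lambert-lin ((c , r) ∷ t) n = trans (lambert-+ (λ a → c * a ^ᶻ r) (lin t) n)
    (cong₂ _+_ (trans (lambert-* c (_^ᶻ r) n) (sym (·-at c (s r) n))) (lambert-lin t n))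

  lambert₂-lin : ∀ t n → lambert₂ (lin₂ t) n ≡ linˢ₂ t n
  lambert₂-lin []                n = trans (Σ<-zero n λ _ _ → Σ<-zero n λ _ _ → refl) (sym (constS-zero n))
  lambert₂-lin ((c , i , j) ∷ t) n = trans (lambert₂-+ (λ a b → c * (a ^ᶻ i * b ^ᶻ j)) (lin₂ t) n)
    (cong₂ _+_ (trans (lambert₂-* c (λ a b → a ^ᶻ i * b ^ᶻ j) n)
       (trans (cong (λ x → c * x) (sym (lambert-product (_^ᶻ i) (_^ᶻ j) n)))
              (sym (·-at c (conv (s i) (s j)) n))))
     (lambert₂-lin t n))

  -- The diagonal terms of Skoruppa's identity: a (q^a/(1-q^a))² = θ(q^a/(1-q^a)) - a q^a/(1-q^a).
  diagonal : ∀ (H h : ℤ → ℤ) → (∀ a → H a ≡ h a * a) → ∀ N →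
    Σ< N (λ i → H (+ suc i) * conv (ℓ (suc i)) (ℓ (suc i)) N) ≡
    θ (lambert h) N - lambert (λ a → a * h a) N
  diagonal H h Hh N = begin
    Σ< N (λ i → H (+ suc i) * conv (ℓ (suc i)) (ℓ (suc i)) N)
      ≡⟨ Σ<-cong N (λ i _ → term i) ⟩
    Σ< N (λ i → + N * (h (+ suc i) * ℓ (suc i) N) + -[1+ 0 ] * (+ suc i * h (+ suc i) * ℓ (suc i) N))
      ≡⟨ Σ<-+ _ _ N ⟩
    Σ< N (λ i → + N * (h (+ suc i) * ℓ (suc i) N)) + Σ< N (λ i → -[1+ 0 ] * (+ suc i * h (+ suc i) * ℓ (suc i) N))
      ≡⟨ cong₂ _+_ (Σ<-* (+ N) _ N) (trans (Σ<-* -[1+ 0 ] _ N) (ℤP.-1*i≡-i _)) ⟩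
    θ (lambert h) N - lambert (λ a → a * h a) N ∎
    where
    term : ∀ i → H (+ suc i) * conv (ℓ (suc i)) (ℓ (suc i)) N ≡
      + N * (h (+ suc i) * ℓ (suc i) N) + -[1+ 0 ] * (+ suc i * h (+ suc i) * ℓ (suc i) N)
    term i = Z.linear-combination
      (H (+ suc i) ∷ h (+ suc i) ∷ + suc i ∷ conv (ℓ (suc i)) (ℓ (suc i)) N ∷ ℓ (suc i) N ∷ + N ∷ [])
      (v₀ :* v₃) (v₅ :* (v₁ :* v₄) :+ con -[1+ 0 ] :* (v₂ :* v₁ :* v₄))
      ( (v₃ Z.⊛ v₀ ≐ v₁ :* v₂ by Hh (+ suc i))
      ∷ (:- v₁ Z.⊛ v₅ :* v₄ ≐ v₂ :* (v₃ :+ v₄) by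
          trans (exact⁻¹ (θ-ℓ i) N) (·-at (+ suc i) (conv (ℓ (suc i)) (ℓ (suc i)) ⊕ ℓ (suc i)) N))
      ∷ []) refl

  -- Taking the difference G(a, b) - G(a, b - a) is useful because it is a sum of products of a
  -- function of a and one of b in every application. Divisibility of G(a, 0) by a turns the
  -- diagonal into a derivative.
  skoruppa-θ : ∀ (G : ℤ → ℤ → ℤ)
    → (∀ a b → G a b ≡ G b a) → (∀ a b → G a b ≡ G (a + b) (- b))
    → (h : ℤ → ℤ) → (∀ a → G a (+ 0) ≡ h a * a)
    → ∀ N → lambert₂ (λ a b → G a b - G a (b - a)) N ≡
            lambertℕ (antidiagonalSum G) N + lambert (λ a → a * h a) N - θ (lambert h) N
  skoruppa-θ G G-sym G-rot h Gh N = Z.linear-combination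
    ( lambert₂ (λ a b → G a b - G a (b - a)) N ∷ lambert₂ G N ∷ lambert₂ (λ a b → G a (b - a)) N
    ∷ lambertℕ (antidiagonalSum G) N ∷ lambert (λ a → a * h a) N ∷ θ (lambert h) N ∷ D ∷ [])
    v₀ (v₃ :+ v₄ :- v₅)
    ( (# 1 Z.⊛ v₀ ≐ v₁ :+ con -[1+ 0 ] :* v₂ by
         trans (trans (lambert₂-cong (λ a b → G a b - G a (b - a)) (λ a b → G a b + -[1+ 0 ] * G a (b - a))
             (λ i j → cong (λ x → G (+ suc i) (+ suc j) + x) (sym (ℤP.-1*i≡-i (G (+ suc i) (+ suc j - + suc i))))) N)
           (lambert₂-+ G (λ a b → -[1+ 0 ] * G a (b - a)) N))
           (cong (λ x → lambert₂ G N + x) (lambert₂-* -[1+ 0 ] (λ a b → G a (b - a)) N)))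
    ∷ (# 1 Z.⊛ v₁ ≐ v₂ :+ v₃ :- v₆ by skoruppa G G-sym G-rot N)
    ∷ (:- # 1 Z.⊛ v₆ ≐ v₅ :- v₄ by
        trans (diagonal (λ a → G a (a - a)) h (λ a → trans (cong (G a) (ℤP.+-inverseʳ a)) (Gh a)) N) refl)
    ∷ []) refl
    where
    D : ℤ
    D = Σ< N (λ i → G (+ suc i) (+ suc i - + suc i) * conv (ℓ (suc i)) (ℓ (suc i)) N)

  raise : Lin → Lin
  raise []            = []
  raise ((c , r) ∷ t) = (c , suc r) ∷ raise t

  lin-raise : ∀ t a → a * lin t a ≡ lin (raise t) a
  lin-raise []            a = ℤP.*-zeroʳ a
  lin-raise ((c , r) ∷ t) a = trans
    (Z.identity (a ∷ c ∷ a ^ᶻ r ∷ lin t a ∷ []) (v₀ :* (v₁ :* v₂ :+ v₃)) (v₁ :* (v₀ :* v₂) :+ v₀ :* v₃) refl)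
    (cong (λ x → c * (a * a ^ᶻ r) + x) (lin-raise t a))

  -- The factor `c` is a common denominator for the power sums in `antidiagonalSum`.
  skoruppa-polynomial : ∀ (G : ℤ → ℤ → ℤ)
    → (∀ a b → G a b ≡ G b a) → (∀ a b → G a b ≡ G (a + b) (- b))
    → ∀ c F P h
    → (∀ a b → G a b - G a (b - a) ≡ lin₂ F a b)
    → (∀ m → c * antidiagonalSum G m ≡ lin P (+ suc m))
    → (∀ a → G a (+ 0) ≡ lin h a * a)
    → c · linˢ₂ F ≋ linˢ P ⊕ c · (linˢ (raise h) ⊕ ⊖ θ (linˢ h))
  skoruppa-polynomial G G-sym G-rot c F P h GF GP Gh = exact λ N → begin
    (c · linˢ₂ F) N
      ≡⟨ ·-at c (linˢ₂ F) N ⟩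
    c * linˢ₂ F N
      ≡⟨ cong (λ x → c * x) (trans (sym (lambert₂-lin F N)) (trans
           (lambert₂-cong (lin₂ F) (λ a b → G a b - G a (b - a)) (λ i j → sym (GF (+ suc i) (+ suc j))) N)
           (skoruppa-θ G G-sym G-rot (lin h) Gh N))) ⟩
    c * (lambertℕ (antidiagonalSum G) N + lambert (λ a → a * lin h a) N - θ (lambert (lin h)) N)
      ≡⟨ Z.identity (c ∷ lambertℕ (antidiagonalSum G) N ∷ lambert (λ a → a * lin h a) N ∷ θ (lambert (lin h)) N ∷ [])
           (v₀ :* (v₁ :+ v₂ :- v₃)) (v₀ :* v₁ :+ v₀ :* (v₂ :- v₃)) refl ⟩
    c * lambertℕ (antidiagonalSum G) N + c * (lambert (λ a → a * lin h a) N - θ (lambert (lin h)) N)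
      ≡⟨ cong₂ (λ x y → x + c * y)
           (trans (sym (Σ<-* c _ N)) (trans
             (Σ<-cong N λ i _ → trans (sym (ℤP.*-assoc c (antidiagonalSum G i) _)) (cong (_* ℓ (suc i) N) (GP i)))
             (lambert-lin P N)))
           (cong₂ (λ x y → x - + N * y)
             (trans (lambert-cong (λ a → a * lin h a) (lin (raise h)) (λ i → lin-raise h (+ suc i)) N) (lambert-lin (raise h) N))
             (lambert-lin h N)) ⟩
    linˢ P N + c * (linˢ (raise h) N - θ (linˢ h) N)
      ≡⟨ cong (λ x → linˢ P N + x) (·-at c (linˢ (raise h) ⊕ ⊖ θ (linˢ h)) N) ⟨
    linˢ P N + (c · (linˢ (raise h) ⊕ ⊖ θ (linˢ h))) N ∎

open LambertSeries

-- Eisenstein series, Ramanujan's equations and the discriminant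

module Eisenstein where
  open SeriesMod 0

  abSum : ℕ → ℕ → ℤ
  abSum r = antidiagonalSum (λ a b → (a * b) ^ᶻ r)

  -- In the applications Φ is a Faulhaber polynomial for the partial sums of (i (x - i))^r with x
  -- fixed, times its denominator; k = m and x = m + 1 close the sum.
  telescope : ∀ c (f : ℕ → ℤ) (Φ : ℤ → ℤ) → Φ (+ 0) ≡ + 0 →
    (∀ k → Φ (+ 1 + + k) ≡ Φ (+ k) + c * f k) → ∀ k → c * Σ< k f ≡ Φ (+ k)
  telescope c f Φ Φ0 ΦS zero    = trans (ℤP.*-zeroʳ c) (sym Φ0)
  telescope c f Φ Φ0 ΦS (suc k) = trans (ℤP.*-distribˡ-+ c (Σ< k f) (f k))
    (trans (cong (_+ c * f k) (telescope c f Φ Φ0 ΦS k)) (sym (ΦS k)))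

  abSum₁ : ∀ m → + 6 * abSum 1 m ≡ (+ suc m) ^ᶻ 3 - + suc m
  abSum₁ m = trans
    (telescope (+ 6) _ (λ k → Z.⟦ Φ v₀ v₁ ⟧ (k ∷ + suc m ∷ []))
      (Z.identity (+ suc m ∷ []) (Φ (# 0) v₀) (# 0) refl)
      (λ k → Z.identity (+ k ∷ + suc m ∷ []) (Φ (# 1 :+ v₀) v₁)
        (Φ v₀ v₁ :+ # 6 :* (((# 1 :+ v₀) :* (v₁ :- (# 1 :+ v₀))) :^ 1)) refl) m)
    (Z.identity (+ m ∷ []) (Φ v₀ (# 1 :+ v₀)) ((# 1 :+ v₀) :^ 3 :- (# 1 :+ v₀)) refl)
    where
    Φ : ∀ {n} → Expr n → Expr n → Expr n
    Φ k x = :- k :- # 3 :* k :^ 2 :- # 2 :* k :^ 3 :+ x :* (# 3 :* k :+ # 3 :* k :^ 2)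

  abSum₂ : ∀ m → + 30 * abSum 2 m ≡ (+ suc m) ^ᶻ 5 - + suc m
  abSum₂ m = trans
    (telescope (+ 30) _ (λ k → Z.⟦ Φ v₀ v₁ ⟧ (k ∷ + suc m ∷ []))
      (Z.identity (+ suc m ∷ []) (Φ (# 0) v₀) (# 0) refl)
      (λ k → Z.identity (+ k ∷ + suc m ∷ []) (Φ (# 1 :+ v₀) v₁)
        (Φ v₀ v₁ :+ # 30 :* (((# 1 :+ v₀) :* (v₁ :- (# 1 :+ v₀))) :^ 2)) refl) m)
    (Z.identity (+ m ∷ []) (Φ v₀ (# 1 :+ v₀)) ((# 1 :+ v₀) :^ 5 :- (# 1 :+ v₀)) refl)
    where
    Φ : ∀ {n} → Expr n → Expr n → Expr n
    Φ k x = :- k :+ # 10 :* k :^ 3 :+ # 15 :* k :^ 4 :+ # 6 :* k :^ 5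
      :- x :* (# 15 :* k :^ 2 :+ # 30 :* k :^ 3 :+ # 15 :* k :^ 4)
      :+ x :^ 2 :* (# 5 :* k :+ # 15 :* k :^ 2 :+ # 10 :* k :^ 3)

  abSum₃ : ∀ m → + 420 * abSum 3 m ≡ + 3 * (+ suc m) ^ᶻ 7 + + 7 * (+ suc m) ^ᶻ 3 - + 10 * + suc m
  abSum₃ m = trans
    (telescope (+ 420) _ (λ k → Z.⟦ Φ v₀ v₁ ⟧ (k ∷ + suc m ∷ []))
      (Z.identity (+ suc m ∷ []) (Φ (# 0) v₀) (# 0) refl)
      (λ k → Z.identity (+ k ∷ + suc m ∷ []) (Φ (# 1 :+ v₀) v₁)
        (Φ v₀ v₁ :+ # 420 :* (((# 1 :+ v₀) :* (v₁ :- (# 1 :+ v₀))) :^ 3)) refl) m)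
    (Z.identity (+ m ∷ []) (Φ v₀ (# 1 :+ v₀))
      (# 3 :* (# 1 :+ v₀) :^ 7 :+ # 7 :* (# 1 :+ v₀) :^ 3 :- # 10 :* (# 1 :+ v₀)) refl)
    where
    Φ : ∀ {n} → Expr n → Expr n → Expr n
    Φ k x = # 70 :* k :^ 3 :- # 10 :* k :- # 210 :* k :^ 5 :- # 210 :* k :^ 6 :- # 60 :* k :^ 7
      :+ x :* (# 525 :* k :^ 4 :- # 105 :* k :^ 2 :+ # 630 :* k :^ 5 :+ # 210 :* k :^ 6)
      :+ x :^ 2 :* (# 42 :* k :- # 420 :* k :^ 3 :- # 630 :* k :^ 4 :- # 252 :* k :^ 5)
      :+ x :^ 3 :* (# 105 :* k :^ 2 :+ # 210 :* k :^ 3 :+ # 105 :* k :^ 4)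

  -- A symmetric polynomial is a polynomial in a + b and a b, and a + b is constant along the
  -- antidiagonal.
  antidiagonalSum-ab : ∀ (G : ℤ → ℤ → ℤ) (α β γ δ : ℤ → ℤ) →
    (∀ a b → G a b ≡ α (a + b) + β (a + b) * (a * b) ^ᶻ 1 + γ (a + b) * (a * b) ^ᶻ 2 + δ (a + b) * (a * b) ^ᶻ 3) →
    ∀ m → antidiagonalSum G m ≡ α (+ suc m) * + m
      + β (+ suc m) * abSum 1 m + γ (+ suc m) * abSum 2 m + δ (+ suc m) * abSum 3 m
  antidiagonalSum-ab G α β γ δ h m = trans
    (Σ<-cong m λ i _ → trans (h (+ suc i) (+ suc m - + suc i))
      (cong (λ c → α c + β c * u i ^ᶻ 1 + γ c * u i ^ᶻ 2 + δ c * u i ^ᶻ 3)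
        (Z.identity (+ suc i ∷ + suc m ∷ []) (v₀ :+ (v₁ :- v₀)) v₁ refl)))
    (linear m)
    where
    c = + suc m
    u : ℕ → ℤ
    u i = + suc i * (+ suc m - + suc i)
    linear : ∀ k → Σ< k (λ i → α c + β c * u i ^ᶻ 1 + γ c * u i ^ᶻ 2 + δ c * u i ^ᶻ 3) ≡
      α c * + k + β c * Σ< k (λ i → u i ^ᶻ 1) + γ c * Σ< k (λ i → u i ^ᶻ 2) + δ c * Σ< k (λ i → u i ^ᶻ 3)
    linear zero    = Z.identity (α c ∷ β c ∷ γ c ∷ δ c ∷ [])
      (# 0) (v₀ :* # 0 :+ v₁ :* # 0 :+ v₂ :* # 0 :+ v₃ :* # 0) refl
    linear (suc k) = trans (cong (_+ (α c + β c * u k ^ᶻ 1 + γ c * u k ^ᶻ 2 + δ c * u k ^ᶻ 3)) (linear k))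
      (Z.identity (α c ∷ β c ∷ γ c ∷ δ c ∷ u k ∷ + k ∷
          Σ< k (λ i → u i ^ᶻ 1) ∷ Σ< k (λ i → u i ^ᶻ 2) ∷ Σ< k (λ i → u i ^ᶻ 3) ∷ [])
        (v₀ :* v₅ :+ v₁ :* v₆ :+ v₂ :* v₇ :+ v₃ :* v₈ :+ (v₀ :+ v₁ :* v₄ :^ 1 :+ v₂ :* v₄ :^ 2 :+ v₃ :* v₄ :^ 3))
        (v₀ :* (# 1 :+ v₅) :+ v₁ :* (v₆ :+ v₄ :^ 1) :+ v₂ :* (v₇ :+ v₄ :^ 2) :+ v₃ :* (v₈ :+ v₄ :^ 3)) refl)

  module _ where
    private
      -- Generators, of degrees 2 and 6, of the polynomial invariants of the dihedral group of order
      -- 12. An invariant of degree k yields products of Eisenstein series of total weight k + 2: N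
      -- for E₂², N² for E₂E₄, N³ and D for E₂E₆ and E₄², N D for E₄E₆.
      N D : ℤ → ℤ → ℤ
      N a b = a * a + a * b + b * b
      D a b = (a * b * (a + b)) ^ᶻ 2

      Nᴱ Dᴱ : ∀ {n} → Expr n → Expr n → Expr n
      Nᴱ a b = a :* a :+ a :* b :+ b :* b
      Dᴱ a b = (a :* b :* (a :+ b)) :^ 2

    sum-N : + 6 · linˢ₂ ((+ 2 , 1 , 1) ∷ []) ≋
      linˢ ((+ 5 , 3) ∷ (-[1+ 5 ] , 2) ∷ (+ 1 , 1) ∷ []) ⊕
      + 6 · (linˢ ((+ 1 , 2) ∷ []) ⊕ ⊖ θ (linˢ ((+ 1 , 1) ∷ [])))
    sum-N = skoruppa-polynomial N
      (λ a b → Z.identity (a ∷ b ∷ []) (Nᴱ v₀ v₁) (Nᴱ v₁ v₀) refl)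
      (λ a b → Z.identity (a ∷ b ∷ []) (Nᴱ v₀ v₁) (Nᴱ (v₀ :+ v₁) (:- v₁)) refl)
      (+ 6) ((+ 2 , 1 , 1) ∷ []) ((+ 5 , 3) ∷ (-[1+ 5 ] , 2) ∷ (+ 1 , 1) ∷ []) ((+ 1 , 1) ∷ [])
      (λ a b → Z.identity (a ∷ b ∷ []) (Nᴱ v₀ v₁ :- Nᴱ v₀ (v₁ :- v₀)) (# 2 :* (v₀ :^ 1 :* v₁ :^ 1) :+ # 0) refl)
      (λ m → Z.linear-combination (antidiagonalSum N m ∷ + m ∷ abSum 1 m ∷ abSum 2 m ∷ abSum 3 m ∷ [])
        (# 6 :* v₀)
        (# 5 :* c :^ 3 :+ (con -[1+ 5 ] :* c :^ 2 :+ (# 1 :* c :^ 1 :+ # 0)))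
        ( (# 6 Z.⊛ v₀ ≐ c :^ 2 :* v₁ :+ (con -[1+ 0 ]) :* v₂ :+ # 0 :* v₃ :+ # 0 :* v₄
            by antidiagonalSum-ab N (λ c → c ^ᶻ 2) (λ _ → -[1+ 0 ]) (λ _ → + 0) (λ _ → + 0)
              (λ a b → Z.identity (a ∷ b ∷ []) (Nᴱ v₀ v₁)
                ((v₀ :+ v₁) :^ 2 :+ con -[1+ 0 ] :* (v₀ :* v₁) :^ 1 :+ # 0 :* (v₀ :* v₁) :^ 2 :+ # 0 :* (v₀ :* v₁) :^ 3) refl) m)
        ∷ (:- # 1 Z.⊛ # 6 :* v₂ ≐ c :^ 3 :- c by abSum₁ m)
        ∷ []) refl)
      (λ a → Z.identity (a ∷ []) (Nᴱ v₀ (# 0)) ((# 1 :* v₀ :^ 1 :+ # 0) :* v₀) refl)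
      where
      c : Expr 5
      c = # 1 :+ v₁

    sum-N² : + 30 · linˢ₂ ((+ 4 , 3 , 1) ∷ (+ 4 , 1 , 3) ∷ []) ≋
      linˢ ((+ 21 , 5) ∷ (-[1+ 29 ] , 4) ∷ (+ 10 , 3) ∷ (-[1+ 0 ] , 1) ∷ []) ⊕
      + 30 · (linˢ ((+ 1 , 4) ∷ []) ⊕ ⊖ θ (linˢ ((+ 1 , 3) ∷ [])))
    sum-N² = skoruppa-polynomial (λ a b → N a b ^ᶻ 2)
      (λ a b → Z.identity (a ∷ b ∷ []) (Nᴱ v₀ v₁ :^ 2) (Nᴱ v₁ v₀ :^ 2) refl)
      (λ a b → Z.identity (a ∷ b ∷ []) (Nᴱ v₀ v₁ :^ 2) (Nᴱ (v₀ :+ v₁) (:- v₁) :^ 2) refl)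
      (+ 30) ((+ 4 , 3 , 1) ∷ (+ 4 , 1 , 3) ∷ [])
      ((+ 21 , 5) ∷ (-[1+ 29 ] , 4) ∷ (+ 10 , 3) ∷ (-[1+ 0 ] , 1) ∷ []) ((+ 1 , 3) ∷ [])
      (λ a b → Z.identity (a ∷ b ∷ []) (Nᴱ v₀ v₁ :^ 2 :- Nᴱ v₀ (v₁ :- v₀) :^ 2)
        (# 4 :* (v₀ :^ 3 :* v₁ :^ 1) :+ (# 4 :* (v₀ :^ 1 :* v₁ :^ 3) :+ # 0)) refl)
      (λ m → Z.linear-combination (antidiagonalSum (λ a b → N a b ^ᶻ 2) m ∷ + m ∷ abSum 1 m ∷ abSum 2 m ∷ abSum 3 m ∷ [])
        (# 30 :* v₀)
        (# 21 :* c :^ 5 :+ (con -[1+ 29 ] :* c :^ 4 :+ (# 10 :* c :^ 3 :+ (con -[1+ 0 ] :* c :^ 1 :+ # 0))))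
        ( (# 30 Z.⊛ v₀ ≐ c :^ 4 :* v₁ :+ (con -[1+ 1 ] :* c :^ 2) :* v₂ :+ # 1 :* v₃ :+ # 0 :* v₄
            by antidiagonalSum-ab (λ a b → N a b ^ᶻ 2) (λ c → c ^ᶻ 4) (λ c → -[1+ 1 ] * c ^ᶻ 2) (λ _ → + 1) (λ _ → + 0)
              (λ a b → Z.identity (a ∷ b ∷ []) (Nᴱ v₀ v₁ :^ 2)
                ((v₀ :+ v₁) :^ 4 :+ con -[1+ 1 ] :* (v₀ :+ v₁) :^ 2 :* (v₀ :* v₁) :^ 1
                  :+ # 1 :* (v₀ :* v₁) :^ 2 :+ # 0 :* (v₀ :* v₁) :^ 3) refl) m)
        ∷ (:- # 10 :* c :^ 2 Z.⊛ # 6 :* v₂ ≐ c :^ 3 :- c by abSum₁ m)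
        ∷ (# 1 Z.⊛ # 30 :* v₃ ≐ c :^ 5 :- c by abSum₂ m)
        ∷ []) refl)
      (λ a → Z.identity (a ∷ []) (Nᴱ v₀ (# 0) :^ 2) ((# 1 :* v₀ :^ 3 :+ # 0) :* v₀) refl)
      where
      c : Expr 5
      c = # 1 :+ v₁

    sum-N³ : + 420 · linˢ₂ ((+ 6 , 5 , 1) ∷ (+ 14 , 3 , 3) ∷ (+ 6 , 1 , 5) ∷ []) ≋
      linˢ ((+ 249 , 7) ∷ (-[1+ 419 ] , 6) ∷ (+ 210 , 5) ∷ (-[1+ 48 ] , 3) ∷ (+ 10 , 1) ∷ []) ⊕
      + 420 · (linˢ ((+ 1 , 6) ∷ []) ⊕ ⊖ θ (linˢ ((+ 1 , 5) ∷ [])))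
    sum-N³ = skoruppa-polynomial (λ a b → N a b ^ᶻ 3)
      (λ a b → Z.identity (a ∷ b ∷ []) (Nᴱ v₀ v₁ :^ 3) (Nᴱ v₁ v₀ :^ 3) refl)
      (λ a b → Z.identity (a ∷ b ∷ []) (Nᴱ v₀ v₁ :^ 3) (Nᴱ (v₀ :+ v₁) (:- v₁) :^ 3) refl)
      (+ 420) ((+ 6 , 5 , 1) ∷ (+ 14 , 3 , 3) ∷ (+ 6 , 1 , 5) ∷ [])
      ((+ 249 , 7) ∷ (-[1+ 419 ] , 6) ∷ (+ 210 , 5) ∷ (-[1+ 48 ] , 3) ∷ (+ 10 , 1) ∷ []) ((+ 1 , 5) ∷ [])
      (λ a b → Z.identity (a ∷ b ∷ []) (Nᴱ v₀ v₁ :^ 3 :- Nᴱ v₀ (v₁ :- v₀) :^ 3)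
        (# 6 :* (v₀ :^ 5 :* v₁ :^ 1) :+ (# 14 :* (v₀ :^ 3 :* v₁ :^ 3) :+ (# 6 :* (v₀ :^ 1 :* v₁ :^ 5) :+ # 0))) refl)
      (λ m → Z.linear-combination (antidiagonalSum (λ a b → N a b ^ᶻ 3) m ∷ + m ∷ abSum 1 m ∷ abSum 2 m ∷ abSum 3 m ∷ [])
        (# 420 :* v₀)
        (# 249 :* c :^ 7 :+ (con -[1+ 419 ] :* c :^ 6 :+ (# 210 :* c :^ 5 :+ (con -[1+ 48 ] :* c :^ 3
          :+ (# 10 :* c :^ 1 :+ # 0)))))
        ( (# 420 Z.⊛ v₀ ≐ c :^ 6 :* v₁ :+ (con -[1+ 2 ] :* c :^ 4) :* v₂ :+ (# 3 :* c :^ 2) :* v₃ :+ con -[1+ 0 ] :* v₄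
            by antidiagonalSum-ab (λ a b → N a b ^ᶻ 3) (λ c → c ^ᶻ 6) (λ c → -[1+ 2 ] * c ^ᶻ 4)
              (λ c → + 3 * c ^ᶻ 2) (λ _ → -[1+ 0 ])
              (λ a b → Z.identity (a ∷ b ∷ []) (Nᴱ v₀ v₁ :^ 3)
                ((v₀ :+ v₁) :^ 6 :+ con -[1+ 2 ] :* (v₀ :+ v₁) :^ 4 :* (v₀ :* v₁) :^ 1
                  :+ # 3 :* (v₀ :+ v₁) :^ 2 :* (v₀ :* v₁) :^ 2 :+ con -[1+ 0 ] :* (v₀ :* v₁) :^ 3) refl) m)
        ∷ (:- # 210 :* c :^ 4 Z.⊛ # 6 :* v₂ ≐ c :^ 3 :- c by abSum₁ m)
        ∷ (# 42 :* c :^ 2 Z.⊛ # 30 :* v₃ ≐ c :^ 5 :- c by abSum₂ m)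
        ∷ (:- # 1 Z.⊛ # 420 :* v₄ ≐ # 3 :* c :^ 7 :+ # 7 :* c :^ 3 :- # 10 :* c by abSum₃ m)
        ∷ []) refl)
      (λ a → Z.identity (a ∷ []) (Nᴱ v₀ (# 0) :^ 3) ((# 1 :* v₀ :^ 5 :+ # 0) :* v₀) refl)
      where
      c : Expr 5
      c = # 1 :+ v₁

    sum-D : + 30 · linˢ₂ ((+ 4 , 3 , 3) ∷ []) ≋
      linˢ ((+ 1 , 7) ∷ (-[1+ 0 ] , 3) ∷ []) ⊕ + 30 · (linˢ [] ⊕ ⊖ θ (linˢ []))
    sum-D = skoruppa-polynomial D
      (λ a b → Z.identity (a ∷ b ∷ []) (Dᴱ v₀ v₁) (Dᴱ v₁ v₀) refl)
      (λ a b → Z.identity (a ∷ b ∷ []) (Dᴱ v₀ v₁) (Dᴱ (v₀ :+ v₁) (:- v₁)) refl)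
      (+ 30) ((+ 4 , 3 , 3) ∷ []) ((+ 1 , 7) ∷ (-[1+ 0 ] , 3) ∷ []) []
      (λ a b → Z.identity (a ∷ b ∷ []) (Dᴱ v₀ v₁ :- Dᴱ v₀ (v₁ :- v₀)) (# 4 :* (v₀ :^ 3 :* v₁ :^ 3) :+ # 0) refl)
      (λ m → Z.linear-combination (antidiagonalSum D m ∷ + m ∷ abSum 1 m ∷ abSum 2 m ∷ abSum 3 m ∷ [])
        (# 30 :* v₀)
        (# 1 :* c :^ 7 :+ (con -[1+ 0 ] :* c :^ 3 :+ # 0))
        ( (# 30 Z.⊛ v₀ ≐ # 0 :* v₁ :+ # 0 :* v₂ :+ c :^ 2 :* v₃ :+ # 0 :* v₄
            by antidiagonalSum-ab D (λ _ → + 0) (λ _ → + 0) (λ c → c ^ᶻ 2) (λ _ → + 0)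
              (λ a b → Z.identity (a ∷ b ∷ []) (Dᴱ v₀ v₁)
                (# 0 :+ # 0 :* (v₀ :* v₁) :^ 1 :+ (v₀ :+ v₁) :^ 2 :* (v₀ :* v₁) :^ 2 :+ # 0 :* (v₀ :* v₁) :^ 3) refl) m)
        ∷ (c :^ 2 Z.⊛ # 30 :* v₃ ≐ c :^ 5 :- c by abSum₂ m)
        ∷ []) refl)
      (λ a → Z.identity (a ∷ []) (Dᴱ v₀ (# 0)) (# 0 :* v₀) refl)
      where
      c : Expr 5
      c = # 1 :+ v₁

    sum-ND : + 420 · linˢ₂ ((+ 6 , 5 , 3) ∷ (+ 6 , 3 , 5) ∷ []) ≋
      linˢ ((+ 11 , 9) ∷ (-[1+ 20 ] , 5) ∷ (+ 10 , 3) ∷ []) ⊕ + 420 · (linˢ [] ⊕ ⊖ θ (linˢ []))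
    sum-ND = skoruppa-polynomial (λ a b → N a b * D a b)
      (λ a b → Z.identity (a ∷ b ∷ []) (Nᴱ v₀ v₁ :* Dᴱ v₀ v₁) (Nᴱ v₁ v₀ :* Dᴱ v₁ v₀) refl)
      (λ a b → Z.identity (a ∷ b ∷ []) (Nᴱ v₀ v₁ :* Dᴱ v₀ v₁) (Nᴱ (v₀ :+ v₁) (:- v₁) :* Dᴱ (v₀ :+ v₁) (:- v₁)) refl)
      (+ 420) ((+ 6 , 5 , 3) ∷ (+ 6 , 3 , 5) ∷ []) ((+ 11 , 9) ∷ (-[1+ 20 ] , 5) ∷ (+ 10 , 3) ∷ []) []
      (λ a b → Z.identity (a ∷ b ∷ [])
        (Nᴱ v₀ v₁ :* Dᴱ v₀ v₁ :- Nᴱ v₀ (v₁ :- v₀) :* Dᴱ v₀ (v₁ :- v₀))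
        (# 6 :* (v₀ :^ 5 :* v₁ :^ 3) :+ (# 6 :* (v₀ :^ 3 :* v₁ :^ 5) :+ # 0)) refl)
      (λ m → Z.linear-combination (antidiagonalSum (λ a b → N a b * D a b) m ∷ + m ∷ abSum 1 m ∷ abSum 2 m ∷ abSum 3 m ∷ [])
        (# 420 :* v₀)
        (# 11 :* c :^ 9 :+ (con -[1+ 20 ] :* c :^ 5 :+ (# 10 :* c :^ 3 :+ # 0)))
        ( (# 420 Z.⊛ v₀ ≐ # 0 :* v₁ :+ # 0 :* v₂ :+ c :^ 4 :* v₃ :+ (con -[1+ 0 ] :* c :^ 2) :* v₄
            by antidiagonalSum-ab (λ a b → N a b * D a b) (λ _ → + 0) (λ _ → + 0) (λ c → c ^ᶻ 4) (λ c → -[1+ 0 ] * c ^ᶻ 2)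
              (λ a b → Z.identity (a ∷ b ∷ []) (Nᴱ v₀ v₁ :* Dᴱ v₀ v₁)
                (# 0 :+ # 0 :* (v₀ :* v₁) :^ 1 :+ (v₀ :+ v₁) :^ 4 :* (v₀ :* v₁) :^ 2
                  :+ con -[1+ 0 ] :* (v₀ :+ v₁) :^ 2 :* (v₀ :* v₁) :^ 3) refl) m)
        ∷ (# 14 :* c :^ 4 Z.⊛ # 30 :* v₃ ≐ c :^ 5 :- c by abSum₂ m)
        ∷ (:- (c :^ 2) Z.⊛ # 420 :* v₄ ≐ # 3 :* c :^ 7 :+ # 7 :* c :^ 3 :- # 10 :* c by abSum₃ m)
        ∷ []) refl)
      (λ a → Z.identity (a ∷ []) (Nᴱ v₀ (# 0) :* Dᴱ v₀ (# 0)) (# 0 :* v₀) refl)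
      where
      c : Expr 5
      c = # 1 :+ v₁

  eisenstein : ℤ → ℕ → Series
  eisenstein c r = constS (+ 1) ⊕ c · s r

  e₂ e₄ e₆ e₁₀ : Series
  e₂  = eisenstein -[1+ 23 ] 1
  e₄  = eisenstein (+ 240) 3
  e₆  = eisenstein -[1+ 503 ] 5
  e₁₀ = eisenstein -[1+ 263 ] 9

  θ-eisenstein : ∀ c r → θ (eisenstein c r) ≋ c · θ (s r)
  θ-eisenstein c r = ≋-trans (θ-⊕ (constS (+ 1)) (c · s r))
    (≋-trans (⊕-cong (θ-const (+ 1)) (θ-scale c (s r)))
      (identity (c · θ (s r) ∷ []) (# 0 :+ v₀) v₀ refl))

  θ-linˢ-single : ∀ r → θ (linˢ ((+ 1 , r) ∷ [])) ≋ θ (s r)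
  θ-linˢ-single r = θ-cong (identity (s r ∷ []) (# 1 :* v₀ :+ # 0) v₀ refl)

  -- The terms in `s 2` cancel. This is Besge's convolution formula for σ; its components by
  -- residues modulo 2 and 3 drive the last two cases.
  sum-σσ : + 12 · conv (s 1) (s 1) ≋ + 5 · s 3 ⊕ s 1 ⊕ ⊖ (+ 6 · θ (s 1))
  sum-σσ = linear-combination
    (s 1 ∷ s 2 ∷ s 3 ∷ θ (linˢ ((+ 1 , 1) ∷ [])) ∷ θ (s 1) ∷ [])
    (# 12 :* (v₀ :* v₀)) (# 5 :* v₂ :+ v₀ :- # 6 :* v₄)
    ( (:- # 6 ⊛ v₃ ≐ v₄ by θ-linˢ-single 1)
    ∷ (# 1 ⊛ # 6 :* (# 2 :* (v₀ :* v₀) :+ # 0)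
         ≐ (# 5 :* v₂ :+ (con -[1+ 5 ] :* v₁ :+ (# 1 :* v₀ :+ # 0))) :+ # 6 :* ((# 1 :* v₁ :+ # 0) :- v₃)
         by sum-N)
    ∷ []) refl

  ramanujan₂ : + 12 · θ e₂ ≋ conv e₂ e₂ ⊕ ⊖ e₄
  ramanujan₂ = linear-combination (s 1 ∷ s 3 ∷ θ (s 1) ∷ θ e₂ ∷ [])
    (# 12 :* v₃) (e2 :* e2 :- (# 1 :+ # 240 :* v₁))
    ( (# 12 ⊛ v₃ ≐ con -[1+ 23 ] :* v₂ by θ-eisenstein -[1+ 23 ] 1)
    ∷ (:- # 48 ⊛ # 12 :* (v₀ :* v₀) ≐ # 5 :* v₁ :+ v₀ :- # 6 :* v₂ by sum-σσ)
    ∷ []) refl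
    where
    e2 : Expr 4
    e2 = # 1 :+ con -[1+ 23 ] :* v₀

  ramanujan₄ : + 3 · θ e₄ ≋ conv e₂ e₄ ⊕ ⊖ e₆
  ramanujan₄ = linear-combination
    (s 1 ∷ s 3 ∷ s 4 ∷ s 5 ∷ θ (linˢ ((+ 1 , 3) ∷ [])) ∷ θ (s 3) ∷ θ e₄ ∷ [])
    (# 3 :* v₆) ((# 1 :+ con -[1+ 23 ] :* v₀) :* (# 1 :+ # 240 :* v₁) :- (# 1 :+ con -[1+ 503 ] :* v₃))
    ( (# 3 ⊛ v₆ ≐ # 240 :* v₅ by θ-eisenstein (+ 240) 3)
    ∷ (:- # 720 ⊛ v₄ ≐ v₅ by θ-linˢ-single 3)
    ∷ (# 24 ⊛ # 30 :* (# 4 :* (v₁ :* v₀) :+ (# 4 :* (v₀ :* v₁) :+ # 0))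
         ≐ (# 21 :* v₃ :+ (con -[1+ 29 ] :* v₂ :+ (# 10 :* v₁ :+ (con -[1+ 0 ] :* v₀ :+ # 0))))
           :+ # 30 :* ((# 1 :* v₂ :+ # 0) :- v₄)
         by sum-N²)
    ∷ []) refl

  ramanujan₆ : + 2 · θ e₆ ≋ conv e₂ e₆ ⊕ ⊖ conv e₄ e₄
  ramanujan₆ = ·-cancel (+ 5) (linear-combination
    (s 1 ∷ s 3 ∷ s 5 ∷ s 6 ∷ s 7 ∷ θ (linˢ ((+ 1 , 5) ∷ [])) ∷ θ (s 5) ∷ θ e₆ ∷ θ (linˢ []) ∷ [])
    (# 5 :* (# 2 :* v₇))
    (# 5 :* ((# 1 :+ con -[1+ 23 ] :* v₀) :* (# 1 :+ con -[1+ 503 ] :* v₂)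
       :- (# 1 :+ # 240 :* v₁) :* (# 1 :+ # 240 :* v₁)))
    ( (# 10 ⊛ v₇ ≐ con -[1+ 503 ] :* v₆ by θ-eisenstein -[1+ 503 ] 5)
    ∷ (# 5040 ⊛ v₅ ≐ v₆ by θ-linˢ-single 5)
    ∷ (:- # 12 ⊛ # 420 :* (# 6 :* (v₂ :* v₀) :+ (# 14 :* (v₁ :* v₁) :+ (# 6 :* (v₀ :* v₂) :+ # 0)))
         ≐ (# 249 :* v₄ :+ (con -[1+ 419 ] :* v₃ :+ (# 210 :* v₂ :+ (con -[1+ 48 ] :* v₁ :+ (# 10 :* v₀ :+ # 0)))))
           :+ # 420 :* ((# 1 :* v₃ :+ # 0) :- v₅)
         by sum-N³)
    -- N³ brings in both s₁s₅ and s₃². D expresses s₃² by s₇ and s₃, and 2988 = 12 · 249 eliminates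
    -- s₇.
    ∷ (# 2988 ⊛ # 30 :* (# 4 :* (v₁ :* v₁) :+ # 0)
         ≐ (# 1 :* v₄ :+ (con -[1+ 0 ] :* v₁ :+ # 0)) :+ # 30 :* (# 0 :- v₈)
         by sum-D)
    ∷ (:- # 89640 ⊛ v₈ ≐ # 0 by θ-const (+ 0))
    ∷ []) refl)

  e₄e₆≋e₁₀ : conv e₄ e₆ ≋ e₁₀
  e₄e₆≋e₁₀ = linear-combination (s 3 ∷ s 5 ∷ s 9 ∷ θ (linˢ []) ∷ [])
    ((# 1 :+ # 240 :* v₀) :* (# 1 :+ con -[1+ 503 ] :* v₁)) (# 1 :+ con -[1+ 263 ] :* v₂)
    ( (:- # 24 ⊛ # 420 :* (# 6 :* (v₁ :* v₀) :+ (# 6 :* (v₀ :* v₁) :+ # 0))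
         ≐ (# 11 :* v₂ :+ (con -[1+ 20 ] :* v₁ :+ (# 10 :* v₀ :+ # 0))) :+ # 420 :* (# 0 :- v₃)
         by sum-ND)
    ∷ (# 10080 ⊛ v₃ ≐ # 0 by θ-const (+ 0))
    ∷ []) refl

  θ-^ : ∀ f k → θ (f ^ suc k) ≋ + suc k · conv (f ^ k) (θ f)
  θ-^ f zero    = ≋-trans (θ-* f (constS (+ 1)))
    (linear-combination (f ∷ θ f ∷ θ (constS (+ 1)) ∷ [])
      (v₁ :* # 1 :+ v₀ :* v₂) (# 1 :* (# 1 :* v₁)) ((v₀ ⊛ v₂ ≐ # 0 by θ-const (+ 1)) ∷ []) refl)
  θ-^ f (suc k) = ≋-trans (θ-* f (f ^ suc k))
    (linear-combination (f ∷ f ^ k ∷ θ f ∷ θ (f ^ suc k) ∷ constS (+ suc k) ∷ constS (+ suc (suc k)) ∷ [])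
      (v₂ :* (v₀ :* v₁) :+ v₀ :* v₃) (v₅ :* (v₀ :* v₁ :* v₂))
      ( (v₀ ⊛ v₃ ≐ v₄ :* (v₁ :* v₂) by θ-^ f k)
      -- The exponent is a variable, so its constants are atoms for the prover and their relation
      -- has to be supplied.
      ∷ (:- (v₀ :* v₁ :* v₂) ⊛ v₅ ≐ # 1 :+ v₄ by exact λ { zero → refl ; (suc n) → refl })
      ∷ []) refl)

  powS≋^ : ∀ f k → powS f k ≋ f ^ k
  powS≋^ f zero    = exact oneS≡
  powS≋^ f (suc k) = conv-cong (≋-refl {f}) (powS≋^ f k)

  prodFrom-stable : ∀ M n → n ≤ M → prodFrom 1 M n ≡ infProd 1 n
  prodFrom-stable M n n≤M = trans (cong (λ k → prodFrom 1 k n) (sym (ℕP.m∸n+n≡m n≤M))) (go (M ∸ n))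
    where
    step : ∀ k → prodFrom 1 (suc k ℕ.+ n) n ≡ prodFrom 1 (k ℕ.+ n) n
    step k = trans (conv-congᵇ {f = prodFrom 1 (k ℕ.+ n)} {g = geo (suc (k ℕ.+ n))} {g′ = constS (+ 1)} n (λ _ _ → refl) λ
        { zero    _ → geo-yes {suc (k ℕ.+ n)} (_ ℕD.∣0)
        ; (suc i) h → geo-no {suc (k ℕ.+ n)} λ d → ℕP.<⇒≱ (s≤s (ℕP.≤-trans h (ℕP.m≤n+m n k))) (ℕD.∣⇒≤ d) })
      (trans (conv-comm (prodFrom 1 (k ℕ.+ n)) (constS (+ 1)) n)
        (trans (conv-const (+ 1) (prodFrom 1 (k ℕ.+ n)) n) (ℤP.*-identityˡ _)))
    go : ∀ k → prodFrom 1 (k ℕ.+ n) n ≡ infProd 1 n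
    go zero    = refl
    go (suc k) = trans (step k) (go k)

  -- Logarithmic derivative of a finite product: the factor 1/(1 - q^d) contributes d q^d/(1 - q^d).
  θ-prodFrom : ∀ M → θ (prodFrom 1 M) ≋ conv (prodFrom 1 M) (λ n → Σ< M (λ i → (+ suc i) ^ᶻ 1 * ℓ (suc i) n))
  θ-prodFrom zero    = linear-combination (θ oneS ∷ oneS ∷ (λ _ → + 0) ∷ []) v₀ (v₁ :* v₂)
    ( (# 1 ⊛ v₀ ≐ # 0 by exact λ { zero → refl ; (suc n) → ℤP.*-zeroʳ (+ suc n) })
    ∷ (:- v₁ ⊛ v₂ ≐ # 0 by exact λ { zero → refl ; (suc n) → refl })
    ∷ []) refl
  θ-prodFrom (suc M) = ≋-trans (θ-* (prodFrom 1 M) (geo (suc M)))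
    (linear-combination
      (prodFrom 1 M ∷ geo (suc M) ∷ θ (prodFrom 1 M) ∷ θ (geo (suc M)) ∷ S ∷ constS (+ suc M) ∷ ℓ (suc M)
        ∷ (λ n → (+ suc M) ^ᶻ 1 * ℓ (suc M) n) ∷ [])
      (v₂ :* v₁ :+ v₀ :* v₃) (v₀ :* v₁ :* (v₄ :+ v₇))
      ( (v₁ ⊛ v₂ ≐ v₀ :* v₄ by θ-prodFrom M)
      ∷ (v₀ ⊛ v₃ ≐ v₅ :* (v₁ :* v₆) by θ-geo M)
      ∷ (:- (v₀ :* v₁) ⊛ v₇ ≐ v₅ :* v₆ by exact λ n →
           trans (cong (_* ℓ (suc M) n) (ℤP.*-identityʳ (+ suc M))) (sym (·-at (+ suc M) (ℓ (suc M)) n)))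
      ∷ []) refl)
    where
    S : Series
    S n = Σ< M (λ i → (+ suc i) ^ᶻ 1 * ℓ (suc i) n)

  θ-infProd : θ (infProd 1) ≋ conv (infProd 1) (s 1)
  θ-infProd = exact λ n → trans (exact⁻¹ (θ-prodFrom n) n)
    (conv-congᵇ n (prodFrom-stable n) λ k k≤n → Σ<-truncate k≤n λ i k≤i →
      trans (cong (λ x → (+ suc i) ^ᶻ 1 * x) (ℓ-vanish k≤i)) (ℤP.*-zeroʳ ((+ suc i) ^ᶻ 1)))

  -- W = q/Δ
  W : Series
  W = infProd 1 ^ 24

  -- The logarithmic derivative of Δ is E₂, here in the form 24 s₁ = 1 - E₂.
  θ-W : θ W ≋ conv W (constS (+ 1) ⊕ ⊖ e₂)
  θ-W = ≋-trans (θ-^ (infProd 1) 23)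
    (linear-combination (infProd 1 ∷ infProd 1 ^ 23 ∷ θ (infProd 1) ∷ s 1 ∷ [])
      (# 24 :* (v₁ :* v₂)) (v₀ :* v₁ :* (# 1 :- (# 1 :+ con -[1+ 23 ] :* v₃)))
      ((# 24 :* v₁ ⊛ v₂ ≐ v₀ :* v₃ by θ-infProd) ∷ []) refl)

  q : Series
  q = mono 1

  -- Comparison of coefficients gives (n - 1) f(n) = 0.
  eigen₁ : ∀ f → θ f ≋ f → f ≋ f 1 · q
  eigen₁ f h = exact λ
    { zero → trans (sym (exact⁻¹ h 0)) (sym (trans (·-at (f 1) q 0) (ℤP.*-zeroʳ (f 1))))
    ; (suc zero) → sym (trans (·-at (f 1) q 1) (ℤP.*-identityʳ (f 1)))
    ; (suc (suc n)) → trans (vanish n) (sym (trans (·-at (f 1) q (suc (suc n))) (ℤP.*-zeroʳ (f 1)))) }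
    where
    vanish : ∀ n → f (suc (suc n)) ≡ + 0
    vanish n = ℤP.*-cancelˡ-≡ (+ suc n) _ _ (Z.linear-combination (f (2 ℕ.+ n) ∷ + n ∷ [])
      ((# 1 :+ v₁) :* v₀) ((# 1 :+ v₁) :* # 0)
      ((# 1 Z.⊛ (# 2 :+ v₁) :* v₀ ≐ v₀ by exact⁻¹ h (suc (suc n))) ∷ []) refl)

  -- By Ramanujan's equations the left side is fixed by θ, hence a multiple of q.
  discriminant : conv (e₄ ^ 3 ⊕ ⊖ (e₆ ^ 2)) W ≋ + 1728 · q
  discriminant = ≋-trans (eigen₁ F (·-cancel (+ 6) θF))
    (conv-cong {constS (F 1)} {constS (+ 1728)} (exact λ { zero → refl ; (suc n) → refl }) (≋-refl {q}))
    where
    F : Series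
    F = conv (e₄ ^ 3 ⊕ ⊖ (e₆ ^ 2)) W
    θF : + 6 · θ F ≋ + 6 · F
    θF = linear-combination
      (e₂ ∷ e₄ ∷ e₆ ∷ θ e₄ ∷ θ e₆ ∷ W ∷ θ W ∷ θ F ∷ θ (e₄ ^ 3) ∷ θ (e₆ ^ 2) ∷ θ (e₄ ^ 3 ⊕ ⊖ (e₆ ^ 2)) ∷ θ (⊖ (e₆ ^ 2)) ∷ [])
      (# 6 :* v₇) (# 6 :* ((v₁ :^ 3 :- v₂ :^ 2) :* v₅))
      ( (# 6 ⊛ v₇ ≐ v₁₀ :* v₅ :+ (v₁ :^ 3 :- v₂ :^ 2) :* v₆ by θ-* (e₄ ^ 3 ⊕ ⊖ (e₆ ^ 2)) W)
      ∷ (# 6 :* v₅ ⊛ v₁₀ ≐ v₈ :+ v₁₁ by θ-⊕ (e₄ ^ 3) (⊖ (e₆ ^ 2)))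
      ∷ (# 6 :* v₅ ⊛ v₁₁ ≐ :- v₉ by θ-⊖ (e₆ ^ 2))
      ∷ (# 6 :* v₅ ⊛ v₈ ≐ # 3 :* (v₁ :^ 2 :* v₃) by θ-^ e₄ 2)
      ∷ (:- # 6 :* v₅ ⊛ v₉ ≐ # 2 :* (v₂ :^ 1 :* v₄) by θ-^ e₆ 1)
      ∷ (# 6 :* v₅ :* v₁ :^ 2 ⊛ # 3 :* v₃ ≐ v₀ :* v₁ :- v₂ by ramanujan₄)
      ∷ (:- # 6 :* v₅ :* v₂ ⊛ # 2 :* v₄ ≐ v₀ :* v₂ :- v₁ :* v₁ by ramanujan₆)
      ∷ (# 6 :* (v₁ :^ 3 :- v₂ :^ 2) ⊛ v₆ ≐ v₅ :* (# 1 :- v₀) by θ-W)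
      ∷ []) refl

  σ₃-term : ∀ n d → + (if does (suc d ℕD.∣? n) then suc d ℕ.^ 3 else 0) ≡ (+ suc d) ^ᶻ 3 * geo (suc d) n
  σ₃-term n d = go (does (suc d ℕD.∣? n))
    where
    cube : ∀ n → + (n ℕ.^ 3) ≡ (+ n) ^ᶻ 3
    cube n = trans (ℤP.pos-* n (n ℕ.* (n ℕ.* 1))) (cong (λ x → + n * x)
      (trans (ℤP.pos-* n (n ℕ.* 1)) (cong (λ x → + n * x) (ℤP.pos-* n 1))))
    go : ∀ b → + (if b then suc d ℕ.^ 3 else 0) ≡ (+ suc d) ^ᶻ 3 * (if b then + 1 else + 0)
    go true  = trans (cube (suc d)) (sym (ℤP.*-identityʳ ((+ suc d) ^ᶻ 3)))
    go false = sym (ℤP.*-zeroʳ ((+ suc d) ^ᶻ 3))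

  -- The local function of σ3 has no name outside its definition: it enters as h, and σ₃-local is
  -- recovered from it by unification.
  σ₃-sum : (h : ℕ → ℕ) (n : ℕ) → h 0 ≡ 0 →
    (∀ d → h (suc d) ≡ (if does (suc d ℕD.∣? n) then suc d ℕ.^ 3 else 0) ℕ.+ h d) →
    ∀ d → + ((if does (suc d ℕD.∣? n) then suc d ℕ.^ 3 else 0) ℕ.+ h d)
          ≡ Σ< (suc d) (λ i → (+ suc i) ^ᶻ 3 * geo (suc i) n)
  σ₃-sum h n h0 hS d = trans (ℤP.+-comm (+ (if does (suc d ℕD.∣? n) then suc d ℕ.^ 3 else 0)) (+ h d))
    (cong₂ _+_ (rest d) (σ₃-term n d))
    where
    rest : ∀ d → + h d ≡ Σ< d (λ i → (+ suc i) ^ᶻ 3 * geo (suc i) n)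
    rest zero    = cong +_ h0
    rest (suc d) = trans (cong +_ (hS d)) (σ₃-sum h n h0 hS d)

  mutual
    σ₃-local : ℕ → ℕ → ℕ
    σ₃-local = _

    σ₃≡Σ : ∀ n → + σ3 (suc n) ≡ Σ< (suc n) (λ i → (+ suc i) ^ᶻ 3 * geo (suc i) (suc n))
    σ₃≡Σ n with suc n
    ... | N = σ₃-sum (σ₃-local N) N refl (λ _ → refl) n

  σ₃≡s₃ : ∀ n → + σ3 (suc n) ≡ s 3 (suc n)
  σ₃≡s₃ n = trans (σ₃≡Σ n) (Σ<-cong (suc n) λ i _ →
    cong (λ x → (+ suc i) ^ᶻ 3 * x) (sym (ℤP.+-identityʳ (geo (suc i) (suc n)))))

  E4≋e₄ : E4 ≋ e₄
  E4≋e₄ = exact λ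
    { zero → refl
    ; (suc n) → trans (trans (ℤP.pos-* 240 (σ3 (suc n))) (cong (λ x → + 240 * x) (σ₃≡s₃ n)))
        (sym (trans (ℤP.+-identityˡ _) (·-at (+ 240) (s 3) (suc n)))) }

  abstract
    -- ψ = q j
    ψ : Series
    ψ = conv (e₄ ^ 3) W

    ψ≋ : ψ ≋ conv (e₄ ^ 3) W
    ψ≋ = ≋-refl {conv (e₄ ^ 3) W}

    -- The two leading coefficients are computed inside the abstract block: outside it ψ does not
    -- unfold, which keeps the type checker from expanding q j.
    ψ-0 : ψ 0 ≡ + 1
    ψ-0 = refl

    ψ-1 : ψ 1 ≡ + 744
    ψ-1 = refl

  jL≋ψ : co jL ≋ ψ
  jL≋ψ = ≋-trans (conv-cong (≋-trans (powS≋^ E4 3) (^-cong 3)) (powS≋^ (infProd 1) 24)) (≋-sym ψ≋)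
    where
    ^-cong : ∀ k → E4 ^ k ≋ e₄ ^ k
    ^-cong zero    = ≋-refl {constS (+ 1)}
    ^-cong (suc k) = conv-cong E4≋e₄ (^-cong k)

open Eisenstein

-- Polynomials in j and their principal parts

module PrincipalParts where
  open SeriesMod 0 hiding (_≡ᶻ_; refl′; sym′; trans′; +-cong′; *-cong′; mk; module _≡ᶻ_)

  infixl 5 _‼_
  -- Total on ℤ, so that exponents can be shifted without a case distinction on the order of the
  -- pole.
  _‼_ : Series → ℤ → ℤ
  f ‼ (+ m)    = f m
  f ‼ -[1+ _ ] = + 0

  coeff≡at : ∀ o f n → coeff (mkL o f) n ≡ f ‼ (n + + o)
  coeff≡at o f n with n + + o
  ... | + m      = refl
  ... | -[1+ _ ] = refl

  at-cong : ∀ {f g} → f ≋ g → ∀ z → f ‼ z ≡ g ‼ z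
  at-cong h (+ m)    = exact⁻¹ h m
  at-cong h -[1+ _ ] = refl

  at-+ : ∀ f g z → f ⊕ g ‼ z ≡ (f ‼ z) + (g ‼ z)
  at-+ f g (+ m)    = refl
  at-+ f g -[1+ _ ] = refl

  at-· : ∀ c f z → c · f ‼ z ≡ c * (f ‼ z)
  at-· c f (+ m)    = ·-at c f m
  at-· c f -[1+ _ ] = sym (ℤP.*-zeroʳ c)

  at-shift₁ : ∀ f z → shift 1 f ‼ (+ 1 + z) ≡ f ‼ z
  at-shift₁ f (+ m)        = refl
  at-shift₁ f -[1+ zero ]  = refl
  at-shift₁ f -[1+ suc k ] = refl

  shift-suc : ∀ d f n → shift (suc d) f n ≡ shift 1 (shift d f) n
  shift-suc d f zero    = refl
  shift-suc d f (suc n) = refl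

  at-shift : ∀ d f z → shift d f ‼ (+ d + z) ≡ f ‼ z
  at-shift zero    f z = cong (f ‼_) (ℤP.+-identityˡ z)
  at-shift (suc d) f z = trans (cong (shift (suc d) f ‼_) (ℤP.+-assoc (+ 1) (+ d) z))
    (trans (at-cong (exact (shift-suc d f)) (+ 1 + (+ d + z)))
      (trans (at-shift₁ (shift d f) (+ d + z)) (at-shift d f z)))

  at-negative : ∀ f {z} → z ℤ.< + 0 → f ‼ z ≡ + 0
  at-negative f {+ _}      (ℤ.+<+ ())
  at-negative f { -[1+ _ ]} _ = refl

  -- the coefficient of q^n in j^i
  jCoeff : ℕ → ℤ → ℤ
  jCoeff i n = ψ ^ i ‼ (n + + i)

  jSum : ℕ → List ℤ → ℤ → ℤ
  jSum i []       n = + 0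
  jSum i (c ∷ cs) n = c * jCoeff i n + jSum (suc i) cs n

  co-polyJ : ∀ c cs → co (polyJ (c ∷ cs)) ≋ shift (suc (ord (polyJ cs))) (constS c) ⊕ conv ψ (co (polyJ cs))
  co-polyJ c cs = ⊕-cong {x = shift (suc o) (co (constL c))}
    (exact (shift-cong (suc o) λ { zero → refl ; (suc _) → refl }))
    (≋-trans (exact λ n → cong (λ d → shift d (conv (co jL) (co (polyJ cs))) n) (ℕP.n∸n≡0 (suc o)))
      (conv-cong jL≋ψ (≋-refl {co (polyJ cs)})))
    where o = ord (polyJ cs)

  shift-const : ∀ d c → shift d (constS c) ≋ c · mono d
  shift-const d c = exact λ n → trans (shift-cong d (λ k → sym (trans (conv-const c (constS (+ 1)) k) (lem k))) n)
    (trans (sym (mono-conv d (c · constS (+ 1)) n)) (exact⁻¹ (identity (mono d ∷ constS c ∷ [])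
      (v₀ :* (v₁ :* # 1)) (v₁ :* v₀) refl) n))
    where
    lem : ∀ k → c * constS (+ 1) k ≡ constS c k
    lem zero    = ℤP.*-identityʳ c
    lem (suc k) = ℤP.*-zeroʳ c

  -- The factor ψ^i carries the induction along the list: j^i (c + j P) = c j^i + j^(i+1) P. The
  -- declared order of `polyJ cs` is the length of the list and may exceed the order of the pole.
  at-polyJ : ∀ i cs n → conv (ψ ^ i) (co (polyJ cs)) ‼ (n + + (i ℕ.+ ord (polyJ cs))) ≡ jSum i cs n
  at-polyJ i []       n = trans (at-cong (≋-trans
      (conv-cong {f = ψ ^ i} {g = co (polyJ [])} {g′ = constS (+ 0)} (≋-refl {ψ ^ i})
        (exact {co (polyJ [])} {constS (+ 0)} λ { zero → refl ; (suc _) → refl }))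
      (identity (ψ ^ i ∷ []) (v₀ :* # 0) (# 0) refl)) z)
    (zero-at z)
    where
    z = n + + (i ℕ.+ 0)
    zero-at : ∀ z → constS (+ 0) ‼ z ≡ + 0
    zero-at (+ zero)  = refl
    zero-at (+ suc _) = refl
    zero-at -[1+ _ ]  = refl
  at-polyJ i (c ∷ cs) n = begin
    conv (ψ ^ i) (co (polyJ (c ∷ cs))) ‼ z
      ≡⟨ at-cong (≋-trans (conv-cong (≋-refl {ψ ^ i}) (co-polyJ c cs)) (linear-combination
           (ψ ^ i ∷ ψ ∷ co (polyJ cs) ∷ mono (suc o) ∷ constS c ∷ shift (suc o) (constS c) ∷ [])
           (v₀ :* (v₅ :+ v₁ :* v₂)) (v₄ :* (v₃ :* v₀) :+ v₁ :* v₀ :* v₂)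
           ((v₀ ⊛ v₅ ≐ v₄ :* v₃ by shift-const (suc o) c) ∷ []) refl)) z ⟩
    c · conv (mono (suc o)) (ψ ^ i) ⊕ conv (ψ ^ suc i) (co (polyJ cs)) ‼ z
      ≡⟨ at-+ (c · conv (mono (suc o)) (ψ ^ i)) (conv (ψ ^ suc i) (co (polyJ cs))) z ⟩
    (c · conv (mono (suc o)) (ψ ^ i) ‼ z) + (conv (ψ ^ suc i) (co (polyJ cs)) ‼ z)
      ≡⟨ cong₂ _+_
           (trans (at-· c (conv (mono (suc o)) (ψ ^ i)) z) (cong (λ x → c * x)
             (trans (at-cong (exact (mono-conv (suc o) (ψ ^ i))) z)
               (trans (cong (shift (suc o) (ψ ^ i) ‼_) z₁) (at-shift (suc o) (ψ ^ i) (n + + i))))))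
           (trans (cong (conv (ψ ^ suc i) (co (polyJ cs)) ‼_) (cong (λ k → n + + k) (ℕP.+-suc i o)))
             (at-polyJ (suc i) cs n)) ⟩
    jSum i (c ∷ cs) n ∎
    where
    o = ord (polyJ cs)
    z = n + + (i ℕ.+ suc o)
    z₁ : z ≡ + suc o + (n + + i)
    z₁ = trans (cong (λ x → n + x) (ℤP.pos-+ i (suc o)))
      (Z.identity (n ∷ + i ∷ + suc o ∷ []) (v₀ :+ (v₁ :+ v₂)) (v₂ :+ (v₀ :+ v₁)) refl)

  coeff-polyJ : ∀ cs n → coeff (polyJ cs) n ≡ jSum 0 cs n
  coeff-polyJ cs n = trans (coeff≡at (ord (polyJ cs)) (co (polyJ cs)) n)
    (trans (at-cong (identity (co (polyJ cs) ∷ []) v₀ (# 1 :* v₀) refl) (n + + ord (polyJ cs))) (at-polyJ 0 cs n))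

  ^-0 : ∀ f → f 0 ≡ + 1 → ∀ i → (f ^ i) 0 ≡ + 1
  ^-0 f h zero    = refl
  ^-0 f h (suc i) = cong₂ _*_ h (^-0 f h i)

  ^-1 : ∀ f → f 0 ≡ + 1 → ∀ i → (f ^ i) 1 ≡ f 1 * + i
  ^-1 f h zero    = sym (ℤP.*-zeroʳ (f 1))
  ^-1 f h (suc i) = trans (cong₂ _+_ (cong₂ _*_ h (^-1 f h i)) (cong (λ x → f 1 * x) (^-0 f h i)))
    (Z.identity (+ i ∷ f 1 ∷ []) (# 1 :* (v₁ :* v₀) :+ v₁ :* # 1) (v₁ :* (# 1 :+ v₀)) refl)

  ψ^-0 : ∀ i → (ψ ^ i) 0 ≡ + 1
  ψ^-0 = ^-0 ψ ψ-0

  ψ^-1 : ∀ i → (ψ ^ i) 1 ≡ + 744 * + i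
  ψ^-1 i = trans (^-1 ψ ψ-0 i) (cong (_* + i) ψ-1)

  jCoeff-below : ∀ {i n} → n ℤ.< - (+ i) → jCoeff i n ≡ + 0
  jCoeff-below {i} {n} h = at-negative (ψ ^ i)
    (subst (n + + i ℤ.<_) (ℤP.+-inverseˡ (+ i)) (ℤP.+-monoˡ-< (+ i) h))

  jCoeff-lead : ∀ i → jCoeff i (- (+ i)) ≡ + 1
  jCoeff-lead i = trans (cong (ψ ^ i ‼_) (ℤP.+-inverseˡ (+ i))) (ψ^-0 i)

  jCoeff-next : ∀ i → jCoeff (suc i) (- (+ i)) ≡ + 744 * + suc i
  jCoeff-next i = trans (cong (ψ ^ suc i ‼_) (Z.identity (+ i ∷ []) (:- v₀ :+ (# 1 :+ v₀)) (# 1) refl)) (ψ^-1 (suc i))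

  -suc< : ∀ {i n} → n ℤ.≤ - (+ suc i) → n ℤ.< - (+ i)
  -suc< {i} h = ℤP.≤-<-trans h (ℤP.neg-mono-< (ℤ.+<+ (ℕP.n<1+n i)))

  jSum-tail : ∀ i c cs {n} → n ℤ.< - (+ i) → jSum i (c ∷ cs) n ≡ jSum (suc i) cs n
  jSum-tail i c cs {n} h = trans (cong (λ x → c * x + jSum (suc i) cs n) (jCoeff-below {i} h))
    (trans (cong (_+ jSum (suc i) cs n) (ℤP.*-zeroʳ c)) (ℤP.+-identityˡ _))

  -- Triangularity: j^i starts with q^(-i). By induction the higher powers vanish, and then the
  -- coefficient at q^(-i) is `c` itself.
  jSum-zero : ∀ i cs → (∀ n → n ℤ.≤ - (+ i) → jSum i cs n ≡ + 0) → ∀ n → jSum i cs n ≡ + 0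
  jSum-zero i []       h n = refl
  jSum-zero i (c ∷ cs) h n = trans (cong₂ (λ x y → x * jCoeff i n + y) c≡0 (rest n)) refl
    where
    rest : ∀ n → jSum (suc i) cs n ≡ + 0
    rest = jSum-zero (suc i) cs λ n n≤ →
      trans (sym (jSum-tail i c cs (-suc< {i} n≤))) (h n (ℤP.<⇒≤ (-suc< {i} n≤)))
    c≡0 : c ≡ + 0
    c≡0 = trans (trans (sym (ℤP.*-identityʳ c)) (sym (ℤP.+-identityʳ (c * + 1))))
      (trans (sym (cong₂ (λ x y → c * x + y) (jCoeff-lead i) (rest (- (+ i))))) (h (- (+ i)) ℤP.≤-refl))

  module Glue (p M : ℕ) .{{_ : ℕ.NonZero p}} where
    open Congruence M using (_≡ᶻ_; refl′; sym′; trans′; +-cong′; *-cong′; mk)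

    -- the coefficients of q^{-i} f at all exponents p n ≠ 0 vanish modulo M
    Good : ℕ → Series → Set
    Good i f = ∀ m n → + m ≡ + p * n + + i → n ≢ + 0 → f m ≡ᶻ + 0

    good-at : ∀ {i f} → Good i f → ∀ n → n ≢ + 0 → f ‼ (+ p * n + + i) ≡ᶻ + 0
    good-at {i} {f} h n n≢0 with + p * n + + i in e
    ... | + m      = h m n (sym e) n≢0
    ... | -[1+ _ ] = refl′ refl

    ≡ᶻ0⇒∣ : ∀ {x} → x ≡ᶻ + 0 → + M ∣ x
    ≡ᶻ0⇒∣ (mk t refl) = ℕD.divides ℤ.∣ t ∣ (trans (cong ℤ.∣_∣ (ℤP.+-identityˡ (t * + M))) (ℤP.abs-* t (+ M)))

    module _ (good : ∀ i → 1 ≤ i → i ≤ p ∸ 1 → Good i (ψ ^ i)) (N : ℤ) (N≢0 : N ≢ + 0) where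

      term : ∀ i c → i ≤ p ∸ 1 → c * jCoeff i (+ p * N) ≡ᶻ + 0
      term i c i≤ = trans′ (*-cong′ (refl′ {c} refl) (head i i≤)) (refl′ (ℤP.*-zeroʳ c))
        where
        const-at : ∀ z → z ≢ + 0 → constS (+ 1) ‼ (z + + 0) ≡ᶻ + 0
        const-at (+ zero)  h = ⊥-elim (h refl)
        const-at (+ suc n) h = refl′ refl
        const-at -[1+ n ]  h = refl′ refl
        head : ∀ i → i ≤ p ∸ 1 → jCoeff i (+ p * N) ≡ᶻ + 0
        head zero    _ = const-at (+ p * N) λ e → N≢0 (ℤP.*-cancelˡ-≡ (+ p) N (+ 0) (trans e (sym (ℤP.*-zeroʳ (+ p)))))
        head (suc i) h = good-at (good (suc i) (s≤s z≤n) h) N N≢0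

      -- Peels off the powers j^i with i < b: by `term` they contribute 0 modulo `M` at p N, and
      -- they do not reach the exponents ≤ -b, where the principal part is known. The remaining
      -- powers are left to `end`.
      walk : ∀ b (g : ℤ → ℤ) t i cs → i ℕ.+ t ≡ b → b ∸ 1 ≤ p ∸ 1 →
        (∀ n → n ℤ.≤ - (+ b) → jSum i cs n ≡ g n) →
        (∀ cs′ → (∀ n → n ℤ.≤ - (+ b) → jSum b cs′ n ≡ g n) → jSum b cs′ (+ p * N) ≡ᶻ + 0) →
        jSum i cs (+ p * N) ≡ᶻ + 0
      walk b g zero    i cs       e le h end with trans (sym (ℕP.+-identityʳ i)) e
      ... | refl = end cs h
      walk b g (suc t) i []       e le h end = refl′ refl
      walk b g (suc t) i (c ∷ cs) e le h end = trans′
        (+-cong′ (term i c (ℕP.≤-trans (subst (i ℕ.≤_) (cong (_∸ 1) e′) (ℕP.m≤m+n i t)) le))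
          (walk b g t (suc i) cs e′ le
            (λ n n≤ → trans (sym (jSum-tail i c cs (ℤP.≤-<-trans n≤ (ℤP.neg-mono-< (ℤ.+<+ i<b))))) (h n n≤)) end))
        (refl′ refl)
        where
        e′ : suc i ℕ.+ t ≡ b
        e′ = trans (sym (ℕP.+-suc i t)) e
        i<b : i < b
        i<b = subst (suc i ℕ.≤_) e′ (ℕP.m≤m+n (suc i) t)

      module _ (c : List ℤ) where

        -- The target has no pole of order above k, so the powers beyond j^k have coefficient 0, and
        -- those up to j^k have index at most p - 1.
        small : ∀ k → k ≤ p ∸ 1 → IsZk k (polyJ c) → jSum 0 c (+ p * N) ≡ᶻ + 0
        small k k≤ isZ = walk (suc k) (λ _ → + 0) (suc k) 0 c refl k≤
          (λ n n≤ → trans (sym (coeff-polyJ c n)) (trans (isZ n (ℤP.≤-trans n≤ ℤ.-≤+))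
            (trans (coeff≡at k (infProd 2) n)
              (at-negative (infProd 2) (subst (n + + k ℤ.<_) (ℤP.+-inverseˡ (+ k)) (ℤP.+-monoˡ-< (+ k) (-suc< {k} n≤)))))))
          (λ cs h → refl′ (jSum-zero (suc k) cs h (+ p * N)))

        -- ∏_{n≥2} (1 - q^n)^{-1} has no term in q, so j^p and j^{p+1} enter Z_{p+1} only through the
        -- combination j^{p+1} - 744 (p+1) j^p.
        large : Good (suc p) (ψ ^ suc p ⊕ ⊖ ((+ 744 * + suc p) · conv q (ψ ^ p))) →
          IsZk (suc p) (polyJ c) → jSum 0 c (+ p * N) ≡ᶻ + 0
        large good′ isZ = walk p g p 0 c refl ℕP.≤-refl
          (λ n n≤ → trans (sym (coeff-polyJ c n)) (trans (isZ n (ℤP.≤-trans n≤ ℤP.neg-≤-pos))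
            (coeff≡at (suc p) (infProd 2) n)))
          end
          where
          g : ℤ → ℤ
          g n = infProd 2 ‼ (n + + suc p)
          g-p : g (- (+ p)) ≡ + 0
          g-p = cong (infProd 2 ‼_) (Z.identity (+ p ∷ []) (:- v₀ :+ (# 1 :+ v₀)) (# 1) refl)
          end : ∀ cs → (∀ n → n ℤ.≤ - (+ p) → jSum p cs n ≡ g n) → jSum p cs (+ p * N) ≡ᶻ + 0
          end [] h = refl′ refl
          end (a ∷ []) h = refl′ (trans (cong (λ x → x * jCoeff p (+ p * N) + + 0) a≡0) refl)
            where
            a≡0 : a ≡ + 0
            a≡0 = trans (Z.identity (a ∷ []) v₀ (v₀ :* # 1 :+ # 0) refl)
              (trans (cong (λ x → a * x + + 0) (sym (jCoeff-lead p))) (trans (h (- (+ p)) ℤP.≤-refl) g-p))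
          end (a ∷ b ∷ cs) h = trans′ (refl′ combine)
            (trans′ (*-cong′ (refl′ {b} refl) (good-at good′ N N≢0)) (refl′ (ℤP.*-zeroʳ b)))
            where
            rest : ∀ n → jSum (suc (suc p)) cs n ≡ + 0
            rest = jSum-zero (suc (suc p)) cs λ n n≤ → begin
              jSum (suc (suc p)) cs n   ≡⟨ jSum-tail (suc p) b cs (-suc< {suc p} n≤) ⟨
              jSum (suc p) (b ∷ cs) n   ≡⟨ jSum-tail p a (b ∷ cs) (lower n n≤) ⟨
              jSum p (a ∷ b ∷ cs) n     ≡⟨ h n (ℤP.<⇒≤ (lower n n≤)) ⟩
              g n                       ≡⟨ at-negative (infProd 2)
                (subst (n + + suc p ℤ.<_) (ℤP.+-inverseˡ (+ suc p)) (ℤP.+-monoˡ-< (+ suc p) (-suc< {suc p} n≤))) ⟩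
              + 0                       ∎
              where
              lower : ∀ n → n ℤ.≤ - (+ suc (suc p)) → n ℤ.< - (+ p)
              lower n n≤ = ℤP.<-trans (-suc< {suc p} n≤) (ℤP.neg-mono-< (ℤ.+<+ (ℕP.n<1+n p)))
            -- Comparison at q^(-p): the target contributes 0, and j^(p+1) contributes 744 (p + 1).
            relation : a * + 1 + (b * (+ 744 * + suc p) + + 0) ≡ + 0
            relation = begin
              a * + 1 + (b * (+ 744 * + suc p) + + 0)
                ≡⟨ cong₂ (λ x y → a * x + (b * y + + 0)) (jCoeff-lead p) (jCoeff-next p) ⟨
              a * jCoeff p (- (+ p)) + (b * jCoeff (suc p) (- (+ p)) + + 0)
                ≡⟨ cong (λ x → a * jCoeff p (- (+ p)) + (b * jCoeff (suc p) (- (+ p)) + x)) (rest (- (+ p))) ⟨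
              jSum p (a ∷ b ∷ cs) (- (+ p))   ≡⟨ h (- (+ p)) ℤP.≤-refl ⟩
              g (- (+ p))                     ≡⟨ g-p ⟩
              + 0 ∎
            z = + p * N + + suc p
            expand : (ψ ^ suc p ⊕ ⊖ ((+ 744 * + suc p) · conv q (ψ ^ p)) ‼ z) ≡
              jCoeff (suc p) (+ p * N) - + 744 * + suc p * jCoeff p (+ p * N)
            expand = trans (at-cong (linear-combination
                (ψ ^ suc p ∷ constS (+ 744 * + suc p) ∷ q ∷ ψ ^ p ∷ constS (- (+ 744 * + suc p)) ∷ [])
                (v₀ :- v₁ :* (v₂ :* v₃)) (v₀ :+ v₄ :* (v₂ :* v₃))
                ((:- (v₂ :* v₃) ⊛ v₄ ≐ :- v₁ by exact λ { zero → refl ; (suc _) → refl }) ∷ []) refl) z)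
              (trans (at-+ (ψ ^ suc p) (- (+ 744 * + suc p) · conv q (ψ ^ p)) z)
              (cong (λ x → (ψ ^ suc p ‼ z) + x) (trans (at-· (- (+ 744 * + suc p)) (conv q (ψ ^ p)) z)
                (trans (sym (ℤP.neg-distribˡ-* (+ 744 * + suc p) (conv q (ψ ^ p) ‼ z)))
                (cong (λ x → - (+ 744 * + suc p * x))
                (trans (at-cong (exact (mono-conv 1 (ψ ^ p))) z)
                (trans (cong (shift 1 (ψ ^ p) ‼_)
                  (Z.identity (+ p * N ∷ + p ∷ []) (v₀ :+ (# 1 :+ v₁)) (# 1 :+ (v₀ :+ v₁)) refl))
                (at-shift₁ (ψ ^ p) (+ p * N + + p)))))))))
            combine : a * jCoeff p (+ p * N) + (b * jCoeff (suc p) (+ p * N) + jSum (suc (suc p)) cs (+ p * N)) ≡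
              b * (ψ ^ suc p ⊕ ⊖ ((+ 744 * + suc p) · conv q (ψ ^ p)) ‼ z)
            combine = trans (Z.linear-combination
              (a ∷ b ∷ + 744 * + suc p ∷ jCoeff p (+ p * N) ∷ jCoeff (suc p) (+ p * N) ∷ jSum (suc (suc p)) cs (+ p * N) ∷ [])
              (v₀ :* v₃ :+ (v₁ :* v₄ :+ v₅)) (v₁ :* (v₄ :- v₂ :* v₃))
              ( (v₃ Z.⊛ v₀ :* # 1 :+ (v₁ :* v₂ :+ # 0) ≐ # 0 by relation)
              ∷ (# 1 Z.⊛ v₅ ≐ # 0 by rest (+ p * N))
              ∷ []) refl) (cong (λ x → b * x) (sym expand))

    conclude : (∀ i → 1 ≤ i → i ≤ p ∸ 1 → Good i (ψ ^ i)) →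
      Good (suc p) (ψ ^ suc p ⊕ ⊖ ((+ 744 * + suc p) · conv q (ψ ^ p))) →
      ∀ k → ((1 ≤ k × k ≤ p ∸ 1) ⊎ k ≡ suc p) → ∀ c → IsZk k (polyJ c) →
      ∀ n → n ≢ + 0 → + M ∣ coeff (polyJ c) (+ p * n)
    conclude good good′ k (inj₁ (_ , k≤)) c isZ n n≢0 =
      ≡ᶻ0⇒∣ (trans′ (refl′ (coeff-polyJ c (+ p * n))) (small good n n≢0 c k k≤ isZ))
    conclude good good′ _ (inj₂ refl) c isZ n n≢0 =
      ≡ᶻ0⇒∣ (trans′ (refl′ (coeff-polyJ c (+ p * n))) (large good n n≢0 c good′ isZ))

open PrincipalParts

-- Powers, polynomials and derivatives modulo M

mono-off : ∀ {i m} → m ≢ i → mono i m ≡ + 0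
mono-off {zero}  {zero}  h = ⊥-elim (h refl)
mono-off {zero}  {suc m} h = refl
mono-off {suc i} {zero}  h = refl
mono-off {suc i} {suc m} h = mono-off {i} {m} λ e → h (cong suc e)

derivative : List ℤ → List ℤ
derivative []      = []
derivative (a ∷ p) = addᴾ 1 p (+ 0 ∷ derivative p)

-- The list as an expression, so that the prover can expand it together with other terms; `⟦_⟧ᴾ`
-- evaluates it directly.
horner : ∀ {n} → List ℤ → Expr (suc n)
horner []      = con (+ 0)
horner (a ∷ p) = con a :+ v₀ :* horner p

module PowersMod (M : ℕ) where
  open SeriesMod M

  ^-cong : ∀ k {f g} → f ≋ g → f ^ k ≋ g ^ k
  ^-cong zero    h = ≋-refl {constS (+ 1)}
  ^-cong (suc k) h = conv-cong h (^-cong k h)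

  ^-* : ∀ f g k → conv f g ^ k ≋ conv (f ^ k) (g ^ k)
  ^-* f g zero    = identity [] (# 1) (# 1 :* # 1) refl
  ^-* f g (suc k) = linear-combination (f ∷ g ∷ f ^ k ∷ g ^ k ∷ conv f g ^ k ∷ [])
    (v₀ :* v₁ :* v₄) (v₀ :* v₂ :* (v₁ :* v₃)) ((v₀ :* v₁ ⊛ v₄ ≐ v₂ :* v₃ by ^-* f g k) ∷ []) refl

  θ-power : ∀ f k → θ (f ^ suc k) ≋ + suc k · conv (f ^ k) (θ f)
  θ-power f k = mod M (θ-^ f k)

  θ-^-log : ∀ f w → θ f ≋ conv f w → ∀ k → θ (f ^ k) ≋ + k · conv (f ^ k) w
  θ-^-log f w h zero    = ≋-trans (θ-const (+ 1)) (identity (w ∷ []) (# 0) (# 0 :* (# 1 :* v₀)) refl)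
  θ-^-log f w h (suc k) = linear-combination
    (f ∷ f ^ k ∷ θ f ∷ θ (f ^ suc k) ∷ constS (+ suc k) ∷ w ∷ [])
    v₃ (v₄ :* (v₀ :* v₁ :* v₅))
    ((# 1 ⊛ v₃ ≐ v₄ :* (v₁ :* v₂) by θ-power f k) ∷ (v₄ :* v₁ ⊛ v₂ ≐ v₀ :* v₅ by h) ∷ []) refl

  q^≋mono : ∀ i → q ^ i ≋ mono i
  q^≋mono zero    = ≋-refl {constS (+ 1)}
  q^≋mono (suc i) = ≋-trans (conv-cong (≋-refl {q}) (q^≋mono i)) (mod M (mono-+ 1 i))

  horner≋ : ∀ t p → ⟦ horner p ⟧ (t ∷ []) ≋ ⟦_⟧ᴾ {1} p (t ∷ [])
  horner≋ t []      = ≋-refl {constS (+ 0)}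
  horner≋ t (a ∷ p) = ⊕-cong (≋-refl {constS a}) (conv-cong (≋-refl {t}) (horner≋ t p))

  θ-horner : ∀ p t → θ (⟦ horner p ⟧ (t ∷ [])) ≋ conv (⟦ horner (derivative p) ⟧ (t ∷ [])) (θ t)
  θ-horner []      t = ≋-trans (θ-const (+ 0)) (identity (θ t ∷ []) (# 0) (# 0 :* v₀) refl)
  θ-horner (a ∷ p) t = ≋-trans (θ-⊕ (constS a) (conv t P)) (linear-combination
    (θ (constS a) ∷ θ (conv t P) ∷ t ∷ θ t ∷ P ∷ θ P ∷ P′ ∷ Q ∷ [])
    (v₀ :+ v₁) (v₇ :* v₃)
    ( (# 1 ⊛ v₀ ≐ # 0 by θ-const a)
    ∷ (# 1 ⊛ v₁ ≐ v₃ :* v₄ :+ v₂ :* v₅ by θ-* t P)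
    ∷ (v₂ ⊛ v₅ ≐ v₆ :* v₃ by θ-horner p t)
    ∷ (:- v₃ ⊛ v₇ ≐ v₄ :+ v₂ :* v₆ by sum)
    ∷ []) refl)
    where
    P P′ Q : Series
    P  = ⟦ horner p ⟧ (t ∷ [])
    P′ = ⟦ horner (derivative p) ⟧ (t ∷ [])
    Q  = ⟦ horner (addᴾ 1 p (+ 0 ∷ derivative p)) ⟧ (t ∷ [])
    sum : Q ≋ P ⊕ conv t P′
    sum = ≋-trans (horner≋ t (addᴾ 1 p (+ 0 ∷ derivative p)))
      (≋-trans (addᴾ-ok 1 p (+ 0 ∷ derivative p) (t ∷ []))
      (⊕-cong (≋-sym (horner≋ t p)) (≋-trans
        (≋-sym (horner≋ t (+ 0 ∷ derivative p)))
        (identity (t ∷ P′ ∷ []) (# 0 :+ v₀ :* v₁) (v₀ :* v₁) refl))))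

  θ-poly : ∀ p t → θ (⟦_⟧ᴾ {1} p (t ∷ [])) ≋ conv (⟦_⟧ᴾ {1} (derivative p) (t ∷ [])) (θ t)
  θ-poly p t = ≋-trans (θ-cong (≋-sym (horner≋ t p)))
    (≋-trans (θ-horner p t) (conv-cong (horner≋ t (derivative p)) (≋-refl {θ t})))

module GoodMod (p M : ℕ) .{{_ : ℕ.NonZero p}} where
  open SeriesMod M
  open PowersMod M
  open Glue p M

  good-cong : ∀ {i f g} → f ≋ g → Good i g → Good i f
  good-cong h G m n e n≢0 = trans′ (at h m) (G m n e n≢0)

  good-⊕ : ∀ {i f g} → Good i f → Good i g → Good i (f ⊕ g)
  good-⊕ F G m n e n≢0 = +-cong′ (F m n e n≢0) (G m n e n≢0)

  -- After division by q^i this is a constant, and exponent 0 is the one that `Good` leaves out.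
  good-mono : ∀ i c → Good i (c · q ^ i)
  good-mono i c m n e n≢0 = trans′ (at (conv-cong (≋-refl {constS c}) (q^≋mono i)) m)
    (refl′ (trans (·-at c (mono i) m) (trans (cong (λ x → c * x) (mono-off {i} {m} m≢i)) (ℤP.*-zeroʳ c))))
    where
    m≢i : m ≢ i
    m≢i refl = n≢0 (ℤP.*-cancelˡ-≡ (+ p) n (+ 0) (trans
      (Z.linear-combination (+ p * n ∷ + i ∷ []) v₀ (# 0)
        ((:- # 1 Z.⊛ v₁ ≐ v₀ :+ v₁ by e) ∷ []) refl)
      (sym (ℤP.*-zeroʳ (+ p)))))

  -- On q^{-i} Z[[q]] the derivation θ becomes θ - i.
  θ[_] : ℕ → Series → Series
  θ[ i ] f = θ f ⊕ ⊖ (+ i · f)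

  θ[]-at : ∀ i f {m n} → + m ≡ + p * n + + i → θ[ i ] f m ≡ + p * (n * f m)
  θ[]-at i f {m} {n} e = trans (cong (λ x → + m * f m - x) (·-at (+ i) f m))
    (Z.linear-combination (+ m ∷ + p ∷ n ∷ + i ∷ f m ∷ [])
      (v₀ :* v₄ :- v₃ :* v₄) (v₁ :* (v₂ :* v₄))
      ((v₄ Z.⊛ v₀ ≐ v₁ :* v₂ :+ v₃ by e) ∷ []) refl)

-- Functions that are constants plus derivatives modulo p

module Supersingular (p : ℕ) .{{_ : ℕ.NonZero p}} where
  open SeriesMod p
  open PowersMod p
  open Glue p p
  open GoodMod p p

  good-θ : ∀ i f → Good i (θ[ i ] f)
  good-θ i f m n e _ = mk (n * f m)
    (trans (θ[]-at i f e) (trans (ℤP.*-comm (+ p) (n * f m)) (sym (ℤP.+-identityˡ _))))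

  -- Multiplied by q^i, both j^i and 1 are V^i times a polynomial in t, and θ - i maps V^i z k(t) to
  -- V^i (numerator i k)(t): that j^i is a constant plus a derivative becomes a polynomial identity,
  -- a linear system over 𝔽_p for the constant c and the coefficients of k.
  module Certificate (z t V u : Series) (γ ε : ℤ)
    (θ-V : θ V ≋ conv V (constS (+ 1) ⊕ ⊖ u))
    (θ-z : θ z ≋ γ · (constS (+ 1) ⊕ ⊖ t))
    (z-θt : conv z (θ t) ≋ conv t (t ⊕ ⊖ constS (+ 1)))
    (z-u : conv z u ≋ t)
    (q≋ : q ≋ conv (ε · (t ⊕ ⊖ constS (+ 1))) V)
    (ψ≋tV : ψ ≋ conv t V)
    where

    -- The three terms come from differentiating V^i (where z u = t is used), z and k(t).
    numerator : ℕ → List ℤ → Expr 1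
    numerator i k = :- (# i :* v₀ :* horner k) :+ con γ :* (# 1 :- v₀) :* horner k
      :+ v₀ :* (v₀ :- # 1) :* horner (derivative k)

    θ-antiderivative : ∀ i k → θ[ i ] (conv (V ^ i) (conv z (⟦ horner k ⟧ (t ∷ [])))) ≋
      conv (V ^ i) (⟦ numerator i k ⟧ (t ∷ []))
    θ-antiderivative i k = linear-combination
      ( K ∷ K′ ∷ z ∷ t ∷ θ t ∷ θ z ∷ θ K ∷ θ (conv (V ^ i) (conv z K)) ∷ θ (conv z K)
      ∷ θ (V ^ i) ∷ constS γ ∷ V ^ i ∷ u ∷ constS (+ i) ∷ [])
      (v₇ :- v₁₃ :* (v₁₁ :* (v₂ :* v₀)))
      (v₁₁ :* (:- (v₁₃ :* v₃ :* v₀) :+ v₁₀ :* (# 1 :- v₃) :* v₀ :+ v₃ :* (v₃ :- # 1) :* v₁))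
      ( (# 1 ⊛ v₇ ≐ v₉ :* (v₂ :* v₀) :+ v₁₁ :* v₈ by θ-* (V ^ i) (conv z K))
      ∷ (v₂ :* v₀ ⊛ v₉ ≐ v₁₃ :* (v₁₁ :* (# 1 :- v₁₂)) by θ-^-log V (constS (+ 1) ⊕ ⊖ u) θ-V i)
      ∷ (:- (v₀ :* v₁₃ :* v₁₁) ⊛ v₂ :* v₁₂ ≐ v₃ by z-u)
      ∷ (v₁₁ ⊛ v₈ ≐ v₅ :* v₀ :+ v₂ :* v₆ by θ-* z K)
      ∷ (v₁₁ :* v₂ ⊛ v₆ ≐ v₁ :* v₄ by θ-horner k t)
      ∷ (v₁₁ :* v₁ ⊛ v₂ :* v₄ ≐ v₃ :* (v₃ :- # 1) by z-θt)
      ∷ (v₁₁ :* v₀ ⊛ v₅ ≐ v₁₀ :* (# 1 :- v₃) by θ-z)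
      ∷ []) refl
      where
      K K′ : Series
      K  = ⟦ horner k ⟧ (t ∷ [])
      K′ = ⟦ horner (derivative k) ⟧ (t ∷ [])

    certificate : ∀ i (T : Expr 1) c k →
      isZero p 1 (norm (T :- (con c :* (con ε :* (v₀ :- # 1)) :^ i :+ numerator i k) :- con (+ 0))) ≡ true →
      Good i (conv (V ^ i) (⟦ T ⟧ (t ∷ [])))
    certificate i T c k check = good-cong decomposition
      (good-⊕ {i} {c · q ^ i} {θ[ i ] g} (good-mono i c) (good-θ i g))
      where
      g E : Series
      g = conv (V ^ i) (conv z (⟦ horner k ⟧ (t ∷ [])))
      E = ε · (t ⊕ ⊖ constS (+ 1))
      decomposition : conv (V ^ i) (⟦ T ⟧ (t ∷ [])) ≋ c · q ^ i ⊕ θ[ i ] g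
      decomposition = linear-combination
        ( V ^ i ∷ ⟦ T ⟧ (t ∷ []) ∷ q ^ i ∷ θ[ i ] g ∷ constS c ∷ E ^ i ∷ ⟦ numerator i k ⟧ (t ∷ []) ∷ [])
        (v₀ :* v₁) (v₄ :* v₂ :+ v₃)
        ( (v₀ ⊛ v₁ ≐ v₄ :* v₅ :+ v₆ by identity (t ∷ []) T
             (con c :* (con ε :* (v₀ :- # 1)) :^ i :+ numerator i k) check)
        ∷ (:- v₄ ⊛ v₂ ≐ v₅ :* v₀ by ≋-trans (^-cong i q≋) (^-* E V i))
        ∷ (:- # 1 ⊛ v₃ ≐ v₀ :* v₆ by θ-antiderivative i k)
        ∷ []) refl

    -- The constant `c` has to be the constant term of j^i modulo p, since θ - i annihilates q^i;
    -- `k` solves the remaining linear equations.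
    good-power : ∀ i c k →
      isZero p 1 (norm (v₀ :^ i :- (con c :* (con ε :* (v₀ :- # 1)) :^ i :+ numerator i k) :- con (+ 0))) ≡ true →
      Good i (ψ ^ i)
    good-power i c k check = good-cong
      (≋-trans (^-cong i ψ≋tV) (≋-trans (^-* t V i)
        (identity (t ^ i ∷ V ^ i ∷ []) (v₀ :* v₁) (v₁ :* v₀) refl)))
      (certificate i (v₀ :^ i) c k check)

    good-last : ∀ c k → let i = suc p; T = v₀ :^ i :- con (+ 744 * + i) :* (con ε :* (v₀ :- # 1) :* v₀ :^ p) in
      isZero p 1 (norm (T :- (con c :* (con ε :* (v₀ :- # 1)) :^ i :+ numerator i k) :- con (+ 0))) ≡ true →
      Good i (ψ ^ i ⊕ ⊖ ((+ 744 * + i) · conv q (ψ ^ p)))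
    good-last c k check = good-cong
      (linear-combination
        (ψ ∷ ψ ^ p ∷ q ∷ t ∷ V ∷ t ^ p ∷ V ^ p ∷ constS (+ 744 * + suc p) ∷ constS ε ∷ [])
        (v₀ :* v₁ :- v₇ :* (v₂ :* v₁))
        (v₄ :* v₆ :* (v₃ :* v₅ :- v₇ :* (v₈ :* (v₃ :- # 1) :* v₅)))
        ( (v₁ ⊛ v₀ ≐ v₃ :* v₄ by ψ≋tV)
        ∷ (v₃ :* v₄ :- v₇ :* v₂ ⊛ v₁ ≐ v₅ :* v₆ by ≋-trans (^-cong p ψ≋tV) (^-* t V p))
        ∷ (:- (v₇ :* v₅ :* v₆) ⊛ v₂ ≐ v₈ :* (v₃ :- # 1) :* v₄ by q≋)
        ∷ []) refl)
      (certificate (suc p)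
        (v₀ :^ suc p :- con (+ 744 * + suc p) :* (con ε :* (v₀ :- # 1) :* v₀ :^ p)) c k check)

Claim : ℕ → ℕ → Set
Claim p M = ∀ k → ((1 ≤ k × k ≤ p ∸ 1) ⊎ k ≡ suc p) → ∀ c → IsZk k (polyJ c) →
  ∀ n → n ≢ + 0 → + M ∣ coeff (polyJ c) (+ p * n)

-- The prime 7

module Seven where
  open SeriesMod 7
  open PowersMod 7
  open Supersingular 7

  x : Series
  x = e₄

  -- 504 is a multiple of 7.
  e₆≋1 : e₆ ≋ constS (+ 1)
  e₆≋1 = identity (s 5 ∷ []) (# 1 :+ con -[1+ 503 ] :* v₀) (# 1) refl

  -- As E₆ ≡ 1, its derivative vanishes modulo 7, and Ramanujan's equation for θE₆ reduces to E₂ ≡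
  -- E₄².
  e₂≋x² : e₂ ≋ x ^ 2
  e₂≋x² = linear-combination (e₂ ∷ x ∷ e₆ ∷ θ e₆ ∷ [])
    v₀ (v₁ :^ 2)
    ( (:- # 1 ⊛ # 2 :* v₃ ≐ v₀ :* v₂ :- v₁ :* v₁ by mod 7 ramanujan₆)
    ∷ (# 2 ⊛ v₃ ≐ # 0 by ≋-trans (θ-cong e₆≋1) (θ-const (+ 1)))
    ∷ (:- v₀ ⊛ v₂ ≐ # 1 by e₆≋1)
    ∷ []) refl

  θx : θ x ≋ + 2 · (constS (+ 1) ⊕ ⊖ (x ^ 3))
  θx = linear-combination (e₂ ∷ x ∷ e₆ ∷ θ x ∷ [])
    v₃ (# 2 :* (# 1 :- v₁ :^ 3))
    ( (# 5 ⊛ # 3 :* v₃ ≐ v₀ :* v₁ :- v₂ by mod 7 ramanujan₄)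
    ∷ (# 5 :* v₁ ⊛ v₀ ≐ v₁ :^ 2 by e₂≋x²)
    ∷ (:- # 5 ⊛ v₂ ≐ # 1 by e₆≋1)
    ∷ []) refl

  -- Here t is E₄³/E₆² = j/(j - 1728), because E₆ ≡ 1; the sign in q ≡ -(t - 1) W comes from 1728 ≡
  -- -1.
  open Certificate x (x ^ 3) W (x ^ 2) (+ 2) -[1+ 0 ]
    (linear-combination (W ∷ θ W ∷ e₂ ∷ x ∷ [])
      v₁ (v₀ :* (# 1 :- v₃ :^ 2))
      ((# 1 ⊛ v₁ ≐ v₀ :* (# 1 :- v₂) by mod 7 θ-W) ∷ (:- v₀ ⊛ v₂ ≐ v₃ :^ 2 by e₂≋x²) ∷ []) refl)
    θx
    (linear-combination (x ∷ θ x ∷ θ (x ^ 3) ∷ [])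
      (v₀ :* v₂) (v₀ :^ 3 :* (v₀ :^ 3 :- # 1))
      ( (v₀ ⊛ v₂ ≐ # 3 :* (v₀ :^ 2 :* v₁) by θ-power x 2)
      ∷ (# 3 :* v₀ :^ 3 ⊛ v₁ ≐ # 2 :* (# 1 :- v₀ :^ 3) by θx)
      ∷ []) refl)
    (identity (x ∷ []) (v₀ :* v₀ :^ 2) (v₀ :^ 3) refl)
    (linear-combination (x ∷ e₆ ∷ W ∷ q ∷ [])
      v₃ (con -[1+ 0 ] :* (v₀ :^ 3 :- # 1) :* v₂)
      ( (# 1 ⊛ (v₀ :^ 3 :- v₁ :^ 2) :* v₂ ≐ # 1728 :* v₃ by mod 7 discriminant)
      ∷ (v₂ :* (v₁ :+ # 1) ⊛ v₁ ≐ # 1 by e₆≋1)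
      ∷ []) refl)
    (mod 7 ψ≋)

  powers : ∀ i → 1 ≤ i → i ≤ 6 → Glue.Good 7 7 i (ψ ^ i)
  powers 1 _ _ = good-power 1 (+ 2) (+ 6 ∷ []) refl
  powers 2 _ _ = good-power 2 (+ 1) (+ 3 ∷ []) refl
  powers 3 _ _ = good-power 3 (+ 0) (+ 0 ∷ + 0 ∷ + 2 ∷ []) refl
  powers 4 _ _ = good-power 4 (+ 0) (+ 0 ∷ + 0 ∷ + 3 ∷ + 2 ∷ []) refl
  powers 5 _ _ = good-power 5 (+ 0) (+ 0 ∷ + 0 ∷ + 3 ∷ + 6 ∷ + 2 ∷ []) refl
  powers 6 _ _ = good-power 6 (+ 0) (+ 0 ∷ + 0 ∷ + 2 ∷ + 2 ∷ + 2 ∷ + 2 ∷ []) refl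
  powers (suc (suc (suc (suc (suc (suc (suc _))))))) _ (s≤s (s≤s (s≤s (s≤s (s≤s (s≤s ()))))))

  -- Modulo 7, θ(j^7) ≡ 0, so j - 744 ≡ θ(f) implies j^7 (j - 744) ≡ θ(j^7 f). The witness is
  -- therefore the one for i = 1 times t^7.
  last : Glue.Good 7 7 8 (ψ ^ 8 ⊕ ⊖ ((+ 744 * + 8) · conv q (ψ ^ 7)))
  last = good-last (+ 0) (+ 0 ∷ + 0 ∷ + 0 ∷ + 0 ∷ + 0 ∷ + 0 ∷ + 0 ∷ + 6 ∷ []) refl

  claim : Claim 7 7
  claim = Glue.conclude 7 7 powers last

-- The prime 11

module Eleven where
  open SeriesMod 11
  open PowersMod 11
  open Supersingular 11

  x y V : Series
  x = e₄
  y = e₆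
  V = conv (y ^ 2) W

  -- E₄E₆ = E₁₀, and 264 is a multiple of 11.
  xy≋1 : conv x y ≋ constS (+ 1)
  xy≋1 = ≋-trans (mod 11 e₄e₆≋e₁₀) (identity (s 9 ∷ []) (# 1 :+ con -[1+ 263 ] :* v₀) (# 1) refl)

  -- Differentiating E₄E₆ ≡ 1 by Ramanujan's equations gives a linear equation for E₂ whose
  -- coefficient 1/3 + 1/2 is invertible modulo 11.
  e₂≋ : e₂ ≋ + 5 · x ^ 3 ⊕ + 7 · y ^ 2
  e₂≋ = linear-combination (e₂ ∷ x ∷ y ∷ θ x ∷ θ y ∷ θ (conv x y) ∷ [])
    v₀ (# 5 :* v₁ :^ 3 :+ # 7 :* v₂ :^ 2)
    ( (:- # 18 :* v₂ ⊛ # 3 :* v₃ ≐ v₀ :* v₁ :- v₂ by mod 11 ramanujan₄)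
    ∷ (:- # 27 :* v₁ ⊛ # 2 :* v₄ ≐ v₀ :* v₂ :- v₁ :* v₁ by mod 11 ramanujan₆)
    ∷ (:- # 54 ⊛ v₅ ≐ v₃ :* v₂ :+ v₁ :* v₄ by θ-* x y)
    ∷ (# 54 ⊛ v₅ ≐ # 0 by ≋-trans (θ-cong xy≋1) (θ-const (+ 1)))
    ∷ (:- v₀ ⊛ v₁ :* v₂ ≐ # 1 by xy≋1)
    ∷ []) refl

  θx : θ x ≋ + 2 · y ⊕ ⊖ (+ 2 · x ^ 4)
  θx = linear-combination (e₂ ∷ x ∷ y ∷ θ x ∷ [])
    v₃ (# 2 :* v₂ :- # 2 :* v₁ :^ 4)
    ( (# 4 ⊛ # 3 :* v₃ ≐ v₀ :* v₁ :- v₂ by mod 11 ramanujan₄)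
    ∷ (# 4 :* v₁ ⊛ v₀ ≐ # 5 :* v₁ :^ 3 :+ # 7 :* v₂ :^ 2 by e₂≋)
    ∷ (# 28 :* v₂ ⊛ v₁ :* v₂ ≐ # 1 by xy≋1)
    ∷ []) refl

  θy : θ y ≋ + 2 · x ^ 2 ⊕ ⊖ (+ 2 · y ^ 3)
  θy = linear-combination (e₂ ∷ x ∷ y ∷ θ y ∷ [])
    v₃ (# 2 :* v₁ :^ 2 :- # 2 :* v₂ :^ 3)
    ( (# 6 ⊛ # 2 :* v₃ ≐ v₀ :* v₂ :- v₁ :* v₁ by mod 11 ramanujan₆)
    ∷ (# 6 :* v₂ ⊛ v₀ ≐ # 5 :* v₁ :^ 3 :+ # 7 :* v₂ :^ 2 by e₂≋)
    ∷ (# 30 :* v₁ :^ 2 ⊛ v₁ :* v₂ ≐ # 1 by xy≋1)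
    ∷ []) refl

  -- E₆ is the inverse of E₄, so t = E₄³/E₆² becomes E₄⁵, with V = E₆² W; moreover 1728 ≡ 1.
  open Certificate (x ^ 2) (x ^ 5) V (x ^ 3) (+ 4) (+ 1)
    (linear-combination (x ∷ y ∷ W ∷ θ y ∷ θ W ∷ θ (y ^ 2) ∷ θ V ∷ e₂ ∷ [])
      v₆ (v₁ :^ 2 :* v₂ :* (# 1 :- v₀ :^ 3))
      ( (# 1 ⊛ v₆ ≐ v₅ :* v₂ :+ v₁ :^ 2 :* v₄ by θ-* (y ^ 2) W)
      ∷ (v₂ ⊛ v₅ ≐ # 2 :* (v₁ :^ 1 :* v₃) by θ-power y 1)
      ∷ (# 2 :* v₁ :* v₂ ⊛ v₃ ≐ # 2 :* v₀ :^ 2 :- # 2 :* v₁ :^ 3 by θy)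
      ∷ (v₁ :^ 2 ⊛ v₄ ≐ v₂ :* (# 1 :- v₇) by mod 11 θ-W)
      ∷ (:- (v₁ :^ 2 :* v₂) ⊛ v₇ ≐ # 5 :* v₀ :^ 3 :+ # 7 :* v₁ :^ 2 by e₂≋)
      ∷ (v₂ :* (# 4 :* v₀ :- # 4 :* v₀ :* (v₀ :* v₁ :+ # 1)) ⊛ v₀ :* v₁ ≐ # 1 by xy≋1)
      ∷ []) refl)
    (linear-combination (x ∷ y ∷ θ x ∷ θ (x ^ 2) ∷ [])
      v₃ (# 4 :* (# 1 :- v₀ :^ 5))
      ( (# 1 ⊛ v₃ ≐ # 2 :* (v₀ :^ 1 :* v₂) by θ-power x 1)
      ∷ (# 2 :* v₀ ⊛ v₂ ≐ # 2 :* v₁ :- # 2 :* v₀ :^ 4 by θx)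
      ∷ (# 4 ⊛ v₀ :* v₁ ≐ # 1 by xy≋1)
      ∷ []) refl)
    (linear-combination (x ∷ y ∷ θ x ∷ θ (x ^ 5) ∷ [])
      (v₀ :^ 2 :* v₃) (v₀ :^ 5 :* (v₀ :^ 5 :- # 1))
      ( (v₀ :^ 2 ⊛ v₃ ≐ # 5 :* (v₀ :^ 4 :* v₂) by θ-power x 4)
      ∷ (# 5 :* v₀ :^ 6 ⊛ v₂ ≐ # 2 :* v₁ :- # 2 :* v₀ :^ 4 by θx)
      ∷ (# 10 :* v₀ :^ 5 ⊛ v₀ :* v₁ ≐ # 1 by xy≋1)
      ∷ []) refl)
    (identity (x ∷ []) (v₀ :^ 2 :* v₀ :^ 3) (v₀ :^ 5) refl)
    (linear-combination (x ∷ y ∷ W ∷ q ∷ [])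
      v₃ (# 1 :* (v₀ :^ 5 :- # 1) :* (v₁ :^ 2 :* v₂))
      ( (:- # 1 ⊛ (v₀ :^ 3 :- v₁ :^ 2) :* v₂ ≐ # 1728 :* v₃ by mod 11 discriminant)
      ∷ (:- (v₀ :^ 3 :* v₂ :* (v₀ :* v₁ :+ # 1)) ⊛ v₀ :* v₁ ≐ # 1 by xy≋1)
      ∷ []) refl)
    (linear-combination (x ∷ y ∷ W ∷ ψ ∷ [])
      v₃ (v₀ :^ 5 :* (v₁ :^ 2 :* v₂))
      ( (# 1 ⊛ v₃ ≐ v₀ :^ 3 :* v₂ by mod 11 ψ≋)
      ∷ (:- (v₀ :^ 3 :* v₂ :* (v₀ :* v₁ :+ # 1)) ⊛ v₀ :* v₁ ≐ # 1 by xy≋1)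
      ∷ []) refl)

  powers : ∀ i → 1 ≤ i → i ≤ 10 → Glue.Good 11 11 i (ψ ^ i)
  powers 1 _ _ = good-power 1 (+ 7) (+ 10 ∷ []) refl
  powers 2 _ _ = good-power 2 (+ 6) (+ 4 ∷ + 1 ∷ []) refl
  powers 3 _ _ = good-power 3 (+ 7) (+ 10 ∷ + 9 ∷ + 10 ∷ []) refl
  powers 4 _ _ = good-power 4 (+ 1) (+ 8 ∷ + 8 ∷ + 3 ∷ []) refl
  powers 5 _ _ = good-power 5 (+ 0) (+ 0 ∷ + 0 ∷ + 0 ∷ + 0 ∷ + 2 ∷ []) refl
  powers 6 _ _ = good-power 6 (+ 0) (+ 0 ∷ + 0 ∷ + 0 ∷ + 0 ∷ + 7 ∷ + 2 ∷ []) refl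
  powers 7 _ _ = good-power 7 (+ 0) (+ 0 ∷ + 0 ∷ + 0 ∷ + 0 ∷ + 9 ∷ + 3 ∷ + 2 ∷ []) refl
  powers 8 _ _ = good-power 8 (+ 0) (+ 0 ∷ + 0 ∷ + 0 ∷ + 0 ∷ + 9 ∷ + 5 ∷ + 10 ∷ + 2 ∷ []) refl
  powers 9 _ _ = good-power 9 (+ 0) (+ 0 ∷ + 0 ∷ + 0 ∷ + 0 ∷ + 7 ∷ + 3 ∷ + 10 ∷ + 6 ∷ + 2 ∷ []) refl
  powers 10 _ _ = good-power 10 (+ 0) (+ 0 ∷ + 0 ∷ + 0 ∷ + 0 ∷ + 2 ∷ + 2 ∷ + 2 ∷ + 2 ∷ + 2 ∷ + 2 ∷ []) refl
  powers (suc (suc (suc (suc (suc (suc (suc (suc (suc (suc (suc _))))))))))) _ (s≤s (s≤s (s≤s (s≤s (s≤s (s≤s (s≤s (s≤s (s≤s (s≤s ()))))))))))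

  -- The witness for i = 1 times t^11, as θ(j^11) ≡ 0 modulo 11.
  last : Glue.Good 11 11 12 (ψ ^ 12 ⊕ ⊖ ((+ 744 * + 12) · conv q (ψ ^ 11)))
  last = good-last (+ 0) (+ 0 ∷ + 0 ∷ + 0 ∷ + 0 ∷ + 0 ∷ + 0 ∷ + 0 ∷ + 0 ∷ + 0 ∷ + 0 ∷ + 0 ∷ + 10 ∷ []) refl

  claim : Claim 11 11
  claim = Glue.conclude 11 11 powers last

-- Complementary divisors

Σ<-single : ∀ {f} n k → k < n → (∀ j → j ≢ k → f j ≡ + 0) → Σ< n f ≡ f k
Σ<-single {f} (suc n) k k<n h with k ℕP.≟ n
... | yes refl = trans (cong (_+ f k) (Σ<-zero n λ i i<n → h i (ℕP.<⇒≢ i<n))) (ℤP.+-identityˡ (f k))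
... | no k≢n   = trans (cong (λ x → Σ< n f + x) (h n (λ e → k≢n (sym e))))
  (trans (ℤP.+-identityʳ _) (Σ<-single n k (ℕP.≤∧≢⇒< (ℕP.≤-pred k<n) k≢n) h))

δ : ℕ → ℕ → ℕ → ℤ
δ n i j = if does (suc i ℕ.* suc j ℕP.≟ n) then + 1 else + 0

δ-yes : ∀ {n i j} → suc i ℕ.* suc j ≡ n → δ n i j ≡ + 1
δ-yes {n} {i} {j} e rewrite dec-true (suc i ℕ.* suc j ℕP.≟ n) e = refl

δ-no : ∀ {n i j} → suc i ℕ.* suc j ≢ n → δ n i j ≡ + 0
δ-no {n} {i} {j} e rewrite dec-false (suc i ℕ.* suc j ℕP.≟ n) e = refl

δ-sym : ∀ n i j → δ n i j ≡ δ n j i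
δ-sym n i j = go (suc i ℕ.* suc j ℕP.≟ n)
  where
  go : Dec (suc i ℕ.* suc j ≡ n) → δ n i j ≡ δ n j i
  go (yes e) = trans (δ-yes {n} {i} {j} e)
    (sym (δ-yes {n} {j} {i} (trans (ℕP.*-comm (suc j) (suc i)) e)))
  go (no ¬e) = trans (δ-no {n} {i} {j} ¬e)
    (sym (δ-no {n} {j} {i} (λ e → ¬e (trans (ℕP.*-comm (suc i) (suc j)) e))))

ℓ-δ : ∀ i n → ℓ (suc i) (suc n) ≡ Σ< (suc n) (δ (suc n) i)
ℓ-δ i n = trans (ℤP.+-identityʳ _) (go (suc i ℕD.∣? suc n))
  where
  go : Dec (suc i ℕD.∣ suc n) → geo (suc i) (suc n) ≡ Σ< (suc n) (δ (suc n) i)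
  go (no ¬d) = trans (geo-no {suc i} ¬d) (sym (Σ<-zero (suc n) λ j _ → δ-no {suc n} {i} {j} λ e →
    ¬d (ℕD.divides (suc j) (trans (sym e) (ℕP.*-comm (suc i) (suc j))))))
  go (yes d@(ℕD.divides (suc k) e)) = trans (geo-yes {suc i} d) (sym (trans
    (Σ<-single (suc n) k (subst (suc k ℕ.≤_) (sym e) (ℕP.m≤m*n (suc k) (suc i))) λ j j≢k → δ-no {suc n} {i} {j} λ e′ →
      j≢k (ℕP.suc-injective (ℕP.*-cancelˡ-≡ (suc j) (suc k) (suc i)
        (trans e′ (trans e (ℕP.*-comm (suc k) (suc i)))))))
    (δ-yes {suc n} {i} {k} (trans (ℕP.*-comm (suc i) (suc k)) (sym e)))))

lambert-δ : ∀ w n → lambert w (suc n) ≡ Σ< (suc n) λ i → Σ< (suc n) λ j → w (+ suc i) * δ (suc n) i j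
lambert-δ w n = Σ<-cong (suc n) λ i _ → trans (cong (λ x → w (+ suc i) * x) (ℓ-δ i n))
  (sym (Σ<-* (w (+ suc i)) (δ (suc n) i) (suc n)))

module _ (M : ℕ) where
  open Congruence M

  Σ<-cong′ : ∀ {f g} n → (∀ i → f i ≡ᶻ g i) → Σ< n f ≡ᶻ Σ< n g
  Σ<-cong′ zero    h = refl′ refl
  Σ<-cong′ (suc n) h = +-cong′ (Σ<-cong′ n h) (h n)

  -- As a sum over pairs (a, b) with a b = n, a coefficient is symmetric in the two divisors, so a
  -- weight of a may be traded for a weight of b.
  lambert-dual : ∀ u v n → (∀ i j → suc i ℕ.* suc j ≡ n → u (+ suc i) ≡ᶻ v (+ suc j)) → lambert u n ≡ᶻ lambert v n
  lambert-dual u v zero    h = refl′ refl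
  lambert-dual u v (suc n) h = trans′ (refl′ (lambert-δ u n)) (trans′
    (Σ<-cong′ (suc n) λ i → Σ<-cong′ (suc n) λ j → term i j (suc i ℕ.* suc j ℕP.≟ suc n))
    (refl′ (trans (Σ<-swap _ (suc n) (suc n)) (sym (lambert-δ v n)))))
    where
    term : ∀ i j → Dec (suc i ℕ.* suc j ≡ suc n) → u (+ suc i) * δ (suc n) i j ≡ᶻ v (+ suc j) * δ (suc n) j i
    term i j (yes e) = *-cong′ (h i j e) (refl′ (δ-sym (suc n) i j))
    term i j (no ¬e) = refl′ (trans (cong (λ x → u (+ suc i) * x) (δ-no {suc n} {i} {j} ¬e))
      (trans (ℤP.*-zeroʳ (u (+ suc i))) (sym (trans (cong (λ x → v (+ suc j) * x)
        (trans (δ-sym (suc n) j i) (δ-no {suc n} {i} {j} ¬e))) (ℤP.*-zeroʳ (v (+ suc j)))))))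

fermat₅ : ∀ n → Congruence._≡ᶻ_ 5 ((+ n) ^ᶻ 5) (+ n)
fermat₅ zero    = Congruence.refl′ 5 refl
fermat₅ (suc n) with fermat₅ n
... | Congruence.mk t e = Congruence.mk (t + (+ n) ^ᶻ 4 + + 2 * (+ n) ^ᶻ 3 + + 2 * (+ n) ^ᶻ 2 + + n)
  (Z.linear-combination (+ n ∷ t ∷ []) ((# 1 :+ v₀) :^ 5)
    (# 1 :+ v₀ :+ (v₁ :+ v₀ :^ 4 :+ # 2 :* v₀ :^ 3 :+ # 2 :* v₀ :^ 2 :+ v₀) :* # 5)
    ((# 1 Z.⊛ v₀ :^ 5 ≐ v₀ :+ v₁ :* # 5 by e) ∷ []) refl)

-- For n = a b and b⁵ ≡ b: n⁴ b = a⁴ b⁵ ≡ a⁴ b = n a³ modulo 5.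
θs₃≋θ⁴s₁ : Congruence._≋_ 5 (θ (s 3)) (θ (θ (θ (θ (s 1)))))
θs₃≋θ⁴s₁ = pointwise λ n → trans′
  (refl′ (sym (lambert-* (+ n) (_^ᶻ 3) n)))
  (trans′ (lambert-dual 5 (λ a → + n * a ^ᶻ 3) (λ b → (+ n) ^ᶻ 4 * b ^ᶻ 1) n λ i j e → pair i j n e)
    (refl′ (trans (lambert-* ((+ n) ^ᶻ 4) (_^ᶻ 1) n)
      (Z.identity (+ n ∷ s 1 n ∷ []) (v₀ :^ 4 :* v₁) (v₀ :* (v₀ :* (v₀ :* (v₀ :* v₁)))) refl))))
  where
  open Congruence 5
  pair : ∀ i j n → suc i ℕ.* suc j ≡ n → + n * (+ suc i) ^ᶻ 3 ≡ᶻ (+ n) ^ᶻ 4 * (+ suc j) ^ᶻ 1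
  pair i j n e = trans′
    (refl′ (Z.linear-combination (+ suc i ∷ + suc j ∷ + n ∷ []) (v₂ :* v₀ :^ 3) (v₀ :^ 4 :* v₁)
      ((v₀ :^ 3 Z.⊛ v₂ ≐ v₀ :* v₁ by n≡) ∷ []) refl))
    (trans′ (*-cong′ (refl′ {(+ suc i) ^ᶻ 4} refl) (sym′ (fermat₅ (suc j))))
    (refl′ (sym (trans (cong (λ x → x ^ᶻ 4 * (+ suc j) ^ᶻ 1) n≡)
      (Z.identity (+ suc i ∷ + suc j ∷ []) ((v₀ :* v₁) :^ 4 :* v₁ :^ 1) (v₀ :^ 4 :* v₁ :^ 5) refl)))))
    where
    n≡ : + n ≡ + suc i * + suc j
    n≡ = trans (cong +_ (sym e)) (ℤP.pos-* (suc i) (suc j))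

-- The prime 5, modulo 25

module Five where
  open SeriesMod 25
  open PowersMod 25
  open GoodMod 5 25
  open Glue 5 25

  -- E₄ = 1 + E, and 240 = 5 · 48 makes E² and 5 E vanish modulo 25.
  X E : Series
  X = e₂
  E = + 240 · s 3

  lift : ∀ {f g} → Congruence._≋_ 5 f g → + 5 · f ≋ + 5 · g
  lift {f} {g} h = pointwise λ n → scale n (Congruence.at h n)
    where
    scale : ∀ n → Congruence._≡ᶻ_ 5 (f n) (g n) → (+ 5 · f) n ≡ᶻ (+ 5 · g) n
    scale n (Congruence.mk t e) = mk t (trans (·-at (+ 5) f n) (trans
      (Z.linear-combination (f n ∷ g n ∷ t ∷ []) (# 5 :* v₀) (# 5 :* v₁ :+ v₂ :* # 25)
        ((# 5 Z.⊛ v₀ ≐ v₁ :+ v₂ :* # 5 by e) ∷ []) refl)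
      (cong (_+ t * + 25) (sym (·-at (+ 5) g n)))))

  E² : conv E E ≋ constS (+ 0)
  E² = identity (s 3 ∷ []) (# 240 :* v₀ :* (# 240 :* v₀)) (# 0) refl

  5E : + 5 · E ≋ constS (+ 0)
  5E = identity (s 3 ∷ []) (# 5 :* (# 240 :* v₀)) (# 0) refl

  -- -2 is the inverse of 12 modulo 25.
  θX : θ X ≋ -[1+ 1 ] · (conv X X ⊕ ⊖ constS (+ 1) ⊕ ⊖ E)
  θX = linear-combination (X ∷ E ∷ θ X ∷ []) v₂ (con -[1+ 1 ] :* (v₀ :* v₀ :- # 1 :- v₁))
    ((:- # 2 ⊛ # 12 :* v₂ ≐ v₀ :* v₀ :- (# 1 :+ v₁) by mod 25 ramanujan₂) ∷ []) refl

  -- θE = 240 θs₃ depends only on θs₃ ≡ θ⁴s₁ modulo 5, a polynomial in X.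
  θE : θ E ≋ + 5 · conv X (conv (constS (+ 1) ⊕ ⊖ conv X X) (constS (+ 3) ⊕ ⊖ (+ 2 · conv X X)))
  θE = linear-combination
    (X ∷ θ E ∷ θ (s 3) ∷ θ (θ (θ (θ (s 1)))) ∷ θ (θ (θ (θ X))) ∷ [])
    v₁ (# 5 :* (v₀ :* ((# 1 :- v₀ :* v₀) :* (# 3 :- # 2 :* (v₀ :* v₀)))))
    ( (# 1 ⊛ v₁ ≐ # 240 :* v₂ by θ-scale (+ 240) (s 3))
    ∷ (# 48 ⊛ # 5 :* v₂ ≐ # 5 :* v₃ by lift θs₃≋θ⁴s₁)
    ∷ (:- # 10 ⊛ con -[1+ 23 ] :* v₃ ≐ v₄ by ≋-sym θ⁴X)
    ∷ (:- # 2 ⊛ # 5 :* v₄ ≐ # 5 :* horner P₄ by 5θ⁴X)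
    ∷ []) refl
    where
    θ⁴X : θ (θ (θ (θ X))) ≋ -[1+ 23 ] · θ (θ (θ (θ (s 1))))
    θ⁴X = ≋-trans (θ-cong (θ-cong (θ-cong (mod 25 (θ-eisenstein -[1+ 23 ] 1)))))
      (≋-trans (θ-cong (θ-cong (θ-scale -[1+ 23 ] (θ (s 1)))))
      (≋-trans (θ-cong (θ-scale -[1+ 23 ] (θ (θ (s 1))))) (θ-scale -[1+ 23 ] (θ (θ (θ (s 1)))))))
    -- Modulo 5, E vanishes and θX ≡ P₁(X) = 2 - 2X², so θ acts on polynomials in X as P ↦ P′ P₁.
    P₁ P₂ P₃ P₄ : List ℤ
    P₁ = + 2 ∷ + 0 ∷ -[1+ 1 ] ∷ []
    P₂ = mulᴾ 1 (derivative P₁) P₁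
    P₃ = mulᴾ 1 (derivative P₂) P₁
    P₄ = mulᴾ 1 (derivative P₃) P₁
    ev : List ℤ → Series
    ev P = ⟦ horner P ⟧ (X ∷ [])
    step : ∀ {f} P → + 5 · f ≋ + 5 · ev P → + 5 · θ f ≋ + 5 · ev (mulᴾ 1 (derivative P) P₁)
    step {f} P h = linear-combination
      (θ f ∷ θ (+ 5 · f) ∷ θ (+ 5 · ev P) ∷ θ (ev P) ∷ ev (derivative P) ∷ θ X ∷ X ∷ E
        ∷ ev (mulᴾ 1 (derivative P) P₁) ∷ [])
      (# 5 :* v₀) (# 5 :* v₈)
      ( (:- # 1 ⊛ v₁ ≐ # 5 :* v₀ by θ-scale (+ 5) f)
      ∷ (# 1 ⊛ v₁ ≐ v₂ by θ-cong h)
      ∷ (# 1 ⊛ v₂ ≐ # 5 :* v₃ by θ-scale (+ 5) (ev P))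
      ∷ (# 5 ⊛ v₃ ≐ v₄ :* v₅ by θ-horner P X)
      ∷ (# 5 :* v₄ ⊛ v₅ ≐ con -[1+ 1 ] :* (v₆ :* v₆ :- # 1 :- v₇) by θX)
      ∷ (# 2 :* v₄ ⊛ # 5 :* v₇ ≐ # 0 by 5E)
      ∷ (:- # 5 ⊛ v₈ ≐ v₄ :* (# 2 :- # 2 :* (v₆ :* v₆)) by product)
      ∷ []) refl
      where
      product : ev (mulᴾ 1 (derivative P) P₁) ≋ conv (ev (derivative P)) (constS (+ 2) ⊕ ⊖ (+ 2 · conv X X))
      product = ≋-trans (horner≋ X (mulᴾ 1 (derivative P) P₁)) (≋-trans (mulᴾ-ok 1 (derivative P) P₁ (X ∷ []))
        (conv-cong (≋-sym (horner≋ X (derivative P)))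
          (identity (X ∷ []) (# 2 :+ v₀ :* (# 0 :+ v₀ :* (con -[1+ 1 ] :+ v₀ :* # 0))) (# 2 :- # 2 :* (v₀ :* v₀)) refl)))
    5θX : + 5 · θ X ≋ + 5 · ev P₁
    5θX = linear-combination (θ X ∷ X ∷ E ∷ []) (# 5 :* v₀) (# 5 :* (# 2 :+ v₁ :* (# 0 :+ v₁ :* (con -[1+ 1 ] :+ v₁ :* # 0))))
      ( (# 5 ⊛ v₀ ≐ con -[1+ 1 ] :* (v₁ :* v₁ :- # 1 :- v₂) by θX)
      ∷ (# 2 ⊛ # 5 :* v₂ ≐ # 0 by 5E) ∷ []) refl
    5θ⁴X : + 5 · θ (θ (θ (θ X))) ≋ + 5 · ev P₄
    5θ⁴X = step {θ (θ (θ X))} P₃ (step {θ (θ X)} P₂ (step {θ X} P₁ 5θX))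

  infix 8 ⟪_⟫
  ⟪_⟫ : List ℤ → Series
  ⟪ f ⟫ = ⟦_⟧ᴾ {1} f (X ∷ [])

  -- (f₀ , f₁) stands for f₀(X) + E f₁(X); here E² = 5 E = 0.
  Dual : Set
  Dual = List ℤ × List ℤ

  ev : Dual → Series
  ev (f₀ , f₁) = ⟪ f₀ ⟫ ⊕ conv E ⟪ f₁ ⟫

  addᴰ mulᴰ : Dual → Dual → Dual
  addᴰ (f₀ , f₁) (g₀ , g₁) = addᴾ 1 f₀ g₀ , addᴾ 1 f₁ g₁
  mulᴰ (f₀ , f₁) (g₀ , g₁) = mulᴾ 1 f₀ g₀ , addᴾ 1 (mulᴾ 1 f₀ g₁) (mulᴾ 1 f₁ g₀)

  conᴰ : ℤ → Dual
  conᴰ c = (c ∷ []) , []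

  powᴰ : Dual → ℕ → Dual
  powᴰ F zero    = conᴰ (+ 1)
  powᴰ F (suc k) = mulᴰ F (powᴰ F k)

  -- Since 5 E = 0, the cofactor of E matters only modulo 5.
  isZeroᴰ : Dual → Bool
  isZeroᴰ (f₀ , f₁) = isZero 25 1 f₀ ∧ isZero 5 1 f₁

  -- `θXᴾ` omits the summand 2 E of θX, which enters `derivationᴰ` as the constant polynomial 2.
  θXᴾ θEᴾ : List ℤ
  θXᴾ = + 2 ∷ + 0 ∷ -[1+ 1 ] ∷ []
  θEᴾ = + 0 ∷ + 15 ∷ + 0 ∷ -[1+ 24 ] ∷ + 0 ∷ + 10 ∷ []

  combine : ℕ → List ℤ → List ℤ → List ℤ → List ℤ → List ℤ
  combine i f′ f g h = addᴾ 1 (addᴾ 1 (mulᴾ 1 θXᴾ f′) (mulᴾ 1 (+ 0 ∷ - (+ i) ∷ []) f)) (mulᴾ 1 g h)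

  derivationᴰ : ℕ → Dual → Dual
  derivationᴰ i (f₀ , f₁) =
    combine i (derivative f₀) f₀ θEᴾ f₁ , combine i (derivative f₁) f₁ (+ 2 ∷ []) (derivative f₀)

  add-ok : ∀ f g → ⟪ addᴾ 1 f g ⟫ ≋ ⟪ f ⟫ ⊕ ⟪ g ⟫
  add-ok f g = addᴾ-ok 1 f g (X ∷ [])

  mul-ok : ∀ f g → ⟪ mulᴾ 1 f g ⟫ ≋ conv ⟪ f ⟫ ⟪ g ⟫
  mul-ok f g = mulᴾ-ok 1 f g (X ∷ [])

  addᴰ-ok : ∀ F G → ev (addᴰ F G) ≋ ev F ⊕ ev G
  addᴰ-ok (f₀ , f₁) (g₀ , g₁) = linear-combination
    (⟪ f₀ ⟫ ∷ ⟪ f₁ ⟫ ∷ ⟪ g₀ ⟫ ∷ ⟪ g₁ ⟫ ∷ ⟪ addᴾ 1 f₀ g₀ ⟫ ∷ ⟪ addᴾ 1 f₁ g₁ ⟫ ∷ E ∷ [])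
    (v₄ :+ v₆ :* v₅) (v₀ :+ v₆ :* v₁ :+ (v₂ :+ v₆ :* v₃))
    ((# 1 ⊛ v₄ ≐ v₀ :+ v₂ by add-ok f₀ g₀) ∷ (v₆ ⊛ v₅ ≐ v₁ :+ v₃ by add-ok f₁ g₁) ∷ []) refl

  mulᴰ-ok : ∀ F G → ev (mulᴰ F G) ≋ conv (ev F) (ev G)
  mulᴰ-ok (f₀ , f₁) (g₀ , g₁) = linear-combination
    (⟪ f₀ ⟫ ∷ ⟪ f₁ ⟫ ∷ ⟪ g₀ ⟫ ∷ ⟪ g₁ ⟫ ∷ ⟪ mulᴾ 1 f₀ g₀ ⟫ ∷ ⟪ addᴾ 1 (mulᴾ 1 f₀ g₁) (mulᴾ 1 f₁ g₀) ⟫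
      ∷ ⟪ mulᴾ 1 f₀ g₁ ⟫ ∷ ⟪ mulᴾ 1 f₁ g₀ ⟫ ∷ E ∷ [])
    (v₄ :+ v₈ :* v₅) ((v₀ :+ v₈ :* v₁) :* (v₂ :+ v₈ :* v₃))
    ( (# 1 ⊛ v₄ ≐ v₀ :* v₂ by mul-ok f₀ g₀)
    ∷ (v₈ ⊛ v₅ ≐ v₆ :+ v₇ by add-ok (mulᴾ 1 f₀ g₁) (mulᴾ 1 f₁ g₀))
    ∷ (v₈ ⊛ v₆ ≐ v₀ :* v₃ by mul-ok f₀ g₁)
    ∷ (v₈ ⊛ v₇ ≐ v₁ :* v₂ by mul-ok f₁ g₀)
    ∷ (:- (v₁ :* v₃) ⊛ v₈ :* v₈ ≐ # 0 by E²)
    ∷ []) refl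

  conᴰ-ok : ∀ c → ev (conᴰ c) ≋ constS c
  conᴰ-ok c = identity (X ∷ E ∷ constS c ∷ []) (v₂ :+ v₀ :* # 0 :+ v₁ :* # 0) v₂ refl

  powᴰ-ok : ∀ F k → ev (powᴰ F k) ≋ ev F ^ k
  powᴰ-ok F zero    = conᴰ-ok (+ 1)
  powᴰ-ok F (suc k) = ≋-trans (mulᴰ-ok F (powᴰ F k)) (conv-cong (≋-refl {ev F}) (powᴰ-ok F k))

  isZeroᴰ-ok : ∀ F → isZeroᴰ F ≡ true → ev F ≋ constS (+ 0)
  isZeroᴰ-ok (f₀ , f₁) h with isZero 25 1 f₀ in h₀
  ... | true = linear-combination (⟪ f₀ ⟫ ∷ conv E ⟪ f₁ ⟫ ∷ []) (v₀ :+ v₁) (# 0)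
    ((# 1 ⊛ v₀ ≐ # 0 by isZero-ok 1 f₀ (X ∷ []) h₀) ∷ (# 1 ⊛ v₁ ≐ # 0 by E-multiple f₁ h) ∷ []) refl
    where
    E-constant : ∀ a → isMultiple 5 ℤ.∣ a ∣ ≡ true → conv E (constS a) ≋ constS (+ 0)
    E-constant a h = linear-combination (s 3 ∷ constS a ∷ constS (+ 240 * a) ∷ [])
      (# 240 :* v₀ :* v₁) (# 0)
      ( (:- v₀ ⊛ v₂ ≐ # 240 :* v₁ by mod 25 (SeriesMod.exact 0 λ n →
            trans (constS-* (+ 240) a n) (sym (conv-const (+ 240) (constS a) n))))
      ∷ (v₀ ⊛ v₂ ≐ # 0 by constS-multiple (+ 240 * a) (subst (25 ℕD.∣_) (sym (ℤP.abs-* (+ 240) a))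
           (ℕD.*-pres-∣ (ℕD.divides {5} {240} 48 refl) (isMultiple-ok 5 ℤ.∣ a ∣ h))))
      ∷ []) refl
    E-multiple : ∀ f → isZero 5 1 f ≡ true → conv E ⟪ f ⟫ ≋ constS (+ 0)
    E-multiple []      h = identity (E ∷ []) (v₀ :* # 0) (# 0) refl
    E-multiple (a ∷ f) h with isMultiple 5 ℤ.∣ a ∣ in ha
    ... | true = linear-combination (E ∷ constS a ∷ X ∷ ⟪ f ⟫ ∷ []) (v₀ :* (v₁ :+ v₂ :* v₃)) (# 0)
      ((# 1 ⊛ v₀ :* v₁ ≐ # 0 by E-constant a ha) ∷ (v₂ ⊛ v₀ :* v₃ ≐ # 0 by E-multiple f h) ∷ []) refl

  θ-derivation : ∀ i F → θ[ i ] (conv (W ^ i) (ev F)) ≋ conv (W ^ i) (ev (derivationᴰ i F))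
  θ-derivation i (f₀ , f₁) = linear-combination
    ( W ^ i ∷ θ (W ^ i) ∷ ⟪ f₀ ⟫ ∷ ⟪ f₁ ⟫ ∷ ⟪ derivative f₀ ⟫ ∷ ⟪ derivative f₁ ⟫ ∷ θ ⟪ f₀ ⟫ ∷ θ ⟪ f₁ ⟫
    ∷ θ X ∷ X ∷ E ∷ θ E ∷ constS (+ i) ∷ θ (conv E ⟪ f₁ ⟫) ∷ θ (ev (f₀ , f₁)) ∷ θ (conv (W ^ i) (ev (f₀ , f₁)))
    ∷ R₀ ∷ R₁ ∷ [])
    (v₁₅ :- v₁₂ :* (v₀ :* (v₂ :+ v₁₀ :* v₃))) (v₀ :* (v₁₆ :+ v₁₀ :* v₁₇))
    ( (# 1 ⊛ v₁₅ ≐ v₁ :* (v₂ :+ v₁₀ :* v₃) :+ v₀ :* v₁₄ by θ-* (W ^ i) (ev (f₀ , f₁)))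
    ∷ (v₂ :+ v₁₀ :* v₃ ⊛ v₁ ≐ v₁₂ :* (v₀ :* (# 1 :- v₉)) by θ-^-log W (constS (+ 1) ⊕ ⊖ X) (mod 25 θ-W) i)
    ∷ (v₀ ⊛ v₁₄ ≐ v₆ :+ v₁₃ by θ-⊕ ⟪ f₀ ⟫ (conv E ⟪ f₁ ⟫))
    ∷ (v₀ ⊛ v₁₃ ≐ v₁₁ :* v₃ :+ v₁₀ :* v₇ by θ-* E ⟪ f₁ ⟫)
    ∷ (v₀ ⊛ v₆ ≐ v₄ :* v₈ by θ-poly f₀ X)
    ∷ (v₀ :* v₁₀ ⊛ v₇ ≐ v₅ :* v₈ by θ-poly f₁ X)
    ∷ (v₀ :* (v₄ :+ v₁₀ :* v₅) ⊛ v₈ ≐ con -[1+ 1 ] :* (v₉ :* v₉ :- # 1 :- v₁₀) by θX)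
    ∷ (v₀ :* v₃ ⊛ v₁₁ ≐ # 5 :* (v₉ :* ((# 1 :- v₉ :* v₉) :* (# 3 :- # 2 :* (v₉ :* v₉)))) by θE)
    ∷ (# 2 :* v₀ :* v₅ ⊛ v₁₀ :* v₁₀ ≐ # 0 by E²)
    ∷ (:- v₀ ⊛ v₁₆ ≐ (# 2 :- # 2 :* (v₉ :* v₉)) :* v₄ :- v₉ :* v₁₂ :* v₂
         :+ # 5 :* (v₉ :* ((# 1 :- v₉ :* v₉) :* (# 3 :- # 2 :* (v₉ :* v₉)))) :* v₃
         by combine-ok (derivative f₀) f₀ θEᴾ f₁ _ θEᴾ-ok)
    ∷ (:- (v₀ :* v₁₀) ⊛ v₁₇ ≐ (# 2 :- # 2 :* (v₉ :* v₉)) :* v₅ :- v₉ :* v₁₂ :* v₃ :+ # 2 :* v₄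
         by combine-ok (derivative f₁) f₁ (+ 2 ∷ []) (derivative f₀) _
           (identity (X ∷ []) (# 2 :+ v₀ :* # 0) (# 2) refl))
    ∷ []) refl
    where
    R₀ R₁ : Series
    R₀ = ⟪ combine i (derivative f₀) f₀ θEᴾ f₁ ⟫
    R₁ = ⟪ combine i (derivative f₁) f₁ (+ 2 ∷ []) (derivative f₀) ⟫
    θEᴾ-ok : ⟪ θEᴾ ⟫ ≋ + 5 · conv X (conv (constS (+ 1) ⊕ ⊖ conv X X) (constS (+ 3) ⊕ ⊖ (+ 2 · conv X X)))
    θEᴾ-ok = identity (X ∷ [])
      (# 0 :+ v₀ :* (# 15 :+ v₀ :* (# 0 :+ v₀ :* (con -[1+ 24 ] :+ v₀ :* (# 0 :+ v₀ :* (# 10 :+ v₀ :* # 0))))))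
      (# 5 :* (v₀ :* ((# 1 :- v₀ :* v₀) :* (# 3 :- # 2 :* (v₀ :* v₀))))) refl
    combine-ok : ∀ f′ f g h γ → ⟪ g ⟫ ≋ γ → ⟪ combine i f′ f g h ⟫ ≋
      conv (constS (+ 2) ⊕ ⊖ (+ 2 · conv X X)) ⟪ f′ ⟫ ⊕ ⊖ conv (conv X (constS (+ i))) ⟪ f ⟫ ⊕ conv γ ⟪ h ⟫
    combine-ok f′ f g h γ g≋γ = linear-combination
      ( ⟪ combine i f′ f g h ⟫ ∷ ⟪ addᴾ 1 (mulᴾ 1 θXᴾ f′) (mulᴾ 1 (+ 0 ∷ - (+ i) ∷ []) f) ⟫ ∷ ⟪ mulᴾ 1 g h ⟫
      ∷ ⟪ mulᴾ 1 θXᴾ f′ ⟫ ∷ ⟪ mulᴾ 1 (+ 0 ∷ - (+ i) ∷ []) f ⟫ ∷ X ∷ constS (- (+ i)) ∷ constS (+ i)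
      ∷ ⟪ f′ ⟫ ∷ ⟪ f ⟫ ∷ ⟪ g ⟫ ∷ ⟪ h ⟫ ∷ γ ∷ [])
      v₀ ((# 2 :- # 2 :* (v₅ :* v₅)) :* v₈ :- v₅ :* v₇ :* v₉ :+ v₁₂ :* v₁₁)
      ( (# 1 ⊛ v₀ ≐ v₁ :+ v₂ by add-ok (addᴾ 1 (mulᴾ 1 θXᴾ f′) (mulᴾ 1 (+ 0 ∷ - (+ i) ∷ []) f)) (mulᴾ 1 g h))
      ∷ (# 1 ⊛ v₁ ≐ v₃ :+ v₄ by add-ok (mulᴾ 1 θXᴾ f′) (mulᴾ 1 (+ 0 ∷ - (+ i) ∷ []) f))
      ∷ (# 1 ⊛ v₂ ≐ v₁₀ :* v₁₁ by mul-ok g h)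
      ∷ (v₁₁ ⊛ v₁₀ ≐ v₁₂ by g≋γ)
      ∷ (# 1 ⊛ v₃ ≐ (# 2 :+ v₅ :* (# 0 :+ v₅ :* (con -[1+ 1 ] :+ v₅ :* # 0))) :* v₈ by mul-ok θXᴾ f′)
      ∷ (# 1 ⊛ v₄ ≐ (# 0 :+ v₅ :* (v₆ :+ v₅ :* # 0)) :* v₉ by mul-ok (+ 0 ∷ - (+ i) ∷ []) f)
      ∷ (v₅ :* v₉ ⊛ v₆ ≐ :- v₇ by exact λ { zero → refl ; (suc _) → refl })
      ∷ []) refl

  -- These are Δ = 17 (E₄³ - E₆²), where 17 inverts 1728 ≡ 3 and E₆ = X E₄ - 3 θE₄ by Ramanujan, and
  -- E₄³ = (1 + E)³ = 1 + 3 E.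
  discriminantᴰ jᴰ : Dual
  discriminantᴰ = (+ 17 ∷ + 0 ∷ + 13 ∷ + 0 ∷ + 0 ∷ + 0 ∷ + 20 ∷ []) , (+ 1 ∷ + 0 ∷ + 16 ∷ [])
  jᴰ = (+ 1 ∷ []) , (+ 3 ∷ [])

  q≋ : q ≋ conv (ev discriminantᴰ) W
  q≋ = linear-combination (q ∷ W ∷ X ∷ E ∷ e₆ ∷ θ e₄ ∷ θ E ∷ [])
    v₀ ((# 17 :+ v₂ :* (# 0 :+ v₂ :* (# 13 :+ v₂ :* (# 0 :+ v₂ :* (# 0 :+ v₂ :* (# 0 :+ v₂ :* (# 20 :+ v₂ :* # 0))))))
      :+ v₃ :* (# 1 :+ v₂ :* (# 0 :+ v₂ :* (# 16 :+ v₂ :* # 0)))) :* v₁)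
    ( (:- # 17 ⊛ ((# 1 :+ v₃) :^ 3 :- v₄ :^ 2) :* v₁ ≐ # 1728 :* v₀ by mod 25 discriminant)
    ∷ (:- # 17 :* v₁ :* (v₄ :+ r v₅) ⊛ # 3 :* v₅ ≐ v₂ :* (# 1 :+ v₃) :- v₄ by mod 25 ramanujan₄)
    ∷ (# 51 :* v₁ :* (r v₅ :+ r v₆) ⊛ v₅ ≐ v₆ by
        ≋-trans (θ-⊕ (constS (+ 1)) E) (linear-combination (θ (constS (+ 1)) ∷ θ E ∷ []) (v₀ :+ v₁) v₁
          ((# 1 ⊛ v₀ ≐ # 0 by θ-const (+ 1)) ∷ []) refl))
    ∷ (# 51 :* v₁ :* (r v₆ :+ r (# 5 :* v)) ⊛ v₆ ≐ # 5 :* v by θE)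
    ∷ (# 17 :* v₁ :* (# 3 :+ v₃ :- v₂ :* v₂) ⊛ v₃ :* v₃ ≐ # 0 by E²)
    ∷ (# 102 :* v₂ :* v :* v₁ ⊛ # 5 :* v₃ ≐ # 0 by 5E)
    ∷ []) refl
    where
    v : Expr 7
    v = v₂ :* ((# 1 :- v₂ :* v₂) :* (# 3 :- # 2 :* (v₂ :* v₂)))
    r : Expr 7 → Expr 7
    r y = v₂ :* (# 1 :+ v₃) :- # 3 :* y

  ψ≋jW : ψ ≋ conv (ev jᴰ) W
  ψ≋jW = linear-combination (ψ ∷ W ∷ X ∷ E ∷ [])
    v₀ ((# 1 :+ v₂ :* # 0 :+ v₃ :* (# 3 :+ v₂ :* # 0)) :* v₁)
    ((# 1 ⊛ v₀ ≐ (# 1 :+ v₃) :^ 3 :* v₁ by mod 25 ψ≋) ∷ (v₁ :* (# 3 :+ v₃) ⊛ v₃ :* v₃ ≐ # 0 by E²) ∷ []) refl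

  -- With g = W^i G(X) and h = W^i H(X) the function is c q^i plus (θ - i)((θ - i) g + E h). At an
  -- exponent belonging to 5 n, each application of θ - i gives a factor 5, and so does E. The data
  -- solve a linear system over ℤ/25 in which `c` is the constant term.
  certificate : ∀ i T c G H →
    isZeroᴰ (addᴰ T (mulᴰ (conᴰ -[1+ 0 ]) (addᴰ (mulᴰ (conᴰ c) (powᴰ discriminantᴰ i))
      (derivationᴰ i (addᴰ (derivationᴰ i (G , [])) ([] , H)))))) ≡ true →
    Good i (conv (W ^ i) (ev T))
  certificate i T c G H check = good-cong decomposition
    (good-⊕ {i} {c · q ^ i} {θ[ i ] g₁} (good-mono i c)
      (good-cong {i} {θ[ i ] g₁} {θ[ i ] (θ[ i ] g ⊕ conv E h)} (≋-refl {θ[ i ] g₁}) good-part))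
    where
    g h g₁ : Series
    g  = conv (W ^ i) (ev (G , []))
    h  = conv (W ^ i) ⟪ H ⟫
    g₁ = θ[ i ] g ⊕ conv E h
    F₁ F₂ F₃ : Dual
    F₁ = derivationᴰ i (G , [])
    F₂ = addᴰ F₁ ([] , H)
    F₃ = mulᴰ (conᴰ c) (powᴰ discriminantᴰ i)
    good-part : Good i (θ[ i ] (θ[ i ] g ⊕ conv E h))
    good-part m n e _ = mk (n * (n * g m + + 48 * conv (s 3) h m)) (begin
      θ[ i ] g₁ m
        ≡⟨ θ[]-at i g₁ {m} {n} e ⟩
      + 5 * (n * (θ[ i ] g m + conv E h m))
        ≡⟨ cong₂ (λ x y → + 5 * (n * (x + y))) (θ[]-at i g {m} {n} e)
             (trans (conv-assoc (constS (+ 240)) (s 3) h m) (·-at (+ 240) (conv (s 3) h) m)) ⟩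
      + 5 * (n * (+ 5 * (n * g m) + + 240 * conv (s 3) h m))
        ≡⟨ Z.identity (n ∷ g m ∷ conv (s 3) h m ∷ [])
             (# 5 :* (v₀ :* (# 5 :* (v₀ :* v₁) :+ # 240 :* v₂))) (# 0 :+ v₀ :* (v₀ :* v₁ :+ # 48 :* v₂) :* # 25) refl ⟩
      + 0 + n * (n * g m + + 48 * conv (s 3) h m) * + 25 ∎)
    g₁≋ : g₁ ≋ conv (W ^ i) (ev F₂)
    g₁≋ = linear-combination (θ[ i ] g ∷ E ∷ W ^ i ∷ ⟪ H ⟫ ∷ ev F₁ ∷ ev F₂ ∷ ev ([] , H) ∷ [])
      (v₀ :+ v₁ :* (v₂ :* v₃)) (v₂ :* v₅)
      ( (# 1 ⊛ v₀ ≐ v₂ :* v₄ by θ-derivation i (G , []))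
      ∷ (:- v₂ ⊛ v₅ ≐ v₄ :+ v₆ by addᴰ-ok F₁ ([] , H))
      ∷ (:- v₂ ⊛ v₆ ≐ # 0 :+ v₁ :* v₃ by ≋-refl {ev ([] , H)})
      ∷ []) refl
    θ[]-cong : ∀ {a b} → a ≋ b → θ[ i ] a ≋ θ[ i ] b
    θ[]-cong p = ⊕-cong (θ-cong p) (⊖-cong (conv-cong (≋-refl {constS (+ i)}) p))
    decomposition : conv (W ^ i) (ev T) ≋ c · q ^ i ⊕ θ[ i ] g₁
    decomposition = linear-combination
      ( W ^ i ∷ ev T ∷ q ^ i ∷ θ[ i ] g₁ ∷ constS c ∷ ev (derivationᴰ i F₂) ∷ ev discriminantᴰ ^ i
      ∷ ev F₃ ∷ ev (conᴰ c) ∷ ev (powᴰ discriminantᴰ i) ∷ ev (addᴰ F₃ (derivationᴰ i F₂))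
      ∷ ev (mulᴰ (conᴰ -[1+ 0 ]) (addᴰ F₃ (derivationᴰ i F₂))) ∷ ev (conᴰ -[1+ 0 ])
      ∷ ev (addᴰ T (mulᴰ (conᴰ -[1+ 0 ]) (addᴰ F₃ (derivationᴰ i F₂)))) ∷ [])
      (v₀ :* v₁) (v₄ :* v₂ :+ v₃)
      ( (v₀ ⊛ v₁₃ ≐ # 0 by isZeroᴰ-ok (addᴰ T (mulᴰ (conᴰ -[1+ 0 ]) (addᴰ F₃ (derivationᴰ i F₂)))) check)
      ∷ (:- v₀ ⊛ v₁₃ ≐ v₁ :+ v₁₁ by addᴰ-ok T (mulᴰ (conᴰ -[1+ 0 ]) (addᴰ F₃ (derivationᴰ i F₂))))
      ∷ (:- v₀ ⊛ v₁₁ ≐ v₁₂ :* v₁₀ by mulᴰ-ok (conᴰ -[1+ 0 ]) (addᴰ F₃ (derivationᴰ i F₂)))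
      ∷ (:- (v₀ :* v₁₀) ⊛ v₁₂ ≐ con -[1+ 0 ] by conᴰ-ok -[1+ 0 ])
      ∷ (v₀ ⊛ v₁₀ ≐ v₇ :+ v₅ by addᴰ-ok F₃ (derivationᴰ i F₂))
      ∷ (v₀ ⊛ v₇ ≐ v₈ :* v₉ by mulᴰ-ok (conᴰ c) (powᴰ discriminantᴰ i))
      ∷ (v₀ :* v₉ ⊛ v₈ ≐ v₄ by conᴰ-ok c)
      ∷ (v₀ :* v₄ ⊛ v₉ ≐ v₆ by powᴰ-ok discriminantᴰ i)
      ∷ (:- v₄ ⊛ v₂ ≐ v₆ :* v₀ by ≋-trans (^-cong i q≋) (^-* (ev discriminantᴰ) W i))
      ∷ (:- # 1 ⊛ v₃ ≐ v₀ :* v₅ by ≋-trans (θ[]-cong g₁≋) (θ-derivation i F₂))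
      ∷ []) refl

  good-power : ∀ i c G H →
    isZeroᴰ (addᴰ (powᴰ jᴰ i) (mulᴰ (conᴰ -[1+ 0 ]) (addᴰ (mulᴰ (conᴰ c) (powᴰ discriminantᴰ i))
      (derivationᴰ i (addᴰ (derivationᴰ i (G , [])) ([] , H)))))) ≡ true →
    Good i (ψ ^ i)
  good-power i c G H check = good-cong
    (linear-combination (ψ ^ i ∷ ev jᴰ ^ i ∷ W ^ i ∷ ev (powᴰ jᴰ i) ∷ []) v₀ (v₂ :* v₃)
      ( (# 1 ⊛ v₀ ≐ v₁ :* v₂ by ≋-trans (^-cong i ψ≋jW) (^-* (ev jᴰ) W i))
      ∷ (:- v₂ ⊛ v₃ ≐ v₁ by powᴰ-ok jᴰ i)
      ∷ []) refl)
    (certificate i (powᴰ jᴰ i) c G H check)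

  powers : ∀ i → 1 ≤ i → i ≤ 4 → Good i (ψ ^ i)
  powers 1 _ _ = good-power 1 (+ 19) (+ 11 ∷ + 0 ∷ + 0 ∷ + 0 ∷ + 0 ∷ + 0 ∷ + 15 ∷ []) (+ 0 ∷ + 3 ∷ []) refl
  powers 2 _ _ = good-power 2 (+ 4) (+ 16 ∷ + 0 ∷ + 23 ∷ + 0 ∷ + 0 ∷ + 0 ∷ + 10 ∷ + 0 ∷ + 20 ∷ []) (+ 0 ∷ + 3 ∷ + 0 ∷ + 3 ∷ []) refl
  powers 3 _ _ = good-power 3 (+ 15) (+ 9 ∷ + 0 ∷ + 20 ∷ + 0 ∷ + 10 ∷ []) (+ 0 ∷ + 4 ∷ []) refl
  powers 4 _ _ = good-power 4 (+ 5) (+ 22 ∷ + 0 ∷ + 9 ∷ + 0 ∷ + 15 ∷ + 0 ∷ + 15 ∷ []) (+ 0 ∷ + 2 ∷ []) refl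
  powers (suc (suc (suc (suc (suc _))))) _ (s≤s (s≤s (s≤s (s≤s ()))))

  last : Good 6 (ψ ^ 6 ⊕ ⊖ ((+ 744 * + 6) · conv q (ψ ^ 5)))
  last = good-cong
    (linear-combination
      ( ψ ^ 6 ∷ ψ ^ 5 ∷ q ∷ W ∷ W ^ 5 ∷ ev jᴰ ^ 6 ∷ ev jᴰ ^ 5 ∷ ev discriminantᴰ ∷ ev T
      ∷ ev (powᴰ jᴰ 6) ∷ ev (powᴰ jᴰ 5) ∷ ev C ∷ ev (mulᴰ discriminantᴰ (powᴰ jᴰ 5))
      ∷ ev (mulᴰ C (mulᴰ discriminantᴰ (powᴰ jᴰ 5))) ∷ [])
      (v₀ :- # 4464 :* (v₂ :* v₁)) (v₃ :* v₄ :* v₈)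
      ( (# 1 ⊛ v₀ ≐ v₅ :* (v₃ :* v₄) by ≋-trans (^-cong 6 ψ≋jW) (^-* (ev jᴰ) W 6))
      ∷ (:- # 4464 :* v₂ ⊛ v₁ ≐ v₆ :* v₄ by ≋-trans (^-cong 5 ψ≋jW) (^-* (ev jᴰ) W 5))
      ∷ (:- # 4464 :* v₆ :* v₄ ⊛ v₂ ≐ v₇ :* v₃ by q≋)
      ∷ (:- (v₃ :* v₄) ⊛ v₈ ≐ v₉ :+ v₁₃ by addᴰ-ok (powᴰ jᴰ 6) (mulᴰ C (mulᴰ discriminantᴰ (powᴰ jᴰ 5))))
      ∷ (:- (v₃ :* v₄) ⊛ v₉ ≐ v₅ by powᴰ-ok jᴰ 6)
      ∷ (:- (v₃ :* v₄) ⊛ v₁₃ ≐ v₁₁ :* v₁₂ by mulᴰ-ok C (mulᴰ discriminantᴰ (powᴰ jᴰ 5)))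
      ∷ (:- (v₃ :* v₄ :* v₁₂) ⊛ v₁₁ ≐ con -[1+ 4463 ] by conᴰ-ok -[1+ 4463 ])
      ∷ (# 4464 :* v₃ :* v₄ ⊛ v₁₂ ≐ v₇ :* v₁₀ by mulᴰ-ok discriminantᴰ (powᴰ jᴰ 5))
      ∷ (# 4464 :* v₃ :* v₄ :* v₇ ⊛ v₁₀ ≐ v₆ by powᴰ-ok jᴰ 5)
      ∷ []) refl)
    (certificate 6 T (+ 0) (+ 1 ∷ + 0 ∷ + 0 ∷ + 0 ∷ + 0 ∷ + 0 ∷ + 15 ∷ []) (+ 0 ∷ + 3 ∷ []) refl)
    where
    C T : Dual
    C = conᴰ -[1+ 4463 ]
    T = addᴰ (powᴰ jᴰ 6) (mulᴰ C (mulᴰ discriminantᴰ (powᴰ jᴰ 5)))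

  claim : Claim 5 25
  claim = conclude powers last

-- Homogeneous polynomials in two series and the grading by exponents modulo p

-- Homogeneous polynomials Σ_l c_l α^(D-l) γ^l, given by the list of the c_l.
hom : Series → Series → ℕ → List ℤ → Series
hom α γ D []       = constS (+ 0)
hom α γ D (c ∷ cs) = c · power (constS (+ 1)) conv α D ⊕ conv γ (hom α γ (D ∸ 1) cs)

module Units (M : ℕ) where
  open SeriesMod M

  -- Strong induction on the exponent: the coefficient of κ x at n is x(n) plus terms with smaller
  -- indices of x.
  unit-cancel : ∀ κ x → κ 0 ≡ + 1 → conv κ x ≋ constS (+ 0) → x ≋ constS (+ 0)
  unit-cancel κ x κ0 h = pointwise (<-rec (λ n → x n ≡ᶻ constS (+ 0) n) step)
    where
    step : ∀ n → (∀ {k} → k < n → x k ≡ᶻ constS (+ 0) k) → x n ≡ᶻ constS (+ 0) n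
    step zero    rec = trans′ (refl′ (trans (sym (ℤP.*-identityˡ (x 0))) (cong (_* x 0) (sym κ0)))) (at h 0)
    step (suc n) rec = trans′
      (refl′ (trans (trans (sym (ℤP.*-identityˡ (x (suc n)))) (cong (_* x (suc n)) (sym κ0))) (sym (ℤP.+-identityʳ _))))
      (trans′ (+-cong′ (refl′ {κ 0 * x (suc n)} refl) (sym′ rest))
      (trans′ (refl′ (sym (conv-suc κ x n))) (at h (suc n))))
      where
      rest : conv (tail κ) x n ≡ᶻ + 0
      rest = trans′ (sumTo-cong′ {g = λ _ → + 0} n λ i i≤n →
          trans′ (*-cong′ (refl′ {tail κ i} refl) (trans′ (rec (s≤s (ℕP.m∸n≤m n i))) (refl′ (constS-zero (n ∸ i)))))
            (refl′ (ℤP.*-zeroʳ (tail κ i))))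
        (refl′ (sumTo-zero n λ _ _ → refl))

  q-cancel : ∀ i x y → conv (q ^ i) x ≋ conv (q ^ i) y → x ≋ y
  q-cancel i x y h = pointwise λ n → trans′ (refl′ (sym (lemma x n)))
    (trans′ (at h (i ℕ.+ n)) (refl′ (lemma y n)))
    where
    lemma : ∀ x n → conv (q ^ i) x (i ℕ.+ n) ≡ x n
    lemma x n = trans (conv-congᵇ {g = x} (i ℕ.+ n) (λ k _ → exact⁻¹ (PowersMod.q^≋mono 0 i) k) (λ _ _ → refl))
      (trans (mono-conv i x (i ℕ.+ n)) (shift-at i x n))

  tail-q : ∀ f → f 0 ≡ + 0 → f ≋ conv q (tail f)
  tail-q f f0 = exact λ
    { zero    → trans f0 (sym (mono-conv 1 (tail f) 0))
    ; (suc n) → sym (mono-conv 1 (tail f) (suc n)) }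

module _ {f g h : Series} where
  open SeriesMod 0

  -- Such an f is q times a series with constant term 1, and both factors cancel.
  leading-cancel : f 0 ≡ + 0 → f 1 ≡ + 1 → conv f g ≋ conv f h → g ≋ h
  leading-cancel f0 f1 e = x-y≈0⇒x≈y (Units.unit-cancel 0 (tail f) (g ⊕ ⊖ h) f1
    (Units.q-cancel 0 1 (conv (tail f) (g ⊕ ⊖ h)) (constS (+ 0)) (linear-combination
      (q ∷ tail f ∷ g ∷ h ∷ f ∷ [])
      (v₀ :^ 1 :* (v₁ :* (v₂ :- v₃))) (v₀ :^ 1 :* # 0)
      ( (v₃ :- v₂ ⊛ v₄ ≐ v₀ :* v₁ by Units.tail-q 0 f f0)
      ∷ (# 1 ⊛ v₄ :* v₂ ≐ v₄ :* v₃ by e)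
      ∷ []) refl)))

powᴾ : List ℤ → ℕ → List ℤ
powᴾ f zero    = + 1 ∷ []
powᴾ f (suc k) = mulᴾ 1 f (powᴾ f k)

length-add : ∀ n f g → length f ≤ n → length g ≤ n → length (addᴾ 1 f g) ≤ n
length-add n       []      g       hf hg = hg
length-add n       (_ ∷ _) []      hf hg = hf
length-add (suc n) (_ ∷ f) (_ ∷ g) (s≤s hf) (s≤s hg) = s≤s (length-add n f g hf hg)

length-scale : ∀ a f → length (scaleᴾ 0 a f) ≡ length f
length-scale a []      = refl
length-scale a (_ ∷ f) = cong suc (length-scale a f)

length-mul : ∀ D E f g → length f ≤ suc D → length g ≤ suc E → length (mulᴾ 1 f g) ≤ suc (D ℕ.+ E)
length-mul D E []      g hf hg = z≤n
length-mul D E (a ∷ f) g hf hg = length-add (suc (D ℕ.+ E)) (scaleᴾ 0 a g) (+ 0 ∷ mulᴾ 1 f g)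
  (ℕP.≤-trans (ℕP.≤-reflexive (length-scale a g)) (ℕP.≤-trans hg (s≤s (ℕP.m≤n+m E D))))
  (shifted D f hf)
  where
  shifted : ∀ D f → suc (length f) ≤ suc D → suc (length (mulᴾ 1 f g)) ≤ suc (D ℕ.+ E)
  shifted zero    []      _ = s≤s z≤n
  shifted zero    (_ ∷ _) (s≤s ())
  shifted (suc D) f       (s≤s h) = s≤s (length-mul D E f g h hg)

length-pow : ∀ D f → length f ≤ suc D → ∀ k → length (powᴾ f k) ≤ suc (k ℕ.* D)
length-pow D f h zero    = s≤s z≤n
length-pow D f h (suc k) = length-mul D (k ℕ.* D) f (powᴾ f k) h (length-pow D f h k)

module Residues (p : ℕ) .{{_ : ℕ.NonZero p}} (M : ℕ) where
  open SeriesMod M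
  open Units M

  -- Series are graded by their exponents modulo p: `Supp r` is the piece of degree r, and `Off r`
  -- says that the component of degree r is zero.
  Supp Off : ℕ → Series → Set
  Supp r f = ∀ n → n ℕ.% p ≢ r ℕ.% p → f n ≡ᶻ + 0
  Off  r f = ∀ n → n ℕ.% p ≡ r ℕ.% p → f n ≡ᶻ + 0

  supp⇒off : ∀ {r s f} → s ℕ.% p ≢ r ℕ.% p → Supp s f → Off r f
  supp⇒off s≢r F n e = F n λ e′ → s≢r (trans (sym e′) e)

  supp-⊕ : ∀ {r f g} → Supp r f → Supp r g → Supp r (f ⊕ g)
  supp-⊕ F G n h = +-cong′ (F n h) (G n h)

  off-⊕ : ∀ {r f g} → Off r f → Off r g → Off r (f ⊕ g)
  off-⊕ F G n h = +-cong′ (F n h) (G n h)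

  supp-⊖ : ∀ {r f} → Supp r f → Supp r (⊖ f)
  supp-⊖ F n h = neg-cong′ (F n h)

  off-cong : ∀ {r f g} → f ≋ g → Off r g → Off r f
  off-cong e F n h = trans′ (at e n) (F n h)

  supp-θ : ∀ {r f} → Supp r f → Supp r (θ f)
  supp-θ F n h = trans′ (*-cong′ (refl′ {+ n} refl) (F n h)) (refl′ (ℤP.*-zeroʳ (+ n)))

  supp-const : ∀ c → Supp 0 (constS c)
  supp-const c zero    h = ⊥-elim (h refl)
  supp-const c (suc n) h = refl′ refl

  supp-* : ∀ {r s f g} → Supp r f → Supp s g → Supp (r ℕ.+ s) (conv f g)
  supp-* {r} {s} {f} {g} F G n n≢ = trans′ (sumTo-cong′ {g = λ _ → + 0} n term) (refl′ (sumTo-zero n λ _ _ → refl))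
    where
    term : ∀ i → i ≤ n → f i * g (n ∸ i) ≡ᶻ + 0
    term i i≤n with i ℕ.% p ℕP.≟ r ℕ.% p | (n ∸ i) ℕ.% p ℕP.≟ s ℕ.% p
    ... | no ¬e | _     = *-cong′ (F i ¬e) (refl′ {g (n ∸ i)} refl)
    ... | _     | no ¬e = trans′ (*-cong′ (refl′ {f i} refl) (G (n ∸ i) ¬e)) (refl′ (ℤP.*-zeroʳ (f i)))
    ... | yes e | yes e′ = ⊥-elim (n≢ (begin
      n ℕ.% p                                   ≡⟨ cong (ℕ._% p) (ℕP.m+[n∸m]≡n i≤n) ⟨
      (i ℕ.+ (n ∸ i)) ℕ.% p                     ≡⟨ ℕM.%-distribˡ-+ i (n ∸ i) p ⟩
      (i ℕ.% p ℕ.+ (n ∸ i) ℕ.% p) ℕ.% p         ≡⟨ cong₂ (λ x y → (x ℕ.+ y) ℕ.% p) e e′ ⟩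
      (r ℕ.% p ℕ.+ s ℕ.% p) ℕ.% p               ≡⟨ ℕM.%-distribˡ-+ r s p ⟨
      (r ℕ.+ s) ℕ.% p                           ∎))

  supp-^ : ∀ {r f} → Supp r f → ∀ k → Supp (k ℕ.* r) (f ^ k)
  supp-^ F zero    = supp-const (+ 1)
  supp-^ {r} F (suc k) = supp-* {r} {k ℕ.* r} F (supp-^ {r} F k)

  common : ∀ {P : Set} → ℕ → Dec P → Maybe ℕ
  common r (yes _) = just r
  common r (no _)  = nothing

  -- Computes the degree of an expression from those of its variables, so that supports are verified
  -- by `refl`; `nothing` means that some sum mixes degrees.
  weight : ∀ {n} → Vec ℕ n → Expr n → Maybe ℕ
  weight ws (con c)  = just 0
  weight ws (var i)  = just (lookup ws i)
  weight ws (:- a)   = weight ws a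
  weight ws (a :^ k) = Maybe.map (k ℕ.*_) (weight ws a)
  weight ws (a :* b) = Maybe.zipWith ℕ._+_ (weight ws a) (weight ws b)
  weight ws (a :+ b) with weight ws a | weight ws b
  ... | just r | just s = common r (r ℕ.% p ℕP.≟ s ℕ.% p)
  ... | _      | _      = nothing

  supp-≡ : ∀ {r s f} → r ℕ.% p ≡ s ℕ.% p → Supp r f → Supp s f
  supp-≡ e F n h = F n λ e′ → h (trans e′ e)

  supp-weight : ∀ {n} (ws : Vec ℕ n) ρ → (∀ i → Supp (lookup ws i) (lookup ρ i)) →
    ∀ e {r} → weight ws e ≡ just r → Supp r (⟦ e ⟧ ρ)
  supp-weight ws ρ S (con c)  refl = supp-const c
  supp-weight ws ρ S (var i)  refl = S i
  supp-weight ws ρ S (:- a)   h = supp-⊖ {_} {⟦ a ⟧ ρ} (supp-weight ws ρ S a h)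
  supp-weight ws ρ S (a :^ k) h with weight ws a in eq
  supp-weight ws ρ S (a :^ k) refl | just r = supp-^ {r} (supp-weight ws ρ S a eq) k
  supp-weight ws ρ S (a :* b) h with weight ws a in eqa | weight ws b in eqb
  supp-weight ws ρ S (a :* b) refl | just r | just s =
    supp-* {r} {s} (supp-weight ws ρ S a eqa) (supp-weight ws ρ S b eqb)
  supp-weight ws ρ S (a :+ b) h with weight ws a in eqa | weight ws b in eqb
  supp-weight ws ρ S (a :+ b) h | just r | just s with r ℕ.% p ℕP.≟ s ℕ.% p
  supp-weight ws ρ S (a :+ b) refl | just r | just s | yes e =
    supp-⊕ {r} {⟦ a ⟧ ρ} {⟦ b ⟧ ρ} (supp-weight ws ρ S a eqa) (supp-≡ {s} {r} (sym e) (supp-weight ws ρ S b eqb))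

  isolate : ∀ {r f g} → Supp r f → Off r g → f ⊕ g ≋ constS (+ 0) → f ≋ constS (+ 0)
  isolate {r} {f} {g} F G h = pointwise λ n → component n (n ℕ.% p ℕP.≟ r ℕ.% p)
    where
    component : ∀ n → Dec (n ℕ.% p ≡ r ℕ.% p) → f n ≡ᶻ constS (+ 0) n
    component n (no ¬e) = trans′ (F n ¬e) (refl′ (sym (constS-zero n)))
    component n (yes e) = trans′ (trans′ (refl′ (sym (ℤP.+-identityʳ (f n))))
      (+-cong′ (refl′ {f n} refl) (sym′ (G n e)))) (at h n)

  part : ℕ → Series → Series
  part r f n = if does (n ℕ.% p ℕP.≟ r ℕ.% p) then f n else + 0

  part-yes : ∀ r f {n} → n ℕ.% p ≡ r ℕ.% p → part r f n ≡ f n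
  part-yes r f {n} e rewrite dec-true (n ℕ.% p ℕP.≟ r ℕ.% p) e = refl

  part-no : ∀ r f {n} → n ℕ.% p ≢ r ℕ.% p → part r f n ≡ + 0
  part-no r f {n} e rewrite dec-false (n ℕ.% p ℕP.≟ r ℕ.% p) e = refl

  supp-part : ∀ r f → Supp r (part r f)
  supp-part r f n h = refl′ (part-no r f {n} h)

  -- Multiplication by a κ of degree 0 respects the grading, so the induction for units stays inside
  -- the class of i.
  off-unit : ∀ {i κ g} → Supp 0 κ → κ 0 ≡ + 1 → Off i (conv κ g) → Off i g
  off-unit {i} {κ} {g} S κ0 h = <-rec (λ n → n ℕ.% p ≡ i ℕ.% p → g n ≡ᶻ + 0) step
    where
    step : ∀ n → (∀ {k} → k < n → k ℕ.% p ≡ i ℕ.% p → g k ≡ᶻ + 0) → n ℕ.% p ≡ i ℕ.% p → g n ≡ᶻ + 0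
    step zero    rec e = trans′ (refl′ (trans (sym (ℤP.*-identityˡ (g 0))) (cong (_* g 0) (sym κ0)))) (h 0 e)
    step (suc n) rec e = trans′
      (refl′ (trans (trans (sym (ℤP.*-identityˡ (g (suc n)))) (cong (_* g (suc n)) (sym κ0))) (sym (ℤP.+-identityʳ _))))
      (trans′ (+-cong′ (refl′ {κ 0 * g (suc n)} refl) (sym′ rest))
      (trans′ (refl′ (sym (conv-suc κ g n))) (h (suc n) e)))
      where
      term : ∀ j → j ≤ n → tail κ j * g (n ∸ j) ≡ᶻ + 0
      term j j≤n with suc j ℕ.% p ℕP.≟ 0 ℕ.% p
      ... | no ¬z = *-cong′ (S (suc j) ¬z) (refl′ {g (n ∸ j)} refl)
      ... | yes z = trans′ (*-cong′ (refl′ {tail κ j} refl) (rec (s≤s (ℕP.m∸n≤m n j)) (begin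
          (n ∸ j) ℕ.% p                                 ≡⟨ ℕM.m%n%n≡m%n (n ∸ j) p ⟨
          (n ∸ j) ℕ.% p ℕ.% p                           ≡⟨ cong (λ x → (x ℕ.+ (n ∸ j) ℕ.% p) ℕ.% p) (trans z (ℕD.n∣m⇒m%n≡0 0 p (p ℕD.∣0))) ⟨
          (suc j ℕ.% p ℕ.+ (n ∸ j) ℕ.% p) ℕ.% p         ≡⟨ ℕM.%-distribˡ-+ (suc j) (n ∸ j) p ⟨
          (suc j ℕ.+ (n ∸ j)) ℕ.% p                     ≡⟨ cong (λ x → suc x ℕ.% p) (ℕP.m+[n∸m]≡n j≤n) ⟩
          suc n ℕ.% p                                   ≡⟨ e ⟩
          i ℕ.% p                                       ∎))) (refl′ (ℤP.*-zeroʳ (tail κ j)))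
      rest : conv (tail κ) g n ≡ᶻ + 0
      rest = trans′ (sumTo-cong′ {g = λ _ → + 0} n term) (refl′ (sumTo-zero n λ _ _ → refl))

  residue : ∀ m n i → + m ≡ + p * n + + i → m ℕ.% p ≡ i ℕ.% p
  residue m (+ k) i e = trans (cong (ℕ._% p) m≡) (ℕM.[m+kn]%n≡m%n i k p)
    where
    m≡ : m ≡ i ℕ.+ k ℕ.* p
    m≡ = ℤP.+-injective (trans e (trans (ℤP.+-comm (+ p * + k) (+ i))
      (cong (λ x → + i + x) (trans (sym (ℤP.pos-* p k)) (cong +_ (ℕP.*-comm p k))))))
  residue m -[1+ k ] i e = sym (trans (cong (ℕ._% p) i≡) (ℕM.[m+kn]%n≡m%n m (suc k) p))
    where
    i≡ : i ≡ m ℕ.+ suc k ℕ.* p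
    i≡ = ℤP.+-injective (trans
      (Z.linear-combination (+ i ∷ + m ∷ + p ∷ + suc k ∷ []) v₀ (v₁ :+ v₃ :* v₂)
        ((:- # 1 Z.⊛ v₁ ≐ v₂ :* (:- v₃) :+ v₀ by e) ∷ []) refl)
      (cong (λ x → + m + x) (sym (ℤP.pos-* (suc k) p))))

  module Homogeneous (α γ : Series) where

    hom-add : ∀ D f g → hom α γ D (addᴾ 1 f g) ≋ hom α γ D f ⊕ hom α γ D g
    hom-add D []      g       = identity (hom α γ D g ∷ []) v₀ (# 0 :+ v₀) refl
    hom-add D (a ∷ f) []      = identity (hom α γ D (a ∷ f) ∷ []) v₀ (v₀ :+ # 0) refl
    hom-add D (a ∷ f) (b ∷ g) = linear-combination
      ( constS (a + b) ∷ constS a ∷ constS b ∷ α ^ D ∷ γ ∷ hom α γ (D ∸ 1) (addᴾ 1 f g) ∷ hom α γ (D ∸ 1) f ∷ hom α γ (D ∸ 1) g ∷ [])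
      (v₀ :* v₃ :+ v₄ :* v₅) ((v₁ :* v₃ :+ v₄ :* v₆) :+ (v₂ :* v₃ :+ v₄ :* v₇))
      ( (v₃ ⊛ v₀ ≐ v₁ :+ v₂ by exact λ { zero → refl ; (suc n) → refl })
      ∷ (v₄ ⊛ v₅ ≐ v₆ :+ v₇ by hom-add (D ∸ 1) f g)
      ∷ []) refl

    ^-+ : ∀ D E → α ^ (D ℕ.+ E) ≋ conv (α ^ D) (α ^ E)
    ^-+ zero    E = identity (α ^ E ∷ []) v₀ (# 1 :* v₀) refl
    ^-+ (suc D) E = linear-combination (α ∷ α ^ D ∷ α ^ E ∷ α ^ (D ℕ.+ E) ∷ [])
      (v₀ :* v₃) (v₀ :* v₁ :* v₂) ((v₀ ⊛ v₃ ≐ v₁ :* v₂ by ^-+ D E) ∷ []) refl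

    constS-product : ∀ a b → constS (a * b) ≋ conv (constS a) (constS b)
    constS-product a b = exact λ n → trans (constS-* a b n) (sym (conv-const a (constS b) n))

    hom-scale : ∀ D E a g → length g ≤ suc E → hom α γ (D ℕ.+ E) (scaleᴾ 0 a g) ≋ conv (a · α ^ D) (hom α γ E g)
    hom-scale D E a []      h = identity (constS a ∷ α ^ D ∷ []) (# 0) (v₀ :* v₁ :* # 0) refl
    hom-scale D zero a (b ∷ []) h = linear-combination
      (constS (a * b) ∷ constS a ∷ constS b ∷ α ^ (D ℕ.+ 0) ∷ α ^ D ∷ γ ∷ [])
      (v₀ :* v₃ :+ v₅ :* # 0) (v₁ :* v₄ :* (v₂ :* # 1 :+ v₅ :* # 0))
      ( (v₃ ⊛ v₀ ≐ v₁ :* v₂ by constS-product a b)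
      ∷ (v₁ :* v₂ ⊛ v₃ ≐ v₄ :* # 1 by ^-+ D 0)
      ∷ []) refl
    hom-scale D zero a (b ∷ _ ∷ _) (s≤s ())
    hom-scale D (suc E) a (b ∷ g) (s≤s h) = linear-combination
      ( constS (a * b) ∷ constS a ∷ constS b ∷ α ^ (D ℕ.+ suc E) ∷ α ^ D ∷ α ^ suc E ∷ γ
      ∷ hom α γ (D ℕ.+ suc E ∸ 1) (scaleᴾ 0 a g) ∷ hom α γ E g ∷ [])
      (v₀ :* v₃ :+ v₆ :* v₇) (v₁ :* v₄ :* (v₂ :* v₅ :+ v₆ :* v₈))
      ( (v₃ ⊛ v₀ ≐ v₁ :* v₂ by constS-product a b)
      ∷ (v₁ :* v₂ ⊛ v₃ ≐ v₄ :* v₅ by ^-+ D (suc E))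
      ∷ (v₆ ⊛ v₇ ≐ v₁ :* v₄ :* v₈ by subst (λ k → hom α γ k (scaleᴾ 0 a g) ≋ conv (a · α ^ D) (hom α γ E g))
           (sym (cong (_∸ 1) (ℕP.+-suc D E))) (hom-scale D E a g h))
      ∷ []) refl

    -- The bounds on the lengths matter: `hom` lowers the exponent of α by truncated subtraction, so
    -- a list with more than D + 1 entries would not give a homogeneous form.
    hom-mul : ∀ D E f g → length f ≤ suc D → length g ≤ suc E →
      hom α γ (D ℕ.+ E) (mulᴾ 1 f g) ≋ conv (hom α γ D f) (hom α γ E g)
    hom-mul D E []      g hf hg = identity (hom α γ E g ∷ []) (# 0) (# 0 :* v₀) refl
    hom-mul D E (a ∷ f) g hf hg = ≋-trans (hom-add (D ℕ.+ E) (scaleᴾ 0 a g) (+ 0 ∷ mulᴾ 1 f g))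
      (linear-combination
        ( hom α γ (D ℕ.+ E) (scaleᴾ 0 a g) ∷ α ^ (D ℕ.+ E) ∷ γ ∷ hom α γ (D ℕ.+ E ∸ 1) (mulᴾ 1 f g)
        ∷ constS a ∷ α ^ D ∷ hom α γ (D ∸ 1) f ∷ hom α γ E g ∷ [])
        (v₀ :+ (# 0 :* v₁ :+ v₂ :* v₃)) ((v₄ :* v₅ :+ v₂ :* v₆) :* v₇)
        ( (# 1 ⊛ v₀ ≐ v₄ :* v₅ :* v₇ by hom-scale D E a g hg)
        ∷ (v₂ ⊛ v₃ ≐ v₆ :* v₇ by shifted D f hf)
        ∷ []) refl)
      where
      shifted : ∀ D f → suc (length f) ≤ suc D → hom α γ (D ℕ.+ E ∸ 1) (mulᴾ 1 f g) ≋ conv (hom α γ (D ∸ 1) f) (hom α γ E g)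
      shifted zero    []      _ = identity (hom α γ E g ∷ []) (# 0) (# 0 :* v₀) refl
      shifted zero    (_ ∷ _) (s≤s ())
      shifted (suc D) f       (s≤s hf) = hom-mul D E f g hf hg

    hom-pow : ∀ D f → length f ≤ suc D → ∀ k → hom α γ (k ℕ.* D) (powᴾ f k) ≋ hom α γ D f ^ k
    hom-pow D f h zero    = identity (γ ∷ []) (# 1 :* # 1 :+ v₀ :* # 0) (# 1) refl
    hom-pow D f h (suc k) = ≋-trans (hom-mul D (k ℕ.* D) f (powᴾ f k) h (length-pow D f h k))
      (conv-cong (≋-refl {hom α γ D f}) (hom-pow D f h k))

    hom-product : ∀ D E f g n h a b → D ℕ.+ E ≡ n → mulᴾ 1 f g ≡ h → length f ≤ suc D → length g ≤ suc E →
      hom α γ D f ≋ a → hom α γ E g ≋ b → hom α γ n h ≋ conv a b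
    hom-product D E f g _ _ a b refl refl hf hg f≋a g≋b = ≋-trans (hom-mul D E f g hf hg) (conv-cong f≋a g≋b)

    hom-power : ∀ D k f n h a → k ℕ.* D ≡ n → powᴾ f k ≡ h → length f ≤ suc D →
      hom α γ D f ≋ a → hom α γ n h ≋ a ^ k
    hom-power D k f _ _ a refl refl hf f≋a = ≋-trans (hom-pow D f hf k) (PowersMod.^-cong M k f≋a)

    module _ (Sα : Supp 0 α) (Sγ : Supp 1 γ) where

      -- coefficients at l ≡ i (mod p), where l counts from k, vanish modulo M
      vanishing : ℕ → ℕ → List ℤ → Bool
      vanishing i k []       = true
      vanishing i k (c ∷ cs) = (if does (k ℕ.% p ℕP.≟ i ℕ.% p) then isMultiple M ℤ.∣ c ∣ else true) ∧ vanishing i (suc k) cs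

      -- β collects the powers of γ already split off and has degree k. As α has degree 0, the
      -- current coefficient concerns the class of i only if k ≡ i.
      off-hom : ∀ i k D cs {β} → Supp k β → vanishing i k cs ≡ true → Off i (conv β (hom α γ D cs))
      off-hom i k D []       {β} Sβ h = off-cong (identity (β ∷ []) (v₀ :* # 0) (# 0) refl) λ n _ → refl′ (constS-zero n)
      off-hom i k D (c ∷ cs) {β} Sβ h with does (k ℕ.% p ℕP.≟ i ℕ.% p) in e
      ... | false = off-cong
        (identity (β ∷ constS c ∷ α ^ D ∷ γ ∷ hom α γ (D ∸ 1) cs ∷ [])
          (v₀ :* (v₁ :* v₂ :+ v₃ :* v₄)) (v₁ :* (v₀ :* v₂) :+ v₃ :* v₀ :* v₄) refl)
        (off-⊕ {i} {c · conv β (α ^ D)} {conv (conv γ β) (hom α γ (D ∸ 1) cs)}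
          (supp⇒off {i} {k} k≢i (subst (λ r → Supp r (c · conv β (α ^ D))) exponent
            (supp-* {0} (supp-const c) (supp-* {k} Sβ (supp-^ {0} Sα D)))))
          (off-hom i (suc k) (D ∸ 1) cs (supp-* {1} Sγ Sβ) h))
        where
        k≢i : k ℕ.% p ≢ i ℕ.% p
        k≢i eq with trans (sym e) (dec-true (k ℕ.% p ℕP.≟ i ℕ.% p) eq)
        ... | ()
        exponent : k ℕ.+ D ℕ.* 0 ≡ k
        exponent = trans (cong (k ℕ.+_) (ℕP.*-zeroʳ D)) (ℕP.+-identityʳ k)
      ... | true with isMultiple M ℤ.∣ c ∣ in c≡0
      ...   | true = off-cong
        (linear-combination (β ∷ constS c ∷ α ^ D ∷ γ ∷ hom α γ (D ∸ 1) cs ∷ [])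
          (v₀ :* (v₁ :* v₂ :+ v₃ :* v₄)) (v₃ :* v₀ :* v₄)
          ((v₀ :* v₂ ⊛ v₁ ≐ # 0 by constS-multiple c (isMultiple-ok M ℤ.∣ c ∣ c≡0)) ∷ []) refl)
        (off-hom i (suc k) (D ∸ 1) cs (supp-* {1} Sγ Sβ) h)

supp-mod : ∀ p M .{{_ : ℕ.NonZero p}} {r f} → Residues.Supp p 0 r f → Residues.Supp p M r f
supp-mod p M S n h with S n h
... | Congruence.mk t e = Congruence.refl′ M (trans e (trans (ℤP.+-identityˡ (t * + 0)) (ℤP.*-zeroʳ t)))

-- The substitution of q^p for q

module Multiples (p′ : ℕ) where
  open SeriesMod 0

  p : ℕ
  p = suc p′

  -- f(q) ↦ f(q^p)
  V : Series → Series
  V f n = if does (p ℕD.∣? n) then f (n ℕ./ p) else + 0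

  V-at : ∀ f k → V f (k ℕ.* p) ≡ f k
  V-at f k rewrite dec-true (p ℕD.∣? (k ℕ.* p)) (ℕD.n∣m*n k) = cong f (ℕM.m*n/n≡m k p)

  V-off : ∀ f {n} → ¬ (p ℕD.∣ n) → V f n ≡ + 0
  V-off f {n} h rewrite dec-false (p ℕD.∣? n) h = refl

  by-multiples : ∀ {f g : Series} → (∀ k → f (k ℕ.* p) ≡ g (k ℕ.* p)) → (∀ n → ¬ (p ℕD.∣ n) → f n ≡ g n) → f ≋ g
  by-multiples {f} {g} m o = exact λ n → go n (p ℕD.∣? n)
    where
    go : ∀ n → Dec (p ℕD.∣ n) → f n ≡ g n
    go n (yes (ℕD.divides k refl)) = m k
    go n (no h) = o n h

  V-cong : ∀ {f g} → f ≋ g → V f ≋ V g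
  V-cong {f} {g} h = by-multiples
    (λ k → trans (V-at f k) (trans (exact⁻¹ h k) (sym (V-at g k))))
    (λ n o → trans (V-off f o) (sym (V-off g o)))

  V-⊕ : ∀ f g → V (f ⊕ g) ≋ V f ⊕ V g
  V-⊕ f g = by-multiples
    (λ k → trans (V-at (f ⊕ g) k) (sym (cong₂ _+_ (V-at f k) (V-at g k))))
    (λ n o → trans (V-off (f ⊕ g) o) (sym (cong₂ _+_ (V-off f o) (V-off g o))))

  V-· : ∀ c f → V (c · f) ≋ c · V f
  V-· c f = by-multiples
    (λ k → trans (V-at (c · f) k) (trans (·-at c f k)
      (sym (trans (·-at c (V f) (k ℕ.* p)) (cong (λ x → c * x) (V-at f k))))))
    (λ n o → trans (V-off (c · f) o) (sym (trans (·-at c (V f) n)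
      (trans (cong (λ x → c * x) (V-off f o)) (ℤP.*-zeroʳ c)))))

  V-⊖ : ∀ f → V (⊖ f) ≋ ⊖ V f
  V-⊖ f = by-multiples
    (λ k → trans (V-at (⊖ f) k) (sym (cong -_ (V-at f k))))
    (λ n o → trans (V-off (⊖ f) o) (sym (cong -_ (V-off f o))))

  θ-V : ∀ f → θ (V f) ≋ + p · V (θ f)
  θ-V f = by-multiples
    (λ k → trans (cong (λ x → + (k ℕ.* p) * x) (V-at f k))
      (sym (trans (·-at (+ p) (V (θ f)) (k ℕ.* p)) (trans (cong (λ x → + p * x) (V-at (θ f) k))
        (trans (sym (ℤP.*-assoc (+ p) (+ k) (f k)))
          (cong (_* f k) (trans (ℤP.*-comm (+ p) (+ k)) (sym (ℤP.pos-* k p)))))))))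
    (λ n o → trans (trans (cong (λ x → + n * x) (V-off f o)) (ℤP.*-zeroʳ (+ n)))
      (sym (trans (·-at (+ p) (V (θ f)) n) (trans (cong (λ x → + p * x) (V-off (θ f) o)) (ℤP.*-zeroʳ (+ p))))))

  sumTo-multiples : ∀ F → (∀ n → ¬ (p ℕD.∣ n) → F n ≡ + 0) → ∀ k →
    sumTo F (k ℕ.* p) ≡ sumTo (λ j → F (j ℕ.* p)) k
  sumTo-multiples F h zero    = refl
  sumTo-multiples F h (suc k) = cong (_+ F (suc k ℕ.* p)) (trans (block p′ ℕP.≤-refl) (sumTo-multiples F h k))
    where
    block : ∀ t → t ≤ p′ → sumTo F (t ℕ.+ k ℕ.* p) ≡ sumTo F (k ℕ.* p)
    block zero    _  = refl
    block (suc t) t< = trans (cong₂ _+_ (block t (ℕP.<⇒≤ t<))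
        (h (suc t ℕ.+ k ℕ.* p) λ d → ℕP.<⇒≱ (s≤s t<)
          (ℕD.∣⇒≤ (ℕD.∣m+n∣m⇒∣n (subst (p ℕD.∣_) (ℕP.+-comm (suc t) (k ℕ.* p)) d) (ℕD.n∣m*n k)))))
      (ℤP.+-identityʳ _)

  V-* : ∀ f g → V (conv f g) ≋ conv (V f) (V g)
  V-* f g = by-multiples
    (λ k → trans (V-at (conv f g) k) (sym (trans
      (sumTo-multiples (λ i → V f i * V g (k ℕ.* p ∸ i)) (λ n o → cong (_* V g (k ℕ.* p ∸ n)) (V-off f o)) k)
      (sumTo-cong k λ j j≤k → cong₂ _*_ (V-at f j)
        (trans (cong (V g) (sym (ℕP.*-distribʳ-∸ p k j))) (V-at g (k ∸ j)))))))
    (λ n o → trans (V-off (conv f g) o) (sym (sumTo-zero n λ i i≤n → term n o i i≤n (p ℕD.∣? i))))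
    where
    term : ∀ n → ¬ (p ℕD.∣ n) → ∀ i → i ≤ n → Dec (p ℕD.∣ i) → V f i * V g (n ∸ i) ≡ + 0
    term n o i i≤n (no ¬d) = cong (_* V g (n ∸ i)) (V-off f ¬d)
    term n o i i≤n (yes d) = trans (cong (λ x → V f i * x) (V-off g λ d′ → o (subst (p ℕD.∣_)
      (ℕP.m+[n∸m]≡n i≤n) (ℕD.∣m∣n⇒∣m+n d d′)))) (ℤP.*-zeroʳ (V f i))

  open Residues p 0

  supp-V : ∀ f → Supp 0 (V f)
  supp-V f n h = refl′ (V-off f λ d → h (trans (ℕD.n∣m⇒m%n≡0 n p d) refl))

  constS-multiples : ∀ c k → constS c (k ℕ.* p) ≡ constS c k
  constS-multiples c zero    = refl
  constS-multiples c (suc k) = refl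

  ℓ-V : ∀ a n → ℓ (suc a ℕ.* p) n ≡ V (ℓ (suc a)) n
  ℓ-V a = exact⁻¹ {ℓ (suc a ℕ.* p)} {V (ℓ (suc a))} (by-multiples
    (λ k → trans (go k (suc a ℕD.∣? k)) (sym (V-at (ℓ (suc a)) k)))
    (λ { zero o → ⊥-elim (o (p ℕD.∣0))
       ; (suc n) o → trans (cong (_+ + 0) (geo-no {suc a ℕ.* p} λ d → o (ℕD.∣-trans (ℕD.n∣m*n (suc a)) d)))
           (sym (V-off (ℓ (suc a)) o)) }))
    where
    go : ∀ k → Dec (suc a ℕD.∣ k) → ℓ (suc a ℕ.* p) (k ℕ.* p) ≡ ℓ (suc a) k
    go k (yes d) = cong₂ (λ x y → x - y) (trans (geo-yes {suc a ℕ.* p} (ℕD.*-monoˡ-∣ p d)) (sym (geo-yes {suc a} d))) (constS-multiples (+ 1) k)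
    go k (no ¬d) = cong₂ (λ x y → x - y)
      (trans (geo-no {suc a ℕ.* p} (λ d → ¬d (ℕD.*-cancelʳ-∣ p d))) (sym (geo-no {suc a} ¬d))) (constS-multiples (+ 1) k)

  -- By `ℓ-V` the term at p a is the image of the term at a. The sum is first extended to n p terms,
  -- which adds only zeros, and then restricted to the multiples of p.
  lambert-multiples : ∀ w v → (∀ n → ¬ (p ℕD.∣ n) → w (+ n) ≡ + 0) → (∀ k → w (+ (k ℕ.* p)) ≡ v (+ k)) →
    lambert w ≋ V (lambert v)
  lambert-multiples w v off on = exact λ n → begin
    lambert w n
      ≡⟨ Σ<-truncate (ℕP.m≤m*n n p) (λ i n≤i → trans (cong (λ x → w (+ suc i) * x) (ℓ-vanish n≤i)) (ℤP.*-zeroʳ (w (+ suc i)))) ⟨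
    Σ< (n ℕ.* p) (λ i → w (+ suc i) * ℓ (suc i) n)
      ≡⟨ from-0 (F n) refl (n ℕ.* p) ⟨
    sumTo (F n) (n ℕ.* p)
      ≡⟨ sumTo-multiples (F n) (F-off n) n ⟩
    sumTo (λ j → F n (j ℕ.* p)) n
      ≡⟨ from-0 (λ j → F n (j ℕ.* p)) refl n ⟩
    Σ< n (λ i → w (+ (suc i ℕ.* p)) * ℓ (suc i ℕ.* p) n)
      ≡⟨ Σ<-cong n (λ i _ → cong₂ _*_ (on (suc i)) (ℓ-V i n)) ⟩
    Σ< n (λ i → v (+ suc i) * V (ℓ (suc i)) n)
      ≡⟨ collect n ⟩
    V (lambert v) n ∎
    where
    F : ℕ → ℕ → ℤ
    F n zero    = + 0
    F n (suc i) = w (+ suc i) * ℓ (suc i) n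
    F-off : ∀ n i → ¬ (p ℕD.∣ i) → F n i ≡ + 0
    F-off n zero    _ = refl
    F-off n (suc i) h = cong (_* ℓ (suc i) n) (off (suc i) h)
    from-0 : ∀ F → F 0 ≡ + 0 → ∀ n → sumTo F n ≡ Σ< n (λ i → F (suc i))
    from-0 F h zero    = h
    from-0 F h (suc n) = cong (_+ F (suc n)) (from-0 F h n)
    collect : ∀ n → Σ< n (λ i → v (+ suc i) * V (ℓ (suc i)) n) ≡ V (lambert v) n
    collect = exact⁻¹ {λ n → Σ< n (λ i → v (+ suc i) * V (ℓ (suc i)) n)} {V (lambert v)} (by-multiples
      (λ k → trans (Σ<-cong (k ℕ.* p) λ i _ → cong (λ x → v (+ suc i) * x) (V-at (ℓ (suc i)) k))
        (trans (Σ<-truncate (ℕP.m≤m*n k p) λ i k≤i → trans (cong (λ x → v (+ suc i) * x) (ℓ-vanish k≤i)) (ℤP.*-zeroʳ (v (+ suc i))))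
          (sym (V-at (lambert v) k))))
      (λ n o → trans (Σ<-zero n λ i _ → trans (cong (λ x → v (+ suc i) * x) (V-off (ℓ (suc i)) o)) (ℤP.*-zeroʳ (v (+ suc i))))
        (sym (V-off (lambert v) o))))

  lambert-power : ∀ r w → (∀ n → ¬ (p ℕD.∣ n) → w (+ n) ≡ + 0) →
    (∀ k → w (+ (k ℕ.* p)) ≡ (+ (k ℕ.* p)) ^ᶻ r) → lambert w ≋ V ((+ p) ^ᶻ r · s r)
  lambert-power r w off on = ≋-trans
    (lambert-multiples w (λ a → (+ p) ^ᶻ r * a ^ᶻ r) off λ k →
      trans (on k) (trans (cong (_^ᶻ r) (trans (ℤP.pos-* k p) (ℤP.*-comm (+ k) (+ p)))) (distrib r (+ p) (+ k))))
    (V-cong (exact λ n → trans (lambert-* ((+ p) ^ᶻ r) (_^ᶻ r) n) (sym (·-at ((+ p) ^ᶻ r) (s r) n))))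
    where
    distrib : ∀ r x y → (x * y) ^ᶻ r ≡ x ^ᶻ r * y ^ᶻ r
    distrib zero    x y = refl
    distrib (suc r) x y = trans (cong (λ z → x * y * z) (distrib r x y))
      (Z.identity (x ∷ y ∷ x ^ᶻ r ∷ y ^ᶻ r ∷ []) (v₀ :* v₁ :* (v₂ :* v₃)) (v₀ :* v₂ :* (v₁ :* v₃)) refl)

  -- `V` is a ring homomorphism that does not commute with θ: the last term V(θ s₁) is θ(V s₁)/p.
  V-ramanujan : let v = V (s 1) in + 12 · conv v v ≋ + 5 · V (s 3) ⊕ v ⊕ ⊖ (+ 6 · V (θ (s 1)))
  V-ramanujan = linear-combination
    ( V (s 1) ∷ V (s 3) ∷ V (θ (s 1)) ∷ V (conv (s 1) (s 1)) ∷ V (+ 12 · conv (s 1) (s 1)) ∷ V (+ 5 · s 3)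
    ∷ V (⊖ (+ 6 · θ (s 1))) ∷ V (+ 6 · θ (s 1)) ∷ V (+ 5 · s 3 ⊕ s 1)
    ∷ V (+ 5 · s 3 ⊕ s 1 ⊕ ⊖ (+ 6 · θ (s 1))) ∷ [])
    (# 12 :* (v₀ :* v₀)) (# 5 :* v₁ :+ v₀ :- # 6 :* v₂)
    ( (:- # 12 ⊛ v₃ ≐ v₀ :* v₀ by V-* (s 1) (s 1))
    ∷ (:- # 1 ⊛ v₄ ≐ # 12 :* v₃ by V-· (+ 12) (conv (s 1) (s 1)))
    ∷ (# 1 ⊛ v₄ ≐ v₉ by V-cong sum-σσ)
    ∷ (# 1 ⊛ v₉ ≐ v₈ :+ v₆ by V-⊕ (+ 5 · s 3 ⊕ s 1) (⊖ (+ 6 · θ (s 1))))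
    ∷ (# 1 ⊛ v₈ ≐ v₅ :+ v₀ by V-⊕ (+ 5 · s 3) (s 1))
    ∷ (# 1 ⊛ v₅ ≐ # 5 :* v₁ by V-· (+ 5) (s 3))
    ∷ (# 1 ⊛ v₆ ≐ :- v₇ by V-⊖ (+ 6 · θ (s 1)))
    ∷ (:- # 1 ⊛ v₇ ≐ # 6 :* v₂ by V-· (+ 6) (θ (s 1)))
    ∷ []) refl

-- Dissection of powers of j

-- If q κ = K(α,γ) and K(α,γ) ψ = q N(α,γ) with exponents of α, κ divisible by p and those of γ
-- congruent to 1, the coefficients of j^i = q^{-i} ψ^i at multiples of p are read off from the
-- coefficients of N^i at γ^l with l ≡ i (mod p).
module Dissection (p M : ℕ) .{{_ : ℕ.NonZero p}} (α γ κ : Series) (D : ℕ) (K N : List ℤ)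
  (Sα : Residues.Supp p M 0 α) (Sγ : Residues.Supp p M 1 γ) (Sκ : Residues.Supp p M 0 κ)
  (κ0 : κ 0 ≡ + 1) (lK : length K ≤ suc D) (lN : length N ≤ suc D)
  (qκ≋K : Congruence._≋_ M (conv q κ) (hom α γ D K))
  (Kψ≋qN : Congruence._≋_ M (conv (hom α γ D K) ψ) (conv q (hom α γ D N)))
  where
  open SeriesMod M
  open Units M
  open PowersMod M
  open GoodMod p M
  open Glue p M
  open Residues p M
  open Homogeneous α γ

  off⇒good : ∀ {i f} → Off i f → Good i f
  off⇒good {i} F m n e _ = F m (residue m n i e)

  κψ≋N : conv κ ψ ≋ hom α γ D N
  κψ≋N = q-cancel 1 (conv κ ψ) (hom α γ D N) (linear-combination (q ∷ κ ∷ ψ ∷ hom α γ D N ∷ hom α γ D K ∷ [])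
    (v₀ :^ 1 :* (v₁ :* v₂)) (v₀ :^ 1 :* v₃)
    ( (v₂ ⊛ v₀ :* v₁ ≐ v₄ by qκ≋K)
    ∷ (# 1 ⊛ v₄ :* v₂ ≐ v₀ :* v₃ by Kψ≋qN)
    ∷ []) refl)

  κ^-0 : ∀ i → (κ ^ i) 0 ≡ + 1
  κ^-0 = ^-0 κ κ0

  -- κ^i (f - c q^i) is the form T - c K^i, whose coefficients at γ^l with l ≡ i vanish by the
  -- check. As κ has degree 0 and constant term 1, the same component of f - c q^i vanishes.
  certificate : ∀ i f T c → conv (κ ^ i) f ≋ hom α γ (i ℕ.* D) T →
    vanishing Sα Sγ i 0 (addᴾ 1 T (mulᴾ 1 (- c ∷ []) (powᴾ K i))) ≡ true → Good i f
  certificate i f T c h check = good-cong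
    (identity (f ∷ constS c ∷ q ^ i ∷ []) v₀ (v₁ :* v₂ :+ (v₀ :- v₁ :* v₂)) refl)
    (good-⊕ {i} {c · q ^ i} {g} (good-mono i c) (off⇒good {i} {g}
      (off-unit {i} {κ ^ i} {g} (subst (λ r → Supp r (κ ^ i)) (ℕP.*-zeroʳ i) (supp-^ {0} Sκ i)) (κ^-0 i)
        (off-cong {i} remainder (off-hom Sα Sγ i 0 (i ℕ.* D) R (supp-const (+ 1)) check)))))
    where
    R : List ℤ
    R = addᴾ 1 T (mulᴾ 1 (- c ∷ []) (powᴾ K i))
    g : Series
    g = f ⊕ ⊖ (c · q ^ i)
    remainder : conv (κ ^ i) g ≋ conv (constS (+ 1)) (hom α γ (i ℕ.* D) R)
    remainder = linear-combination
      ( κ ^ i ∷ f ∷ constS c ∷ q ^ i ∷ hom α γ (i ℕ.* D) R ∷ hom α γ (i ℕ.* D) T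
      ∷ hom α γ (i ℕ.* D) (mulᴾ 1 (- c ∷ []) (powᴾ K i)) ∷ hom α γ (i ℕ.* D) (powᴾ K i) ∷ hom α γ D K ^ i ∷ constS (- c)
      ∷ γ ∷ conv q κ ^ i ∷ [])
      (v₀ :* (v₁ :- v₂ :* v₃)) (# 1 :* v₄)
      ( (# 1 ⊛ v₀ :* v₁ ≐ v₅ by h)
      ∷ (:- # 1 ⊛ v₄ ≐ v₅ :+ v₆ by hom-add (i ℕ.* D) T (mulᴾ 1 (- c ∷ []) (powᴾ K i)))
      ∷ (:- # 1 ⊛ v₆ ≐ (v₉ :* # 1 :+ v₁₀ :* # 0) :* v₇ by hom-mul 0 (i ℕ.* D) (- c ∷ []) (powᴾ K i) (s≤s z≤n) (length-pow D K lK i))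
      ∷ (:- v₉ ⊛ v₇ ≐ v₈ by hom-pow D K lK i)
      ∷ (:- v₈ ⊛ v₉ ≐ :- v₂ by exact λ { zero → refl ; (suc _) → refl })
      ∷ (v₂ ⊛ v₁₁ ≐ v₃ :* v₀ by ^-* q κ i)
      ∷ (:- v₂ ⊛ v₁₁ ≐ v₈ by ^-cong i qκ≋K)
      ∷ []) refl

  κ^ψ^ : ∀ i → conv (κ ^ i) (ψ ^ i) ≋ hom α γ (i ℕ.* D) (powᴾ N i)
  κ^ψ^ i = ≋-trans (≋-sym (^-* κ ψ i)) (≋-trans (^-cong i κψ≋N) (≋-sym (hom-pow D N lN i)))

  good-power : ∀ i c → vanishing Sα Sγ i 0 (addᴾ 1 (powᴾ N i) (mulᴾ 1 (- c ∷ []) (powᴾ K i))) ≡ true → Good i (ψ ^ i)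
  good-power i c check = certificate i (ψ ^ i) (powᴾ N i) c (κ^ψ^ i) check

  good-last : ∀ c → let i = suc p; a = + 744 * + i; T = addᴾ 1 (powᴾ N i) (mulᴾ 1 (- a ∷ []) (mulᴾ 1 K (powᴾ N p))) in
    vanishing Sα Sγ i 0 (addᴾ 1 T (mulᴾ 1 (- c ∷ []) (powᴾ K i))) ≡ true →
    Good i (ψ ^ i ⊕ ⊖ (a · conv q (ψ ^ p)))
  good-last c check = certificate (suc p) (ψ ^ suc p ⊕ ⊖ (a · conv q (ψ ^ p))) T c
    (linear-combination
      ( κ ^ p ∷ ψ ^ p ∷ q ∷ κ ∷ ψ ∷ constS a ∷ hom α γ H T ∷ hom α γ H (powᴾ N (suc p)) ∷ hom α γ H A ∷ hom α γ H B
      ∷ constS (- a) ∷ γ ∷ hom α γ D K ∷ hom α γ (p ℕ.* D) (powᴾ N p) ∷ [])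
      (v₃ :* v₀ :* (v₄ :* v₁ :- v₅ :* (v₂ :* v₁))) v₆
      ( (:- # 1 ⊛ v₆ ≐ v₇ :+ v₈ by hom-add H (powᴾ N (suc p)) A)
      ∷ (# 1 ⊛ v₃ :* v₀ :* (v₄ :* v₁) ≐ v₇ by κ^ψ^ (suc p))
      ∷ (:- # 1 ⊛ v₈ ≐ (v₁₀ :* # 1 :+ v₁₁ :* # 0) :* v₉ by hom-mul 0 H (- a ∷ []) B (s≤s z≤n)
           (length-mul D (p ℕ.* D) K (powᴾ N p) lK (length-pow D N lN p)))
      ∷ (:- v₉ ⊛ v₁₀ ≐ :- v₅ by exact λ { zero → refl ; (suc _) → refl })
      ∷ (v₅ ⊛ v₉ ≐ v₁₂ :* v₁₃ by hom-mul D (p ℕ.* D) K (powᴾ N p) lK (length-pow D N lN p))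
      ∷ (:- (v₅ :* v₁₃) ⊛ v₂ :* v₃ ≐ v₁₂ by qκ≋K)
      ∷ (:- (v₅ :* v₂ :* v₃) ⊛ v₀ :* v₁ ≐ v₁₃ by κ^ψ^ p)
      ∷ []) refl) check
    where
    a : ℤ
    a = + 744 * + suc p
    H : ℕ
    H = suc p ℕ.* D
    A B T : List ℤ
    B = mulᴾ 1 K (powᴾ N p)
    A = mulᴾ 1 (- a ∷ []) B
    T = addᴾ 1 (powᴾ N (suc p)) A

module Periodic (f : ℤ → ℤ) (N : ℕ) (step : ∀ x → f (+ N + x) ≡ f x) where

  periodic⁺ : ∀ k x → f (+ N * + k + x) ≡ f x
  periodic⁺ zero    x = cong f (Z.identity (x ∷ + N ∷ []) (v₁ :* # 0 :+ v₀) v₀ refl)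
  periodic⁺ (suc k) x = trans
    (cong f (Z.identity (x ∷ + N ∷ + k ∷ []) (v₁ :* (# 1 :+ v₂) :+ v₀) (v₁ :+ (v₁ :* v₂ :+ v₀)) refl))
    (trans (step (+ N * + k + x)) (periodic⁺ k x))

  periodic : ∀ z {x} r → x ≡ r + + N * z → f x ≡ f r
  periodic (+ k) r refl = trans (cong f (ℤP.+-comm r (+ N * + k))) (periodic⁺ k r)
  periodic -[1+ k ] r refl = trans (sym (periodic⁺ (suc k) (r + + N * -[1+ k ])))
    (cong f (Z.identity (r ∷ + N ∷ + suc k ∷ []) (v₁ :* v₂ :+ (v₀ :+ v₁ :* (:- v₂))) v₀ refl))

comb : List (ℤ × (ℤ → ℤ)) → ℤ → ℤ
comb []            a = + 0
comb ((c , u) ∷ t) a = c * u a + comb t a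

combˢ : List (ℤ × (ℤ → ℤ)) → Series
combˢ []            = constS (+ 0)
combˢ ((c , u) ∷ t) = c · lambert u ⊕ combˢ t

lambert-comb : ∀ t n → lambert (comb t) n ≡ combˢ t n
lambert-comb []            n = trans (Σ<-zero n λ _ _ → refl) (sym (constS-zero n))
lambert-comb ((c , u) ∷ t) n = trans (lambert-+ (λ a → c * u a) (comb t) n)
  (cong₂ _+_ (trans (lambert-* c u n) (sym (·-at c (lambert u) n))) (lambert-comb t n))

-- The prime 2: forms of level 4

module Two where
  open SeriesMod 0
  open Multiples 1 hiding (p)
  open Residues 2 0

  oddℕ : ℕ → ℤ
  oddℕ 0             = + 0
  oddℕ 1             = + 1
  oddℕ (suc (suc n)) = oddℕ n

  odd : ℤ → ℤ
  odd x = oddℕ ℤ.∣ x ∣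

  odd-step : ∀ x → odd (+ 2 + x) ≡ odd x
  odd-step (+ n)              = refl
  odd-step -[1+ 0 ]           = refl
  odd-step -[1+ 1 ]           = refl
  odd-step -[1+ suc (suc n) ] = refl

  open Periodic odd 2 odd-step

  odd-neg : ∀ x → odd (- x) ≡ odd x
  odd-neg x = cong oddℕ (ℤP.∣-i∣≡∣i∣ x)

  data Parity (n : ℕ) : Set where
    even : ∀ k → + n ≡ + 0 + + 2 * + k → Parity n
    odd′ : ∀ k → + n ≡ + 1 + + 2 * + k → Parity n

  parity : ∀ n → Parity n
  parity zero          = even 0 refl
  parity (suc zero)    = odd′ 0 refl
  parity (suc (suc n)) with parity n
  ... | even k e = even (suc k) (trans (cong (λ x → + 2 + x) e)
    (Z.identity (+ k ∷ []) (# 2 :+ (# 0 :+ # 2 :* v₀)) (# 0 :+ # 2 :* (# 1 :+ v₀)) refl))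
  ... | odd′ k e = odd′ (suc k) (trans (cong (λ x → + 2 + x) e)
    (Z.identity (+ k ∷ []) (# 2 :+ (# 1 :+ # 2 :* v₀)) (# 1 :+ # 2 :* (# 1 :+ v₀)) refl))

  evenSquare : ℤ → ℤ
  evenSquare x = (+ 1 - odd x) * (x * x)

  -- The sum of the squares of the even numbers among a, b, a + b. In G(a, b) - G(a, b - a) only (a
  -- + b)² - (b - a)² = 4ab survives, and only if a and b have the same parity.
  G : ℤ → ℤ → ℤ
  G a b = evenSquare a + evenSquare b + evenSquare (a + b)

  G-sym : ∀ a b → G a b ≡ G b a
  G-sym a b = cong₂ _+_ (ℤP.+-comm (evenSquare a) (evenSquare b)) (cong evenSquare (ℤP.+-comm a b))

  evenSquare-neg : ∀ x → evenSquare (- x) ≡ evenSquare x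
  evenSquare-neg x = cong₂ (λ u v → (+ 1 - u) * v) (odd-neg x) (Z.identity (x ∷ []) (:- v₀ :* :- v₀) (v₀ :* v₀) refl)

  G-rot : ∀ a b → G a b ≡ G (a + b) (- b)
  G-rot a b = trans
    (Z.identity (evenSquare a ∷ evenSquare b ∷ evenSquare (a + b) ∷ []) (v₀ :+ v₁ :+ v₂) (v₂ :+ v₁ :+ v₀) refl)
    (sym (cong₂ (λ x y → evenSquare (a + b) + x + y) (evenSquare-neg b)
      (cong evenSquare (Z.identity (a ∷ b ∷ []) (v₀ :+ v₁ :+ (:- v₁)) v₀ refl))))

  G-difference : ∀ i j → let a = + suc i; b = + suc j in
    G a b - G a (b - a) ≡ + 4 * (odd a * a * (odd b * b)) + + 4 * ((+ 1 - odd a) * a * ((+ 1 - odd b) * b))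
  G-difference i j = go (parity (suc i)) (parity (suc j))
    where
    a = + suc i
    b = + suc j
    -- r and s are the parities of a and b, and t is the common parity of a + b and b - a; the four
    -- cases differ only in the numerical equation.
    finish : ∀ r s t k l → a ≡ + r + + 2 * + k → b ≡ + s + + 2 * + l →
      odd (+ r + + s) ≡ t → odd (+ s - + r) ≡ t →
      (+ 1 - t) * + 4 ≡ + 4 * (odd (+ r) * odd (+ s)) + + 4 * ((+ 1 - odd (+ r)) * (+ 1 - odd (+ s))) →
      G a b - G a (b - a) ≡ + 4 * (odd a * a * (odd b * b)) + + 4 * ((+ 1 - odd a) * a * ((+ 1 - odd b) * b))
    finish r s t k l p q rs sr tab = trans
      (cong (λ x → G a b - (evenSquare a + evenSquare (b - a) + evenSquare x)) (Z.identity (a ∷ b ∷ []) (v₀ :+ (v₁ :- v₀)) v₁ refl))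
      (Z.linear-combination (a ∷ b ∷ odd a ∷ odd b ∷ odd (a + b) ∷ odd (b - a) ∷ odd (+ r) ∷ odd (+ s) ∷ t ∷ [])
        (e v₂ v₀ :+ e v₃ v₁ :+ e v₄ (v₀ :+ v₁) :- (e v₂ v₀ :+ e v₅ (v₁ :- v₀) :+ e v₃ v₁))
        (# 4 :* (v₂ :* v₀ :* (v₃ :* v₁)) :+ # 4 :* ((# 1 :- v₂) :* v₀ :* ((# 1 :- v₃) :* v₁)))
        ( (:- ((v₀ :+ v₁) :* (v₀ :+ v₁)) Z.⊛ v₄ ≐ v₈ by trans (periodic (+ k + + l) (+ r + + s) sums) rs)
        ∷ ((v₁ :- v₀) :* (v₁ :- v₀) Z.⊛ v₅ ≐ v₈ by trans (periodic (+ l - + k) (+ s - + r) differences) sr)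
        ∷ (v₀ :* v₁ Z.⊛ (# 1 :- v₈) :* # 4 ≐ # 4 :* (v₆ :* v₇) :+ # 4 :* ((# 1 :- v₆) :* (# 1 :- v₇)) by tab)
        ∷ (:- # 4 :* v₀ :* v₁ :* (v₃ :- (# 1 :- v₃)) Z.⊛ v₂ ≐ v₆ by periodic (+ k) (+ r) p)
        ∷ (:- # 4 :* v₀ :* v₁ :* (v₆ :- (# 1 :- v₆)) Z.⊛ v₃ ≐ v₇ by periodic (+ l) (+ s) q)
        ∷ []) refl)
      where
      e : Expr 9 → Expr 9 → Expr 9
      e o x = (# 1 :- o) :* (x :* x)
      sums : a + b ≡ + r + + s + + 2 * (+ k + + l)
      sums = trans (cong₂ _+_ p q) (Z.identity (+ r ∷ + s ∷ + k ∷ + l ∷ [])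
        (v₀ :+ # 2 :* v₂ :+ (v₁ :+ # 2 :* v₃)) (v₀ :+ v₁ :+ # 2 :* (v₂ :+ v₃)) refl)
      differences : b - a ≡ + s - + r + + 2 * (+ l - + k)
      differences = trans (cong₂ _-_ q p) (Z.identity (+ r ∷ + s ∷ + k ∷ + l ∷ [])
        (v₁ :+ # 2 :* v₃ :- (v₀ :+ # 2 :* v₂)) (v₁ :- v₀ :+ # 2 :* (v₃ :- v₂)) refl)
    go : Parity (suc i) → Parity (suc j) →
      G a b - G a (b - a) ≡ + 4 * (odd a * a * (odd b * b)) + + 4 * ((+ 1 - odd a) * a * ((+ 1 - odd b) * b))
    go (even k p) (even l q) = finish 0 0 (+ 0) k l p q refl refl refl
    go (even k p) (odd′ l q) = finish 0 1 (+ 1) k l p q refl refl refl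
    go (odd′ k p) (even l q) = finish 1 0 (+ 1) k l p q refl refl refl
    go (odd′ k p) (odd′ l q) = finish 1 1 (+ 0) k l p q refl refl refl

  G-value : ∀ a b {α β δ} → odd a ≡ α → odd b ≡ β → odd (a + b) ≡ δ →
    G a b ≡ (+ 1 - α) * (a * a) + (+ 1 - β) * (b * b) + (+ 1 - δ) * ((a + b) * (a + b))
  G-value a b refl refl refl = refl

  blockSum : ∀ c f (Φ : ℤ → ℤ) → Φ (+ 0) ≡ + 0 →
    (∀ k → Φ (+ 1 + + k) ≡ Φ (+ k) + c * (f (k ℕ.* 2) + f (suc (k ℕ.* 2)))) → ∀ k → c * Σ< (k ℕ.* 2) f ≡ Φ (+ k)
  blockSum c f Φ Φ0 ΦS zero    = trans (ℤP.*-zeroʳ c) (sym Φ0)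
  blockSum c f Φ Φ0 ΦS (suc k) = trans
    (Z.linear-combination (c ∷ Σ< (k ℕ.* 2) f ∷ f (k ℕ.* 2) ∷ f (suc (k ℕ.* 2)) ∷ Φ (+ k) ∷ [])
      (v₀ :* (v₁ :+ v₂ :+ v₃)) (v₄ :+ v₀ :* (v₂ :+ v₃))
      ((# 1 Z.⊛ v₀ :* v₁ ≐ v₄ by blockSum c f Φ Φ0 ΦS k) ∷ []) refl)
    (sym (ΦS k))

  double : ∀ k → + (k ℕ.* 2) ≡ + 2 * + k
  double k = trans (ℤP.pos-* k 2) (ℤP.*-comm (+ k) (+ 2))

  innerSum : ℤ → ℤ
  innerSum c = c ^ᶻ 3 - c + + 3 * ((+ 1 - odd c) * (c ^ᶻ 3 - + 2 * c ^ᶻ 2 + c))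

  -- For odd c = a + b exactly one of a, b is even; for even c both or neither are, and c² always
  -- counts. Hence the summation over two consecutive a at a time.
  antidiagonalSum-G : ∀ m → + 3 * antidiagonalSum G m ≡ innerSum (+ suc m)
  antidiagonalSum-G m = go (parity (suc m))
    where
    x = + suc m
    F : ℕ → ℤ
    F i = G (+ suc i) (x - + suc i)
    first second : ∀ k → ℤ
    first  k = + suc (k ℕ.* 2)
    second k = + suc (suc (k ℕ.* 2))
    first≡ : ∀ k → first k ≡ + 1 + + 2 * + k
    first≡ k = cong (λ z → + 1 + z) (double k)
    second≡ : ∀ k → second k ≡ + 2 + + 2 * + k
    second≡ k = cong (λ z → + 2 + z) (double k)
    shiftBy : ∀ r s y z {a} → x ≡ r + + 2 * y → a ≡ s + + 2 * z → x - a ≡ r - s + + 2 * (y - z)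
    shiftBy r s y z p q = trans (cong₂ _-_ p q) (Z.identity (r ∷ s ∷ y ∷ z ∷ [])
      (v₀ :+ # 2 :* v₂ :- (v₁ :+ # 2 :* v₃)) (v₀ :- v₁ :+ # 2 :* (v₂ :- v₃)) refl)
    complement : ∀ a → odd (a + (x - a)) ≡ odd x
    complement a = cong odd (Z.identity (a ∷ x ∷ []) (v₀ :+ (v₁ :- v₀)) v₁ refl)
    go : Parity (suc m) → + 3 * antidiagonalSum G m ≡ innerSum x
    go (even zero    e) with trans (sym (ℤP.+-injective e)) refl
    ... | ()
    -- Here m is odd: the complete blocks reach a = c, and the surplus term G(c, 0) is removed.
    go (even (suc y) e) = Z.linear-combination
      (antidiagonalSum G m ∷ x ∷ + suc y ∷ Σ< (suc y ℕ.* 2) F ∷ F m ∷ odd x ∷ [])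
      (# 3 :* v₀) (v₁ :^ 3 :- v₁ :+ # 3 :* ((# 1 :- v₅) :* (v₁ :^ 3 :- # 2 :* v₁ :^ 2 :+ v₁)))
      ( (:- # 3 Z.⊛ v₃ ≐ v₀ :+ v₄ by cong (λ k → Σ< k F) (sym m≡))
      ∷ (# 1 Z.⊛ # 3 :* v₃ ≐ Φ v₂ v₁ by blockSum (+ 3) F (λ k → Z.⟦ Φ v₀ v₁ ⟧ (k ∷ x ∷ []))
          (Z.identity (x ∷ []) (Φ (# 0) v₀) (# 0) refl) stepᵉ (suc y))
      ∷ (:- # 3 Z.⊛ v₄ ≐ (# 1 :- v₅) :* (v₁ :* v₁) :+ (# 1 :- # 0) :* ((v₁ :- v₁) :* (v₁ :- v₁))
           :+ (# 1 :- v₅) :* ((v₁ :+ (v₁ :- v₁)) :* (v₁ :+ (v₁ :- v₁)))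
           by G-value x (x - x) {odd x} {+ 0} {odd x} refl (cong odd (ℤP.+-inverseʳ x)) (complement x))
      ∷ (# 6 :* v₁ :* v₁ :+ # 3 :* (v₁ :^ 3 :- # 2 :* v₁ :^ 2 :+ v₁) Z.⊛ v₅ ≐ # 0 by periodic (+ suc y) (+ 0) e)
      ∷ (:- # 4 :* v₂ :^ 2 :- # 6 :* v₂ :- # 2 :+ v₁ :* v₂ :- # 4 :* v₁ :^ 2 Z.⊛ v₁ ≐ # 0 :+ # 2 :* v₂ by e)
      ∷ []) refl
      where
      m≡ : suc m ≡ suc y ℕ.* 2
      m≡ = ℤP.+-injective (trans e (trans (ℤP.+-identityˡ _) (sym (double (suc y)))))
      Φ : ∀ {n} → Expr n → Expr n → Expr n
      Φ k x = # 9 :* k :* x :* x :- # 6 :* x :* k :* (k :+ # 1) :+ # 4 :* k :* (k :+ # 1) :* (# 2 :* k :+ # 1)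
      stepᵉ : ∀ k → Z.⟦ Φ (# 1 :+ v₀) v₁ ⟧ (+ k ∷ x ∷ []) ≡
        Z.⟦ Φ v₀ v₁ ⟧ (+ k ∷ x ∷ []) + + 3 * (F (k ℕ.* 2) + F (suc (k ℕ.* 2)))
      stepᵉ k = Z.linear-combination (+ k ∷ x ∷ F (k ℕ.* 2) ∷ F (suc (k ℕ.* 2)) ∷ first k ∷ second k ∷ [])
        (Φ (# 1 :+ v₀) v₁) (Φ v₀ v₁ :+ # 3 :* (v₂ :+ v₃))
        ( (:- # 3 Z.⊛ v₂ ≐ (# 1 :- # 1) :* (v₄ :* v₄) :+ (# 1 :- # 1) :* ((v₁ :- v₄) :* (v₁ :- v₄))
             :+ (# 1 :- # 0) :* ((v₄ :+ (v₁ :- v₄)) :* (v₄ :+ (v₁ :- v₄)))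
             by G-value (first k) (x - first k) (periodic (+ k) (+ 1) (first≡ k))
               (periodic (+ suc y - + k) (+ 0 - + 1) (shiftBy (+ 0) (+ 1) (+ suc y) (+ k) e (first≡ k)))
               (trans (complement (first k)) (periodic (+ suc y) (+ 0) e)))
        ∷ (:- # 3 Z.⊛ v₃ ≐ (# 1 :- # 0) :* (v₅ :* v₅) :+ (# 1 :- # 0) :* ((v₁ :- v₅) :* (v₁ :- v₅))
             :+ (# 1 :- # 0) :* ((v₅ :+ (v₁ :- v₅)) :* (v₅ :+ (v₁ :- v₅)))
             by G-value (second k) (x - second k) (periodic (+ k) (+ 2) (second≡ k))
               (periodic (+ suc y - + k) (+ 0 - + 2) (shiftBy (+ 0) (+ 2) (+ suc y) (+ k) e (second≡ k)))
               (trans (complement (second k)) (periodic (+ suc y) (+ 0) e)))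
        ∷ (:- # 3 :* (# 2 :* (v₅ :+ # 2 :+ # 2 :* v₀) :- # 2 :* v₁) Z.⊛ v₅ ≐ # 2 :+ # 2 :* v₀ by second≡ k)
        ∷ []) refl
    go (odd′ y e) = Z.linear-combination
      (antidiagonalSum G m ∷ x ∷ + y ∷ Σ< (y ℕ.* 2) F ∷ odd x ∷ [])
      (# 3 :* v₀) (v₁ :^ 3 :- v₁ :+ # 3 :* ((# 1 :- v₄) :* (v₁ :^ 3 :- # 2 :* v₁ :^ 2 :+ v₁)))
      ( (:- # 3 Z.⊛ v₃ ≐ v₀ by cong (λ k → Σ< k F) (sym m≡))
      ∷ (# 1 Z.⊛ # 3 :* v₃ ≐ Φ v₂ v₁ by blockSum (+ 3) F (λ k → Z.⟦ Φ v₀ v₁ ⟧ (k ∷ x ∷ []))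
          (Z.identity (x ∷ []) (Φ (# 0) v₀) (# 0) refl) stepᵒ y)
      ∷ (# 3 :* (v₁ :^ 3 :- # 2 :* v₁ :^ 2 :+ v₁) Z.⊛ v₄ ≐ # 1 by periodic (+ y) (+ 1) e)
      ∷ (:- v₂ :- # 4 :* v₂ :^ 2 :+ v₁ :* v₂ :- v₁ :- v₁ :^ 2 Z.⊛ v₁ ≐ # 1 :+ # 2 :* v₂ by e)
      ∷ []) refl
      where
      m≡ : m ≡ y ℕ.* 2
      m≡ = ℕP.suc-injective (ℤP.+-injective (trans e (cong (λ z → + 1 + z) (sym (double y)))))
      Φ : ∀ {n} → Expr n → Expr n → Expr n
      Φ k x = # 3 :* k :* (x :+ # 1) :* (x :+ # 1) :- # 6 :* (x :+ # 1) :* k :* (k :+ # 1) :+ # 4 :* k :* (k :+ # 1) :* (# 2 :* k :+ # 1)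
      stepᵒ : ∀ k → Z.⟦ Φ (# 1 :+ v₀) v₁ ⟧ (+ k ∷ x ∷ []) ≡
        Z.⟦ Φ v₀ v₁ ⟧ (+ k ∷ x ∷ []) + + 3 * (F (k ℕ.* 2) + F (suc (k ℕ.* 2)))
      stepᵒ k = Z.linear-combination (+ k ∷ x ∷ F (k ℕ.* 2) ∷ F (suc (k ℕ.* 2)) ∷ first k ∷ second k ∷ [])
        (Φ (# 1 :+ v₀) v₁) (Φ v₀ v₁ :+ # 3 :* (v₂ :+ v₃))
        ( (:- # 3 Z.⊛ v₂ ≐ (# 1 :- # 1) :* (v₄ :* v₄) :+ (# 1 :- # 0) :* ((v₁ :- v₄) :* (v₁ :- v₄))
             :+ (# 1 :- # 1) :* ((v₄ :+ (v₁ :- v₄)) :* (v₄ :+ (v₁ :- v₄)))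
             by G-value (first k) (x - first k) (periodic (+ k) (+ 1) (first≡ k))
               (periodic (+ y - + k) (+ 1 - + 1) (shiftBy (+ 1) (+ 1) (+ y) (+ k) e (first≡ k)))
               (trans (complement (first k)) (periodic (+ y) (+ 1) e)))
        ∷ (:- # 3 Z.⊛ v₃ ≐ (# 1 :- # 0) :* (v₅ :* v₅) :+ (# 1 :- # 1) :* ((v₁ :- v₅) :* (v₁ :- v₅))
             :+ (# 1 :- # 1) :* ((v₅ :+ (v₁ :- v₅)) :* (v₅ :+ (v₁ :- v₅)))
             by G-value (second k) (x - second k) (periodic (+ k) (+ 2) (second≡ k))
               (periodic (+ y - + k) (+ 1 - + 2) (shiftBy (+ 1) (+ 2) (+ y) (+ k) e (second≡ k)))
               (trans (complement (second k)) (periodic (+ y) (+ 1) e)))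
        ∷ (:- # 3 :* (v₅ :+ # 2 :+ # 2 :* v₀) Z.⊛ v₅ ≐ # 2 :+ # 2 :* v₀ by second≡ k)
        ∷ (:- # 3 :* (v₄ :+ # 1 :+ # 2 :* v₀ :- # 2 :* v₁) Z.⊛ v₄ ≐ # 1 :+ # 2 :* v₀ by first≡ k)
        ∷ []) refl

  ow tw : ℕ → ℤ → ℤ
  ow r a = odd a * a ^ᶻ r
  tw r a = (+ 1 - odd a) * a ^ᶻ r

  h : ℤ → ℤ
  h a = + 2 * ((+ 1 - odd a) * a)

  -- A version of Besge's formula with odd and even divisors separated. The even product is known
  -- from `V-ramanujan`, so this determines the odd one.
  liouville : + 12 · conv (lambert (ow 1)) (lambert (ow 1)) ⊕ + 12 · conv (lambert (tw 1)) (lambert (tw 1)) ≋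
    s 3 ⊕ ⊖ s 1 ⊕ + 3 · lambert (tw 3) ⊕ + 3 · lambert (tw 1) ⊕ ⊖ (+ 6 · θ (lambert (tw 1)))
  liouville = exact λ n → Z.linear-combination
    ( (+ 12 · conv O O) n ∷ (+ 12 · conv T T) n ∷ (+ 3 · T₃) n ∷ (+ 3 · T) n ∷ (+ 6 · θ T) n ∷ s 3 n ∷ s 1 n
    ∷ conv O O n ∷ conv T T n ∷ T₃ n ∷ T n ∷ θ T n ∷ T₂ n
    ∷ lambert₂ (λ a b → G a b - G a (b - a)) n ∷ lambertℕ (antidiagonalSum G) n ∷ lambert (λ a → a * h a) n
    ∷ θ (lambert h) n ∷ [])
    (v₀ :+ v₁) (v₅ :- v₆ :+ v₂ :+ v₃ :- v₄)
    ( (# 1 Z.⊛ v₀ ≐ # 12 :* v₇ by ·-at (+ 12) (conv O O) n)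
    ∷ (# 1 Z.⊛ v₁ ≐ # 12 :* v₈ by ·-at (+ 12) (conv T T) n)
    ∷ (:- # 1 Z.⊛ v₂ ≐ # 3 :* v₉ by ·-at (+ 3) T₃ n)
    ∷ (:- # 1 Z.⊛ v₃ ≐ # 3 :* v₁₀ by ·-at (+ 3) T n)
    ∷ (# 1 Z.⊛ v₄ ≐ # 6 :* v₁₁ by ·-at (+ 6) (θ T) n)
    ∷ (:- # 3 Z.⊛ v₁₃ ≐ # 4 :* v₇ :+ # 4 :* v₈ by products n)
    ∷ (# 3 Z.⊛ v₁₃ ≐ v₁₄ :+ v₁₅ :- v₁₆ by skoruppa-θ G G-sym G-rot h G-axis n)
    ∷ (# 1 Z.⊛ # 3 :* v₁₄ ≐ # 1 :* v₅ :+ (con -[1+ 0 ] :* v₆ :+ (# 3 :* v₉ :+ (con -[1+ 5 ] :* v₁₂ :+ (# 3 :* v₁₀ :+ # 0))))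
        by weights n)
    ∷ (# 3 Z.⊛ v₁₅ ≐ # 2 :* v₁₂ by trans (lambert-cong (λ a → a * h a) (λ a → + 2 * tw 2 a)
          (λ i → Z.identity (+ suc i ∷ odd (+ suc i) ∷ []) (v₀ :* (# 2 :* ((# 1 :- v₁) :* v₀))) (# 2 :* ((# 1 :- v₁) :* v₀ :^ 2)) refl) n)
          (lambert-* (+ 2) (tw 2) n))
    ∷ (:- # 3 Z.⊛ v₁₆ ≐ # 2 :* v₁₁ by trans (cong (λ x → + n * x) (trans (lambert-cong h (λ a → + 2 * tw 1 a)
          (λ i → Z.identity (+ suc i ∷ odd (+ suc i) ∷ []) (# 2 :* ((# 1 :- v₁) :* v₀)) (# 2 :* ((# 1 :- v₁) :* v₀ :^ 1)) refl) n)
          (lambert-* (+ 2) (tw 1) n)))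
          (Z.identity (+ n ∷ T n ∷ []) (v₀ :* (# 2 :* v₁)) (# 2 :* (v₀ :* v₁)) refl))
    ∷ []) refl
    where
    O T T₂ T₃ : Series
    O  = lambert (ow 1)
    T  = lambert (tw 1)
    T₂ = lambert (tw 2)
    T₃ = lambert (tw 3)
    G-axis : ∀ a → G a (+ 0) ≡ h a * a
    G-axis a = trans (cong (λ x → evenSquare a + + 0 + evenSquare x) (ℤP.+-identityʳ a))
      (Z.identity (a ∷ odd a ∷ []) ((# 1 :- v₁) :* (v₀ :* v₀) :+ # 0 :+ (# 1 :- v₁) :* (v₀ :* v₀))
        (# 2 :* ((# 1 :- v₁) :* v₀) :* v₀) refl)
    products : ∀ n → lambert₂ (λ a b → G a b - G a (b - a)) n ≡ + 4 * conv O O n + + 4 * conv T T n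
    products n = trans (lambert₂-cong (λ a b → G a b - G a (b - a))
        (λ a b → + 4 * (ow 1 a * ow 1 b) + + 4 * (tw 1 a * tw 1 b))
        (λ i j → trans (G-difference i j) (Z.identity (+ suc i ∷ + suc j ∷ odd (+ suc i) ∷ odd (+ suc j) ∷ [])
          (# 4 :* (v₂ :* v₀ :* (v₃ :* v₁)) :+ # 4 :* ((# 1 :- v₂) :* v₀ :* ((# 1 :- v₃) :* v₁)))
          (# 4 :* (v₂ :* v₀ :^ 1 :* (v₃ :* v₁ :^ 1)) :+ # 4 :* ((# 1 :- v₂) :* v₀ :^ 1 :* ((# 1 :- v₃) :* v₁ :^ 1))) refl)) n)
      (trans (lambert₂-+ (λ a b → + 4 * (ow 1 a * ow 1 b)) (λ a b → + 4 * (tw 1 a * tw 1 b)) n)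
      (cong₂ _+_
        (trans (lambert₂-* (+ 4) (λ a b → ow 1 a * ow 1 b) n) (cong (λ x → + 4 * x) (sym (lambert-product (ow 1) (ow 1) n))))
        (trans (lambert₂-* (+ 4) (λ a b → tw 1 a * tw 1 b) n) (cong (λ x → + 4 * x) (sym (lambert-product (tw 1) (tw 1) n))))))
    parts : List (ℤ × (ℤ → ℤ))
    parts = (+ 1 , (_^ᶻ 3)) ∷ (-[1+ 0 ] , (_^ᶻ 1)) ∷ (+ 3 , tw 3) ∷ (-[1+ 5 ] , tw 2) ∷ (+ 3 , tw 1) ∷ []
    weights : ∀ n → + 3 * lambertℕ (antidiagonalSum G) n ≡
      + 1 * s 3 n + (-[1+ 0 ] * s 1 n + (+ 3 * T₃ n + (-[1+ 5 ] * T₂ n + (+ 3 * T n + + 0))))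
    weights n = trans (sym (Σ<-* (+ 3) _ n)) (trans
      (Σ<-cong n λ i _ → trans (sym (ℤP.*-assoc (+ 3) (antidiagonalSum G i) (ℓ (suc i) n)))
        (cong (_* ℓ (suc i) n) (trans (antidiagonalSum-G i) (Z.identity (+ suc i ∷ odd (+ suc i) ∷ [])
          (v₀ :^ 3 :- v₀ :+ # 3 :* ((# 1 :- v₁) :* (v₀ :^ 3 :- # 2 :* v₀ :^ 2 :+ v₀)))
          (# 1 :* v₀ :^ 3 :+ (con -[1+ 0 ] :* v₀ :^ 1 :+ (# 3 :* ((# 1 :- v₁) :* v₀ :^ 3)
            :+ (con -[1+ 5 ] :* ((# 1 :- v₁) :* v₀ :^ 2) :+ (# 3 :* ((# 1 :- v₁) :* v₀ :^ 1) :+ # 0))))) refl))))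
      (trans (lambert-comb parts n) (unfold n)))
      where
      unfold : ∀ n → combˢ parts n ≡ + 1 * s 3 n + (-[1+ 0 ] * s 1 n + (+ 3 * T₃ n + (-[1+ 5 ] * T₂ n + (+ 3 * T n + + 0))))
      unfold n = cong₂ _+_ (·-at (+ 1) (s 3) n) (cong₂ _+_ (·-at -[1+ 0 ] (s 1) n) (cong₂ _+_ (·-at (+ 3) T₃ n)
        (cong₂ _+_ (·-at -[1+ 5 ] T₂ n) (cong₂ _+_ (·-at (+ 3) T n) (constS-zero n)))))

  odd-double : ∀ k → odd (+ (k ℕ.* 2)) ≡ + 0
  odd-double k = periodic (+ k) (+ 0) (trans (double k) (sym (ℤP.+-identityˡ _)))

  odd-odd : ∀ {n} → ¬ (2 ℕD.∣ n) → odd (+ n) ≡ + 1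
  odd-odd {n} h with parity n
  ... | even k e = ⊥-elim (h (ℕD.divides k (ℤP.+-injective (trans e (trans (ℤP.+-identityˡ _) (sym (double k)))))))
  ... | odd′ k e = periodic (+ k) (+ 1) e

  tw≋V : ∀ r → lambert (tw r) ≋ V ((+ 2) ^ᶻ r · s r)
  tw≋V r = lambert-power r (tw r)
    (λ n o → cong (λ x → (+ 1 - x) * (+ n) ^ᶻ r) (odd-odd o))
    (λ k → trans (cong (λ x → (+ 1 - x) * (+ (k ℕ.* 2)) ^ᶻ r) (odd-double k)) (ℤP.*-identityˡ _))

  ow-split : ∀ r → s r ≋ lambert (ow r) ⊕ lambert (tw r)
  ow-split r = exact λ n → trans
    (lambert-cong (_^ᶻ r) (λ a → ow r a + tw r a) (λ i → Z.identity (odd (+ suc i) ∷ (+ suc i) ^ᶻ r ∷ [])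
      v₁ (v₀ :* v₁ :+ (# 1 :- v₀) :* v₁) refl) n)
    (lambert-+ (ow r) (tw r) n)

  ℓ-double : ∀ i k → odd (+ suc i) ≡ + 0 ⊎ ℓ (suc i) (k ℕ.* 2) ≡ ℓ (suc i) k
  ℓ-double i k with parity (suc i)
  ... | even j e = inj₁ (periodic (+ j) (+ 0) e)
  ... | odd′ j e = inj₂ (cong₂ (λ x y → x - y) (go (suc i ℕD.∣? k)) (constS-multiples (+ 1) k))
    where
    i≡ : suc i ≡ 1 ℕ.+ j ℕ.* 2
    i≡ = ℤP.+-injective (trans e (cong (λ z → + 1 + z) (sym (double j))))
    halve : suc i ℕD.∣ k ℕ.* 2 → suc i ℕD.∣ k
    halve d = ℕD.∣m+n∣m⇒∣n {suc i} {j ℕ.* (k ℕ.* 2)} {k}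
      (subst (suc i ℕD.∣_) (sym (trans (ℕP.+-comm (j ℕ.* (k ℕ.* 2)) k) (trans
        (cong (k ℕ.+_) (trans (cong (j ℕ.*_) (ℕP.*-comm k 2)) (sym (ℕP.*-assoc j 2 k))))
        (cong (ℕ._* k) (sym i≡)))))
        (ℕD.m∣m*n k))
      (ℕD.∣n⇒∣m*n j d)
    go : Dec (suc i ℕD.∣ k) → geo (suc i) (k ℕ.* 2) ≡ geo (suc i) k
    go (yes d) = trans (geo-yes {suc i} (ℕD.∣m⇒∣m*n 2 d)) (sym (geo-yes {suc i} d))
    go (no ¬d) = trans (geo-no {suc i} (λ d → ¬d (halve d))) (sym (geo-no {suc i} ¬d))

  -- An odd divisor of 2k divides k.
  even-part-ow : ∀ r → part 0 (lambert (ow r)) ≋ V (lambert (ow r))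
  even-part-ow r = by-multiples
    (λ k → trans (part-yes 0 (lambert (ow r)) {k ℕ.* 2} (ℕM.m*n%n≡0 k 2)) (trans
      (Σ<-cong (k ℕ.* 2) λ i _ → term i k (ℓ-double i k))
      (trans (Σ<-truncate (ℕP.m≤m*n k 2) λ i k≤i → trans (cong (λ x → ow r (+ suc i) * x) (ℓ-vanish k≤i)) (ℤP.*-zeroʳ (ow r (+ suc i))))
        (sym (V-at (lambert (ow r)) k)))))
    (λ n o → trans (part-no 0 (lambert (ow r)) {n} (λ e → o (ℕD.m%n≡0⇒n∣m n 2 e))) (sym (V-off (lambert (ow r)) o)))
    where
    term : ∀ i k → odd (+ suc i) ≡ + 0 ⊎ ℓ (suc i) (k ℕ.* 2) ≡ ℓ (suc i) k →
      ow r (+ suc i) * ℓ (suc i) (k ℕ.* 2) ≡ ow r (+ suc i) * ℓ (suc i) k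
    term i k (inj₁ z) = trans (cong (λ x → x * (+ suc i) ^ᶻ r * ℓ (suc i) (k ℕ.* 2)) z)
      (sym (cong (λ x → x * (+ suc i) ^ᶻ r * ℓ (suc i) k) z))
    term i k (inj₂ e) = cong (λ x → ow r (+ suc i) * x) e

  part-split : ∀ f → f ≋ part 0 f ⊕ part 1 f
  part-split f = exact λ n → go n (n ℕ.% 2 ℕP.≟ 0)
    where
    go : ∀ n → Dec (n ℕ.% 2 ≡ 0) → f n ≡ part 0 f n + part 1 f n
    go n (yes e) = sym (trans (cong₂ _+_ (part-yes 0 f {n} e) (part-no 1 f {n} (λ e′ → case (trans (sym e) e′))))
      (ℤP.+-identityʳ (f n)))
      where
      case : 0 ≡ 1 → _
      case ()
    go n (no h) = sym (trans (cong₂ _+_ (part-no 0 f {n} h) (part-yes 1 f {n} (one (n ℕ.% 2) (ℕM.m%n<n n 2) h)))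
      (ℤP.+-identityˡ (f n)))
      where
      one : ∀ r → r < 2 → r ≢ 0 → r ≡ 1
      one 0 _ h = ⊥-elim (h refl)
      one 1 _ _ = refl
      one (suc (suc _)) (s≤s (s≤s ())) _

  even≋0 : ∀ {f g} → Supp 0 f → Supp 1 g → f ⊕ g ≋ constS (+ 0) → f ≋ constS (+ 0)
  even≋0 {f} {g} F G = isolate {0} {f} {g} F (supp⇒off {0} {1} {g} (λ ()) G)

  odd≋0 : ∀ {f g} → Supp 0 f → Supp 1 g → f ⊕ g ≋ constS (+ 0) → g ≋ constS (+ 0)
  odd≋0 {f} {g} F G h = isolate {1} {g} {f} G (supp⇒off {1} {0} {f} (λ ()) F)
    (≋-trans (identity (f ∷ g ∷ []) (v₁ :+ v₀) (v₀ :+ v₁) refl) h)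

  -- `d` and 1 + 24 `o` are modular of weight 2 and level 4. `m₀` is only quasimodular and takes the
  -- place of E₂ in the differential equations.
  v₍₁₎ v₍₃₎ m₀ d O₁ O₃ o : Series
  v₍₁₎ = V (s 1)
  v₍₃₎ = V (s 3)
  m₀ = part 0 (s 1)
  d  = part 1 (s 1)
  O₁ = lambert (ow 1)
  O₃ = lambert (ow 3)
  o  = m₀ ⊕ ⊖ (+ 2 · v₍₁₎)

  s₁≋ : s 1 ≋ O₁ ⊕ + 2 · v₍₁₎
  s₁≋ = ≋-trans (ow-split 1) (⊕-cong (≋-refl {O₁}) (≋-trans (tw≋V 1) (V-· (+ 2) (s 1))))

  s₃≋ : s 3 ≋ O₃ ⊕ + 8 · v₍₃₎
  s₃≋ = ≋-trans (ow-split 3) (⊕-cong (≋-refl {O₃}) (≋-trans (tw≋V 3) (V-· (+ 8) (s 3))))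

  supp-m₀ : Supp 0 m₀
  supp-m₀ = supp-part 0 (s 1)

  supp-d : Supp 1 d
  supp-d = supp-part 1 (s 1)

  supp-v₍₁₎ : Supp 0 v₍₁₎
  supp-v₍₁₎ = supp-V (s 1)

  supp-v₍₃₎ : Supp 0 v₍₃₎
  supp-v₍₃₎ = supp-V (s 3)

  supp-o : Supp 0 o
  supp-o = supp-weight (0 ∷ 0 ∷ []) (m₀ ∷ v₍₁₎ ∷ []) (λ { zero → supp-m₀ ; (suc zero) → supp-v₍₁₎ })
    (v₀ :- # 2 :* v₁) refl

  -- For the form φ = 1 + 24 O₁ = 2E₂(2τ) - E₂(τ) this reads 5φ² = E₄(τ) + 4E₄(2τ).
  O₁² : + 12 · conv O₁ O₁ ≋ s 3 ⊕ + 4 · v₍₃₎ ⊕ ⊖ O₁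
  O₁² = linear-combination
    ( O₁ ∷ lambert (tw 1) ∷ s 3 ∷ s 1 ∷ lambert (tw 3) ∷ θ (lambert (tw 1)) ∷ v₍₁₎ ∷ v₍₃₎ ∷ V (θ (s 1))
    ∷ θ (+ 2 · v₍₁₎) ∷ θ v₍₁₎ ∷ [])
    (# 12 :* (v₀ :* v₀)) (v₂ :+ # 4 :* v₇ :- v₀)
    ( (# 1 ⊛ # 12 :* (v₀ :* v₀) :+ # 12 :* (v₁ :* v₁) ≐ v₂ :- v₃ :+ # 3 :* v₄ :+ # 3 :* v₁ :- # 6 :* v₅ by liouville)
    ∷ (:- # 4 ⊛ # 12 :* (v₆ :* v₆) ≐ # 5 :* v₇ :+ v₆ :- # 6 :* v₈ by V-ramanujan)
    ∷ (# 3 :- # 12 :* (v₁ :+ # 2 :* v₆) ⊛ v₁ ≐ # 2 :* v₆ by ≋-trans (tw≋V 1) (V-· (+ 2) (s 1)))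
    ∷ (# 3 ⊛ v₄ ≐ # 8 :* v₇ by ≋-trans (tw≋V 3) (V-· (+ 8) (s 3)))
    ∷ (:- # 6 ⊛ v₅ ≐ v₉ by θ-cong (≋-trans (tw≋V 1) (V-· (+ 2) (s 1))))
    ∷ (:- # 6 ⊛ v₉ ≐ # 2 :* v₁₀ by θ-scale (+ 2) v₍₁₎)
    ∷ (:- # 12 ⊛ v₁₀ ≐ # 2 :* v₈ by θ-V (s 1))
    ∷ (:- # 1 ⊛ v₃ ≐ v₀ :+ # 2 :* v₆ by s₁≋)
    ∷ []) refl

  -- O₁ = o + d with o even and d odd, and o is O₁(q²).
  o≋VO₁ : o ≋ V O₁
  o≋VO₁ = ≋-trans (x-y≈0⇒x≈y (even≋0 {o ⊕ ⊖ part 0 O₁} {d ⊕ ⊖ part 1 O₁}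
      (supp-⊕ {0} {o} {⊖ part 0 O₁} supp-o (supp-⊖ {0} {part 0 O₁} (supp-part 0 O₁)))
      (supp-⊕ {1} {d} {⊖ part 1 O₁} supp-d (supp-⊖ {1} {part 1 O₁} (supp-part 1 O₁)))
      (linear-combination (m₀ ∷ v₍₁₎ ∷ d ∷ part 0 O₁ ∷ part 1 O₁ ∷ O₁ ∷ s 1 ∷ [])
        ((v₀ :- # 2 :* v₁ :- v₃) :+ (v₂ :- v₄)) (# 0)
        ( (:- # 1 ⊛ v₆ ≐ v₀ :+ v₂ by part-split (s 1))
        ∷ (# 1 ⊛ v₆ ≐ v₅ :+ # 2 :* v₁ by s₁≋)
        ∷ (# 1 ⊛ v₅ ≐ v₃ :+ v₄ by part-split O₁)
        ∷ []) refl)))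
    (even-part-ow 1)

  O₁≋ : O₁ ≋ o ⊕ d
  O₁≋ = linear-combination (m₀ ∷ v₍₁₎ ∷ d ∷ O₁ ∷ s 1 ∷ []) v₃ (v₀ :- # 2 :* v₁ :+ v₂)
    ((:- # 1 ⊛ v₄ ≐ v₃ :+ # 2 :* v₁ by s₁≋) ∷ (# 1 ⊛ v₄ ≐ v₀ :+ v₂ by part-split (s 1)) ∷ []) refl

  o² : + 12 · conv o o ≋ v₍₃₎ ⊕ + 4 · V v₍₃₎ ⊕ ⊖ o
  o² = linear-combination
    ( o ∷ V O₁ ∷ V (+ 12 · conv O₁ O₁) ∷ V (conv O₁ O₁) ∷ V (s 3 ⊕ + 4 · v₍₃₎ ⊕ ⊖ O₁) ∷ V (s 3 ⊕ + 4 · v₍₃₎)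
    ∷ V (⊖ O₁) ∷ v₍₃₎ ∷ V (+ 4 · v₍₃₎) ∷ V v₍₃₎ ∷ [])
    (# 12 :* (v₀ :* v₀)) (v₇ :+ # 4 :* v₉ :- v₀)
    ( (# 12 :* (v₀ :+ v₁) :+ # 1 ⊛ v₀ ≐ v₁ by o≋VO₁)
    ∷ (:- # 12 ⊛ v₃ ≐ v₁ :* v₁ by V-* O₁ O₁)
    ∷ (:- # 1 ⊛ v₂ ≐ # 12 :* v₃ by V-· (+ 12) (conv O₁ O₁))
    ∷ (# 1 ⊛ v₂ ≐ v₄ by V-cong O₁²)
    ∷ (# 1 ⊛ v₄ ≐ v₅ :+ v₆ by V-⊕ (s 3 ⊕ + 4 · v₍₃₎) (⊖ O₁))
    ∷ (# 1 ⊛ v₅ ≐ v₇ :+ v₈ by V-⊕ (s 3) (+ 4 · v₍₃₎))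
    ∷ (# 1 ⊛ v₈ ≐ # 4 :* v₉ by V-· (+ 4) v₍₃₎)
    ∷ (# 1 ⊛ v₆ ≐ :- v₁ by V-⊖ O₁)
    ∷ []) refl

  s₃₀ s₃₁ : Series
  s₃₀ = part 0 (s 3)
  s₃₁ = part 1 (s 3)

  -- σ₃(2n) = 9 σ₃(n) - 8 σ₃(n/2)
  hecke : s₃₀ ≋ + 9 · v₍₃₎ ⊕ ⊖ (+ 8 · V v₍₃₎)
  hecke = linear-combination
    ( s₃₀ ∷ s₃₁ ∷ s 3 ∷ O₃ ∷ v₍₃₎ ∷ part 0 O₃ ∷ V O₃ ∷ V (s 3) ∷ V (O₃ ⊕ + 8 · v₍₃₎) ∷ V (+ 8 · v₍₃₎) ∷ V v₍₃₎ ∷ [])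
    v₀ (# 9 :* v₄ :- # 8 :* v₁₀)
    ( (# 1 ⊛ v₀ :- v₅ :- # 8 :* v₄ ≐ # 0 by even≋0
         {s₃₀ ⊕ ⊖ part 0 O₃ ⊕ ⊖ (+ 8 · v₍₃₎)} {s₃₁ ⊕ ⊖ part 1 O₃}
         (supp-weight (0 ∷ 0 ∷ 0 ∷ []) (s₃₀ ∷ part 0 O₃ ∷ v₍₃₎ ∷ [])
           (λ { zero → supp-part 0 (s 3) ; (suc zero) → supp-part 0 O₃ ; (suc (suc zero)) → supp-v₍₃₎ })
           (v₀ :- v₁ :- # 8 :* v₂) refl)
         (supp-⊕ {1} {s₃₁} {⊖ part 1 O₃} (supp-part 1 (s 3)) (supp-⊖ {1} {part 1 O₃} (supp-part 1 O₃)))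
         (linear-combination (s₃₀ ∷ s₃₁ ∷ part 0 O₃ ∷ part 1 O₃ ∷ v₍₃₎ ∷ s 3 ∷ O₃ ∷ [])
           (v₀ :- v₂ :- # 8 :* v₄ :+ (v₁ :- v₃)) (# 0)
           ( (:- # 1 ⊛ v₅ ≐ v₀ :+ v₁ by part-split (s 3))
           ∷ (# 1 ⊛ v₅ ≐ v₆ :+ # 8 :* v₄ by s₃≋)
           ∷ (# 1 ⊛ v₆ ≐ v₂ :+ v₃ by part-split O₃)
           ∷ []) refl))
    ∷ (# 1 ⊛ v₅ ≐ v₆ by even-part-ow 3)
    ∷ (:- # 1 ⊛ v₇ ≐ v₈ by V-cong s₃≋)
    ∷ (# 1 ⊛ v₇ ≐ v₄ by ≋-refl {v₍₃₎})
    ∷ (:- # 1 ⊛ v₈ ≐ v₆ :+ v₉ by V-⊕ O₃ (+ 8 · v₍₃₎))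
    ∷ (:- # 1 ⊛ v₉ ≐ # 8 :* v₁₀ by V-· (+ 8) v₍₃₎)
    ∷ []) refl

  private
    ρ : Vec Series 8
    ρ = m₀ ∷ o ∷ d ∷ s₃₀ ∷ s₃₁ ∷ v₍₃₎ ∷ θ m₀ ∷ θ d ∷ []

    weights-ρ : Vec ℕ 8
    weights-ρ = 0 ∷ 0 ∷ 1 ∷ 0 ∷ 1 ∷ 0 ∷ 0 ∷ 1 ∷ []

    supp-ρ : ∀ i → Supp (lookup weights-ρ i) (lookup ρ i)
    supp-ρ zero                                                       = supp-m₀
    supp-ρ (suc zero)                                                 = supp-o
    supp-ρ (suc (suc zero))                                           = supp-d
    supp-ρ (suc (suc (suc zero)))                                     = supp-part 0 (s 3)
    supp-ρ (suc (suc (suc (suc zero))))                               = supp-part 1 (s 3)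
    supp-ρ (suc (suc (suc (suc (suc zero)))))                         = supp-v₍₃₎
    supp-ρ (suc (suc (suc (suc (suc (suc zero))))))                   = supp-θ {0} {m₀} supp-m₀
    supp-ρ (suc (suc (suc (suc (suc (suc (suc zero)))))))             = supp-θ {1} {d} supp-d

    -- The two components of `O₁²` after the substitution O₁ = o + d.
    even-part odd-part : Series
    even-part = + 12 · conv o o ⊕ + 12 · conv d d ⊕ ⊖ s₃₀ ⊕ ⊖ (+ 4 · v₍₃₎) ⊕ o
    odd-part  = + 24 · conv o d ⊕ ⊖ s₃₁ ⊕ d

    supp-even : Supp 0 even-part
    supp-even = supp-weight weights-ρ ρ supp-ρ (# 12 :* (v₁ :* v₁) :+ # 12 :* (v₂ :* v₂) :- v₃ :- # 4 :* v₅ :+ v₁) refl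

    supp-odd : Supp 1 odd-part
    supp-odd = supp-weight weights-ρ ρ supp-ρ (# 24 :* (v₁ :* v₂) :- v₄ :+ v₂) refl

    even+odd : even-part ⊕ odd-part ≋ constS (+ 0)
    even+odd = linear-combination (o ∷ d ∷ s₃₀ ∷ s₃₁ ∷ v₍₃₎ ∷ O₁ ∷ s 3 ∷ [])
      (# 12 :* (v₀ :* v₀) :+ # 12 :* (v₁ :* v₁) :- v₂ :- # 4 :* v₄ :+ v₀ :+ (# 24 :* (v₀ :* v₁) :- v₃ :+ v₁)) (# 0)
      ( (# 1 ⊛ # 12 :* (v₅ :* v₅) ≐ v₆ :+ # 4 :* v₄ :- v₅ by O₁²)
      ∷ (:- # 1 :- # 12 :* (v₅ :+ v₀ :+ v₁) ⊛ v₅ ≐ v₀ :+ v₁ by O₁≋)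
      ∷ (# 1 ⊛ v₆ ≐ v₂ :+ v₃ by part-split (s 3))
      ∷ []) refl

  s₃₀≋ : s₃₀ ≋ + 12 · conv o o ⊕ + 12 · conv d d ⊕ ⊖ (+ 4 · v₍₃₎) ⊕ o
  s₃₀≋ = linear-combination (o ∷ d ∷ s₃₀ ∷ v₍₃₎ ∷ [])
    v₂ (# 12 :* (v₀ :* v₀) :+ # 12 :* (v₁ :* v₁) :- # 4 :* v₃ :+ v₀)
    ((:- # 1 ⊛ # 12 :* (v₀ :* v₀) :+ # 12 :* (v₁ :* v₁) :- v₂ :- # 4 :* v₃ :+ v₀ ≐ # 0
        by even≋0 {even-part} {odd-part} supp-even supp-odd even+odd) ∷ []) refl

  s₃₁≋ : s₃₁ ≋ + 24 · conv o d ⊕ d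
  s₃₁≋ = linear-combination (o ∷ d ∷ s₃₁ ∷ []) v₂ (# 24 :* (v₀ :* v₁) :+ v₁)
    ((:- # 1 ⊛ # 24 :* (v₀ :* v₁) :- v₂ :+ v₁ ≐ # 0
        by odd≋0 {even-part} {odd-part} supp-even supp-odd even+odd) ∷ []) refl

  -- The even part of s₃ is known from `s₃₀≋` and from `hecke`; `o²` eliminates V(V s₃) from their
  -- comparison.
  5v₍₃₎ : + 5 · v₍₃₎ ≋ + 12 · conv o o ⊕ + 4 · conv d d ⊕ o
  5v₍₃₎ = ·-cancel (+ 3) (linear-combination (o ∷ d ∷ s₃₀ ∷ v₍₃₎ ∷ V v₍₃₎ ∷ [])
    (# 3 :* (# 5 :* v₃)) (# 3 :* (# 12 :* (v₀ :* v₀) :+ # 4 :* (v₁ :* v₁) :+ v₀))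
    ( (# 1 ⊛ v₂ ≐ # 12 :* (v₀ :* v₀) :+ # 12 :* (v₁ :* v₁) :- # 4 :* v₃ :+ v₀ by s₃₀≋)
    ∷ (:- # 1 ⊛ v₂ ≐ # 9 :* v₃ :- # 8 :* v₄ by hecke)
    ∷ (:- # 2 ⊛ # 12 :* (v₀ :* v₀) ≐ v₃ :+ # 4 :* v₄ :- v₀ by o²)
    ∷ []) refl)

  private
    -- The two components of `sum-σσ`: the odd one determines θd, the even one θo.
    even-ramanujan odd-ramanujan : Series
    even-ramanujan = + 12 · conv m₀ m₀ ⊕ + 12 · conv d d ⊕ ⊖ (+ 5 · s₃₀) ⊕ ⊖ m₀ ⊕ + 6 · θ m₀
    odd-ramanujan  = + 24 · conv m₀ d ⊕ ⊖ (+ 5 · s₃₁) ⊕ ⊖ d ⊕ + 6 · θ d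

    supp-even-ramanujan : Supp 0 even-ramanujan
    supp-even-ramanujan = supp-weight weights-ρ ρ supp-ρ
      (# 12 :* (v₀ :* v₀) :+ # 12 :* (v₂ :* v₂) :- # 5 :* v₃ :- v₀ :+ # 6 :* v₆) refl

    supp-odd-ramanujan : Supp 1 odd-ramanujan
    supp-odd-ramanujan = supp-weight weights-ρ ρ supp-ρ (# 24 :* (v₀ :* v₂) :- # 5 :* v₄ :- v₂ :+ # 6 :* v₇) refl

    even+odd-ramanujan : even-ramanujan ⊕ odd-ramanujan ≋ constS (+ 0)
    even+odd-ramanujan = linear-combination (m₀ ∷ d ∷ s₃₀ ∷ s₃₁ ∷ θ m₀ ∷ θ d ∷ s 1 ∷ s 3 ∷ θ (s 1) ∷ θ (m₀ ⊕ d) ∷ [])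
      (# 12 :* (v₀ :* v₀) :+ # 12 :* (v₁ :* v₁) :- # 5 :* v₂ :- v₀ :+ # 6 :* v₄
        :+ (# 24 :* (v₀ :* v₁) :- # 5 :* v₃ :- v₁ :+ # 6 :* v₅)) (# 0)
      ( (# 1 ⊛ # 12 :* (v₆ :* v₆) ≐ # 5 :* v₇ :+ v₆ :- # 6 :* v₈ by sum-σσ)
      ∷ (# 1 :- # 12 :* (v₆ :+ v₀ :+ v₁) ⊛ v₆ ≐ v₀ :+ v₁ by part-split (s 1))
      ∷ (# 5 ⊛ v₇ ≐ v₂ :+ v₃ by part-split (s 3))
      ∷ (:- # 6 ⊛ v₈ ≐ v₉ by θ-cong (part-split (s 1)))
      ∷ (:- # 6 ⊛ v₉ ≐ v₄ :+ v₅ by θ-⊕ m₀ d)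
      ∷ []) refl

  -- By Jacobi's four-square theorem `A` and `B` are the fourth powers of the sums of q^(n²) and of
  -- (-1)^n q^(n²) over all integers n. The series `wᵈ`, `wᴬ`, `wᴮ` are the logarithmic derivatives
  -- of d, A, B.
  wᵈ wᴬ wᴮ A B α : Series
  wᵈ = constS (+ 1) ⊕ + 20 · o ⊕ ⊖ (+ 4 · m₀)
  wᴬ = + 8 · d ⊕ ⊖ (+ 4 · m₀) ⊕ ⊖ (+ 4 · o)
  wᴮ = ⊖ (+ 8 · d) ⊕ ⊖ (+ 4 · m₀) ⊕ ⊖ (+ 4 · o)
  α = constS (+ 1) ⊕ + 24 · o
  A = α ⊕ + 8 · d
  B = α ⊕ ⊖ (+ 8 · d)

  θd : θ d ≋ conv d wᵈ
  θd = ·-cancel (+ 6) (linear-combination (m₀ ∷ o ∷ d ∷ s₃₁ ∷ θ d ∷ [])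
    (# 6 :* v₄) (# 6 :* (v₂ :* (# 1 :+ # 20 :* v₁ :- # 4 :* v₀)))
    ( (# 1 ⊛ # 24 :* (v₀ :* v₂) :- # 5 :* v₃ :- v₂ :+ # 6 :* v₄ ≐ # 0
         by odd≋0 {even-ramanujan} {odd-ramanujan} supp-even-ramanujan supp-odd-ramanujan even+odd-ramanujan)
    ∷ (# 5 ⊛ v₃ ≐ # 24 :* (v₁ :* v₂) :+ v₂ by s₃₁≋)
    ∷ []) refl)

  6θo : + 6 · θ o ≋ + 16 · conv d d ⊕ ⊖ (+ 24 · conv o o) ⊕ ⊖ o ⊕ ⊖ m₀ ⊕ ⊖ (+ 24 · conv m₀ o)
  6θo = linear-combination
    (m₀ ∷ v₍₁₎ ∷ d ∷ s₃₀ ∷ v₍₃₎ ∷ θ m₀ ∷ θ v₍₁₎ ∷ V (θ (s 1)) ∷ θ o ∷ θ (+ 2 · v₍₁₎) ∷ θ (⊖ (+ 2 · v₍₁₎)) ∷ [])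
    (# 6 :* v₈) (# 16 :* (v₂ :* v₂) :- # 24 :* (x :* x) :- x :- v₀ :- # 24 :* (v₀ :* x))
    ( (# 6 ⊛ v₈ ≐ v₅ :+ v₁₀ by θ-⊕ m₀ (⊖ (+ 2 · v₍₁₎)))
    ∷ (# 6 ⊛ v₁₀ ≐ :- v₉ by θ-⊖ (+ 2 · v₍₁₎))
    ∷ (:- # 6 ⊛ v₉ ≐ # 2 :* v₆ by θ-scale (+ 2) v₍₁₎)
    ∷ (:- # 12 ⊛ v₆ ≐ # 2 :* v₇ by θ-V (s 1))
    ∷ (:- # 4 ⊛ # 12 :* (v₁ :* v₁) ≐ # 5 :* v₄ :+ v₁ :- # 6 :* v₇ by V-ramanujan)
    ∷ (# 1 ⊛ # 12 :* (v₀ :* v₀) :+ # 12 :* (v₂ :* v₂) :- # 5 :* v₃ :- v₀ :+ # 6 :* v₅ ≐ # 0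
         by even≋0 {even-ramanujan} {odd-ramanujan} supp-even-ramanujan supp-odd-ramanujan even+odd-ramanujan)
    ∷ (# 5 ⊛ v₃ ≐ # 12 :* (x :* x) :+ # 12 :* (v₂ :* v₂) :- # 4 :* v₄ :+ x by s₃₀≋)
    ∷ (:- # 8 ⊛ # 5 :* v₄ ≐ # 12 :* (x :* x) :+ # 4 :* (v₂ :* v₂) :+ x by 5v₍₃₎)
    ∷ []) refl
    where
    x : Expr 11
    x = v₀ :- # 2 :* v₁

  θα : θ α ≋ + 24 · θ o
  θα = ≋-trans (θ-⊕ (constS (+ 1)) (+ 24 · o)) (≋-trans (⊕-cong (θ-const (+ 1)) (θ-scale (+ 24) o))
    (identity (θ o ∷ []) (# 0 :+ # 24 :* v₀) (# 24 :* v₀) refl))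

  θA : θ A ≋ conv A wᴬ
  θA = linear-combination (m₀ ∷ o ∷ d ∷ θ o ∷ θ d ∷ θ A ∷ θ α ∷ θ (+ 8 · d) ∷ [])
    v₅ ((# 1 :+ # 24 :* v₁ :+ # 8 :* v₂) :* (# 8 :* v₂ :- # 4 :* v₀ :- # 4 :* v₁))
    ( (# 1 ⊛ v₅ ≐ v₆ :+ v₇ by θ-⊕ α (+ 8 · d))
    ∷ (# 1 ⊛ v₆ ≐ # 24 :* v₃ by θα)
    ∷ (# 4 ⊛ # 6 :* v₃ ≐ # 16 :* (v₂ :* v₂) :- # 24 :* (v₁ :* v₁) :- v₁ :- v₀ :- # 24 :* (v₀ :* v₁) by 6θo)
    ∷ (# 1 ⊛ v₇ ≐ # 8 :* v₄ by θ-scale (+ 8) d)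
    ∷ (# 8 ⊛ v₄ ≐ v₂ :* (# 1 :+ # 20 :* v₁ :- # 4 :* v₀) by θd)
    ∷ []) refl

  θB : θ B ≋ conv B wᴮ
  θB = linear-combination (m₀ ∷ o ∷ d ∷ θ o ∷ θ d ∷ θ B ∷ θ α ∷ θ (⊖ (+ 8 · d)) ∷ θ (+ 8 · d) ∷ [])
    v₅ ((# 1 :+ # 24 :* v₁ :- # 8 :* v₂) :* (:- (# 8 :* v₂) :- # 4 :* v₀ :- # 4 :* v₁))
    ( (# 1 ⊛ v₅ ≐ v₆ :+ v₇ by θ-⊕ α (⊖ (+ 8 · d)))
    ∷ (# 1 ⊛ v₆ ≐ # 24 :* v₃ by θα)
    ∷ (# 4 ⊛ # 6 :* v₃ ≐ # 16 :* (v₂ :* v₂) :- # 24 :* (v₁ :* v₁) :- v₁ :- v₀ :- # 24 :* (v₀ :* v₁) by 6θo)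
    ∷ (# 1 ⊛ v₇ ≐ :- v₈ by θ-⊖ (+ 8 · d))
    ∷ (:- # 1 ⊛ v₈ ≐ # 8 :* v₄ by θ-scale (+ 8) d)
    ∷ (:- # 8 ⊛ v₄ ≐ v₂ :* (# 1 :+ # 20 :* v₁ :- # 4 :* v₀) by θd)
    ∷ []) refl

  -- In eta quotients A = η(2τ)^20/(η(τ)η(4τ))^8, B = η(τ)^8/η(2τ)^4 and d = η(4τ)^8/η(2τ)^4, so
  -- that A B⁴ d = η(τ)^24.
  Δ : Series
  Δ = conv (conv A (B ^ 4)) d

  -- wᴬ + 4wᴮ + wᵈ = 1 - 24 (m₀ + d) = E₂, while W has logarithmic derivative 1 - E₂; so θ fixes the
  -- product, and its coefficient at q is computed to be 1.
  ΔW≋q : conv Δ W ≋ q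
  ΔW≋q = ≋-trans (eigen₁ (conv Δ W) θ-fixed) (≋-trans
    (conv-cong {constS (conv Δ W 1)} {constS (+ 1)} (exact λ { zero → refl ; (suc n) → refl }) (≋-refl {q}))
    (identity (q ∷ []) (# 1 :* v₀) v₀ refl))
    where
    θ-fixed : θ (conv Δ W) ≋ conv Δ W
    θ-fixed = linear-combination
      ( m₀ ∷ o ∷ d ∷ A ∷ B ^ 4 ∷ W ∷ θ (conv Δ W) ∷ θ Δ ∷ θ W ∷ θ (conv A (B ^ 4)) ∷ θ d ∷ θ A ∷ θ (B ^ 4) ∷ s 1 ∷ [])
      v₆ (v₃ :* v₄ :* v₂ :* v₅)
      ( (# 1 ⊛ v₆ ≐ v₇ :* v₅ :+ v₃ :* v₄ :* v₂ :* v₈ by θ-* Δ W)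
      ∷ (v₅ ⊛ v₇ ≐ v₉ :* v₂ :+ v₃ :* v₄ :* v₁₀ by θ-* (conv A (B ^ 4)) d)
      ∷ (v₅ :* v₂ ⊛ v₉ ≐ v₁₁ :* v₄ :+ v₃ :* v₁₂ by θ-* A (B ^ 4))
      ∷ (v₅ :* v₂ :* v₄ ⊛ v₁₁ ≐ v₃ :* (# 8 :* v₂ :- # 4 :* v₀ :- # 4 :* v₁) by θA)
      ∷ (v₅ :* v₂ :* v₃ ⊛ v₁₂ ≐ # 4 :* (v₄ :* (:- (# 8 :* v₂) :- # 4 :* v₀ :- # 4 :* v₁)) by PowersMod.θ-^-log 0 B wᴮ θB 4)
      ∷ (v₅ :* v₃ :* v₄ ⊛ v₁₀ ≐ v₂ :* (# 1 :+ # 20 :* v₁ :- # 4 :* v₀) by θd)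
      ∷ (v₃ :* v₄ :* v₂ ⊛ v₈ ≐ v₅ :* (# 1 :- (# 1 :+ con -[1+ 23 ] :* v₁₃)) by θ-W)
      ∷ (# 24 :* v₅ :* v₃ :* v₄ :* v₂ ⊛ v₁₃ ≐ v₀ :+ v₂ by part-split (s 1))
      ∷ []) refl

  e₄≋ : e₄ ≋ conv α α ⊕ + 240 · conv α d ⊕ + 2112 · conv d d
  e₄≋ = linear-combination (o ∷ d ∷ s₃₀ ∷ s₃₁ ∷ v₍₃₎ ∷ s 3 ∷ [])
    (# 1 :+ # 240 :* v₅)
    ((# 1 :+ # 24 :* v₀) :* (# 1 :+ # 24 :* v₀) :+ # 240 :* ((# 1 :+ # 24 :* v₀) :* v₁) :+ # 2112 :* (v₁ :* v₁))
    ( (# 240 ⊛ v₅ ≐ v₂ :+ v₃ by part-split (s 3))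
    ∷ (# 240 ⊛ v₂ ≐ # 12 :* (v₀ :* v₀) :+ # 12 :* (v₁ :* v₁) :- # 4 :* v₄ :+ v₀ by s₃₀≋)
    ∷ (# 240 ⊛ v₃ ≐ # 24 :* (v₀ :* v₁) :+ v₁ by s₃₁≋)
    ∷ (:- # 192 ⊛ # 5 :* v₄ ≐ # 12 :* (v₀ :* v₀) :+ # 4 :* (v₁ :* v₁) :+ v₀ by 5v₍₃₎)
    ∷ []) refl

  -- The sign change of q exchanges A and B, so u = A B has even exponents. The factor A³ completes
  -- A B⁴ d to u⁴ d, which is homogeneous for the grading.
  u κ : Series
  u = conv α α ⊕ ⊖ (+ 64 · conv d d)
  κ = conv (u ^ 4) (tail d)

  K N : List ℤ
  K = mulᴾ 1 (+ 0 ∷ + 1 ∷ []) (powᴾ (+ 1 ∷ + 0 ∷ -[1+ 63 ] ∷ []) 4)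
  N = powᴾ (mulᴾ 1 (+ 1 ∷ + 8 ∷ []) (+ 1 ∷ + 240 ∷ + 2112 ∷ [])) 3

  -- (A B)⁴ d ψ = A³ E₄³ (A B⁴ d W) = (A E₄)³ q
  Kψ≋ : conv (conv d (u ^ 4)) ψ ≋ conv q (conv A e₄ ^ 3)
  Kψ≋ = linear-combination (α ∷ d ∷ W ∷ q ∷ e₄ ∷ ψ ∷ [])
    (v₁ :* (v₀ :* v₀ :- # 64 :* (v₁ :* v₁)) :^ 4 :* v₅) (v₃ :* (a :* v₄) :^ 3)
    ( ((v₀ :* v₀ :- # 64 :* (v₁ :* v₁)) :^ 4 :* v₁ ⊛ v₅ ≐ v₄ :^ 3 :* v₂ by ψ≋)
    ∷ (a :^ 3 :* v₄ :^ 3 ⊛ a :* b :^ 4 :* v₁ :* v₂ ≐ v₃ by ΔW≋q)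
    ∷ []) refl
    where
    a b : Expr 6
    a = v₀ :+ # 8 :* v₁
    b = v₀ :- # 8 :* v₁

  supp-α : Supp 0 α
  supp-α = supp-weight weights-ρ ρ supp-ρ (# 1 :+ # 24 :* v₁) refl

  supp-u : Supp 0 u
  supp-u = supp-weight (0 ∷ 1 ∷ []) (α ∷ d ∷ []) (λ { zero → supp-α ; (suc zero) → supp-d })
    (v₀ :* v₀ :- # 64 :* (v₁ :* v₁)) refl

  supp-tail-d : Supp 0 (tail d)
  supp-tail-d n h = supp-d (suc n) (lemma n h)
    where
    lemma : ∀ n → n ℕ.% 2 ≢ 0 → suc n ℕ.% 2 ≢ 1
    lemma zero          h _ = h refl
    lemma (suc zero)    h ()
    lemma (suc (suc n)) h e = lemma n (λ z → h (trans (shift2 n) z)) (trans (sym (shift2 (suc n))) e)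
      where
      shift2 : ∀ n → suc (suc n) ℕ.% 2 ≡ n ℕ.% 2
      shift2 n = trans (cong (ℕ._% 2) (ℕP.+-comm 2 n)) (ℕM.[m+n]%n≡m%n n 2)

  supp-κ : Supp 0 κ
  supp-κ = supp-* {0} {0} (supp-^ {0} supp-u 4) supp-tail-d

  open Homogeneous α d

  u² F₁ F₂ : List ℤ
  u² = + 1 ∷ + 0 ∷ -[1+ 63 ] ∷ []
  F₁ = + 1 ∷ + 8 ∷ []
  F₂ = + 1 ∷ + 240 ∷ + 2112 ∷ []

  homK≋ : hom α d 9 K ≋ conv d (u ^ 4)
  homK≋ = hom-product 1 8 (+ 0 ∷ + 1 ∷ []) (powᴾ u² 4) 9 K d (u ^ 4) refl refl ℕP.≤-refl ℕP.≤-refl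
    (identity (α ∷ d ∷ []) (# 0 :* v₀ :^ 1 :+ v₁ :* (# 1 :* # 1 :+ v₁ :* # 0)) v₁ refl)
    (hom-power 2 4 u² 8 (powᴾ u² 4) u refl refl ℕP.≤-refl (identity (α ∷ d ∷ [])
      (# 1 :* v₀ :^ 2 :+ v₁ :* (# 0 :* v₀ :^ 1 :+ v₁ :* (con -[1+ 63 ] :* # 1 :+ v₁ :* # 0)))
      (v₀ :* v₀ :- # 64 :* (v₁ :* v₁)) refl))

  homN≋ : hom α d 9 N ≋ conv A e₄ ^ 3
  homN≋ = hom-power 3 3 (mulᴾ 1 F₁ F₂) 9 N (conv A e₄) refl refl ℕP.≤-refl
    (hom-product 1 2 F₁ F₂ 3 (mulᴾ 1 F₁ F₂) A e₄ refl refl ℕP.≤-refl ℕP.≤-refl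
      (identity (α ∷ d ∷ []) (# 1 :* v₀ :^ 1 :+ v₁ :* (# 8 :* # 1 :+ v₁ :* # 0)) (v₀ :+ # 8 :* v₁) refl)
      (≋-trans (identity (α ∷ d ∷ [])
        (# 1 :* v₀ :^ 2 :+ v₁ :* (# 240 :* v₀ :^ 1 :+ v₁ :* (# 2112 :* # 1 :+ v₁ :* # 0)))
        (v₀ :* v₀ :+ # 240 :* (v₀ :* v₁) :+ # 2112 :* (v₁ :* v₁)) refl) (≋-sym e₄≋)))

  qκ≋K : conv q κ ≋ hom α d 9 K
  qκ≋K = ≋-trans (linear-combination (u ^ 4 ∷ d ∷ q ∷ tail d ∷ []) (v₂ :* (v₀ :* v₃)) (v₁ :* v₀)
    ((:- v₀ ⊛ v₁ ≐ v₂ :* v₃ by Units.tail-q 0 d refl) ∷ []) refl) (≋-sym homK≋)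

  Kψ≋qN : conv (hom α d 9 K) ψ ≋ conv q (hom α d 9 N)
  Kψ≋qN = ≋-trans (conv-cong homK≋ (≋-refl {ψ})) (≋-trans Kψ≋ (conv-cong (≋-refl {q}) (≋-sym homN≋)))

  open Dissection 2 2048 α d κ 9 K N (supp-mod 2 2048 {0} {α} supp-α) (supp-mod 2 2048 {1} {d} supp-d)
    (supp-mod 2 2048 {0} {κ} supp-κ) refl
    ℕP.≤-refl ℕP.≤-refl (mod 2048 qκ≋K) (mod 2048 Kψ≋qN)

  powers : ∀ i → 1 ≤ i → i ≤ 1 → Glue.Good 2 2048 i (ψ ^ i)
  -- 744 is the constant term of j.
  powers 1 _ _ = good-power 1 (+ 744) refl
  powers (suc (suc _)) _ (s≤s ())

  claim : Claim 2 2048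
  -- 1024 is the constant term of j³ - 744 · 3 j² modulo 2048.
  claim = Glue.conclude 2 2048 powers (good-last (+ 1024) refl)


-- The prime 3: cubic theta functions

module Three where
  open SeriesMod 0
  open Multiples 2 hiding (p)
  open Residues 3 0

  uℕ χℕ : ℕ → ℤ
  uℕ 0                   = + 0
  uℕ 1                   = + 1
  uℕ 2                   = + 1
  uℕ (suc (suc (suc n))) = uℕ n
  χℕ 0                   = + 0
  χℕ 1                   = + 1
  χℕ 2                   = -[1+ 0 ]
  χℕ (suc (suc (suc n))) = χℕ n

  -- the indicator of 3 ∤ x, and the quadratic character modulo 3
  u χ : ℤ → ℤ
  u x = uℕ ℤ.∣ x ∣
  χ (+ n)    = χℕ n
  χ -[1+ n ] = - χℕ (suc n)

  u-step : ∀ x → u (+ 3 + x) ≡ u x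
  u-step (+ n)                    = refl
  u-step -[1+ 0 ]                 = refl
  u-step -[1+ 1 ]                 = refl
  u-step -[1+ 2 ]                 = refl
  u-step -[1+ suc (suc (suc n)) ] = refl

  χ-step : ∀ x → χ (+ 3 + x) ≡ χ x
  χ-step (+ n)                    = refl
  χ-step -[1+ 0 ]                 = refl
  χ-step -[1+ 1 ]                 = refl
  χ-step -[1+ 2 ]                 = refl
  χ-step -[1+ suc (suc (suc n)) ] = refl

  open Periodic u 3 u-step
  open Periodic χ 3 χ-step using () renaming (periodic to χ-periodic)

  u-neg : ∀ x → u (- x) ≡ u x
  u-neg x = cong uℕ (ℤP.∣-i∣≡∣i∣ x)

  data Residue (n : ℕ) : Set where
    res₀ : ∀ k → n ≡ 0 ℕ.+ k ℕ.* 3 → Residue n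
    res₁ : ∀ k → n ≡ 1 ℕ.+ k ℕ.* 3 → Residue n
    res₂ : ∀ k → n ≡ 2 ℕ.+ k ℕ.* 3 → Residue n

  residue₃ : ∀ n → Residue n
  residue₃ 0 = res₀ 0 refl
  residue₃ 1 = res₁ 0 refl
  residue₃ 2 = res₂ 0 refl
  residue₃ (suc (suc (suc n))) with residue₃ n
  ... | res₀ k e = res₀ (suc k) (cong (3 ℕ.+_) e)
  ... | res₁ k e = res₁ (suc k) (cong (3 ℕ.+_) e)
  ... | res₂ k e = res₂ (suc k) (cong (3 ℕ.+_) e)

  triple : ∀ k → + (k ℕ.* 3) ≡ + 3 * + k
  triple k = trans (ℤP.pos-* k 3) (ℤP.*-comm (+ k) (+ 3))

  cast : ∀ {n} r k → n ≡ r ℕ.+ k ℕ.* 3 → + n ≡ + r + + 3 * + k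
  cast r k e = trans (cong +_ e) (cong (λ z → + r + z) (triple k))

  -- χ(a) χ(b) as a difference of values of an invariant function
  G₁ : ℤ → ℤ → ℤ
  G₁ a b = u a * u b * u (a + b)

  G₁-sym : ∀ a b → G₁ a b ≡ G₁ b a
  G₁-sym a b = cong₂ _*_ (ℤP.*-comm (u a) (u b)) (cong u (ℤP.+-comm a b))

  a+b-b≡a : ∀ a b → a + b + - b ≡ a
  a+b-b≡a a b = Z.identity (a ∷ b ∷ []) (v₀ :+ v₁ :+ (:- v₁)) v₀ refl

  a+[b-a]≡b : ∀ a b → a + (b - a) ≡ b
  a+[b-a]≡b a b = Z.identity (a ∷ b ∷ []) (v₀ :+ (v₁ :- v₀)) v₁ refl

  G₁-rot : ∀ a b → G₁ a b ≡ G₁ (a + b) (- b)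
  G₁-rot a b = trans (Z.identity (u a ∷ u b ∷ u (a + b) ∷ []) (v₀ :* v₁ :* v₂) (v₂ :* v₁ :* v₀) refl)
    (sym (cong₂ (λ x y → u (a + b) * x * y) (u-neg b) (cong u (a+b-b≡a a b))))

  -- G₂ separates the orbits of the dihedral group on (ℤ/3)²: it is the square of the multiple of 3
  -- among a, b, a + b if there is one only, and a² + a b + b² if there is none.
  square₃ : ℤ → ℤ
  square₃ x = (+ 1 - u x) * (x * x)

  G₂ : ℤ → ℤ → ℤ
  G₂ a b = square₃ a + square₃ b + square₃ (a + b) + (a * a + a * b + b * b) * G₁ a b

  square₃-neg : ∀ x → square₃ (- x) ≡ square₃ x
  square₃-neg x = cong₂ (λ u v → (+ 1 - u) * v) (u-neg x) (Z.identity (x ∷ []) (:- v₀ :* :- v₀) (v₀ :* v₀) refl)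

  G₂-sym : ∀ a b → G₂ a b ≡ G₂ b a
  G₂-sym a b = cong₂ _+_ (cong₂ _+_ (ℤP.+-comm (square₃ a) (square₃ b)) (cong square₃ (ℤP.+-comm a b)))
    (cong₂ _*_ (Z.identity (a ∷ b ∷ []) (v₀ :* v₀ :+ v₀ :* v₁ :+ v₁ :* v₁) (v₁ :* v₁ :+ v₁ :* v₀ :+ v₀ :* v₀) refl) (G₁-sym a b))

  G₂-rot : ∀ a b → G₂ a b ≡ G₂ (a + b) (- b)
  G₂-rot a b = cong₂ _+_
    (trans (Z.identity (square₃ a ∷ square₃ b ∷ square₃ (a + b) ∷ []) (v₀ :+ v₁ :+ v₂) (v₂ :+ v₁ :+ v₀) refl)
      (sym (cong₂ (λ x y → square₃ (a + b) + x + y) (square₃-neg b) (cong square₃ (a+b-b≡a a b)))))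
    (cong₂ _*_ (Z.identity (a ∷ b ∷ []) (v₀ :* v₀ :+ v₀ :* v₁ :+ v₁ :* v₁)
      ((v₀ :+ v₁) :* (v₀ :+ v₁) :+ (v₀ :+ v₁) :* (:- v₁) :+ (:- v₁) :* (:- v₁)) refl) (G₁-rot a b))

  module Differences (i j : ℕ) where
    a b : ℤ
    a = + suc i
    b = + suc j

    Goal₁ Goal₂ : Set
    Goal₁ = G₁ a b - G₁ a (b - a) ≡ χ a * χ b
    Goal₂ = G₂ a b - G₂ a (b - a) ≡ + 3 * (u a * a * (u b * b)) + + 4 * ((+ 1 - u a) * a * ((+ 1 - u b) * b))

    module _ (r s k l : ℕ) (p : suc i ≡ r ℕ.+ k ℕ.* 3) (q : suc j ≡ s ℕ.+ l ℕ.* 3) where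
      ua : u a ≡ u (+ r)
      ua = periodic (+ k) (+ r) (cast r k p)
      ub : u b ≡ u (+ s)
      ub = periodic (+ l) (+ s) (cast s l q)
      uab : u (a + b) ≡ u (+ r + + s)
      uab = periodic (+ k + + l) (+ r + + s) (trans (cong₂ _+_ (cast r k p) (cast s l q))
        (Z.identity (+ r ∷ + s ∷ + k ∷ + l ∷ []) (v₀ :+ # 3 :* v₂ :+ (v₁ :+ # 3 :* v₃)) (v₀ :+ v₁ :+ # 3 :* (v₂ :+ v₃)) refl))
      uba : u (b - a) ≡ u (+ s - + r)
      uba = periodic (+ l - + k) (+ s - + r) (trans (cong₂ _-_ (cast s l q) (cast r k p))
        (Z.identity (+ r ∷ + s ∷ + k ∷ + l ∷ []) (v₁ :+ # 3 :* v₃ :- (v₀ :+ # 3 :* v₂)) (v₁ :- v₀ :+ # 3 :* (v₃ :- v₂)) refl))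

      finish₁ : u (+ r) * u (+ s) * u (+ r + + s) - u (+ r) * u (+ s - + r) * u (+ s) ≡ χ (+ r) * χ (+ s) → Goal₁
      finish₁ table = trans (cong₂ (λ x y → x - y)
          (cong₂ _*_ (cong₂ _*_ ua ub) uab)
          (cong₂ _*_ (cong₂ _*_ ua uba) (trans (cong u (a+[b-a]≡b a b)) ub)))
        (trans table (sym (cong₂ _*_ (χ-periodic (+ k) (+ r) (cast r k p)) (χ-periodic (+ l) (+ s) (cast s l q)))))

      finish₂ : (∀ (a b : ℤ) →
          let α = u (+ r); β = u (+ s); γ = u (+ r + + s); δ = u (+ s - + r) in
          (+ 1 - α) * (a * a) + (+ 1 - β) * (b * b) + (+ 1 - γ) * ((a + b) * (a + b)) + (a * a + a * b + b * b) * (α * β * γ)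
          - ((+ 1 - α) * (a * a) + (+ 1 - δ) * ((b - a) * (b - a)) + (+ 1 - β) * (b * b)
             + (a * a + a * (b - a) + (b - a) * (b - a)) * (α * δ * β))
          ≡ + 3 * (α * a * (β * b)) + + 4 * ((+ 1 - α) * a * ((+ 1 - β) * b))) → Goal₂
      finish₂ table = trans (substitute (u a) (u b) (u (a + b)) (u (b - a)) (u (a + (b - a))) ua ub uab uba
          (trans (cong u (a+[b-a]≡b a b)) ub))
        (trans (table a b) (sym (cong₂ (λ x y → + 3 * (x * a * (y * b)) + + 4 * ((+ 1 - x) * a * ((+ 1 - y) * b))) ua ub)))
        where
        substitute : ∀ α β γ δ ε → α ≡ u (+ r) → β ≡ u (+ s) → γ ≡ u (+ r + + s) → δ ≡ u (+ s - + r) → ε ≡ u (+ s) →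
          (+ 1 - α) * (a * a) + (+ 1 - β) * (b * b) + (+ 1 - γ) * ((a + b) * (a + b)) + (a * a + a * b + b * b) * (α * β * γ)
          - ((+ 1 - α) * (a * a) + (+ 1 - δ) * ((b - a) * (b - a)) + (+ 1 - ε) * ((a + (b - a)) * (a + (b - a)))
             + (a * a + a * (b - a) + (b - a) * (b - a)) * (α * δ * ε)) ≡
          (let α = u (+ r); β = u (+ s); γ = u (+ r + + s); δ = u (+ s - + r) in
          (+ 1 - α) * (a * a) + (+ 1 - β) * (b * b) + (+ 1 - γ) * ((a + b) * (a + b)) + (a * a + a * b + b * b) * (α * β * γ)
          - ((+ 1 - α) * (a * a) + (+ 1 - δ) * ((b - a) * (b - a)) + (+ 1 - β) * (b * b)
             + (a * a + a * (b - a) + (b - a) * (b - a)) * (α * δ * β)))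
        substitute _ _ _ _ _ refl refl refl refl refl = cong
          (λ x → (+ 1 - u (+ r)) * (a * a) + (+ 1 - u (+ s)) * (b * b) + (+ 1 - u (+ r + + s)) * ((a + b) * (a + b))
            + (a * a + a * b + b * b) * (u (+ r) * u (+ s) * u (+ r + + s))
            - ((+ 1 - u (+ r)) * (a * a) + (+ 1 - u (+ s - + r)) * ((b - a) * (b - a)) + (+ 1 - u (+ s)) * (x * x)
             + (a * a + a * (b - a) + (b - a) * (b - a)) * (u (+ r) * u (+ s - + r) * u (+ s)))) (a+[b-a]≡b a b)

    -- With the values of the indicator given as numerals, each of the nine residue cases is a
    -- polynomial identity in a and b.
    table : ∀ α β γ δ → isZero 0 2 (norm {2}
        ( (# 1 :- con α) :* (v₀ :* v₀) :+ (# 1 :- con β) :* (v₁ :* v₁) :+ (# 1 :- con γ) :* ((v₀ :+ v₁) :* (v₀ :+ v₁))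
          :+ (v₀ :* v₀ :+ v₀ :* v₁ :+ v₁ :* v₁) :* (con α :* con β :* con γ)
          :- ((# 1 :- con α) :* (v₀ :* v₀) :+ (# 1 :- con δ) :* ((v₁ :- v₀) :* (v₁ :- v₀)) :+ (# 1 :- con β) :* (v₁ :* v₁)
            :+ (v₀ :* v₀ :+ v₀ :* (v₁ :- v₀) :+ (v₁ :- v₀) :* (v₁ :- v₀)) :* (con α :* con δ :* con β))
        :- (# 3 :* (con α :* v₀ :* (con β :* v₁)) :+ # 4 :* ((# 1 :- con α) :* v₀ :* ((# 1 :- con β) :* v₁)))
        :- con (+ 0))) ≡ true → ∀ (a b : ℤ) →
          (+ 1 - α) * (a * a) + (+ 1 - β) * (b * b) + (+ 1 - γ) * ((a + b) * (a + b)) + (a * a + a * b + b * b) * (α * β * γ)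
          - ((+ 1 - α) * (a * a) + (+ 1 - δ) * ((b - a) * (b - a)) + (+ 1 - β) * (b * b)
             + (a * a + a * (b - a) + (b - a) * (b - a)) * (α * δ * β))
          ≡ + 3 * (α * a * (β * b)) + + 4 * ((+ 1 - α) * a * ((+ 1 - β) * b))
    table α β γ δ check a b = Z.identity (a ∷ b ∷ [])
      ((# 1 :- con α) :* (v₀ :* v₀) :+ (# 1 :- con β) :* (v₁ :* v₁) :+ (# 1 :- con γ) :* ((v₀ :+ v₁) :* (v₀ :+ v₁))
          :+ (v₀ :* v₀ :+ v₀ :* v₁ :+ v₁ :* v₁) :* (con α :* con β :* con γ)
          :- ((# 1 :- con α) :* (v₀ :* v₀) :+ (# 1 :- con δ) :* ((v₁ :- v₀) :* (v₁ :- v₀)) :+ (# 1 :- con β) :* (v₁ :* v₁)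
            :+ (v₀ :* v₀ :+ v₀ :* (v₁ :- v₀) :+ (v₁ :- v₀) :* (v₁ :- v₀)) :* (con α :* con δ :* con β)))
      (# 3 :* (con α :* v₀ :* (con β :* v₁)) :+ # 4 :* ((# 1 :- con α) :* v₀ :* ((# 1 :- con β) :* v₁))) check

    both : ∀ r s k l → suc i ≡ r ℕ.+ k ℕ.* 3 → suc j ≡ s ℕ.+ l ℕ.* 3 →
      u (+ r) * u (+ s) * u (+ r + + s) - u (+ r) * u (+ s - + r) * u (+ s) ≡ χ (+ r) * χ (+ s) → _ → Goal₁ × Goal₂
    both r s k l p q t₁ t₂ = finish₁ r s k l p q t₁ , finish₂ r s k l p q (table (u (+ r)) (u (+ s)) (u (+ r + + s)) (u (+ s - + r)) t₂)

    differences : Residue (suc i) → Residue (suc j) → Goal₁ × Goal₂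
    differences (res₀ k p) (res₀ l q) = both 0 0 k l p q refl refl
    differences (res₀ k p) (res₁ l q) = both 0 1 k l p q refl refl
    differences (res₀ k p) (res₂ l q) = both 0 2 k l p q refl refl
    differences (res₁ k p) (res₀ l q) = both 1 0 k l p q refl refl
    differences (res₁ k p) (res₁ l q) = both 1 1 k l p q refl refl
    differences (res₁ k p) (res₂ l q) = both 1 2 k l p q refl refl
    differences (res₂ k p) (res₀ l q) = both 2 0 k l p q refl refl
    differences (res₂ k p) (res₁ l q) = both 2 1 k l p q refl refl
    differences (res₂ k p) (res₂ l q) = both 2 2 k l p q refl refl

    proof : Goal₁ × Goal₂
    proof = differences (residue₃ (suc i)) (residue₃ (suc j))

  blockSum : ∀ c f (Φ : ℤ → ℤ) → Φ (+ 0) ≡ + 0 →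
    (∀ k → Φ (+ 1 + + k) ≡ Φ (+ k) + c * (f (k ℕ.* 3) + f (suc (k ℕ.* 3)) + f (suc (suc (k ℕ.* 3))))) →
    ∀ k → c * Σ< (k ℕ.* 3) f ≡ Φ (+ k)
  blockSum c f Φ Φ0 ΦS zero    = trans (ℤP.*-zeroʳ c) (sym Φ0)
  blockSum c f Φ Φ0 ΦS (suc k) = trans
    (Z.linear-combination (c ∷ Σ< (k ℕ.* 3) f ∷ f (k ℕ.* 3) ∷ f (suc (k ℕ.* 3)) ∷ f (suc (suc (k ℕ.* 3))) ∷ Φ (+ k) ∷ [])
      (v₀ :* (v₁ :+ v₂ :+ v₃ :+ v₄)) (v₅ :+ v₀ :* (v₂ :+ v₃ :+ v₄))
      ((# 1 Z.⊛ v₀ :* v₁ ≐ v₅ by blockSum c f Φ Φ0 ΦS k) ∷ []) refl)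
    (sym (ΦS k))

  value₂ : ℤ → ℤ → ℤ → ℤ → ℤ → ℤ
  value₂ α β δ a b = (+ 1 - α) * (a * a) + (+ 1 - β) * (b * b) + (+ 1 - δ) * ((a + b) * (a + b))
    + (a * a + a * b + b * b) * (α * β * δ)

  valueᴱ : ∀ {n} → ℕ → ℕ → ℕ → Expr n → Expr n → Expr n
  valueᴱ α β δ a b = (# 1 :- # α) :* (a :* a) :+ (# 1 :- # β) :* (b :* b) :+ (# 1 :- # δ) :* ((a :+ b) :* (a :+ b))
    :+ (a :* a :+ a :* b :+ b :* b) :* (# α :* # β :* # δ)

  module Column (m R y : ℕ) (x≡ : suc m ≡ R ℕ.+ y ℕ.* 3) where
    x : ℤ
    x = + suc m

    ux : u x ≡ u (+ R)
    ux = periodic (+ y) (+ R) (cast R y x≡)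

    module At (r k : ℕ) {a : ℕ} (a≡ : a ≡ r ℕ.+ k ℕ.* 3) where
      ua : u (+ a) ≡ u (+ r)
      ua = periodic (+ k) (+ r) (cast r k a≡)
      ub : u (x - + a) ≡ u (+ R - + r)
      ub = periodic (+ y - + k) (+ R - + r) (trans (cong₂ _-_ (cast R y x≡) (cast r k a≡))
        (Z.identity (+ R ∷ + r ∷ + y ∷ + k ∷ []) (v₀ :+ # 3 :* v₂ :- (v₁ :+ # 3 :* v₃)) (v₀ :- v₁ :+ # 3 :* (v₂ :- v₃)) refl))
      uab : u (+ a + (x - + a)) ≡ u (+ R)
      uab = trans (cong u (a+[b-a]≡b (+ a) x)) ux

      G₁-at : G₁ (+ a) (x - + a) ≡ u (+ r) * u (+ R - + r) * u (+ R)
      G₁-at = cong₂ _*_ (cong₂ _*_ ua ub) uab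

      G₂-at : G₂ (+ a) (x - + a) ≡ value₂ (u (+ r)) (u (+ R - + r)) (u (+ R)) (+ r + + 3 * + k) (x - (+ r + + 3 * + k))
      G₂-at = trans (values (u (+ a)) (u (x - + a)) (u (+ a + (x - + a))) ua ub uab)
        (cong (λ z → value₂ (u (+ r)) (u (+ R - + r)) (u (+ R)) z (x - z)) (cast r k a≡))
        where
        values : ∀ α β δ → α ≡ u (+ r) → β ≡ u (+ R - + r) → δ ≡ u (+ R) →
          value₂ α β δ (+ a) (x - + a) ≡ value₂ (u (+ r)) (u (+ R - + r)) (u (+ R)) (+ a) (x - + a)
        values _ _ _ refl refl refl = refl

  -- This counts the a with a ≢ 0 and a ≢ c modulo 3: none if 3 divides c, otherwise one residue
  -- class.
  antidiagonalSum-G₁ : ∀ m → + 3 * antidiagonalSum G₁ m ≡ u (+ suc m) * + suc m - χ (+ suc m)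
  antidiagonalSum-G₁ m = go (residue₃ (suc m))
    where
    F : ℕ → ℤ
    F i = G₁ (+ suc i) (+ suc m - + suc i)
    go : Residue (suc m) → + 3 * antidiagonalSum G₁ m ≡ u (+ suc m) * + suc m - χ (+ suc m)
    go (res₀ y e) = trans (cong (λ z → + 3 * z) (Σ<-zero m λ i _ →
        trans (cong (λ z → u (+ suc i) * u (+ suc m - + suc i) * z) (trans (cong u (a+[b-a]≡b (+ suc i) (+ suc m))) ux))
          (ℤP.*-zeroʳ (u (+ suc i) * u (+ suc m - + suc i)))))
      (sym (cong₂ (λ p q → p * + suc m - q) ux (χ-periodic (+ y) (+ 0) (cast 0 y e))))
      where open Column m 0 y e
    go (res₁ y e) = Z.linear-combination
      (antidiagonalSum G₁ m ∷ + suc m ∷ + y ∷ Σ< (y ℕ.* 3) F ∷ u (+ suc m) ∷ χ (+ suc m) ∷ [])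
      (# 3 :* v₀) (v₄ :* v₁ :- v₅)
      ( (:- # 3 Z.⊛ v₃ ≐ v₀ by cong (λ k → Σ< k F) (sym (ℕP.suc-injective e)))
      ∷ (# 1 Z.⊛ # 3 :* v₃ ≐ # 3 :* v₂ by blockSum (+ 3) F (λ k → + 3 * k) refl stepₒ y)
      ∷ (:- v₁ Z.⊛ v₄ ≐ # 1 by ux)
      ∷ (# 1 Z.⊛ v₅ ≐ # 1 by χ-periodic (+ y) (+ 1) (cast 1 y e))
      ∷ (:- # 1 Z.⊛ v₁ ≐ # 1 :+ # 3 :* v₂ by cast 1 y e)
      ∷ []) refl
      where
      open Column m 1 y e
      stepₒ : ∀ k → + 3 * (+ 1 + + k) ≡ + 3 * + k + + 3 * (F (k ℕ.* 3) + F (suc (k ℕ.* 3)) + F (suc (suc (k ℕ.* 3))))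
      stepₒ k = Z.linear-combination (+ k ∷ F (k ℕ.* 3) ∷ F (suc (k ℕ.* 3)) ∷ F (suc (suc (k ℕ.* 3))) ∷ [])
        (# 3 :* (# 1 :+ v₀)) (# 3 :* v₀ :+ # 3 :* (v₁ :+ v₂ :+ v₃))
        ( (:- # 3 Z.⊛ v₁ ≐ # 0 by At.G₁-at 1 k refl)
        ∷ (:- # 3 Z.⊛ v₂ ≐ # 1 by At.G₁-at 2 k refl)
        ∷ (:- # 3 Z.⊛ v₃ ≐ # 0 by At.G₁-at 3 k refl) ∷ []) refl
    go (res₂ y e) = Z.linear-combination
      (antidiagonalSum G₁ m ∷ + suc m ∷ + y ∷ Σ< (y ℕ.* 3) F ∷ u (+ suc m) ∷ χ (+ suc m) ∷ F (y ℕ.* 3) ∷ [])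
      (# 3 :* v₀) (v₄ :* v₁ :- v₅)
      ( (:- # 3 Z.⊛ v₃ :+ v₆ ≐ v₀ by cong (λ k → Σ< k F) (sym (ℕP.suc-injective e)))
      ∷ (# 1 Z.⊛ # 3 :* v₃ ≐ # 3 :* v₂ by blockSum (+ 3) F (λ k → + 3 * k) refl stepₒ y)
      ∷ (# 3 Z.⊛ v₆ ≐ # 1 by At.G₁-at 1 y refl)
      ∷ (:- v₁ Z.⊛ v₄ ≐ # 1 by ux)
      ∷ (# 1 Z.⊛ v₅ ≐ con -[1+ 0 ] by χ-periodic (+ y) (+ 2) (cast 2 y e))
      ∷ (:- # 1 Z.⊛ v₁ ≐ # 2 :+ # 3 :* v₂ by cast 2 y e)
      ∷ []) refl
      where
      open Column m 2 y e
      stepₒ : ∀ k → + 3 * (+ 1 + + k) ≡ + 3 * + k + + 3 * (F (k ℕ.* 3) + F (suc (k ℕ.* 3)) + F (suc (suc (k ℕ.* 3))))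
      stepₒ k = Z.linear-combination (+ k ∷ F (k ℕ.* 3) ∷ F (suc (k ℕ.* 3)) ∷ F (suc (suc (k ℕ.* 3))) ∷ [])
        (# 3 :* (# 1 :+ v₀)) (# 3 :* v₀ :+ # 3 :* (v₁ :+ v₂ :+ v₃))
        ( (:- # 3 Z.⊛ v₁ ≐ # 1 by At.G₁-at 1 k refl)
        ∷ (:- # 3 Z.⊛ v₂ ≐ # 0 by At.G₁-at 2 k refl)
        ∷ (:- # 3 Z.⊛ v₃ ≐ # 0 by At.G₁-at 3 k refl) ∷ []) refl

  innerSum : ℤ → ℤ
  innerSum c = + 9 * (c ^ᶻ 3 - c) + (+ 1 - u c) * (+ 13 * c ^ᶻ 3 - + 36 * c ^ᶻ 2 + + 27 * c)

  -- Summation over blocks of three consecutive a, beginning with a = 1. If 3 divides c, the surplus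
  -- term G₂(c, 0) is removed; if c ≡ 2, one term of an incomplete block is added.
  antidiagonalSum-G₂ : ∀ m → + 18 * antidiagonalSum G₂ m ≡ innerSum (+ suc m)
  antidiagonalSum-G₂ m = go (residue₃ (suc m))
    where
    F : ℕ → ℤ
    F i = G₂ (+ suc i) (+ suc m - + suc i)
    P : ∀ {n} → Expr n → Expr n
    P c = # 13 :* c :^ 3 :- # 36 :* c :^ 2 :+ # 27 :* c
    innerSumᴱ : ∀ {n} → Expr n → Expr n → Expr n
    innerSumᴱ c w = # 9 :* (c :^ 3 :- c) :+ (# 1 :- w) :* P c
    go : Residue (suc m) → + 18 * antidiagonalSum G₂ m ≡ innerSum (+ suc m)
    go (res₀ zero ())
    go (res₀ (suc y) e) = Z.linear-combination
      (antidiagonalSum G₂ m ∷ + suc m ∷ + suc y ∷ Σ< (suc y ℕ.* 3) F ∷ u (+ suc m) ∷ F m ∷ [])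
      (# 18 :* v₀) (innerSumᴱ v₁ v₄)
      ( (:- # 18 Z.⊛ v₃ ≐ v₀ :+ v₅ by cong (λ k → Σ< k F) (sym e))
      ∷ (# 1 Z.⊛ # 18 :* v₃ ≐ Φ v₂ v₁ by blockSum (+ 18) F (λ k → Z.⟦ Φ v₀ v₁ ⟧ (k ∷ x ∷ []))
          (Z.identity (x ∷ []) (Φ (# 0) v₀) (# 0) refl) step (suc y))
      ∷ (:- # 18 Z.⊛ v₅ ≐ valueᴱ 0 0 0 (# 0 :+ # 3 :* v₂) (v₁ :- (# 0 :+ # 3 :* v₂)) by At.G₂-at 0 (suc y) e)
      ∷ (P v₁ Z.⊛ v₄ ≐ # 0 by ux)
      ∷ (:- # 18 :- # 22 :* v₁ :^ 2 :+ # 54 :* v₂ :+ # 6 :* v₂ :* v₁ :- # 36 :* v₂ :^ 2 Z.⊛ v₁ ≐ # 0 :+ # 3 :* v₂ by cast 0 (suc y) e)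
      ∷ []) refl
      where
      open Column m 0 (suc y) e
      Φ : ∀ {n} → Expr n → Expr n → Expr n
      Φ k x = # 54 :* k :- # 54 :* k :* x :+ # 72 :* k :* x :^ 2 :+ # 162 :* k :^ 2 :- # 54 :* k :^ 2 :* x :+ # 108 :* k :^ 3
      step : ∀ k → Z.⟦ Φ (# 1 :+ v₀) v₁ ⟧ (+ k ∷ x ∷ []) ≡
        Z.⟦ Φ v₀ v₁ ⟧ (+ k ∷ x ∷ []) + + 18 * (F (k ℕ.* 3) + F (suc (k ℕ.* 3)) + F (suc (suc (k ℕ.* 3))))
      step k = Z.linear-combination (+ k ∷ x ∷ F (k ℕ.* 3) ∷ F (suc (k ℕ.* 3)) ∷ F (suc (suc (k ℕ.* 3))) ∷ [])
        (Φ (# 1 :+ v₀) v₁) (Φ v₀ v₁ :+ # 18 :* (v₂ :+ v₃ :+ v₄))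
        ( (:- # 18 Z.⊛ v₂ ≐ valueᴱ 1 1 0 (# 1 :+ # 3 :* v₀) (v₁ :- (# 1 :+ # 3 :* v₀)) by At.G₂-at 1 k refl)
        ∷ (:- # 18 Z.⊛ v₃ ≐ valueᴱ 1 1 0 (# 2 :+ # 3 :* v₀) (v₁ :- (# 2 :+ # 3 :* v₀)) by At.G₂-at 2 k refl)
        ∷ (:- # 18 Z.⊛ v₄ ≐ valueᴱ 0 0 0 (# 3 :+ # 3 :* v₀) (v₁ :- (# 3 :+ # 3 :* v₀)) by At.G₂-at 3 k refl)
        ∷ []) refl
    go (res₁ y e) = Z.linear-combination
      (antidiagonalSum G₂ m ∷ + suc m ∷ + y ∷ Σ< (y ℕ.* 3) F ∷ u (+ suc m) ∷ [])
      (# 18 :* v₀) (innerSumᴱ v₁ v₄)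
      ( (:- # 18 Z.⊛ v₃ ≐ v₀ by cong (λ k → Σ< k F) (sym (ℕP.suc-injective e)))
      ∷ (# 1 Z.⊛ # 18 :* v₃ ≐ Φ v₂ v₁ by blockSum (+ 18) F (λ k → Z.⟦ Φ v₀ v₁ ⟧ (k ∷ x ∷ []))
          (Z.identity (x ∷ []) (Φ (# 0) v₀) (# 0) refl) step y)
      ∷ (P v₁ Z.⊛ v₄ ≐ # 1 by ux)
      ∷ (:- # 9 :* v₁ :- # 9 :* v₁ :^ 2 :- # 9 :* v₂ :+ # 9 :* v₂ :* v₁ :- # 54 :* v₂ :^ 2 Z.⊛ v₁ ≐ # 1 :+ # 3 :* v₂ by cast 1 y e)
      ∷ []) refl
      where
      open Column m 1 y e
      Φ : ∀ {n} → Expr n → Expr n → Expr n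
      Φ k x = # 9 :* k :+ # 9 :* k :* x :+ # 36 :* k :* x :^ 2 :+ # 81 :* k :^ 2 :- # 81 :* k :^ 2 :* x :+ # 162 :* k :^ 3
      step : ∀ k → Z.⟦ Φ (# 1 :+ v₀) v₁ ⟧ (+ k ∷ x ∷ []) ≡
        Z.⟦ Φ v₀ v₁ ⟧ (+ k ∷ x ∷ []) + + 18 * (F (k ℕ.* 3) + F (suc (k ℕ.* 3)) + F (suc (suc (k ℕ.* 3))))
      step k = Z.linear-combination (+ k ∷ x ∷ F (k ℕ.* 3) ∷ F (suc (k ℕ.* 3)) ∷ F (suc (suc (k ℕ.* 3))) ∷ [])
        (Φ (# 1 :+ v₀) v₁) (Φ v₀ v₁ :+ # 18 :* (v₂ :+ v₃ :+ v₄))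
        ( (:- # 18 Z.⊛ v₂ ≐ valueᴱ 1 0 1 (# 1 :+ # 3 :* v₀) (v₁ :- (# 1 :+ # 3 :* v₀)) by At.G₂-at 1 k refl)
        ∷ (:- # 18 Z.⊛ v₃ ≐ valueᴱ 1 1 1 (# 2 :+ # 3 :* v₀) (v₁ :- (# 2 :+ # 3 :* v₀)) by At.G₂-at 2 k refl)
        ∷ (:- # 18 Z.⊛ v₄ ≐ valueᴱ 0 1 1 (# 3 :+ # 3 :* v₀) (v₁ :- (# 3 :+ # 3 :* v₀)) by At.G₂-at 3 k refl)
        ∷ []) refl
    go (res₂ y e) = Z.linear-combination
      (antidiagonalSum G₂ m ∷ + suc m ∷ + y ∷ Σ< (y ℕ.* 3) F ∷ u (+ suc m) ∷ F (y ℕ.* 3) ∷ [])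
      (# 18 :* v₀) (innerSumᴱ v₁ v₄)
      ( (:- # 18 Z.⊛ v₃ :+ v₅ ≐ v₀ by cong (λ k → Σ< k F) (sym (ℕP.suc-injective e)))
      ∷ (# 1 Z.⊛ # 18 :* v₃ ≐ Φ v₂ v₁ by blockSum (+ 18) F (λ k → Z.⟦ Φ v₀ v₁ ⟧ (k ∷ x ∷ []))
          (Z.identity (x ∷ []) (Φ (# 0) v₀) (# 0) refl) step y)
      ∷ (# 18 Z.⊛ v₅ ≐ valueᴱ 1 1 1 (# 1 :+ # 3 :* v₂) (v₁ :- (# 1 :+ # 3 :* v₂)) by At.G₂-at 1 y refl)
      ∷ (P v₁ Z.⊛ v₄ ≐ # 1 by ux)
      ∷ (:- # 9 :- # 9 :* v₁ :^ 2 :- # 45 :* v₂ :+ # 9 :* v₂ :* v₁ :- # 54 :* v₂ :^ 2 Z.⊛ v₁ ≐ # 2 :+ # 3 :* v₂ by cast 2 y e)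
      ∷ []) refl
      where
      open Column m 2 y e
      Φ : ∀ {n} → Expr n → Expr n → Expr n
      Φ k x = # 9 :* k :- # 9 :* k :* x :+ # 36 :* k :* x :^ 2 :+ # 81 :* k :^ 2 :- # 81 :* k :^ 2 :* x :+ # 162 :* k :^ 3
      step : ∀ k → Z.⟦ Φ (# 1 :+ v₀) v₁ ⟧ (+ k ∷ x ∷ []) ≡
        Z.⟦ Φ v₀ v₁ ⟧ (+ k ∷ x ∷ []) + + 18 * (F (k ℕ.* 3) + F (suc (k ℕ.* 3)) + F (suc (suc (k ℕ.* 3))))
      step k = Z.linear-combination (+ k ∷ x ∷ F (k ℕ.* 3) ∷ F (suc (k ℕ.* 3)) ∷ F (suc (suc (k ℕ.* 3))) ∷ [])
        (Φ (# 1 :+ v₀) v₁) (Φ v₀ v₁ :+ # 18 :* (v₂ :+ v₃ :+ v₄))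
        ( (:- # 18 Z.⊛ v₂ ≐ valueᴱ 1 1 1 (# 1 :+ # 3 :* v₀) (v₁ :- (# 1 :+ # 3 :* v₀)) by At.G₂-at 1 k refl)
        ∷ (:- # 18 Z.⊛ v₃ ≐ valueᴱ 1 0 1 (# 2 :+ # 3 :* v₀) (v₁ :- (# 2 :+ # 3 :* v₀)) by At.G₂-at 2 k refl)
        ∷ (:- # 18 Z.⊛ v₄ ≐ valueᴱ 0 1 1 (# 3 :+ # 3 :* v₀) (v₁ :- (# 3 :+ # 3 :* v₀)) by At.G₂-at 3 k refl)
        ∷ []) refl

  uw tw : ℕ → ℤ → ℤ
  uw r a = u a * a ^ᶻ r
  tw r a = (+ 1 - u a) * a ^ᶻ r

  -- For the hexagonal theta series a(q) = 1 + 6 Σ χ(n) q^n/(1 - q^n) this is 2a² = 3E₂(3τ) - E₂(τ).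
  χ² : + 3 · conv (lambert χ) (lambert χ) ≋ lambert (uw 1) ⊕ ⊖ lambert χ
  χ² = exact λ n → Z.linear-combination
    ( (+ 3 · conv X X) n ∷ conv X X n ∷ lambert (uw 1) n ∷ X n
    ∷ lambert₂ (λ a b → G₁ a b - G₁ a (b - a)) n ∷ lambertℕ (antidiagonalSum G₁) n
    ∷ lambert (λ a → a * + 0) n ∷ θ (lambert (λ _ → + 0)) n ∷ [])
    v₀ (v₂ :- v₃)
    ( (# 1 Z.⊛ v₀ ≐ # 3 :* v₁ by ·-at (+ 3) (conv X X) n)
    ∷ (:- # 3 Z.⊛ v₄ ≐ v₁ by products n)
    ∷ (# 3 Z.⊛ v₄ ≐ v₅ :+ v₆ :- v₇ by skoruppa-θ G₁ G₁-sym G₁-rot (λ _ → + 0) G₁-axis n)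
    ∷ (# 1 Z.⊛ # 3 :* v₅ ≐ # 1 :* v₂ :+ (con -[1+ 0 ] :* v₃ :+ # 0) by weights n)
    ∷ (# 3 Z.⊛ v₆ ≐ # 0 by Σ<-zero n λ i _ → cong (_* ℓ (suc i) n) (ℤP.*-zeroʳ (+ suc i)))
    ∷ (:- # 3 Z.⊛ v₇ ≐ # 0 by trans (cong (λ x → + n * x) (Σ<-zero n λ _ _ → refl)) (ℤP.*-zeroʳ (+ n)))
    ∷ []) refl
    where
    X : Series
    X = lambert χ
    G₁-axis : ∀ a → G₁ a (+ 0) ≡ + 0 * a
    G₁-axis a = cong (_* u (a + + 0)) (ℤP.*-zeroʳ (u a))
    products : ∀ n → lambert₂ (λ a b → G₁ a b - G₁ a (b - a)) n ≡ conv X X n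
    products n = trans (lambert₂-cong (λ a b → G₁ a b - G₁ a (b - a)) (λ a b → χ a * χ b)
      (λ i j → proj₁ (Differences.proof i j)) n) (sym (lambert-product χ χ n))
    parts : List (ℤ × (ℤ → ℤ))
    parts = (+ 1 , uw 1) ∷ (-[1+ 0 ] , χ) ∷ []
    weights : ∀ n → + 3 * lambertℕ (antidiagonalSum G₁) n ≡ + 1 * lambert (uw 1) n + (-[1+ 0 ] * X n + + 0)
    weights n = trans (sym (Σ<-* (+ 3) _ n)) (trans
      (Σ<-cong n λ i _ → trans (sym (ℤP.*-assoc (+ 3) (antidiagonalSum G₁ i) (ℓ (suc i) n)))
        (cong (_* ℓ (suc i) n) (trans (antidiagonalSum-G₁ i) (Z.identity (+ suc i ∷ u (+ suc i) ∷ χ (+ suc i) ∷ [])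
          (v₁ :* v₀ :- v₂) (# 1 :* (v₁ :* v₀ :^ 1) :+ (con -[1+ 0 ] :* v₂ :+ # 0)) refl))))
      (trans (lambert-comb parts n)
        (cong₂ _+_ (·-at (+ 1) (lambert (uw 1)) n) (cong₂ _+_ (·-at -[1+ 0 ] X n) (constS-zero n)))))

  h : ℤ → ℤ
  h a = + 2 * ((+ 1 - u a) * a)

  liouville : + 54 · conv (lambert (uw 1)) (lambert (uw 1)) ⊕ + 72 · conv (lambert (tw 1)) (lambert (tw 1)) ≋
    + 9 · s 3 ⊕ ⊖ (+ 9 · s 1) ⊕ + 13 · lambert (tw 3) ⊕ + 27 · lambert (tw 1) ⊕ ⊖ (+ 36 · θ (lambert (tw 1)))
  liouville = exact λ n → Z.linear-combination
    ( (+ 54 · conv O O) n ∷ (+ 72 · conv T T) n ∷ (+ 13 · T₃) n ∷ (+ 27 · T) n ∷ (+ 36 · θ T) n ∷ (+ 9 · s 3) n ∷ (+ 9 · s 1) n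
    ∷ conv O O n ∷ conv T T n ∷ T₃ n ∷ T n ∷ θ T n ∷ T₂ n
    ∷ lambert₂ (λ a b → G₂ a b - G₂ a (b - a)) n ∷ lambertℕ (antidiagonalSum G₂) n ∷ lambert (λ a → a * h a) n
    ∷ θ (lambert h) n ∷ s 3 n ∷ s 1 n ∷ [])
    (v₀ :+ v₁) (v₅ :- v₆ :+ v₂ :+ v₃ :- v₄)
    ( (# 1 Z.⊛ v₀ ≐ # 54 :* v₇ by ·-at (+ 54) (conv O O) n)
    ∷ (# 1 Z.⊛ v₁ ≐ # 72 :* v₈ by ·-at (+ 72) (conv T T) n)
    ∷ (:- # 1 Z.⊛ v₂ ≐ # 13 :* v₉ by ·-at (+ 13) T₃ n)
    ∷ (:- # 1 Z.⊛ v₃ ≐ # 27 :* v₁₀ by ·-at (+ 27) T n)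
    ∷ (# 1 Z.⊛ v₄ ≐ # 36 :* v₁₁ by ·-at (+ 36) (θ T) n)
    ∷ (:- # 1 Z.⊛ v₅ ≐ # 9 :* v₁₇ by ·-at (+ 9) (s 3) n)
    ∷ (# 1 Z.⊛ v₆ ≐ # 9 :* v₁₈ by ·-at (+ 9) (s 1) n)
    ∷ (:- # 18 Z.⊛ v₁₃ ≐ # 3 :* v₇ :+ # 4 :* v₈ by products n)
    ∷ (# 18 Z.⊛ v₁₃ ≐ v₁₄ :+ v₁₅ :- v₁₆ by skoruppa-θ G₂ G₂-sym G₂-rot h G₂-axis n)
    ∷ (# 1 Z.⊛ # 18 :* v₁₄ ≐ # 9 :* v₁₇ :+ (con -[1+ 8 ] :* v₁₈ :+ (# 13 :* v₉ :+ (con -[1+ 35 ] :* v₁₂ :+ (# 27 :* v₁₀ :+ # 0))))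
        by weights n)
    ∷ (# 18 Z.⊛ v₁₅ ≐ # 2 :* v₁₂ by trans (lambert-cong (λ a → a * h a) (λ a → + 2 * tw 2 a)
          (λ i → Z.identity (+ suc i ∷ u (+ suc i) ∷ []) (v₀ :* (# 2 :* ((# 1 :- v₁) :* v₀))) (# 2 :* ((# 1 :- v₁) :* v₀ :^ 2)) refl) n)
          (lambert-* (+ 2) (tw 2) n))
    ∷ (:- # 18 Z.⊛ v₁₆ ≐ # 2 :* v₁₁ by trans (cong (λ x → + n * x) (trans (lambert-cong h (λ a → + 2 * tw 1 a)
          (λ i → Z.identity (+ suc i ∷ u (+ suc i) ∷ []) (# 2 :* ((# 1 :- v₁) :* v₀)) (# 2 :* ((# 1 :- v₁) :* v₀ :^ 1)) refl) n)
          (lambert-* (+ 2) (tw 1) n)))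
          (Z.identity (+ n ∷ T n ∷ []) (v₀ :* (# 2 :* v₁)) (# 2 :* (v₀ :* v₁)) refl))
    ∷ []) refl
    where
    O T T₂ T₃ : Series
    O  = lambert (uw 1)
    T  = lambert (tw 1)
    T₂ = lambert (tw 2)
    T₃ = lambert (tw 3)
    G₂-axis : ∀ a → G₂ a (+ 0) ≡ h a * a
    G₂-axis a = trans (cong₂ (λ x y → square₃ a + + 0 + square₃ x + (a * a + a * + 0 + + 0 * + 0) * y) (ℤP.+-identityʳ a)
        (cong (_* u (a + + 0)) (ℤP.*-zeroʳ (u a))))
      (Z.identity (a ∷ u a ∷ u (a + + 0) ∷ []) ((# 1 :- v₁) :* (v₀ :* v₀) :+ # 0 :+ (# 1 :- v₁) :* (v₀ :* v₀)
          :+ (v₀ :* v₀ :+ v₀ :* # 0 :+ # 0 :* # 0) :* (# 0 :* v₂))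
        (# 2 :* ((# 1 :- v₁) :* v₀) :* v₀) refl)
    products : ∀ n → lambert₂ (λ a b → G₂ a b - G₂ a (b - a)) n ≡ + 3 * conv O O n + + 4 * conv T T n
    products n = trans (lambert₂-cong (λ a b → G₂ a b - G₂ a (b - a))
        (λ a b → + 3 * (uw 1 a * uw 1 b) + + 4 * (tw 1 a * tw 1 b))
        (λ i j → trans (proj₂ (Differences.proof i j)) (Z.identity (+ suc i ∷ + suc j ∷ u (+ suc i) ∷ u (+ suc j) ∷ [])
          (# 3 :* (v₂ :* v₀ :* (v₃ :* v₁)) :+ # 4 :* ((# 1 :- v₂) :* v₀ :* ((# 1 :- v₃) :* v₁)))
          (# 3 :* (v₂ :* v₀ :^ 1 :* (v₃ :* v₁ :^ 1)) :+ # 4 :* ((# 1 :- v₂) :* v₀ :^ 1 :* ((# 1 :- v₃) :* v₁ :^ 1))) refl)) n)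
      (trans (lambert₂-+ (λ a b → + 3 * (uw 1 a * uw 1 b)) (λ a b → + 4 * (tw 1 a * tw 1 b)) n)
      (cong₂ _+_
        (trans (lambert₂-* (+ 3) (λ a b → uw 1 a * uw 1 b) n) (cong (λ x → + 3 * x) (sym (lambert-product (uw 1) (uw 1) n))))
        (trans (lambert₂-* (+ 4) (λ a b → tw 1 a * tw 1 b) n) (cong (λ x → + 4 * x) (sym (lambert-product (tw 1) (tw 1) n))))))
    parts : List (ℤ × (ℤ → ℤ))
    parts = (+ 9 , (_^ᶻ 3)) ∷ (-[1+ 8 ] , (_^ᶻ 1)) ∷ (+ 13 , tw 3) ∷ (-[1+ 35 ] , tw 2) ∷ (+ 27 , tw 1) ∷ []
    weights : ∀ n → + 18 * lambertℕ (antidiagonalSum G₂) n ≡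
      + 9 * s 3 n + (-[1+ 8 ] * s 1 n + (+ 13 * T₃ n + (-[1+ 35 ] * T₂ n + (+ 27 * T n + + 0))))
    weights n = trans (sym (Σ<-* (+ 18) _ n)) (trans
      (Σ<-cong n λ i _ → trans (sym (ℤP.*-assoc (+ 18) (antidiagonalSum G₂ i) (ℓ (suc i) n)))
        (cong (_* ℓ (suc i) n) (trans (antidiagonalSum-G₂ i) (Z.identity (+ suc i ∷ u (+ suc i) ∷ [])
          (# 9 :* (v₀ :^ 3 :- v₀) :+ (# 1 :- v₁) :* (# 13 :* v₀ :^ 3 :- # 36 :* v₀ :^ 2 :+ # 27 :* v₀))
          (# 9 :* v₀ :^ 3 :+ (con -[1+ 8 ] :* v₀ :^ 1 :+ (# 13 :* ((# 1 :- v₁) :* v₀ :^ 3)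
            :+ (con -[1+ 35 ] :* ((# 1 :- v₁) :* v₀ :^ 2) :+ (# 27 :* ((# 1 :- v₁) :* v₀ :^ 1) :+ # 0))))) refl))))
      (trans (lambert-comb parts n)
        (cong₂ _+_ (·-at (+ 9) (s 3) n) (cong₂ _+_ (·-at -[1+ 8 ] (s 1) n) (cong₂ _+_ (·-at (+ 13) T₃ n)
        (cong₂ _+_ (·-at -[1+ 35 ] T₂ n) (cong₂ _+_ (·-at (+ 27) T n) (constS-zero n))))))))

  u-triple : ∀ k → u (+ (k ℕ.* 3)) ≡ + 0
  u-triple k = periodic (+ k) (+ 0) (trans (triple k) (sym (ℤP.+-identityˡ _)))

  u-off : ∀ {n} → ¬ (3 ℕD.∣ n) → u (+ n) ≡ + 1
  u-off {n} h with residue₃ n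
  ... | res₀ k e = ⊥-elim (h (ℕD.divides k e))
  ... | res₁ k e = periodic (+ k) (+ 1) (cast 1 k e)
  ... | res₂ k e = periodic (+ k) (+ 2) (cast 2 k e)

  tw≋V : ∀ r → lambert (tw r) ≋ V ((+ 3) ^ᶻ r · s r)
  tw≋V r = lambert-power r (tw r)
    (λ n o → cong (λ x → (+ 1 - x) * (+ n) ^ᶻ r) (u-off o))
    (λ k → trans (cong (λ x → (+ 1 - x) * (+ (k ℕ.* 3)) ^ᶻ r) (u-triple k)) (ℤP.*-identityˡ _))

  -- χ(a) χ(b) = χ(n) = -1 for n = a b ≡ 2 modulo 3.
  χ-opposite : ∀ n → n ℕ.% 3 ≡ 2 → ∀ i j → suc i ℕ.* suc j ≡ n → χ (+ suc i) ≡ -[1+ 0 ] * χ (+ suc j)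
  χ-opposite n n≡2 i j e = go (residue₃ (suc i)) (residue₃ (suc j))
    where
    residues : ∀ r s k l → suc i ≡ r ℕ.+ k ℕ.* 3 → suc j ≡ s ℕ.+ l ℕ.* 3 → (r ℕ.% 3 ℕ.* (s ℕ.% 3)) ℕ.% 3 ≡ 2
    residues r s k l p q = trans (cong₂ (λ x y → (x ℕ.* y) ℕ.% 3)
        (trans (sym (ℕM.[m+kn]%n≡m%n r k 3)) (cong (ℕ._% 3) (sym p)))
        (trans (sym (ℕM.[m+kn]%n≡m%n s l 3)) (cong (ℕ._% 3) (sym q))))
      (trans (sym (ℕM.%-distribˡ-* (suc i) (suc j) 3)) (trans (cong (ℕ._% 3) e) n≡2))
    values : ∀ r s k l → suc i ≡ r ℕ.+ k ℕ.* 3 → suc j ≡ s ℕ.+ l ℕ.* 3 → χ (+ r) ≡ -[1+ 0 ] * χ (+ s) →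
      χ (+ suc i) ≡ -[1+ 0 ] * χ (+ suc j)
    values r s k l p q t = trans (χ-periodic (+ k) (+ r) (cast r k p)) (trans t
      (cong (λ x → -[1+ 0 ] * x) (sym (χ-periodic (+ l) (+ s) (cast s l q)))))
    go : Residue (suc i) → Residue (suc j) → χ (+ suc i) ≡ -[1+ 0 ] * χ (+ suc j)
    go (res₀ k p) (res₀ l q) with residues 0 0 k l p q
    ... | ()
    go (res₀ k p) (res₁ l q) with residues 0 1 k l p q
    ... | ()
    go (res₀ k p) (res₂ l q) with residues 0 2 k l p q
    ... | ()
    go (res₁ k p) (res₀ l q) with residues 1 0 k l p q
    ... | ()
    go (res₁ k p) (res₁ l q) with residues 1 1 k l p q
    ... | ()
    go (res₁ k p) (res₂ l q) = values 1 2 k l p q refl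
    go (res₂ k p) (res₀ l q) with residues 2 0 k l p q
    ... | ()
    go (res₂ k p) (res₁ l q) = values 2 1 k l p q refl
    go (res₂ k p) (res₂ l q) with residues 2 2 k l p q
    ... | ()

  -- Exchanging each divisor with its complement changes the sign of the coefficient.
  lambert-χ-off : ∀ n → n ℕ.% 3 ≡ 2 → lambert χ n ≡ + 0
  lambert-χ-off n n≡2 = ℤP.*-cancelˡ-≡ (+ 2) _ _ (Z.linear-combination (lambert χ n ∷ [])
    (# 2 :* v₀) (# 2 :* # 0) ((# 1 Z.⊛ v₀ ≐ con -[1+ 0 ] :* v₀ by negated) ∷ []) refl)
    where
    negated : lambert χ n ≡ -[1+ 0 ] * lambert χ n
    negated with lambert-dual 0 χ (λ b → -[1+ 0 ] * χ b) n (λ i j e → refl′ (χ-opposite n n≡2 i j e))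
    ... | mk t e = trans e (trans (cong (λ x → lambert (λ b → -[1+ 0 ] * χ b) n + x) (ℤP.*-zeroʳ t))
      (trans (ℤP.+-identityʳ _) (lambert-* -[1+ 0 ] χ n)))

  part-split : ∀ f → f ≋ part 0 f ⊕ part 1 f ⊕ part 2 f
  part-split f = exact λ n → go n (n ℕ.% 3) refl (ℕM.m%n<n n 3)
    where
    go : ∀ n r → n ℕ.% 3 ≡ r → r < 3 → f n ≡ part 0 f n + part 1 f n + part 2 f n
    go n 0 e _ = sym (trans (cong₂ _+_ (cong₂ _+_ (part-yes 0 f {n} e) (part-no 1 f {n} λ e′ → 0≢1 (trans (sym e) e′)))
        (part-no 2 f {n} λ e′ → 0≢2 (trans (sym e) e′)))
      (Z.identity (f n ∷ []) (v₀ :+ # 0 :+ # 0) v₀ refl))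
      where
      0≢1 : 0 ≢ 1
      0≢1 ()
      0≢2 : 0 ≢ 2
      0≢2 ()
    go n 1 e _ = sym (trans (cong₂ _+_ (cong₂ _+_ (part-no 0 f {n} λ e′ → 1≢0 (trans (sym e) e′)) (part-yes 1 f {n} e))
        (part-no 2 f {n} λ e′ → 1≢2 (trans (sym e) e′)))
      (Z.identity (f n ∷ []) (# 0 :+ v₀ :+ # 0) v₀ refl))
      where
      1≢0 : 1 ≢ 0
      1≢0 ()
      1≢2 : 1 ≢ 2
      1≢2 ()
    go n 2 e _ = sym (trans (cong₂ _+_ (cong₂ _+_ (part-no 0 f {n} λ e′ → 2≢0 (trans (sym e) e′))
        (part-no 1 f {n} λ e′ → 2≢1 (trans (sym e) e′))) (part-yes 2 f {n} e))
      (Z.identity (f n ∷ []) (# 0 :+ # 0 :+ v₀) v₀ refl))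
      where
      2≢0 : 2 ≢ 0
      2≢0 ()
      2≢1 : 2 ≢ 1
      2≢1 ()
    go n (suc (suc (suc _))) _ (s≤s (s≤s (s≤s ())))

  module Components {f₀ f₁ f₂ : Series} (S₀ : Supp 0 f₀) (S₁ : Supp 1 f₁) (S₂ : Supp 2 f₂)
    (sum≋0 : f₀ ⊕ f₁ ⊕ f₂ ≋ constS (+ 0)) where

    f₀≋0 : f₀ ≋ constS (+ 0)
    f₀≋0 = isolate {0} {f₀} {f₁ ⊕ f₂} S₀
      (off-⊕ {0} {f₁} {f₂} (supp⇒off {0} {1} {f₁} (λ ()) S₁) (supp⇒off {0} {2} {f₂} (λ ()) S₂))
      (≋-trans (identity (f₀ ∷ f₁ ∷ f₂ ∷ []) (v₀ :+ (v₁ :+ v₂)) (v₀ :+ v₁ :+ v₂) refl) sum≋0)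

    f₁≋0 : f₁ ≋ constS (+ 0)
    f₁≋0 = isolate {1} {f₁} {f₀ ⊕ f₂} S₁
      (off-⊕ {1} {f₀} {f₂} (supp⇒off {1} {0} {f₀} (λ ()) S₀) (supp⇒off {1} {2} {f₂} (λ ()) S₂))
      (≋-trans (identity (f₀ ∷ f₁ ∷ f₂ ∷ []) (v₁ :+ (v₀ :+ v₂)) (v₀ :+ v₁ :+ v₂) refl) sum≋0)

    f₂≋0 : f₂ ≋ constS (+ 0)
    f₂≋0 = isolate {2} {f₂} {f₀ ⊕ f₁} S₂
      (off-⊕ {2} {f₀} {f₁} (supp⇒off {2} {0} {f₀} (λ ()) S₀) (supp⇒off {2} {1} {f₁} (λ ()) S₁))
      (≋-trans (identity (f₀ ∷ f₁ ∷ f₂ ∷ []) (v₂ :+ (v₀ :+ v₁)) (v₀ :+ v₁ :+ v₂) refl) sum≋0)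

  -- The hexagonal theta series satisfies a(q) = a(q³) + 2c(q³) with the Borweins' c, so `α` = a(q³)
  -- and 3 `g` = c(q³). `U₀` is chosen so that α² = 1 + 12 U₀.
  v₍₁₎ v₍₃₎ m₀ m₁ m₂ A₀ g α U₀ : Series
  v₍₁₎ = V (s 1)
  v₍₃₎ = V (s 3)
  m₀ = part 0 (s 1)
  m₁ = part 1 (s 1)
  m₂ = part 2 (s 1)
  A₀ = part 0 (lambert χ)
  g  = part 1 (lambert χ)
  α  = constS (+ 1) ⊕ + 6 · A₀
  U₀ = + 3 · conv A₀ A₀ ⊕ A₀

  lambert-χ≋ : lambert χ ≋ A₀ ⊕ g
  lambert-χ≋ = linear-combination (A₀ ∷ g ∷ lambert χ ∷ part 2 (lambert χ) ∷ []) v₂ (v₀ :+ v₁)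
    ( (# 1 ⊛ v₂ ≐ v₀ :+ v₁ :+ v₃ by part-split (lambert χ))
    ∷ (# 1 ⊛ v₃ ≐ # 0 by exact λ n → trans (zero-part n (n ℕ.% 3 ℕP.≟ 2)) (sym (constS-zero n)))
    ∷ []) refl
    where
    zero-part : ∀ n → Dec (n ℕ.% 3 ≡ 2) → part 2 (lambert χ) n ≡ + 0
    zero-part n (yes e) = trans (part-yes 2 (lambert χ) {n} e) (lambert-χ-off n e)
    zero-part n (no ¬e) = part-no 2 (lambert χ) {n} ¬e

  uw≋ : lambert (uw 1) ≋ s 1 ⊕ ⊖ (+ 3 · v₍₁₎)
  uw≋ = linear-combination (lambert (uw 1) ∷ lambert (tw 1) ∷ s 1 ∷ v₍₁₎ ∷ []) v₀ (v₂ :- # 3 :* v₃)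
    ( (:- # 1 ⊛ v₂ ≐ v₀ :+ v₁ by exact λ n → trans
        (lambert-cong (_^ᶻ 1) (λ a → uw 1 a + tw 1 a) (λ i → Z.identity (u (+ suc i) ∷ (+ suc i) ^ᶻ 1 ∷ [])
          v₁ (v₀ :* v₁ :+ (# 1 :- v₀) :* v₁) refl) n)
        (lambert-+ (uw 1) (tw 1) n))
    ∷ (:- # 1 ⊛ v₁ ≐ # 3 :* v₃ by ≋-trans (tw≋V 1) (V-· (+ 3) (s 1)))
    ∷ []) refl

  -- With a² = 1 + 12 `lambert (uw 1)` this is 10a⁴ = E₄(τ) + 9E₄(3τ).
  uw² : + 6 · conv (lambert (uw 1)) (lambert (uw 1)) ≋ s 3 ⊕ + 9 · v₍₃₎ ⊕ ⊖ lambert (uw 1)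
  uw² = ·-cancel (+ 9) (linear-combination
    ( lambert (uw 1) ∷ lambert (tw 1) ∷ s 3 ∷ s 1 ∷ lambert (tw 3) ∷ θ (lambert (tw 1)) ∷ v₍₁₎ ∷ v₍₃₎ ∷ V (θ (s 1))
    ∷ θ (+ 3 · v₍₁₎) ∷ θ v₍₁₎ ∷ [])
    (# 9 :* (# 6 :* (v₀ :* v₀))) (# 9 :* (v₂ :+ # 9 :* v₇ :- v₀))
    ( (# 1 ⊛ # 54 :* (v₀ :* v₀) :+ # 72 :* (v₁ :* v₁)
         ≐ # 9 :* v₂ :- # 9 :* v₃ :+ # 13 :* v₄ :+ # 27 :* v₁ :- # 36 :* v₅ by liouville)
    ∷ (:- # 54 ⊛ # 12 :* (v₆ :* v₆) ≐ # 5 :* v₇ :+ v₆ :- # 6 :* v₈ by V-ramanujan)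
    ∷ (# 27 :- # 72 :* (v₁ :+ # 3 :* v₆) ⊛ v₁ ≐ # 3 :* v₆ by ≋-trans (tw≋V 1) (V-· (+ 3) (s 1)))
    ∷ (# 13 ⊛ v₄ ≐ # 27 :* v₇ by ≋-trans (tw≋V 3) (V-· (+ 27) (s 3)))
    ∷ (:- # 36 ⊛ v₅ ≐ v₉ by θ-cong (≋-trans (tw≋V 1) (V-· (+ 3) (s 1))))
    ∷ (:- # 36 ⊛ v₉ ≐ # 3 :* v₁₀ by θ-scale (+ 3) v₍₁₎)
    ∷ (:- # 108 ⊛ v₁₀ ≐ # 3 :* v₈ by θ-V (s 1))
    ∷ (# 9 ⊛ v₀ ≐ v₃ :- # 3 :* v₆ by uw≋)
    ∷ []) refl)

  private
    ρ : Vec Series 10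
    ρ = m₀ ∷ m₁ ∷ m₂ ∷ A₀ ∷ g ∷ v₍₁₎ ∷ v₍₃₎ ∷ θ m₀ ∷ θ m₁ ∷ θ m₂ ∷ []

    weights-ρ : Vec ℕ 10
    weights-ρ = 0 ∷ 1 ∷ 2 ∷ 0 ∷ 1 ∷ 0 ∷ 0 ∷ 0 ∷ 1 ∷ 2 ∷ []

    supp-ρ : ∀ i → Supp (lookup weights-ρ i) (lookup ρ i)
    supp-ρ zero                                                             = supp-part 0 (s 1)
    supp-ρ (suc zero)                                                       = supp-part 1 (s 1)
    supp-ρ (suc (suc zero))                                                 = supp-part 2 (s 1)
    supp-ρ (suc (suc (suc zero)))                                           = supp-part 0 (lambert χ)
    supp-ρ (suc (suc (suc (suc zero))))                                     = supp-part 1 (lambert χ)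
    supp-ρ (suc (suc (suc (suc (suc zero)))))                               = supp-V (s 1)
    supp-ρ (suc (suc (suc (suc (suc (suc zero))))))                         = supp-V (s 3)
    supp-ρ (suc (suc (suc (suc (suc (suc (suc zero)))))))                   = supp-θ {0} {m₀} (supp-part 0 (s 1))
    supp-ρ (suc (suc (suc (suc (suc (suc (suc (suc zero))))))))             = supp-θ {1} {m₁} (supp-part 1 (s 1))
    supp-ρ (suc (suc (suc (suc (suc (suc (suc (suc (suc zero)))))))))       = supp-θ {2} {m₂} (supp-part 2 (s 1))

    supp : ∀ (e : Expr 10) {r} → weight weights-ρ e ≡ just r → Supp r (⟦ e ⟧ ρ)
    supp = supp-weight weights-ρ ρ supp-ρ

    -- The three components of `χ²` after `lambert χ` = A₀ + g. They express m₁ and m₂ by α and g,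
    -- and tie m₀ to A₀.
    χ²₀ χ²₁ χ²₂ : Expr 10
    χ²₀ = # 3 :* (v₃ :* v₃) :+ v₃ :- v₀ :+ # 3 :* v₅
    χ²₁ = # 6 :* (v₃ :* v₄) :+ v₄ :- v₁
    χ²₂ = # 3 :* (v₄ :* v₄) :- v₂

    open Components (supp χ²₀ refl) (supp χ²₁ refl) (supp χ²₂ refl)
      (linear-combination (m₀ ∷ m₁ ∷ m₂ ∷ A₀ ∷ g ∷ v₍₁₎ ∷ lambert χ ∷ lambert (uw 1) ∷ s 1 ∷ [])
        (# 3 :* (v₃ :* v₃) :+ v₃ :- v₀ :+ # 3 :* v₅ :+ (# 6 :* (v₃ :* v₄) :+ v₄ :- v₁) :+ (# 3 :* (v₄ :* v₄) :- v₂)) (# 0)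
        ( (# 1 ⊛ # 3 :* (v₆ :* v₆) ≐ v₇ :- v₆ by χ²)
        ∷ (:- # 1 :- # 3 :* (v₆ :+ v₃ :+ v₄) ⊛ v₆ ≐ v₃ :+ v₄ by lambert-χ≋)
        ∷ (# 1 ⊛ v₇ ≐ v₈ :- # 3 :* v₅ by uw≋)
        ∷ (# 1 ⊛ v₈ ≐ v₀ :+ v₁ :+ v₂ by part-split (s 1))
        ∷ []) refl)
      renaming (f₀≋0 to χ²₀≋0; f₁≋0 to χ²₁≋0; f₂≋0 to χ²₂≋0)

  U₀≋ : U₀ ≋ m₀ ⊕ ⊖ (+ 3 · v₍₁₎)
  U₀≋ = linear-combination (A₀ ∷ m₀ ∷ v₍₁₎ ∷ []) (# 3 :* (v₀ :* v₀) :+ v₀) (v₁ :- # 3 :* v₂)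
    ((# 1 ⊛ # 3 :* (v₀ :* v₀) :+ v₀ :- v₁ :+ # 3 :* v₂ ≐ # 0 by χ²₀≋0) ∷ []) refl

  m₁≋ : m₁ ≋ conv α g
  m₁≋ = linear-combination (A₀ ∷ g ∷ m₁ ∷ []) v₂ ((# 1 :+ # 6 :* v₀) :* v₁)
    ((:- # 1 ⊛ # 6 :* (v₀ :* v₁) :+ v₁ :- v₂ ≐ # 0 by χ²₁≋0) ∷ []) refl

  m₂≋ : m₂ ≋ + 3 · conv g g
  m₂≋ = linear-combination (g ∷ m₂ ∷ []) v₁ (# 3 :* (v₀ :* v₀))
    ((:- # 1 ⊛ # 3 :* (v₀ :* v₀) :- v₁ ≐ # 0 by χ²₂≋0) ∷ []) refl

  s₁≋ : s 1 ≋ m₀ ⊕ conv α g ⊕ + 3 · conv g g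
  s₁≋ = ≋-trans (part-split (s 1)) (⊕-cong (⊕-cong (≋-refl {m₀}) m₁≋) m₂≋)

  U : Series
  U = U₀ ⊕ conv α g ⊕ + 3 · conv g g

  uw≋U : lambert (uw 1) ≋ U
  uw≋U = linear-combination (A₀ ∷ g ∷ m₀ ∷ v₍₁₎ ∷ s 1 ∷ lambert (uw 1) ∷ [])
    v₅ (# 3 :* (v₀ :* v₀) :+ v₀ :+ (# 1 :+ # 6 :* v₀) :* v₁ :+ # 3 :* (v₁ :* v₁))
    ( (# 1 ⊛ v₅ ≐ v₄ :- # 3 :* v₃ by uw≋)
    ∷ (# 1 ⊛ v₄ ≐ v₂ :+ (# 1 :+ # 6 :* v₀) :* v₁ :+ # 3 :* (v₁ :* v₁) by s₁≋)
    ∷ (:- # 1 ⊛ # 3 :* (v₀ :* v₀) :+ v₀ ≐ v₂ :- # 3 :* v₃ by U₀≋)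
    ∷ []) refl

  s₃≋ : s 3 ≋ + 6 · conv U U ⊕ U ⊕ ⊖ (+ 9 · v₍₃₎)
  s₃≋ = linear-combination (U ∷ lambert (uw 1) ∷ s 3 ∷ v₍₃₎ ∷ [])
    v₂ (# 6 :* (v₀ :* v₀) :+ v₀ :- # 9 :* v₃)
    ( (:- # 1 ⊛ # 6 :* (v₁ :* v₁) ≐ v₂ :+ # 9 :* v₃ :- v₁ by uw²)
    ∷ (# 1 :+ # 6 :* (v₁ :+ v₀) ⊛ v₁ ≐ v₀ by uw≋U)
    ∷ []) refl

  private
    -- R₀, R₁, R₂ are the components of `sum-σσ` in terms of m₀, A₀, g and V(s₃): R₂ yields θg, R₁
    -- yields θα, and R₀ yields V(s₃).
    αᴱ Uᴱ R₀ R₁ R₂ : ∀ {n} → Expr (10 ℕ.+ n)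
    αᴱ = # 1 :+ # 6 :* v₃
    Uᴱ = # 3 :* (v₃ :* v₃) :+ v₃
    R₀ = # 12 :* (v₀ :* v₀) :- # 108 :* (αᴱ :* v₄ :^ 3) :- # 30 :* (Uᴱ :* Uᴱ)
      :- # 5 :* Uᴱ :+ # 45 :* v₆ :- v₀ :+ # 6 :* v₇
    R₁ = # 24 :* (v₀ :* (αᴱ :* v₄)) :- # 162 :* v₄ :^ 4 :- # 60 :* (Uᴱ :* (αᴱ :* v₄))
      :- # 6 :* (αᴱ :* v₄) :+ # 6 :* v₈
    R₂ = # 72 :* (v₀ :* v₄ :^ 2) :- # 18 :* (αᴱ :^ 2 :* v₄ :^ 2) :- # 180 :* (Uᴱ :* v₄ :^ 2)
      :- # 18 :* v₄ :^ 2 :+ # 6 :* v₉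

    open Components (supp R₀ refl) (supp R₁ refl) (supp R₂ refl)
      (linear-combination (m₀ ∷ m₁ ∷ m₂ ∷ A₀ ∷ g ∷ s 1 ∷ v₍₃₎ ∷ θ m₀ ∷ θ m₁ ∷ θ m₂ ∷ s 3 ∷ θ (s 1) ∷ θ (m₀ ⊕ m₁ ⊕ m₂) ∷ θ (m₀ ⊕ m₁) ∷ [])
        (R₀ :+ R₁ :+ R₂) (# 0)
        ( (# 1 ⊛ # 12 :* (v₅ :* v₅) ≐ # 5 :* v₁₀ :+ v₅ :- # 6 :* v₁₁ by sum-σσ)
        ∷ (# 1 :- # 12 :* (v₅ :+ (v₀ :+ αᴱ :* v₄ :+ # 3 :* (v₄ :* v₄))) ⊛ v₅ ≐ v₀ :+ αᴱ :* v₄ :+ # 3 :* (v₄ :* v₄) by s₁≋)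
        ∷ (# 5 ⊛ v₁₀ ≐ # 6 :* ((Uᴱ :+ αᴱ :* v₄ :+ # 3 :* (v₄ :* v₄)) :* (Uᴱ :+ αᴱ :* v₄ :+ # 3 :* (v₄ :* v₄)))
             :+ (Uᴱ :+ αᴱ :* v₄ :+ # 3 :* (v₄ :* v₄)) :- # 9 :* v₆ by s₃≋)
        ∷ (:- # 6 ⊛ v₁₁ ≐ v₁₂ by θ-cong (part-split (s 1)))
        ∷ (:- # 6 ⊛ v₁₂ ≐ v₁₃ :+ v₉ by θ-⊕ (m₀ ⊕ m₁) m₂)
        ∷ (:- # 6 ⊛ v₁₃ ≐ v₇ :+ v₈ by θ-⊕ m₀ m₁)
        ∷ []) refl)
      renaming (f₀≋0 to R₀≋0; f₁≋0 to R₁≋0; f₂≋0 to R₂≋0)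

  -- `b` is the Borweins' b(q) = a(q³) - c(q³), and b Q = α³ - 27g³ is b(q³)³ by a³ = b³ + c³. The
  -- other three series are logarithmic derivatives.
  w₍g₎ w₍b₎ w₍Q₎ b Q : Series
  w₍g₎ = constS (+ 1) ⊕ + 11 · U₀ ⊕ ⊖ (+ 2 · m₀)
  w₍b₎ = ⊖ (+ 2 · m₀) ⊕ ⊖ U₀ ⊕ ⊖ (+ 3 · conv α g) ⊕ ⊖ (+ 9 · g ^ 2)
  w₍Q₎ = ⊖ (+ 4 · m₀) ⊕ ⊖ (+ 2 · U₀) ⊕ + 3 · conv α g ⊕ + 9 · g ^ 2
  b = α ⊕ ⊖ (+ 3 · g)
  Q = α ^ 2 ⊕ + 3 · conv α g ⊕ + 9 · g ^ 2

  -- R₂ contains the derivative of m₂ = 3g², hence g θg, and one factor g has to be cancelled.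
  θg : θ g ≋ conv g w₍g₎
  θg = ·-cancel (+ 2) (leading-cancel {g} {+ 2 · θ g} {+ 2 · conv g w₍g₎} refl refl
    (·-cancel (+ 18) (linear-combination (m₀ ∷ A₀ ∷ g ∷ θ g ∷ θ m₂ ∷ θ (+ 3 · conv g g) ∷ θ (conv g g) ∷ [])
      (# 18 :* (v₂ :* (# 2 :* v₃))) (# 18 :* (v₂ :* (# 2 :* (v₂ :* (# 1 :+ # 11 :* U′ :- # 2 :* v₀)))))
      ( (# 1 ⊛ # 72 :* (v₀ :* v₂ :^ 2) :- # 18 :* ((# 1 :+ # 6 :* v₁) :^ 2 :* v₂ :^ 2) :- # 180 :* (U′ :* v₂ :^ 2)
           :- # 18 :* v₂ :^ 2 :+ # 6 :* v₄ ≐ # 0 by R₂≋0)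
      ∷ (:- # 6 ⊛ v₄ ≐ v₅ by θ-cong m₂≋)
      ∷ (:- # 6 ⊛ v₅ ≐ # 3 :* v₆ by θ-scale (+ 3) (conv g g))
      ∷ (:- # 18 ⊛ v₆ ≐ v₃ :* v₂ :+ v₂ :* v₃ by θ-* g g)
      ∷ []) refl)))
    where
    U′ : Expr 7
    U′ = # 3 :* (v₁ :* v₁) :+ v₁

  θα : θ α ≋ + 27 · g ^ 3 ⊕ ⊖ conv α (+ 2 · m₀ ⊕ U₀)
  θα = leading-cancel {g} {θ α} {+ 27 · g ^ 3 ⊕ ⊖ conv α (+ 2 · m₀ ⊕ U₀)} refl refl
    (·-cancel (+ 6) (linear-combination (m₀ ∷ A₀ ∷ g ∷ θ α ∷ θ g ∷ θ m₁ ∷ θ (conv α g) ∷ [])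
      (# 6 :* (v₂ :* v₃)) (# 6 :* (v₂ :* (# 27 :* v₂ :^ 3 :- α′ :* (# 2 :* v₀ :+ U′))))
      ( (# 1 ⊛ # 24 :* (v₀ :* (α′ :* v₂)) :- # 162 :* v₂ :^ 4 :- # 60 :* (U′ :* (α′ :* v₂)) :- # 6 :* (α′ :* v₂) :+ # 6 :* v₅
           ≐ # 0 by R₁≋0)
      ∷ (:- # 6 ⊛ v₅ ≐ v₆ by θ-cong m₁≋)
      ∷ (:- # 6 ⊛ v₆ ≐ v₃ :* v₂ :+ α′ :* v₄ by θ-* α g)
      ∷ (:- # 6 :* α′ ⊛ v₄ ≐ v₂ :* (# 1 :+ # 11 :* U′ :- # 2 :* v₀) by θg)
      ∷ []) refl))
    where
    α′ U′ : Expr 7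
    α′ = # 1 :+ # 6 :* v₁
    U′ = # 3 :* (v₁ :* v₁) :+ v₁

  -- The term θm₀ of R₀ is eliminated by m₀ = U₀ + 3V(s₁): θ(V s₁) is known from Besge's formula at
  -- q³, and θU₀ from θα.
  10v₍₃₎ : + 10 · v₍₃₎ ≋ + 6 · conv U₀ U₀ ⊕ U₀ ⊕ + 9 · conv α (g ^ 3)
  10v₍₃₎ = ·-cancel (+ 9) (linear-combination
    ( m₀ ∷ A₀ ∷ g ∷ v₍₁₎ ∷ v₍₃₎ ∷ θ m₀ ∷ θ A₀ ∷ θ α ∷ θ U₀ ∷ V (θ (s 1)) ∷ θ (+ 3 · conv A₀ A₀) ∷ θ (conv A₀ A₀)
    ∷ θ (m₀ ⊕ ⊖ (+ 3 · v₍₁₎)) ∷ θ (⊖ (+ 3 · v₍₁₎)) ∷ θ (+ 3 · v₍₁₎) ∷ θ v₍₁₎ ∷ θ (+ 6 · A₀) ∷ [])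
    (# 9 :* (# 10 :* v₄)) (# 9 :* (# 6 :* (U′ :* U′) :+ U′ :+ # 9 :* (α′ :* v₂ :^ 3)))
    ( (# 1 ⊛ # 12 :* (v₀ :* v₀) :- # 108 :* (α′ :* v₂ :^ 3) :- # 30 :* (U′ :* U′) :- # 5 :* U′ :+ # 45 :* v₄ :- v₀ :+ # 6 :* v₅
         ≐ # 0 by R₀≋0)
    ∷ (:- # 9 ⊛ # 12 :* (v₃ :* v₃) ≐ # 5 :* v₄ :+ v₃ :- # 6 :* v₉ by V-ramanujan)
    ∷ (# 6 ⊛ v₈ ≐ v₁₂ by θ-cong U₀≋)
    ∷ (# 6 ⊛ v₁₂ ≐ v₅ :+ v₁₃ by θ-⊕ m₀ (⊖ (+ 3 · v₍₁₎)))
    ∷ (# 6 ⊛ v₁₃ ≐ :- v₁₄ by θ-⊖ (+ 3 · v₍₁₎))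
    ∷ (:- # 6 ⊛ v₁₄ ≐ # 3 :* v₁₅ by θ-scale (+ 3) v₍₁₎)
    ∷ (:- # 18 ⊛ v₁₅ ≐ # 3 :* v₉ by θ-V (s 1))
    ∷ (:- # 6 ⊛ v₈ ≐ v₁₀ :+ v₆ by θ-⊕ (+ 3 · conv A₀ A₀) A₀)
    ∷ (:- # 6 ⊛ v₁₀ ≐ # 3 :* v₁₁ by θ-scale (+ 3) (conv A₀ A₀))
    ∷ (:- # 18 ⊛ v₁₁ ≐ v₆ :* v₁ :+ v₁ :* v₆ by θ-* A₀ A₀)
    ∷ (α′ ⊛ v₇ ≐ # 6 :* v₆ by ≋-trans (θ-⊕ (constS (+ 1)) (+ 6 · A₀)) (≋-trans (⊕-cong (θ-const (+ 1)) (θ-scale (+ 6) A₀))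
         (identity (θ A₀ ∷ []) (# 0 :+ # 6 :* v₀) (# 6 :* v₀) refl)))
    ∷ (:- α′ ⊛ v₇ ≐ # 27 :* v₂ :^ 3 :- α′ :* (# 2 :* v₀ :+ U′) by θα)
    ∷ (# 12 :* (# 3 :* v₃ :+ v₀ :- U′) :- # 3 ⊛ U′ ≐ v₀ :- # 3 :* v₃ by U₀≋)
    ∷ []) refl)
    where
    α′ U′ : Expr 17
    α′ = # 1 :+ # 6 :* v₁
    U′ = # 3 :* (v₁ :* v₁) :+ v₁

  e₄≋ : e₄ ≋ α ^ 4 ⊕ + 240 · conv (α ^ 3) g ⊕ + 2160 · conv (α ^ 2) (g ^ 2) ⊕ + 6696 · conv α (g ^ 3) ⊕ + 12960 · g ^ 4
  e₄≋ = linear-combination (A₀ ∷ g ∷ v₍₃₎ ∷ s 3 ∷ [])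
    (# 1 :+ # 240 :* v₃)
    (α′ :^ 4 :+ # 240 :* (α′ :^ 3 :* v₁) :+ # 2160 :* (α′ :^ 2 :* v₁ :^ 2) :+ # 6696 :* (α′ :* v₁ :^ 3) :+ # 12960 :* v₁ :^ 4)
    ( (# 240 ⊛ v₃ ≐ # 6 :* (Ũ :* Ũ) :+ Ũ :- # 9 :* v₂ by s₃≋)
    ∷ (:- # 216 ⊛ # 10 :* v₂ ≐ # 6 :* (U′ :* U′) :+ U′ :+ # 9 :* (α′ :* v₁ :^ 3) by 10v₍₃₎)
    ∷ []) refl
    where
    α′ U′ Ũ : Expr 4
    α′ = # 1 :+ # 6 :* v₀
    U′ = # 3 :* (v₀ :* v₀) :+ v₀
    Ũ = U′ :+ α′ :* v₁ :+ # 3 :* (v₁ :* v₁)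

  θb : θ b ≋ conv b w₍b₎
  θb = linear-combination (m₀ ∷ A₀ ∷ g ∷ θ α ∷ θ g ∷ θ b ∷ θ (⊖ (+ 3 · g)) ∷ θ (+ 3 · g) ∷ [])
    v₅ ((α′ :- # 3 :* v₂) :* (:- (# 2 :* v₀) :- U′ :- # 3 :* (α′ :* v₂) :- # 9 :* v₂ :^ 2))
    ( (# 1 ⊛ v₅ ≐ v₃ :+ v₆ by θ-⊕ α (⊖ (+ 3 · g)))
    ∷ (# 1 ⊛ v₆ ≐ :- v₇ by θ-⊖ (+ 3 · g))
    ∷ (:- # 1 ⊛ v₇ ≐ # 3 :* v₄ by θ-scale (+ 3) g)
    ∷ (# 1 ⊛ v₃ ≐ # 27 :* v₂ :^ 3 :- α′ :* (# 2 :* v₀ :+ U′) by θα)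
    ∷ (:- # 3 ⊛ v₄ ≐ v₂ :* (# 1 :+ # 11 :* U′ :- # 2 :* v₀) by θg)
    ∷ []) refl
    where
    α′ U′ : Expr 8
    α′ = # 1 :+ # 6 :* v₁
    U′ = # 3 :* (v₁ :* v₁) :+ v₁

  θQ : θ Q ≋ conv Q w₍Q₎
  θQ = linear-combination
    ( m₀ ∷ A₀ ∷ g ∷ θ α ∷ θ g ∷ θ Q ∷ θ (α ^ 2 ⊕ + 3 · conv α g) ∷ θ (α ^ 2) ∷ θ (+ 3 · conv α g) ∷ θ (conv α g)
    ∷ θ (+ 9 · g ^ 2) ∷ θ (g ^ 2) ∷ [])
    v₅ ((α′ :^ 2 :+ # 3 :* (α′ :* v₂) :+ # 9 :* v₂ :^ 2) :* (:- (# 4 :* v₀) :- # 2 :* U′ :+ # 3 :* (α′ :* v₂) :+ # 9 :* v₂ :^ 2))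
    ( (# 1 ⊛ v₅ ≐ v₆ :+ v₁₀ by θ-⊕ (α ^ 2 ⊕ + 3 · conv α g) (+ 9 · g ^ 2))
    ∷ (# 1 ⊛ v₆ ≐ v₇ :+ v₈ by θ-⊕ (α ^ 2) (+ 3 · conv α g))
    ∷ (# 1 ⊛ v₇ ≐ # 2 :* (α′ :^ 1 :* v₃) by θ-^ α 1)
    ∷ (# 1 ⊛ v₈ ≐ # 3 :* v₉ by θ-scale (+ 3) (conv α g))
    ∷ (# 3 ⊛ v₉ ≐ v₃ :* v₂ :+ α′ :* v₄ by θ-* α g)
    ∷ (# 1 ⊛ v₁₀ ≐ # 9 :* v₁₁ by θ-scale (+ 9) (g ^ 2))
    ∷ (# 9 ⊛ v₁₁ ≐ # 2 :* (v₂ :^ 1 :* v₄) by θ-^ g 1)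
    ∷ (# 2 :* α′ :+ # 3 :* v₂ ⊛ v₃ ≐ # 27 :* v₂ :^ 3 :- α′ :* (# 2 :* v₀ :+ U′) by θα)
    ∷ (# 3 :* α′ :+ # 18 :* v₂ ⊛ v₄ ≐ v₂ :* (# 1 :+ # 11 :* U′ :- # 2 :* v₀) by θg)
    ∷ []) refl
    where
    α′ U′ : Expr 12
    α′ = # 1 :+ # 6 :* v₁
    U′ = # 3 :* (v₁ :* v₁) :+ v₁

  -- With b = η(τ)³/η(3τ), g = η(9τ)³/η(3τ) and Q = η(3τ)^10/(η(τ)η(9τ))³ the product is η(τ)^24.
  Δ : Series
  Δ = conv (conv (b ^ 9) g) Q

  -- The logarithmic derivatives of b⁹, g and Q add up to 1 - 24 (m₀ + αg + 3g²) = E₂.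
  ΔW≋q : conv Δ W ≋ q
  ΔW≋q = ≋-trans (eigen₁ (conv Δ W) θ-fixed) (≋-trans
    (conv-cong {constS (conv Δ W 1)} {constS (+ 1)} (exact λ { zero → refl ; (suc n) → refl }) (≋-refl {q}))
    (identity (q ∷ []) (# 1 :* v₀) v₀ refl))
    where
    α′ U′ : Expr 14
    α′ = # 1 :+ # 6 :* v₁
    U′ = # 3 :* (v₁ :* v₁) :+ v₁
    θ-fixed : θ (conv Δ W) ≋ conv Δ W
    θ-fixed = linear-combination
      ( m₀ ∷ A₀ ∷ g ∷ b ^ 9 ∷ Q ∷ W ∷ θ (conv Δ W) ∷ θ Δ ∷ θ W ∷ θ (conv (b ^ 9) g) ∷ θ g ∷ θ (b ^ 9) ∷ θ Q ∷ s 1 ∷ [])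
      v₆ (v₃ :* v₂ :* v₄ :* v₅)
      ( (# 1 ⊛ v₆ ≐ v₇ :* v₅ :+ v₃ :* v₂ :* v₄ :* v₈ by θ-* Δ W)
      ∷ (v₅ ⊛ v₇ ≐ v₉ :* v₄ :+ v₃ :* v₂ :* v₁₂ by θ-* (conv (b ^ 9) g) Q)
      ∷ (v₅ :* v₄ ⊛ v₉ ≐ v₁₁ :* v₂ :+ v₃ :* v₁₀ by θ-* (b ^ 9) g)
      ∷ (v₅ :* v₄ :* v₂ ⊛ v₁₁ ≐ # 9 :* (v₃ :* (:- (# 2 :* v₀) :- U′ :- # 3 :* (α′ :* v₂) :- # 9 :* v₂ :^ 2))
           by PowersMod.θ-^-log 0 b w₍b₎ θb 9)
      ∷ (v₅ :* v₄ :* v₃ ⊛ v₁₀ ≐ v₂ :* (# 1 :+ # 11 :* U′ :- # 2 :* v₀) by θg)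
      ∷ (v₅ :* v₃ :* v₂ ⊛ v₁₂ ≐ v₄ :* (:- (# 4 :* v₀) :- # 2 :* U′ :+ # 3 :* (α′ :* v₂) :+ # 9 :* v₂ :^ 2) by θQ)
      ∷ (v₃ :* v₂ :* v₄ ⊛ v₈ ≐ v₅ :* (# 1 :- (# 1 :+ con -[1+ 23 ] :* v₁₃)) by θ-W)
      ∷ (# 24 :* v₅ :* v₃ :* v₂ :* v₄ ⊛ v₁₃ ≐ v₀ :+ α′ :* v₂ :+ # 3 :* (v₂ :* v₂) by s₁≋)
      ∷ []) refl

  -- w = b Q is a polynomial in α and g³, so its exponents are multiples of 3; the factor Q⁸
  -- completes b⁹ g Q to g w⁹.
  w κ : Series
  w = α ^ 3 ⊕ ⊖ (+ 27 · g ^ 3)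
  κ = conv (w ^ 9) (tail g)

  w≋bQ : w ≋ conv b Q
  w≋bQ = identity (α ∷ g ∷ []) (v₀ :^ 3 :- # 27 :* v₁ :^ 3)
    ((v₀ :- # 3 :* v₁) :* (v₀ :^ 2 :+ # 3 :* (v₀ :* v₁) :+ # 9 :* v₁ :^ 2)) refl

  -- g (b Q)⁹ ψ = Q⁸ E₄³ (b⁹ g Q W) = Q⁸ E₄³ q
  Kψ≋ : conv (conv g (w ^ 9)) ψ ≋ conv q (conv (Q ^ 8) (e₄ ^ 3))
  Kψ≋ = linear-combination (g ∷ w ^ 9 ∷ ψ ∷ q ∷ Q ∷ Q ^ 8 ∷ e₄ ^ 3 ∷ b ^ 9 ∷ W ∷ conv b Q ^ 9 ∷ [])
    (v₀ :* v₁ :* v₂) (v₃ :* (v₅ :* v₆))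
    ( (v₀ :* v₂ ⊛ v₁ ≐ v₉ by PowersMod.^-cong 0 9 w≋bQ)
    ∷ (v₀ :* v₂ ⊛ v₉ ≐ v₇ :* (v₄ :* v₅) by PowersMod.^-* 0 b Q 9)
    ∷ (v₀ :* v₇ :* v₄ :* v₅ ⊛ v₂ ≐ v₆ :* v₈ by ψ≋)
    ∷ (v₅ :* v₆ ⊛ v₇ :* v₀ :* v₄ :* v₈ ≐ v₃ by ΔW≋q)
    ∷ []) refl

  supp-α : Supp 0 α
  supp-α = supp (# 1 :+ # 6 :* v₃) refl

  supp-g : Supp 1 g
  supp-g = supp-part 1 (lambert χ)

  supp-w : Supp 0 w
  supp-w = supp-weight (0 ∷ 1 ∷ []) (α ∷ g ∷ []) (λ { zero → supp-α ; (suc zero) → supp-g }) (v₀ :^ 3 :- # 27 :* v₁ :^ 3) refl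

  supp-tail-g : Supp 0 (tail g)
  supp-tail-g n h = supp-g (suc n) λ e → h (lemma n e)
    where
    lemma : ∀ n → suc n ℕ.% 3 ≡ 1 → n ℕ.% 3 ≡ 0
    lemma zero                _ = refl
    lemma (suc zero)          ()
    lemma (suc (suc zero))    ()
    lemma (suc (suc (suc n))) e = trans (shift3 n) (lemma n (trans (sym (shift3 (suc n))) e))
      where
      shift3 : ∀ n → suc (suc (suc n)) ℕ.% 3 ≡ n ℕ.% 3
      shift3 n = trans (cong (ℕ._% 3) (ℕP.+-comm 3 n)) (ℕM.[m+n]%n≡m%n n 3)

  supp-κ : Supp 0 κ
  supp-κ = supp-* {0} {0} (supp-^ {0} supp-w 9) supp-tail-g

  x₁ wᴴ Qᴴ e₄ᴴ w⁹ᴴ Q⁸ᴴ e₄³ᴴ K N : List ℤ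
  x₁   = + 0 ∷ + 1 ∷ []
  wᴴ   = + 1 ∷ + 0 ∷ + 0 ∷ -[1+ 26 ] ∷ []
  Qᴴ   = + 1 ∷ + 3 ∷ + 9 ∷ []
  e₄ᴴ  = + 1 ∷ + 240 ∷ + 2160 ∷ + 6696 ∷ + 12960 ∷ []
  w⁹ᴴ  = powᴾ wᴴ 9
  Q⁸ᴴ  = powᴾ Qᴴ 8
  e₄³ᴴ = powᴾ e₄ᴴ 3
  K    = mulᴾ 1 x₁ w⁹ᴴ
  N    = mulᴾ 1 Q⁸ᴴ e₄³ᴴ

  open Homogeneous α g

  hom-w : hom α g 3 wᴴ ≋ w
  hom-w = identity (α ∷ g ∷ [])
    (# 1 :* v₀ :^ 3 :+ v₁ :* (# 0 :* v₀ :^ 2 :+ v₁ :* (# 0 :* v₀ :^ 1 :+ v₁ :* (con -[1+ 26 ] :* # 1 :+ v₁ :* # 0))))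
    (v₀ :^ 3 :- # 27 :* v₁ :^ 3) refl

  hom-Q : hom α g 2 Qᴴ ≋ Q
  hom-Q = identity (α ∷ g ∷ [])
    (# 1 :* v₀ :^ 2 :+ v₁ :* (# 3 :* v₀ :^ 1 :+ v₁ :* (# 9 :* # 1 :+ v₁ :* # 0)))
    (v₀ :^ 2 :+ # 3 :* (v₀ :* v₁) :+ # 9 :* v₁ :^ 2) refl

  hom-e₄ : hom α g 4 e₄ᴴ ≋ e₄
  hom-e₄ = ≋-trans (identity (α ∷ g ∷ [])
    (# 1 :* v₀ :^ 4 :+ v₁ :* (# 240 :* v₀ :^ 3 :+ v₁ :* (# 2160 :* v₀ :^ 2 :+ v₁ :* (# 6696 :* v₀ :^ 1
      :+ v₁ :* (# 12960 :* # 1 :+ v₁ :* # 0)))))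
    (v₀ :^ 4 :+ # 240 :* (v₀ :^ 3 :* v₁) :+ # 2160 :* (v₀ :^ 2 :* v₁ :^ 2) :+ # 6696 :* (v₀ :* v₁ :^ 3) :+ # 12960 :* v₁ :^ 4) refl)
    (≋-sym e₄≋)

  hom-x : hom α g 1 x₁ ≋ g
  hom-x = identity (α ∷ g ∷ []) (# 0 :* v₀ :^ 1 :+ v₁ :* (# 1 :* # 1 :+ v₁ :* # 0)) v₁ refl

  length-w⁹ : length w⁹ᴴ ≤ suc (9 ℕ.* 3)
  length-w⁹ = length-pow 3 wᴴ ℕP.≤-refl 9

  length-Q⁸ : length Q⁸ᴴ ≤ suc (8 ℕ.* 2)
  length-Q⁸ = length-pow 2 Qᴴ ℕP.≤-refl 8

  length-e₄³ : length e₄³ᴴ ≤ suc (3 ℕ.* 4)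
  length-e₄³ = length-pow 4 e₄ᴴ ℕP.≤-refl 3

  homK≋ : hom α g 28 K ≋ conv g (w ^ 9)
  homK≋ = hom-product 1 27 x₁ w⁹ᴴ 28 K g (w ^ 9) refl refl ℕP.≤-refl length-w⁹ hom-x
    (hom-power 3 9 wᴴ 27 w⁹ᴴ w refl refl ℕP.≤-refl hom-w)

  homN≋ : hom α g 28 N ≋ conv (Q ^ 8) (e₄ ^ 3)
  homN≋ = hom-product 16 12 Q⁸ᴴ e₄³ᴴ 28 N (Q ^ 8) (e₄ ^ 3) refl refl length-Q⁸ length-e₄³
    (hom-power 2 8 Qᴴ 16 Q⁸ᴴ Q refl refl ℕP.≤-refl hom-Q) (hom-power 4 3 e₄ᴴ 12 e₄³ᴴ e₄ refl refl ℕP.≤-refl hom-e₄)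

  qκ≋K : conv q κ ≋ hom α g 28 K
  qκ≋K = ≋-trans (linear-combination (w ^ 9 ∷ g ∷ q ∷ tail g ∷ []) (v₂ :* (v₀ :* v₃)) (v₁ :* v₀)
    ((:- v₀ ⊛ v₁ ≐ v₂ :* v₃ by Units.tail-q 0 g refl) ∷ []) refl) (≋-sym homK≋)

  Kψ≋qN : conv (hom α g 28 K) ψ ≋ conv q (hom α g 28 N)
  Kψ≋qN = ≋-trans (conv-cong homK≋ (≋-refl {ψ})) (≋-trans Kψ≋ (conv-cong (≋-refl {q}) (≋-sym homN≋)))

  open Dissection 3 243 α g κ 28 K N (supp-mod 3 243 {0} {α} supp-α) (supp-mod 3 243 {1} {g} supp-g)
    (supp-mod 3 243 {0} {κ} supp-κ) refl
    (length-mul 1 (9 ℕ.* 3) x₁ w⁹ᴴ ℕP.≤-refl length-w⁹)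
    (length-mul (8 ℕ.* 2) (3 ℕ.* 4) Q⁸ᴴ e₄³ᴴ length-Q⁸ length-e₄³)
    (mod 243 qκ≋K) (mod 243 Kψ≋qN)

  powers : ∀ i → 1 ≤ i → i ≤ 2 → Glue.Good 3 243 i (ψ ^ i)
  -- 15 and 90 are the constant terms 744 of j and 947304 of j² modulo 243.
  powers 1 _ _ = good-power 1 (+ 15) refl
  powers 2 _ _ = good-power 2 (+ 90) refl
  powers (suc (suc (suc _))) _ (s≤s (s≤s ()))

  claim : Claim 3 243
  claim = Glue.conclude 3 243 powers (good-last (+ 0) refl)

-- Collection of the cases

theorem1p3 : (p : ℕ) → Prime p → p ≤ 11 →
    (k : ℕ) → ((1 ≤ k × k ≤ p ∸ 1) ⊎ k ≡ suc p) →
    (c : List ℤ) → IsZk k (polyJ c) →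
    (n : ℤ) → n ≢ + 0 → + modulus p ∣ coeff (polyJ c) (+ p * n)
theorem1p3 2  _ _ = Two.claim
theorem1p3 3  _ _ = Three.claim
theorem1p3 5  _ _ = Five.claim
theorem1p3 7  _ _ = Seven.claim
theorem1p3 11 _ _ = Eleven.claim
-- for the remaining p the modulus is 1
theorem1p3 0  _ _ _ _ _ _ _ _ = ℕD.1∣ _
theorem1p3 1  _ _ _ _ _ _ _ _ = ℕD.1∣ _
theorem1p3 4  _ _ _ _ _ _ _ _ = ℕD.1∣ _
theorem1p3 6  _ _ _ _ _ _ _ _ = ℕD.1∣ _
theorem1p3 8  _ _ _ _ _ _ _ _ = ℕD.1∣ _
theorem1p3 9  _ _ _ _ _ _ _ _ = ℕD.1∣ _
theorem1p3 10 _ _ _ _ _ _ _ _ = ℕD.1∣ _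
theorem1p3 (suc (suc (suc (suc (suc (suc (suc (suc (suc (suc (suc (suc _)))))))))))) _ p≤11 =
  ⊥-elim (ℕP.<⇒≱ (ℕP.m≤m+n 12 _) p≤11)
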